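{- Let $H\in\{H_1,H_2,H_3\}$. For every integer $k\ge 1$, \[GR_k(H)=\begin{cases}(R_2(H)-1)\cdot 17^{(k-2)/2}+1, & \text{if } k \text{ is even},\\ 4\cdot 17^{(k-1)/2}+1, & \text{if } k \text{ is odd},\end{cases}\] where $R_2(H_1)=R_2(H_2)=18$ and $R_2(H_3)=22$.
   Context: All graphs are finite, simple and undirected. $K_n$ denotes the complete graph on $n$ vertices. The graphs $H_1,H_2,H_3$ each have five vertices and chromatic number four: $H_1$ is $K_4$ together with one additional vertex adjacent to exactly one vertex of the $K_4$ (a $K_4$ with a pendant edge); $H_2$ is $K_4$ together with one additional vertex adjacent to exactly two vertices of the $K_4$; $H_3$ is $K_5$ minus one edge. A $k$-edge coloring of a complete graph is a Gallai coloring if it contains no rainbow triangle (a triangle whose three edges receive three distinct colors). For a graph $H$ and integer $k\ge1$, the Gallai-Ramsey number $GR_k(H)$ is the minimum integer $n$ such that every Gallai $k$-edge coloring of $K_n$ contains a monochromatic copy of $H$. $R_2(H)$ denotes the classical 2-color Ramsey number of $H$ (the minimum $n$ such that every 2-edge coloring of $K_n$ contains a monochromatic copy of $H$). -}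

module Defs where

open import Data.Nat using (ℕ; zero; suc; _+_; _*_; _∸_; _^_; _<_; _≤_)
open import Data.Nat.DivMod using (_/_; _%_)
open import Data.Nat using (_≡ᵇ_)
open import Data.Bool using (Bool; true; false; if_then_else_)
open import Data.Fin using (Fin; zero; suc)
open import Data.Product using (Σ; _×_; ∃)
open import Relation.Binary.PropositionalEquality using (_≡_; _≢_)
open import Relation.Nullary using (¬_)
open import Function.Definitions using (Injective)

Graph : ℕ → Set
Graph m = Fin m → Fin m → Bool

-- A k-edge colouring of K_n: colour of the edge {i,j} (i ≠ j); must be symmetric.
-- Diagonal values are irrelevant (never used).
Colouring : ℕ → ℕ → Set
Colouring k n = Fin n → Fin n → Fin k

IsEdgeColouring : ∀ {k n} → Colouring k n → Set
IsEdgeColouring {n = n} c = (i j : Fin n) → i ≢ j → c i j ≡ c j i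

RainbowTriangle : ∀ {k n} → Colouring k n → Set
RainbowTriangle {n = n} c =
  Σ (Fin n) λ x → Σ (Fin n) λ y → Σ (Fin n) λ z →
    (x ≢ y) × (y ≢ z) × (x ≢ z) ×
    (c x y ≢ c y z) × (c y z ≢ c x z) × (c x y ≢ c x z)

Gallai : ∀ {k n} → Colouring k n → Set
Gallai c = ¬ RainbowTriangle c

MonoCopy : ∀ {m k n} → Graph m → Colouring k n → Set
MonoCopy {m} {k} {n} H c =
  Σ (Fin k) λ a → Σ (Fin m → Fin n) λ f →
    Injective _≡_ _≡_ f × ((u v : Fin m) → H u v ≡ true → c (f u) (f v) ≡ a)

GallaiArrows : ∀ {m} → ℕ → Graph m → ℕ → Set
GallaiArrows k H n =
  (c : Colouring k n) → IsEdgeColouring c → Gallai c → MonoCopy H c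

Arrows2 : ∀ {m} → Graph m → ℕ → Set
Arrows2 H n = (c : Colouring 2 n) → IsEdgeColouring c → MonoCopy H c

IsMin : (ℕ → Set) → ℕ → Set
IsMin P N = P N × ((n : ℕ) → n < N → ¬ P n)

IsGR : ∀ {m} → ℕ → Graph m → ℕ → Set
IsGR k H N = IsMin (GallaiArrows k H) N

IsR2 : ∀ {m} → Graph m → ℕ → Set
IsR2 H N = IsMin (Arrows2 H) N

-- The three graphs on vertex set Fin 5; vertices 0,1,2,3 form the K4.
H₁ : Graph 5   -- K4 plus vertex 4 adjacent to vertex 0
H₁ zero zero = false
H₁ zero (suc zero) = true
H₁ zero (suc (suc zero)) = true
H₁ zero (suc (suc (suc zero))) = true
H₁ zero (suc (suc (suc (suc zero)))) = true
H₁ (suc zero) zero = true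
H₁ (suc zero) (suc zero) = false
H₁ (suc zero) (suc (suc zero)) = true
H₁ (suc zero) (suc (suc (suc zero))) = true
H₁ (suc zero) (suc (suc (suc (suc zero)))) = false
H₁ (suc (suc zero)) zero = true
H₁ (suc (suc zero)) (suc zero) = true
H₁ (suc (suc zero)) (suc (suc zero)) = false
H₁ (suc (suc zero)) (suc (suc (suc zero))) = true
H₁ (suc (suc zero)) (suc (suc (suc (suc zero)))) = false
H₁ (suc (suc (suc zero))) zero = true
H₁ (suc (suc (suc zero))) (suc zero) = true
H₁ (suc (suc (suc zero))) (suc (suc zero)) = true
H₁ (suc (suc (suc zero))) (suc (suc (suc zero))) = false
H₁ (suc (suc (suc zero))) (suc (suc (suc (suc zero)))) = false
H₁ (suc (suc (suc (suc zero)))) zero = true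
H₁ (suc (suc (suc (suc zero)))) (suc zero) = false
H₁ (suc (suc (suc (suc zero)))) (suc (suc zero)) = false
H₁ (suc (suc (suc (suc zero)))) (suc (suc (suc zero))) = false
H₁ (suc (suc (suc (suc zero)))) (suc (suc (suc (suc zero)))) = false

H₂ : Graph 5   -- K4 plus vertex 4 adjacent to vertices 0 and 1
H₂ zero zero = false
H₂ zero (suc zero) = true
H₂ zero (suc (suc zero)) = true
H₂ zero (suc (suc (suc zero))) = true
H₂ zero (suc (suc (suc (suc zero)))) = true
H₂ (suc zero) zero = true
H₂ (suc zero) (suc zero) = false
H₂ (suc zero) (suc (suc zero)) = true
H₂ (suc zero) (suc (suc (suc zero))) = true
H₂ (suc zero) (suc (suc (suc (suc zero)))) = true
H₂ (suc (suc zero)) zero = true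
H₂ (suc (suc zero)) (suc zero) = true
H₂ (suc (suc zero)) (suc (suc zero)) = false
H₂ (suc (suc zero)) (suc (suc (suc zero))) = true
H₂ (suc (suc zero)) (suc (suc (suc (suc zero)))) = false
H₂ (suc (suc (suc zero))) zero = true
H₂ (suc (suc (suc zero))) (suc zero) = true
H₂ (suc (suc (suc zero))) (suc (suc zero)) = true
H₂ (suc (suc (suc zero))) (suc (suc (suc zero))) = false
H₂ (suc (suc (suc zero))) (suc (suc (suc (suc zero)))) = false
H₂ (suc (suc (suc (suc zero)))) zero = true
H₂ (suc (suc (suc (suc zero)))) (suc zero) = true
H₂ (suc (suc (suc (suc zero)))) (suc (suc zero)) = false
H₂ (suc (suc (suc (suc zero)))) (suc (suc (suc zero))) = false
H₂ (suc (suc (suc (suc zero)))) (suc (suc (suc (suc zero)))) = false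

H₃ : Graph 5   -- K5 minus the edge {3,4}
H₃ zero zero = false
H₃ zero (suc zero) = true
H₃ zero (suc (suc zero)) = true
H₃ zero (suc (suc (suc zero))) = true
H₃ zero (suc (suc (suc (suc zero)))) = true
H₃ (suc zero) zero = true
H₃ (suc zero) (suc zero) = false
H₃ (suc zero) (suc (suc zero)) = true
H₃ (suc zero) (suc (suc (suc zero))) = true
H₃ (suc zero) (suc (suc (suc (suc zero)))) = true
H₃ (suc (suc zero)) zero = true
H₃ (suc (suc zero)) (suc zero) = true
H₃ (suc (suc zero)) (suc (suc zero)) = false
H₃ (suc (suc zero)) (suc (suc (suc zero))) = true
H₃ (suc (suc zero)) (suc (suc (suc (suc zero)))) = true
H₃ (suc (suc (suc zero))) zero = true
H₃ (suc (suc (suc zero))) (suc zero) = true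
H₃ (suc (suc (suc zero))) (suc (suc zero)) = true
H₃ (suc (suc (suc zero))) (suc (suc (suc zero))) = false
H₃ (suc (suc (suc zero))) (suc (suc (suc (suc zero)))) = false
H₃ (suc (suc (suc (suc zero)))) zero = true
H₃ (suc (suc (suc (suc zero)))) (suc zero) = true
H₃ (suc (suc (suc (suc zero)))) (suc (suc zero)) = true
H₃ (suc (suc (suc (suc zero)))) (suc (suc (suc zero))) = false
H₃ (suc (suc (suc (suc zero)))) (suc (suc (suc (suc zero)))) = false

data Which : Set where
  h₁ h₂ h₃ : Which

graphOf : Which → Graph 5
graphOf h₁ = H₁
graphOf h₂ = H₂
graphOf h₃ = H₃

r₂ : Which → ℕ
r₂ h₁ = 18
r₂ h₂ = 18
r₂ h₃ = 22

grValue : ℕ → ℕ → ℕ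
grValue r k =
  if (k % 2) ≡ᵇ 0
  then (r ∸ 1) * 17 ^ ((k ∸ 2) / 2) + 1
  else 4 * 17 ^ ((k ∸ 1) / 2) + 1

-- Lower bounds: substituting a colouring into the vertices of the Paley colouring of K₁₇, which uses two new colours and has no
-- monochromatic K₄, multiplies the number of vertices by 17. The iteration starts from K₄ in one colour, from the Paley
-- colouring itself, or, for K₅ minus an edge, from a colouring of K₂₁.
--
-- Upper bounds: write J_s for K_s minus an edge. A set of vertices is bounded by β m a τ ε when m colours have no J₅, a colours
-- no J₄, τ says whether one colour has no triangle, ε whether colours without J₃ occur, and the remaining colours are unused.
-- By Gallai's theorem the set is split into classes, between which at most two colours R and B occur. Either it is a join in
-- one colour, or every vertex sees both colours outside its class; then the class of a vertex, its red neighbours and its blue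
-- neighbours each avoid smaller graphs, and the bounds follow by induction. If no class has an edge of colour R or B, the classes
-- are counted by two-colour Ramsey numbers. The base case is R₂(J₅) ≤ 22, that is, every two-colouring of K₂₂ has a
-- monochromatic J₅: by Goodman's count of monochromatic triangles some vertex has a dense neighbourhood without J₄ in one colour
-- and without J₅ in the other, and a catalogue of the dense graphs of this kind rules all of them out.
--
-- For an even number of colours H₂ needs a separate induction with value 17^(k/2), which uses the bounds β for all sets that
-- exclude more than H₂ and the two-colour bound R₂(H₂) ≤ 18.
module Submission where

-- Although R₂(J₅) - 1 = 21, two further colours multiply the bound for J₅ by 17 only. A
-- representative whose class has a second vertex cannot lie in a monochromatic K₄ of
-- representatives, since its twin would complete a J₅; and any 18 representatives contain a
-- monochromatic K₄. Hence a colouring of K₂₁ can serve only once, at the innermost level of the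
-- construction. For odd k the bound for J₅ is 4 · 17^j, which K₄ already attains, so it settles all
-- three graphs. For even k it is 21 · 17^j, too large for H₁ and H₂. The obstacle in the induction
-- is a join in a colour without J₅ in which one side has a J₃ and the other no edge of that colour.
-- Counting the first side merely as J₄-free costs 3 · 21 + 21 = 84 at three colours, where only 68
-- is allowed. If the first side has a triangle, the other side is a single vertex; if it has none,
-- the sharper bound 47 for a triangle-free colour gives exactly 47 + 21 = 68. This is why the state
-- T has its own flag.

-- Exhaustive search for graphs avoiding a pattern in each colour.

module Search where
  open import Data.Nat
  open import Data.Nat.Properties
  open import Data.Bool using (Bool; true; false; not; _∧_; _∨_; if_then_else_)
  import Data.Bool.Properties as Boolₚ
  open import Data.List hiding (sum; find)
  open import Data.Nat.ListAction using (sum)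
  open import Data.Nat.ListAction.Properties using (sum-↭)
  open import Data.List.Properties
  open import Data.List.Relation.Unary.All using (All; []; _∷_)
  import Data.List.Relation.Unary.All.Properties as Allₚ
  open import Data.List.Relation.Unary.Any using (here; there)
  import Data.List.Relation.Unary.Any as Any
  open import Data.List.Relation.Unary.AllPairs using ([]; _∷_)
  open import Data.List.Relation.Unary.Unique.Propositional using (Unique)
  open import Data.List.Relation.Binary.Sublist.Propositional using (_⊆_; []; _∷_; minimum) renaming (_∷ʳ_ to omit)
  import Data.List.Relation.Binary.Sublist.Propositional.Properties as Sub
  open import Data.List.Relation.Binary.Permutation.Propositional using (_↭_; ↭⇒↭ₛ; ↭-sym; ↭-trans; ↭-reflexive)
  import Data.List.Relation.Binary.Permutation.Propositional.Properties as Perm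
  import Data.List.Relation.Binary.Permutation.Setoid.Properties as PermS
  open import Data.List.Membership.Propositional using (_∈_; lose; find)
  open import Data.List.Membership.Propositional.Properties
  open import Data.Product using (∃; _×_; _,_; proj₁; proj₂)
  open import Data.Sum using (_⊎_; inj₁; inj₂; [_,_]′)
  open import Data.Empty using (⊥-elim)
  open import Data.Unit using (⊤; tt)
  open import Function using (_∘_; case_of_)
  open import Relation.Nullary
  open import Relation.Binary.PropositionalEquality hiding ([_])

  private variable
    A : Set

  ∧-true : ∀ {a b} → a ∧ b ≡ true → a ≡ true × b ≡ true
  ∧-true {true} {true} refl = refl , refl

  ∨-true : ∀ {a b} → a ∨ b ≡ true → a ≡ true ⊎ b ≡ true
  ∨-true {true} _ = inj₁ refl
  ∨-true {false} p = inj₂ p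

  not-true : ∀ {a} → not a ≡ true → a ≡ false
  not-true {false} _ = refl

  pen : Bool → ℕ
  pen true = 0
  pen false = 1

  lack : (A → A → Bool) → A → List A → ℕ
  lack f x [] = 0
  lack f x (y ∷ C) = pen (f x y) + lack f x C

  miss : (A → A → Bool) → List A → ℕ
  miss f [] = 0
  miss f (x ∷ C) = lack f x C + miss f C

  lackTo : (A → A → Bool) → List A → A → ℕ
  lackTo f [] z = 0
  lackTo f (y ∷ C) z = pen (f y z) + lackTo f C z

  lack-∷ʳ : ∀ (f : A → A → Bool) x C y → lack f x (C ∷ʳ y) ≡ lack f x C + pen (f x y)
  lack-∷ʳ f x [] y = +-identityʳ _
  lack-∷ʳ f x (c ∷ C) y = trans (cong (pen (f x c) +_) (lack-∷ʳ f x C y)) (sym (+-assoc (pen (f x c)) _ _))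

  miss-∷ʳ : ∀ (f : A → A → Bool) C y → miss f (C ∷ʳ y) ≡ miss f C + lackTo f C y
  miss-∷ʳ f [] y = refl
  miss-∷ʳ f (c ∷ C) y rewrite lack-∷ʳ f c C y | miss-∷ʳ f C y
    = trans (+-assoc (lack f c C) _ _)
      (trans (cong (lack f c C +_) (trans (sym (+-assoc (pen (f c y)) _ _))
        (trans (cong (_+ lackTo f C y) (+-comm (pen (f c y)) (miss f C))) (+-assoc (miss f C) _ _))))
      (sym (+-assoc (lack f c C) _ _)))

  lackTo-∷ʳ : ∀ (f : A → A → Bool) C y z → lackTo f (C ∷ʳ y) z ≡ lackTo f C z + pen (f y z)
  lackTo-∷ʳ f [] y z = +-identityʳ _
  lackTo-∷ʳ f (c ∷ C) y z = trans (cong (pen (f c z) +_) (lackTo-∷ʳ f C y z)) (sym (+-assoc (pen (f c z)) _ _))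

  agree : Bool → Bool → Bool
  agree true c = c
  agree false c = not c

  Row = List Bool
  Mat = List Row

  -- A vertex is loose/tight/over when it has 0 / at most 1 / too many missing edges to the vertices chosen so far.
  data Slack : Set where
    loose tight over : Slack

  spend : Slack → Slack
  spend loose = tight
  spend tight = over
  spend over = over

  bump : Bool → List Slack → Row → List Slack
  bump true (d ∷ ds) (true ∷ r) = d ∷ bump true ds r
  bump true (d ∷ ds) (false ∷ r) = spend d ∷ bump true ds r
  bump false (d ∷ ds) (true ∷ r) = spend d ∷ bump false ds r
  bump false (d ∷ ds) (false ∷ r) = d ∷ bump false ds r
  bump _ _ _ = []

  -- `d` is the slack of the set chosen so far and `ds` lists the slacks of the remaining vertices
  -- towards it. At most one missing edge is ever allowed, so these three values replace all
  -- counting: a tight set can only take loose vertices, and a loose set becomes tight by taking a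
  -- tight vertex.
  ext : Bool → ℕ → Slack → List Slack → Mat → Bool
  ext b zero d ds rs = true
  ext b (suc s) d (over ∷ ds) (r ∷ rs) = ext b (suc s) d ds rs
  ext b (suc s) loose (loose ∷ ds) (r ∷ rs) = ext b s loose (bump b ds r) rs ∨ ext b (suc s) loose ds rs
  ext b (suc s) loose (tight ∷ ds) (r ∷ rs) = ext b s tight (bump b ds r) rs ∨ ext b (suc s) loose ds rs
  ext b (suc s) tight (loose ∷ ds) (r ∷ rs) = ext b s tight (bump b ds r) rs ∨ ext b (suc s) tight ds rs
  ext b (suc s) tight (tight ∷ ds) (r ∷ rs) = ext b (suc s) tight ds rs
  ext b (suc s) _ _ _ = false

  start : Bool → Row → List Slack
  start true (true ∷ r) = loose ∷ start true r
  start true (false ∷ r) = tight ∷ start true r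
  start false (true ∷ r) = tight ∷ start false r
  start false (false ∷ r) = loose ∷ start false r
  start _ [] = []

  enter : Bool → Bool → ℕ → Slack → List Slack → Mat → Bool
  enter b true s d ds m = ext b s d ds m
  enter b false s loose ds m = ext b s tight ds m
  enter b false s _ ds m = false

  bad : Bool → ℕ → Slack → Row → Mat → Bool
  bad b s d (c ∷ r) (t ∷ m) = enter b (agree b c) s d (bump b (start b r) t) m
  bad b s d _ _ = false

  -- Forbidden patterns: 2 + s₁ vertices joined by true, 2 + s₀ vertices joined by false; one edge may be missing when the slack is loose.
  record Pat : Set where
    constructor pat
    field
      s₁ : ℕ
      d₁ : Slack
      s₀ : ℕ
      d₀ : Slack

  ok : Pat → Mat → Row → Bool
  ok (pat s₁ d₁ s₀ d₀) m r = not (bad true s₁ d₁ r m) ∧ not (bad false s₀ d₀ r m)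

  keep : Bool → Row → List Row → List Row
  keep true r rs = r ∷ rs
  keep false r rs = rs

  refine : Pat → Mat → List Row → List Row
  refine F m [] = []
  refine F m (t ∷ ts) = keep (ok F m (true ∷ t)) (true ∷ t) (keep (ok F m (false ∷ t)) (false ∷ t) (refine F m ts))

  allRows : Pat → Mat → List Row
  allRows F [] = [] ∷ []
  allRows F (r ∷ m) = refine F (r ∷ m) (allRows F m)

  record Goal : Set where
    constructor goal
    field
      wanted : Row → Bool
      number : ℕ

  have : (Row → Bool) → ℕ → Mat → ℕ
  have p zero m = 0
  have p (suc d) [] = 0
  have p (suc d) (r ∷ m) = if p (drop d r) then suc (have p d m) else have p d m

  -- The candidates are adjacency rows, not vertices. For a row `t` wanted by the current goal,
  -- either some remaining vertex realises it and is chosen, or none does and `t` is discarded; this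
  -- also prevents the same set from being searched in another order. Rows of no interest to the
  -- current goal wait in `pre`. Running out of wanted rows while vertices are still due is a
  -- contradiction, hence `true`. The `drop d` leaves the part of a row that belongs to the base.
  stage : Pat → (Mat → Bool) → ℕ → Mat → List Row → List Goal → Bool
  pick : Pat → (Mat → Bool) → ℕ → Mat → List Row → List Row → (Row → Bool) → ℕ → List Goal → Bool
  stage F leaf d m cs [] = leaf m
  stage F leaf d m cs (goal p n ∷ gs) = pick F leaf d m [] cs p (n ∸ have p d m) gs
  pick F leaf d m pre cs p zero gs = stage F leaf d m (pre ++ cs) gs
  pick F leaf d m pre [] p (suc n) gs = true
  pick F leaf d m pre (t ∷ ts) p (suc n) gs =
    if p (drop d t)
    then pick F leaf (suc d) (t ∷ m) [] (refine F (t ∷ m) (pre ++ t ∷ ts)) p n gs ∧ pick F leaf d m pre ts p (suc n) gs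
    else pick F leaf d m (t ∷ pre) ts p (suc n) gs

  -- A complete pattern is treated as one whose single gap is spent beforehand, so that
  -- `off d + miss f C ≤ 1` describes K_s for `tight` and J_s for `loose`.
  off : Slack → ℕ
  off loose = 0
  off tight = 1
  off over = 2

  Fit : ℕ → Slack → Set
  Fit m loose = m ≡ 0
  Fit m tight = m ≤ 1
  Fit m over = ⊤

  Fit-spend : ∀ m d → Fit m d → Fit (m + 1) (spend d)
  Fit-spend m loose refl = s≤s z≤n
  Fit-spend m tight p = tt
  Fit-spend m over p = tt

  Fit-+0 : ∀ m d → Fit m d → Fit (m + 0) d
  Fit-+0 m d p rewrite +-identityʳ m = p

  module Sound (e : A → A → Bool) where

    adj : Bool → A → A → Bool
    adj b x y = agree b (e x y)

    matOf : List A → Mat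
    matOf [] = []
    matOf (x ∷ L) = map (e x) L ∷ matOf L

    data Fits (b : Bool) (C : List A) : List Slack → List A → Set where
      [] : Fits b C [] []
      _∷_ : ∀ {d ds y L} → Fit (lackTo (adj b) C y) d → Fits b C ds L → Fits b C (d ∷ ds) (y ∷ L)

    bump-fits : ∀ b C x {ds L} → Fits b C ds L → Fits b (C ∷ʳ x) (bump b ds (map (e x) L)) L
    bump-fits true C x [] = []
    bump-fits false C x [] = []
    bump-fits true C x {d ∷ ds} {y ∷ L} (p ∷ ps) with e x y in eq
    ... | true = subst (λ n → Fit n d) (sym (trans (lackTo-∷ʳ _ C x y) (cong (λ c → lackTo (adj true) C y + pen c) eq))) (Fit-+0 _ d p) ∷ bump-fits true C x ps
    ... | false = subst (λ n → Fit n (spend d)) (sym (trans (lackTo-∷ʳ _ C x y) (cong (λ c → lackTo (adj true) C y + pen c) eq))) (Fit-spend _ d p) ∷ bump-fits true C x ps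
    bump-fits false C x {d ∷ ds} {y ∷ L} (p ∷ ps) with e x y in eq
    ... | true = subst (λ n → Fit n (spend d)) (sym (trans (lackTo-∷ʳ _ C x y) (cong (λ c → lackTo (adj false) C y + pen (not c)) eq))) (Fit-spend _ d p) ∷ bump-fits false C x ps
    ... | false = subst (λ n → Fit n d) (sym (trans (lackTo-∷ʳ _ C x y) (cong (λ c → lackTo (adj false) C y + pen (not c)) eq))) (Fit-+0 _ d p) ∷ bump-fits false C x ps

    start-fits : ∀ b x L → Fits b (x ∷ []) (start b (map (e x) L)) L
    start-fits true x [] = []
    start-fits false x [] = []
    start-fits true x (y ∷ L) with e x y in eq
    ... | true = trans (+-identityʳ _) (cong pen eq) ∷ start-fits true x L
    ... | false = ≤-reflexive (trans (+-identityʳ _) (cong pen eq)) ∷ start-fits true x L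
    start-fits false x (y ∷ L) with e x y in eq
    ... | true = ≤-reflexive (trans (+-identityʳ _) (cong (pen ∘ not) eq)) ∷ start-fits false x L
    ... | false = trans (+-identityʳ _) (cong (pen ∘ not) eq) ∷ start-fits false x L

    record Found (b : Bool) (o s : ℕ) (C L : List A) : Set where
      constructor found
      field
        more : List A
        sub : more ⊆ L
        size : length more ≡ s
        few : o + miss (adj b) (C ++ more) ≤ 1

    skip : ∀ {b o s C y L} → Found b o s C L → Found b o s C (y ∷ L)
    skip (found C′ i l m) = found C′ (omit _ i) l m

    take-one : ∀ {b o s C y L} → Found b o s (C ∷ʳ y) L → Found b o (suc s) C (y ∷ L)
    take-one {b} {o} {C = C} {y} (found C′ i l m) = found (y ∷ C′) (refl ∷ i) (cong suc l)
      (subst (λ z → o + miss (adj b) z ≤ 1) (++-assoc C (y ∷ []) C′) m)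

    step : ∀ b o C y → o + miss (adj b) (C ∷ʳ y) ≡ (o + miss (adj b) C) + lackTo (adj b) C y
    step b o C y = trans (cong (o +_) (miss-∷ʳ _ C y)) (sym (+-assoc o _ _))

    ext-sound : ∀ b o s d {ds} C L → ext b s d ds (matOf L) ≡ true → Fits b C ds L →
                Fit (o + miss (adj b) C) d → d ≢ over → Found b o s C L
    ext-sound b o zero loose C L h fs fd nd = found [] (minimum _) refl
      (≤-trans (≤-reflexive (trans (cong (λ z → o + miss (adj b) z) (++-identityʳ C)) fd)) z≤n)
    ext-sound b o zero tight C L h fs fd nd = found [] (minimum _) refl
      (≤-trans (≤-reflexive (cong (λ z → o + miss (adj b) z) (++-identityʳ C))) fd)
    ext-sound b o zero over C L h fs fd nd = ⊥-elim (nd refl)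
    ext-sound b o (suc s) over {ds} C L h fs fd nd = ⊥-elim (nd refl)
    ext-sound b o (suc s) loose {over ∷ ds} C (y ∷ L) h (f ∷ fs) fd nd = skip (ext-sound b o (suc s) loose C L h fs fd nd)
    ext-sound b o (suc s) tight {over ∷ ds} C (y ∷ L) h (f ∷ fs) fd nd = skip (ext-sound b o (suc s) tight C L h fs fd nd)
    ext-sound b o (suc s) loose {loose ∷ ds} C (y ∷ L) h (f ∷ fs) fd nd with ∨-true h
    ... | inj₁ p = take-one (ext-sound b o s loose (C ∷ʳ y) L p (bump-fits b C y fs)
                     (trans (step b o C y) (cong₂ _+_ fd f)) nd)
    ... | inj₂ p = skip (ext-sound b o (suc s) loose C L p fs fd nd)
    ext-sound b o (suc s) loose {tight ∷ ds} C (y ∷ L) h (f ∷ fs) fd nd with ∨-true h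
    ... | inj₁ p = take-one (ext-sound b o s tight (C ∷ʳ y) L p (bump-fits b C y fs)
                     (≤-trans (≤-reflexive (trans (step b o C y) (cong (_+ lackTo (adj b) C y) fd))) f) λ ())
    ... | inj₂ p = skip (ext-sound b o (suc s) loose C L p fs fd nd)
    ext-sound b o (suc s) tight {loose ∷ ds} C (y ∷ L) h (f ∷ fs) fd nd with ∨-true h
    ... | inj₁ p = take-one (ext-sound b o s tight (C ∷ʳ y) L p (bump-fits b C y fs)
                     (≤-trans (≤-reflexive (trans (step b o C y) (trans (cong (_ +_) f) (+-identityʳ _)))) fd) λ ())
    ... | inj₂ p = skip (ext-sound b o (suc s) tight C L p fs fd nd)
    ext-sound b o (suc s) tight {tight ∷ ds} C (y ∷ L) h (f ∷ fs) fd nd = skip (ext-sound b o (suc s) tight C L h fs fd nd)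
    ext-sound b o (suc s) loose C [] h [] fd nd = case h of λ ()
    ext-sound b o (suc s) tight C [] h [] fd nd = case h of λ ()

    bad-sound : ∀ b s d x L → d ≢ over → bad b s d (map (e x) L) (matOf L) ≡ true →
                ∃ λ C → C ⊆ (x ∷ L) × length C ≡ 2 + s × off d + miss (adj b) C ≤ 1
    bad-sound b s d x (y ∷ L) nd h = finish (go (agree b (e x y)) refl d nd h)
      where
      fs : Fits b (x ∷ y ∷ []) (bump b (start b (map (e x) L)) (map (e y) L)) L
      fs = bump-fits b (x ∷ []) y (start-fits b x L)
      m₀ : ∀ {c} → agree b (e x y) ≡ c → miss (adj b) (x ∷ y ∷ []) ≡ pen c
      m₀ {c} q = trans (+-identityʳ _) (trans (+-identityʳ _) (cong pen q))
      go : ∀ c → agree b (e x y) ≡ c → ∀ d → d ≢ over → enter b c s d (bump b (start b (map (e x) L)) (map (e y) L)) (matOf L) ≡ true →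
           Found b (off d) s (x ∷ y ∷ []) L
      go true q loose nd h = ext-sound b 0 s loose _ L h fs (m₀ q) λ ()
      go true q tight nd h = ext-sound b 1 s tight _ L h fs (s≤s (≤-reflexive (m₀ q))) λ ()
      go _ q over nd h = ⊥-elim (nd refl)
      go false q loose nd h = ext-sound b 0 s tight _ L h fs (≤-reflexive (m₀ q)) λ ()
      go false q tight nd ()
      finish : Found b (off d) s (x ∷ y ∷ []) L → _
      finish (found C i l m) = x ∷ y ∷ C , refl ∷ refl ∷ i , cong (suc ∘ suc) l , m

    unique-⊆ : ∀ {xs ys : List A} → xs ⊆ ys → Unique ys → Unique xs
    unique-⊆ [] [] = []
    unique-⊆ (omit y s) (_ ∷ u) = unique-⊆ s u
    unique-⊆ (refl ∷ s) (p ∷ u) = Sub.All-resp-⊆ s p ∷ unique-⊆ s u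

    Free : (A → Set) → Bool → ℕ → Slack → Set
    Free P b s d = ∀ C → Unique C → All P C → length C ≡ 2 + s → 2 ≤ off d + miss (adj b) C

    record Avoids (F : Pat) (P : A → Set) : Set where
      constructor avoids
      open Pat F
      field
        free₁ : Free P true s₁ d₁
        free₀ : Free P false s₀ d₀
        nd₁ : d₁ ≢ over
        nd₀ : d₀ ≢ over

    not-bad : ∀ {P} b s d x L → Free P b s d → d ≢ over → Unique (x ∷ L) → All P (x ∷ L) →
              bad b s d (map (e x) L) (matOf L) ≡ false
    not-bad b s d x L fr nd u al with bad b s d (map (e x) L) (matOf L) in eq
    ... | false = refl
    ... | true with bad-sound b s d x L nd eq
    ...   | C , i , l , m = ⊥-elim (<⇒≱ (fr C (unique-⊆ i u) (Sub.All-resp-⊆ i al) l) m)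

    ok-complete : ∀ {P F} → Avoids F P → ∀ x L → Unique (x ∷ L) → All P (x ∷ L) → ok F (matOf L) (map (e x) L) ≡ true
    ok-complete {F = pat s₁ d₁ s₀ d₀} (avoids f₁ f₀ n₁ n₀) x L u al
      rewrite not-bad true s₁ d₁ x L f₁ n₁ u al | not-bad false s₀ d₀ x L f₀ n₀ u al = refl

    keep-∈ : ∀ {r r′ : Row} {rs} b → r ∈ rs → r ∈ keep b r′ rs
    keep-∈ true i = there i
    keep-∈ false i = i

    keep-here : ∀ {r : Row} {rs} {b} → b ≡ true → r ∈ keep b r rs
    keep-here refl = here refl

    refine-complete : ∀ F m {c t ts} → t ∈ ts → ok F m (c ∷ t) ≡ true → c ∷ t ∈ refine F m ts
    refine-complete F m {true} {ts = t ∷ ts} (here refl) p = keep-here p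
    refine-complete F m {false} {ts = t ∷ ts} (here refl) p = keep-∈ (ok F m (true ∷ t)) (keep-here p)
    refine-complete F m {ts = t ∷ ts} (there i) p =
      keep-∈ (ok F m (true ∷ t)) (keep-∈ (ok F m (false ∷ t)) (refine-complete F m i p))

    allRows-complete : ∀ {P F} → Avoids F P → ∀ x L → Unique (x ∷ L) → All P (x ∷ L) → map (e x) L ∈ allRows F (matOf L)
    allRows-complete av x [] u al = here refl
    allRows-complete {F = F} av x (y ∷ L) u@((_ ∷ p) ∷ (_ ∷ q)) al@(a ∷ _ ∷ b) =
      refine-complete F (matOf (y ∷ L)) (allRows-complete av x L (p ∷ q) (a ∷ b)) (ok-complete av x (y ∷ L) u al)

  bit : Bool → ℕ
  bit true = 1
  bit false = 0

  cnt : (A → Bool) → List A → ℕ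
  cnt p W = sum (map (bit ∘ p) W)

  cnt-++ : ∀ (p : A → Bool) xs ys → cnt p (xs ++ ys) ≡ cnt p xs + cnt p ys
  cnt-++ p [] ys = refl
  cnt-++ p (x ∷ xs) ys = trans (cong (bit (p x) +_) (cnt-++ p xs ys)) (sym (+-assoc (bit (p x)) _ _))

  cnt-↭ : ∀ (p : A → Bool) {xs ys} → xs ↭ ys → cnt p xs ≡ cnt p ys
  cnt-↭ p s = sum-↭ (Perm.map⁺ (bit ∘ p) s)

  cnt-witness : ∀ (p : A → Bool) xs → 1 ≤ cnt p xs → ∃ λ x → x ∈ xs × p x ≡ true
  cnt-witness p (x ∷ xs) h with p x in eq
  ... | true = x , here refl , eq
  ... | false = let (y , i , q) = cnt-witness p xs h in y , there i , q

  cnt-true : ∀ (xs : List A) → cnt (λ _ → true) xs ≡ length xs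
  cnt-true [] = refl
  cnt-true (x ∷ xs) = cong suc (cnt-true xs)

  drop-map-++ : ∀ {X : Set} (f : A → X) xs ys → drop (length xs) (map f (xs ++ ys)) ≡ map f ys
  drop-map-++ f [] ys = refl
  drop-map-++ f (x ∷ xs) ys = drop-map-++ f xs ys

  Unique-↭ : {xs ys : List A} → xs ↭ ys → Unique xs → Unique ys
  Unique-↭ s = PermS.Unique-resp-↭ (setoid _) (↭⇒↭ₛ s)

  All-↭ : {P : A → Set} {xs ys : List A} → xs ↭ ys → All P xs → All P ys
  All-↭ = Perm.All-resp-↭

  module Run {A : Set} (e : A → A → Bool) (F : Pat) (P : A → Set) (leaf : Mat → Bool) (B U : List A) where
    open Sound e

    record Outcome : Set where
      constructor outcome
      field
        chosen rest : List A
        whole : chosen ++ rest ↭ U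
        good : leaf (matOf (chosen ++ B)) ≡ true

    row : List A → A → Row
    row A w = map (e w) (A ++ B)

    wants : (Row → Bool) → A → Bool
    wants p a = p (map (e a) B)

    have-cnt : ∀ p A → have p (length A) (matOf (A ++ B)) ≡ cnt (wants p) A
    have-cnt p [] = refl
    have-cnt p (a ∷ A) with p (drop (length A) (map (e a) (A ++ B))) | cong p (drop-map-++ (e a) A B)
    ... | true | eq rewrite sym eq = cong suc (have-cnt p A)
    ... | false | eq rewrite sym eq = have-cnt p A

    module _ (av : Avoids F P) (uniq : Unique (U ++ B)) (al : All P (U ++ B)) where

      prefix-⊆ : ∀ (xs ys : List A) → xs ⊆ xs ++ ys
      prefix-⊆ [] ys = minimum ys
      prefix-⊆ (x ∷ xs) ys = refl ∷ prefix-⊆ xs ys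

      part : ∀ xs ys → xs ++ ys ↭ U → (xs ++ B) ++ ys ↭ U ++ B
      part xs ys s = ↭-trans (↭-reflexive (++-assoc xs B ys))
        (↭-trans (Perm.++⁺ˡ xs (Perm.++-comm B ys)) (↭-trans (↭-reflexive (sym (++-assoc xs ys B))) (Perm.++⁺ʳ B s)))

      part-unique : ∀ xs ys → xs ++ ys ↭ U → Unique (xs ++ B)
      part-unique xs ys s = unique-⊆ (prefix-⊆ _ ys) (Unique-↭ (↭-sym (part xs ys s)) uniq)

      part-all : ∀ xs ys → xs ++ ys ↭ U → All P (xs ++ B)
      part-all xs ys s = Allₚ.++⁻ˡ _ (All-↭ (↭-sym (part xs ys s)) al)

      Goals : List Goal → Set
      Goals = All (λ g → Goal.number g ≤ cnt (wants (Goal.wanted g)) U)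

      Stage : List Goal → Set
      Stage gs = ∀ A W cs → A ++ W ↭ U → (∀ {w} → w ∈ W → row A w ∈ cs) → Goals gs →
        stage F leaf (length A) (matOf (A ++ B)) cs gs ≡ true → Outcome

      -- The invariants are: the row of every remaining vertex is still a candidate, the rows of
      -- those wanted by the current goal are among the untested candidates, and at least `r` wanted
      -- vertices remain.
      Pick : List Goal → ℕ → Set
      Pick gs r = ∀ p pre cs A W → A ++ W ↭ U → (∀ {w} → w ∈ W → row A w ∈ pre ⊎ row A w ∈ cs) →
        (∀ {w} → w ∈ W → wants p w ≡ true → row A w ∈ cs) → r ≤ cnt (wants p) W → Goals gs →
        pick F leaf (length A) (matOf (A ++ B)) pre cs p r gs ≡ true → Outcome

      -- Soundness for `r` remaining choices enters as a hypothesis, so that the recursion here runs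
      -- over the candidate rows alone and is structural.
      pick-suc : ∀ gs r → Pick gs r → Pick gs (suc r)
      pick-suc gs r rec p pre [] A W s rs ws le gl h =
        let (w , i , q) = cnt-witness (wants p) W (≤-trans (s≤s z≤n) le) in case ws i q of λ ()
      pick-suc gs r rec p pre (t ∷ ts) A W s rs ws le gl h with p (drop (length A) t) in eq
      ... | false = pick-suc gs r rec p (t ∷ pre) ts A W s
            (λ i → case rs i of λ { (inj₁ j) → inj₁ (there j) ; (inj₂ (here q)) → inj₁ (here q) ; (inj₂ (there j)) → inj₂ j })
            (λ {w} i q → case ws i q of λ
               { (here refl) → case trans (sym eq) (trans (cong p (drop-map-++ (e w) A B)) q) of λ ()
               ; (there j) → j }) le gl h
      ... | true with Any.any? (λ w → ≡-dec Boolₚ._≟_ (row A w) t) W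
      ...   | no none = pick-suc gs r rec p pre ts A W s
               (λ i → case rs i of λ { (inj₁ j) → inj₁ j ; (inj₂ (here q)) → ⊥-elim (none (lose i q)) ; (inj₂ (there j)) → inj₂ j })
               (λ i q → case ws i q of λ { (here q′) → ⊥-elim (none (lose i q′)) ; (there j) → j }) le gl
               (proj₂ (∧-true h))
      ...   | yes some with find some
      ...     | w , i , refl with ∈-∃++ i
      -- After a choice all candidates, including `t` itself, are refined and count as untested:
      -- another vertex may have had the same row.
      ...       | W₁ , W₂ , refl = rec p [] _ (w ∷ A) (W₁ ++ W₂) s′ (inj₂ ∘ rs′) (λ i _ → rs′ i) le′ gl
                     (proj₁ (∧-true h))
        where
        mid : W₁ ++ w ∷ W₂ ↭ w ∷ (W₁ ++ W₂)
        mid = Perm.shift w W₁ W₂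
        s′ : (w ∷ A) ++ (W₁ ++ W₂) ↭ U
        s′ = ↭-trans (↭-sym (↭-trans (Perm.++⁺ˡ A mid) (Perm.shift w A (W₁ ++ W₂)))) s
        le′ : r ≤ cnt (wants p) (W₁ ++ W₂)
        le′ = s≤s⁻¹ (≤-trans le (≤-reflexive (trans (cnt-↭ (wants p) mid)
                (cong (λ z → bit z + cnt (wants p) (W₁ ++ W₂)) (trans (sym (cong p (drop-map-++ (e w) A B))) eq)))))
        rs′ : ∀ {v} → v ∈ W₁ ++ W₂ → row (w ∷ A) v ∈ refine F (row A w ∷ matOf (A ++ B)) (pre ++ row A w ∷ ts)
        rs′ {v} j with ∈-∃++ j
        ... | X , Y , eqX = refine-complete F _ ([ ∈-++⁺ˡ , ∈-++⁺ʳ pre ]′ (rs (∈-resp (↭-sym mid) (there j))))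
                (ok-complete av v (w ∷ A ++ B) (part-unique (v ∷ w ∷ A) (X ++ Y) sv) (part-all (v ∷ w ∷ A) (X ++ Y) sv))
          where
          ∈-resp : ∀ {xs ys : List _} → xs ↭ ys → v ∈ xs → v ∈ ys
          ∈-resp q = Perm.∈-resp-↭ q
          sv : v ∷ w ∷ A ++ (X ++ Y) ↭ U
          sv = ↭-trans (↭-sym (↭-trans (↭-reflexive (cong ((w ∷ A) ++_) eqX))
                 (↭-trans (Perm.++⁺ˡ (w ∷ A) (Perm.shift v X Y)) (Perm.shift v (w ∷ A) (X ++ Y))))) s′

      stage-sound : ∀ gs → Stage gs
      pick-sound : ∀ gs r → Pick gs r
      stage-sound [] A W cs s rs gl h = outcome A W s h
      stage-sound (goal p n ∷ gs) A W cs s rs (g ∷ gl) h =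
        pick-sound gs _ p [] cs A W s (inj₂ ∘ rs) (λ i _ → rs i)
          (m≤n+o⇒m∸n≤o n _ (≤-trans g (≤-reflexive (trans (cnt-↭ (wants p) (↭-sym s))
            (trans (cnt-++ (wants p) A W) (cong (_+ cnt (wants p) W) (sym (have-cnt p A)))))))) gl h
      pick-sound gs zero p pre cs A W s rs ws le gl h =
        stage-sound gs A W (pre ++ cs) s ([ ∈-++⁺ˡ , ∈-++⁺ʳ pre ]′ ∘ rs) gl h
      pick-sound gs (suc r) = pick-suc gs r (pick-sound gs r)

-- Small two-colour Ramsey numbers by search.

module SmallRamseyNumbers where
  open import Data.Nat
  open import Data.Nat.Properties
  open import Data.Bool using (Bool; true; false; not)
  open import Data.List hiding (sum; find)
  open import Data.List.Properties
  open import Data.List.Relation.Unary.All using (All; []; _∷_)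
  import Data.List.Relation.Unary.All as All
  open import Data.List.Relation.Unary.Any using (here; there)
  open import Data.List.Relation.Unary.AllPairs using ([]; _∷_)
  import Data.List.Relation.Unary.AllPairs as AllPairs
  open import Data.List.Relation.Unary.Unique.Propositional using (Unique)
  open import Data.List.Relation.Binary.Permutation.Propositional using (_↭_; ↭-refl)
  import Data.List.Relation.Binary.Permutation.Propositional.Properties as Perm
  open import Data.List.Membership.Propositional using (_∈_)
  open import Data.List.Membership.Propositional.Properties
  open import Function using (_∘_; case_of_)
  open import Relation.Nullary
  open import Relation.Binary.PropositionalEquality hiding ([_])
  open Search

  hd : Row → Bool
  hd [] = false
  hd (c ∷ _) = c

  never : Mat → Bool
  never _ = false

  everything : ℕ → Goal
  everything = goal (λ _ → true)

  -- The base is a single root, whose matrix is one empty row. A goal for `n` vertices therefore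
  -- concerns sets of `n + 1` vertices.
  rooted : Pat → (Mat → Bool) → List Goal → Bool
  rooted F leaf gs = stage F leaf 0 ([] ∷ []) (allRows F ([] ∷ [])) gs

  J5J5 J4J5 J4J4 K3J5 K3J4 K3K4 : Pat
  J5J5 = pat 3 loose 3 loose
  J4J5 = pat 2 loose 3 loose
  J4J4 = pat 2 loose 2 loose
  K3J5 = pat 1 tight 3 loose
  K3J4 = pat 1 tight 2 loose
  K3K4 = pat 1 tight 2 tight

  count-split : ∀ {A : Set} (p : A → Bool) xs → cnt p xs + cnt (not ∘ p) xs ≡ length xs
  count-split p [] = refl
  count-split p (x ∷ xs) with p x
  ... | true = cong suc (count-split p xs)
  ... | false = trans (+-suc _ _) (cong suc (count-split p xs))

  cnt-cong : ∀ {A : Set} {p q : A → Bool} → (∀ x → p x ≡ q x) → ∀ xs → cnt p xs ≡ cnt q xs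
  cnt-cong h [] = refl
  cnt-cong h (x ∷ xs) = cong₂ _+_ (cong bit (h x)) (cnt-cong h xs)

  module _ {A : Set} (e : A → A → Bool) {P : A → Set} where
    open Sound e

    rooted-sound : ∀ {F leaf} x U gs → Avoids F P → Unique (x ∷ U) → All P (x ∷ U) →
      All (λ g → Goal.number g ≤ cnt (λ w → Goal.wanted g (e w x ∷ [])) U) gs →
      rooted F leaf gs ≡ true → Run.Outcome e F P leaf (x ∷ []) U
    rooted-sound {F} {leaf} x U gs av u a gl h =
      Run.stage-sound e F P leaf (x ∷ []) U av (Unique-↭ rot u) (All-↭ rot a) gs [] U _ ↭-refl rows gl h
      where
      rot : x ∷ U ↭ U ++ x ∷ []
      rot = Perm.∷↭∷ʳ x U
      rows : ∀ {w} → w ∈ U → map (e w) (x ∷ []) ∈ allRows F ([] ∷ [])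
      rows {w} i = allRows-complete av w (x ∷ []) uw (All.lookup a (there i) ∷ All.lookup a (here refl) ∷ [])
        where
        uw : Unique (w ∷ x ∷ [])
        uw = (≢-sym (All.lookup (AllPairs.head u) i) ∷ []) ∷ [] ∷ []

    refute : ∀ F n → rooted F never (everything n ∷ []) ≡ true → Avoids F P →
             ∀ L → Unique L → All P L → length L ≤ n
    refute F n h av [] u a = z≤n
    refute F n h av (x ∷ U) u a with suc (length U) ≤? n
    ... | yes p = p
    ... | no np = case Run.Outcome.good (rooted-sound {leaf = never} x U _ av u a
                    (≤-trans (s≤s⁻¹ (≰⇒> np)) (≤-reflexive (sym (cnt-true U))) ∷ []) h) of λ ()

    -- A vertex of a 13-set has 5 true or 8 false neighbours in it.
    J4J5-bound : Avoids J4J5 P → ∀ L → Unique L → All P L → length L ≤ 12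
    J4J5-bound av [] u a = z≤n
    J4J5-bound av (x ∷ U) u a with suc (length U) ≤? 12
    ... | yes p = p
    ... | no np with 5 ≤? cnt (λ w → e w x) U
    ...   | yes q = case Run.Outcome.good (rooted-sound {leaf = never} x U (goal hd 5 ∷ everything 12 ∷ []) av u a
                      (q ∷ ≤-trans (s≤s⁻¹ (≰⇒> np)) (≤-reflexive (sym (cnt-true U))) ∷ []) refl) of λ ()
    ...   | no q = case Run.Outcome.good (rooted-sound {leaf = never} x U (goal (not ∘ hd) 8 ∷ everything 12 ∷ []) av u a
                      (many ∷ ≤-trans (s≤s⁻¹ (≰⇒> np)) (≤-reflexive (sym (cnt-true U))) ∷ []) refl) of λ ()
      where
      many : 8 ≤ cnt (λ w → not (e w x)) U
      many = +-cancelˡ-≤ 4 _ _ (≤-trans (s≤s⁻¹ (≰⇒> np)) (≤-trans (≤-reflexive (sym (count-split (λ w → e w x) U)))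
               (+-monoˡ-≤ _ (s≤s⁻¹ (≰⇒> q)))))

    J4J4-bound : Avoids J4J4 P → ∀ L → Unique L → All P L → length L ≤ 9
    J4J4-bound = refute J4J4 9 refl

    K3J5-bound : Avoids K3J5 P → ∀ L → Unique L → All P L → length L ≤ 10
    K3J5-bound = refute K3J5 10 refl

    K3J4-bound : Avoids K3J4 P → ∀ L → Unique L → All P L → length L ≤ 6
    K3J4-bound = refute K3J4 6 refl

    K3K4-bound : Avoids K3K4 P → ∀ L → Unique L → All P L → length L ≤ 8
    K3K4-bound = refute K3K4 8 refl

-- Recognising dense neighbourhoods and extending them to 22 vertices.

module Extension where
  open import Data.Nat
  open import Data.Nat.Properties
  open import Data.Bool using (Bool; true; false; not; _∧_; _∨_; if_then_else_; T)
  open import Data.List hiding (sum; find)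
  open import Data.Nat.ListAction using (sum)
  open import Data.Nat.ListAction.Properties using (sum-↭)
  open import Data.List.Properties
  open import Data.List.Relation.Unary.All using (All; []; _∷_)
  import Data.List.Relation.Unary.All as All
  import Data.List.Relation.Unary.All.Properties as Allₚ
  open import Data.List.Relation.Unary.Any using (here; there)
  open import Data.List.Relation.Unary.AllPairs using ([]; _∷_)
  import Data.List.Relation.Unary.AllPairs as AllPairs
  open import Data.List.Relation.Unary.Unique.Propositional using (Unique)
  open import Data.List.Relation.Binary.Permutation.Propositional using (_↭_; ↭-refl; ↭-sym; ↭-trans; ↭-reflexive)
  import Data.List.Relation.Binary.Permutation.Propositional.Properties as Perm
  open import Data.List.Membership.Propositional using (_∈_)
  open import Data.List.Membership.Propositional.Properties
  open import Data.List.Relation.Binary.Sublist.Propositional using (_⊆_; []; _∷_; ⊆-refl)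
  import Data.List.Relation.Binary.Sublist.Propositional.Properties as Sub
  open import Data.Product using (∃; _×_; _,_; proj₁; proj₂)
  open import Data.Sum using (inj₁; inj₂; [_,_]′)
  open import Data.Empty using (⊥; ⊥-elim)
  open import Function using (_∘_; id; case_of_)
  open import Relation.Nullary
  open import Relation.Binary.PropositionalEquality hiding ([_])
  open Search
  open SmallRamseyNumbers

  edges : Mat → ℕ
  edges m = sum (map (cnt id) m)

  degs : Mat → List ℕ
  degs [] = []
  degs (r ∷ m) = cnt id r ∷ zipWith (λ c d → bit c + d) r (degs m)

  ≡ᵇ-true : ∀ m n → (m ≡ᵇ n) ≡ true → m ≡ n
  ≡ᵇ-true m n h = ≡ᵇ⇒≡ m n (subst T (sym h) _)

  <ᵇ-true : ∀ m n → (m <ᵇ n) ≡ true → m < n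
  <ᵇ-true m n h = <ᵇ⇒< m n (subst T (sym h) _)

  ≤ᵇ-true : ∀ m n → (m ≤ᵇ n) ≡ true → m ≤ n
  ≤ᵇ-true m n h = ≤ᵇ⇒≤ m n (subst T (sym h) _)

  nth : ∀ {X : Set} → X → ℕ → List X → X
  nth d _ [] = d
  nth d zero (x ∷ xs) = x
  nth d (suc i) (x ∷ xs) = nth d i xs

  nth-map : ∀ {X Y : Set} (f : X → Y) {d d′} i xs → i < length xs → nth d i (map f xs) ≡ f (nth d′ i xs)
  nth-map f zero (x ∷ xs) _ = refl
  nth-map f (suc i) (x ∷ xs) (s≤s h) = nth-map f i xs h

  nth-∈ : ∀ {X : Set} {d : X} i xs → i < length xs → nth d i xs ∈ xs
  nth-∈ zero (x ∷ xs) _ = here refl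
  nth-∈ (suc i) (x ∷ xs) (s≤s h) = there (nth-∈ i xs h)

  large-term : ∀ {X : Set} (g : X → ℕ) k xs → k * length xs < sum (map g xs) → ∃ λ x → x ∈ xs × k < g x
  large-term g k [] h = ⊥-elim (n≮0 (≤-trans h z≤n))
  large-term g k (x ∷ xs) h with suc k ≤? g x
  ... | yes p = x , here refl , p
  ... | no np = let (y , i , q) = large-term g k xs (+-cancelˡ-≤ k _ _ (≤-trans (≤-reflexive (trans (+-suc k _) (cong suc (sym (*-suc k _)))))
                                       (≤-trans h (+-monoˡ-≤ _ (s≤s⁻¹ (≰⇒> np))))))
                in y , there i , q

  -- Backtracking search for a reordering of pool with the prescribed (oldest first) adjacency rows.
  eqRow : Row → Row → Bool
  eqRow [] [] = true
  eqRow (true ∷ r) (true ∷ s) = eqRow r s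
  eqRow (false ∷ r) (false ∷ s) = eqRow r s
  eqRow _ _ = false

  eqRow-true : ∀ r s → eqRow r s ≡ true → r ≡ s
  eqRow-true [] [] h = refl
  eqRow-true (true ∷ r) (true ∷ s) h = cong (true ∷_) (eqRow-true r s h)
  eqRow-true (false ∷ r) (false ∷ s) h = cong (false ∷_) (eqRow-true r s h)

  isNil : ∀ {X : Set} → List X → Bool
  isNil [] = true
  isNil (_ ∷ _) = false

  iso : ∀ {X : Set} → (X → ℕ) → (X → X → Bool) → List (ℕ × Row) → List X → List X → Bool
  isos : ∀ {X : Set} → (X → ℕ) → (X → X → Bool) → ℕ → Row → List (ℕ × Row) → List X → List X → List X → Bool
  iso key g [] sel pool = isNil pool
  iso key g ((k , r) ∷ rs) sel pool = isos key g k r rs sel [] pool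
  isos key g k r rs sel pre [] = false
  isos key g k r rs sel pre (a ∷ as) =
    ((key a ≡ᵇ k) ∧ (eqRow r (map (g a) sel) ∧ iso key g rs (a ∷ sel) (pre ++ as))) ∨ isos key g k r rs sel (a ∷ pre) as

  entry : Mat → ℕ → ℕ → Bool
  entry m i j = if i <ᵇ j then nth false (j ∸ suc i) (nth [] i m) else nth false (i ∸ suc j) (nth [] j m)

  dot : Row → List ℕ → ℕ
  dot (true ∷ r) (w ∷ ws) = w + dot r ws
  dot (false ∷ r) (w ∷ ws) = dot r ws
  dot _ _ = 0

  spread : ℕ → Row → List ℕ → List ℕ
  spread w (true ∷ r) (v ∷ vs) = w + v ∷ spread w r vs
  spread w (false ∷ r) (v ∷ vs) = v ∷ spread w r vs
  spread w _ _ = []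

  neighbourSums : Mat → List ℕ → List ℕ
  neighbourSums (r ∷ m) (w ∷ ws) = dot r ws ∷ spread w r (neighbourSums m ws)
  neighbourSums _ _ = []

  -- An isomorphism invariant of the vertices, which prunes the search for isomorphisms.
  keys : Mat → List ℕ
  keys m = map (_% 997) (twist (twist (twist (degs m))))
    where
    twist : List ℕ → List ℕ
    twist w = neighbourSums m (map (λ x → x * x) w)

  isoMat : Mat → List ℕ → List (ℕ × Row) → Bool
  isoMat m ks rs = iso (λ i → nth 0 i ks) (entry m) rs [] (upTo (length m))

  record Spec : Set where
    constructor spec
    field
      index : ℕ
      colour : Bool
      number : ℕ

  -- Position 0 of a row towards the base belongs to the vertex whose neighbourhood is extended, so
  -- vertex `i` of the neighbourhood stands at `suc i`.
  specGoal : Spec → Goal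
  specGoal (spec i b k) = goal (λ r → agree b (nth false (suc i) r)) k

  -- On 22 vertices every vertex has at least 9 neighbours of each colour. A vertex of the
  -- neighbourhood with degree d inside it has one more edge of colour true to the centre, so at
  -- least 8 - d such edges leave. It has n - 1 - d edges of colour false inside, so at least 9 - (n
  -- - 1 - d) = 10 + d - n of these leave.
  valid : ℕ → List ℕ → Spec → Bool
  valid n ds (spec i b k) = (i <ᵇ n) ∧ (k ≤ᵇ (if b then 8 ∸ nth 0 i ds else (10 + nth 0 i ds) ∸ n))

  falses : List Row → List Row
  falses [] = []
  falses ((false ∷ r) ∷ rs) = (false ∷ r) ∷ falses rs
  falses (_ ∷ rs) = falses rs

  falses-∈ : ∀ {r rs} → false ∷ r ∈ rs → false ∷ r ∈ falses rs
  falses-∈ {rs = (false ∷ r) ∷ rs} (here refl) = here refl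
  falses-∈ {rs = (false ∷ r) ∷ rs} (there i) = there (falses-∈ i)
  falses-∈ {rs = (true ∷ r) ∷ rs} (there i) = falses-∈ i
  falses-∈ {rs = [] ∷ rs} (there i) = falses-∈ i

  every : ∀ {X : Set} → (X → Bool) → List X → Bool
  every p [] = true
  every p (x ∷ xs) = p x ∧ every p xs

  every-true : ∀ {X : Set} (p : X → Bool) xs → every p xs ≡ true → All (λ x → p x ≡ true) xs
  every-true p [] h = []
  every-true p (x ∷ xs) h = let (a , b) = ∧-true h in a ∷ every-true p xs b

  -- The base is the centre, joined by `true` to its `n` neighbours; the pool consists of the other
  -- 21 - n vertices, joined to the centre by `false`. The degree conditions come first, so that the
  -- search starts with vertices prescribed to be adjacent to one and the same neighbour.
  glue : ℕ → Mat → List Spec → Bool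
  glue n m gs = every (valid n (degs m)) gs ∧
    stage J5J5 never 0 (replicate n true ∷ m) (falses (allRows J5J5 (replicate n true ∷ m)))
      (map specGoal gs ++ everything (21 ∸ n) ∷ [])

  map-constant : ∀ {X Y : Set} (f : X → Y) y xs → All (λ x → f x ≡ y) xs → map f xs ≡ replicate (length xs) y
  map-constant f y [] [] = refl
  map-constant f y (x ∷ xs) (p ∷ ps) = cong₂ _∷_ p (map-constant f y xs ps)

  no-rest : ∀ {X : Set} (C R : List X) → length C ≡ length (C ++ R) → R ≡ []
  no-rest [] [] _ = refl
  no-rest (_ ∷ C) R h = no-rest C R (suc-injective h)

  dense : ℕ → ℕ → (Mat → Bool) → Mat → Bool
  dense n E extra m = (length m ≡ᵇ n) ∧ ((edges m <ᵇ E) ∨ extra m)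

  module Graph {A : Set} (e : A → A → Bool) (e-sym : ∀ x y → e x y ≡ e y x) (e-irr : ∀ x → e x x ≡ false) where
    open Sound e

    degSum : List A → ℕ
    degSum L = sum (map (λ x → cnt (e x) L) L)

    degSum-↭ : ∀ {L L′} → L ↭ L′ → degSum L ≡ degSum L′
    degSum-↭ {L} {L′} s = trans (cong sum (map-cong (λ x → cnt-↭ (e x) s) L)) (sum-↭ (Perm.map⁺ (λ x → cnt (e x) L′) s))

    cnt-map : ∀ {X : Set} (f : X → Bool) xs → cnt id (map f xs) ≡ cnt f xs
    cnt-map f xs = cong sum (sym (map-∘ xs))

    sum-bits : ∀ (f : A → Bool) (h : A → ℕ) xs → sum (map (λ y → bit (f y) + h y) xs) ≡ cnt f xs + sum (map h xs)
    sum-bits f h [] = refl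
    sum-bits f h (x ∷ xs) rewrite sum-bits f h xs = begin
      bit (f x) + h x + (cnt f xs + sum (map h xs)) ≡⟨ +-assoc (bit (f x)) (h x) _ ⟩
      bit (f x) + (h x + (cnt f xs + sum (map h xs))) ≡⟨ cong (bit (f x) +_) (sym (+-assoc (h x) _ _)) ⟩
      bit (f x) + (h x + cnt f xs + sum (map h xs)) ≡⟨ cong (λ z → bit (f x) + (z + sum (map h xs))) (+-comm (h x) _) ⟩
      bit (f x) + (cnt f xs + h x + sum (map h xs)) ≡⟨ cong (bit (f x) +_) (+-assoc (cnt f xs) _ _) ⟩
      bit (f x) + (cnt f xs + (h x + sum (map h xs))) ≡⟨ sym (+-assoc (bit (f x)) _ _) ⟩
      bit (f x) + cnt f xs + (h x + sum (map h xs)) ∎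
      where open ≡-Reasoning

    degSum-edges : ∀ L → degSum L ≡ edges (matOf L) + edges (matOf L)
    degSum-edges [] = refl
    degSum-edges (x ∷ L) = begin
      cnt (e x) (x ∷ L) + sum (map (λ y → cnt (e y) (x ∷ L)) L)
        ≡⟨ cong₂ _+_ (cong (λ b → bit b + cnt (e x) L) (e-irr x)) (sum-bits (λ y → e y x) (λ y → cnt (e y) L) L) ⟩
      cnt (e x) L + (cnt (λ y → e y x) L + degSum L)
        ≡⟨ cong₂ _+_ (sym (cnt-map (e x) L)) (cong₂ _+_ (trans (cnt-cong (λ y → e-sym y x) L) (sym (cnt-map (e x) L))) (degSum-edges L)) ⟩
      r + (r + (E + E)) ≡⟨ cong (r +_) (trans (sym (+-assoc r E E)) (trans (cong (_+ E) (+-comm r E)) (+-assoc E r E))) ⟩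
      r + (E + (r + E)) ≡⟨ sym (+-assoc r E (r + E)) ⟩
      (r + E) + (r + E) ∎
      where
      open ≡-Reasoning
      r = cnt id (map (e x) L)
      E = edges (matOf L)

    degs-matOf : ∀ L → degs (matOf L) ≡ map (λ x → cnt (e x) L) L
    degs-matOf [] = refl
    degs-matOf (x ∷ L) = cong₂ _∷_
      (trans (cnt-map (e x) L) (cong (λ b → bit b + cnt (e x) L) (sym (e-irr x))))
      (trans (cong (zipWith _ (map (e x) L)) (degs-matOf L)) (zips L))
      where
      zips : ∀ K → zipWith (λ c d → bit c + d) (map (e x) K) (map (λ y → cnt (e y) L) K) ≡ map (λ y → cnt (e y) (x ∷ L)) K
      zips [] = refl
      zips (y ∷ K) = cong₂ _∷_ (cong (λ b → bit b + cnt (e y) L) (e-sym x y)) (zips K)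

    length-matOf : ∀ L → length (matOf L) ≡ length L
    length-matOf [] = refl
    length-matOf (x ∷ L) = cong suc (length-matOf L)

    -- A degree sum above 4n yields a vertex of degree at least 5. Taking it as the root lets the
    -- search start with five of its neighbours. A leaf contains all `n` vertices, so few edges in
    -- it contradict the degree sum and only `extra` remains.
    dense-sound : ∀ {P} → Avoids J4J5 P → ∀ n E extra →
      rooted J4J5 (dense n E extra) (goal hd 5 ∷ everything (pred n) ∷ []) ≡ true →
      ∀ W → Unique W → All P W → length W ≡ n → 4 * n < E + E → E + E ≤ degSum W →
      ∃ λ L → L ↭ W × extra (matOf L) ≡ true
    dense-sound av n E extra h W u a refl lt big with large-term (λ x → cnt (e x) W) 4 W (≤-trans lt big)
    ... | x , i , five with ∈-∃++ i
    ...   | X , Y , refl = result (rooted-sound e {leaf = dense n E extra} x U (goal hd 5 ∷ everything (pred n) ∷ []) av (Unique-↭ mid u) (All-↭ mid a)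
              (five′ ∷ ≤-reflexive (trans (cong pred (Perm.↭-length mid)) (sym (cnt-true U))) ∷ []) h)
      where
      U = X ++ Y
      mid : X ++ x ∷ Y ↭ x ∷ U
      mid = Perm.shift x X Y
      five′ : 5 ≤ cnt (λ w → e w x) U
      five′ = ≤-trans five (≤-reflexive (trans (cnt-↭ (e x) mid)
                (trans (cong (λ b → bit b + cnt (e x) U) (e-irr x)) (cnt-cong (λ w → e-sym x w) U))))
      result : Run.Outcome e J4J5 _ (dense n E extra) (x ∷ []) U → _
      result (Run.outcome C R w g) = [ (λ few → ⊥-elim (<⇒≱ (+-mono-< (<ᵇ-true _ E few) (<ᵇ-true _ E few)) big′)) , (λ ex → C ++ x ∷ [] , perm , ex) ]′
                                       (∨-true (proj₂ (∧-true g)))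
        where
        len : length C + 1 ≡ length (C ++ R) + 1
        len = trans (sym (length-++ C)) (trans (sym (length-matOf (C ++ x ∷ []))) (trans (≡ᵇ-true _ _ (proj₁ (∧-true g))) (trans (Perm.↭-length mid)
                (trans (cong suc (sym (Perm.↭-length w))) (+-comm 1 _)))))
        C↭U : C ↭ U
        C↭U = ↭-trans (↭-reflexive (sym (trans (cong (C ++_) (no-rest C R (+-cancelʳ-≡ 1 _ _ len))) (++-identityʳ C)))) w
        perm : C ++ x ∷ [] ↭ X ++ x ∷ Y
        perm = ↭-trans (↭-sym (Perm.∷↭∷ʳ x C)) (↭-trans (_↭_.prep x C↭U) (↭-sym mid))
        big′ : E + E ≤ edges (matOf (C ++ x ∷ [])) + edges (matOf (C ++ x ∷ []))
        big′ = ≤-trans big (≤-reflexive (trans (degSum-↭ (↭-sym perm)) (degSum-edges (C ++ x ∷ []))))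

    iso-sound : ∀ {X : Set} key (g : X → X → Bool) (f : X → A) → ∀ rs sel pool →
      (∀ {i j} → i ∈ sel ++ pool → j ∈ sel ++ pool → i ≢ j → g i j ≡ e (f i) (f j)) → Unique (sel ++ pool) →
      iso key g rs sel pool ≡ true →
      ∃ λ sel′ → sel′ ↭ sel ++ pool × matOf (map f sel′) ≡ reverseAcc (matOf (map f sel)) (map proj₂ rs)
    isos-sound : ∀ {X : Set} key (g : X → X → Bool) (f : X → A) → ∀ k r rs sel pre pool →
      (∀ {i j} → i ∈ sel ++ pre ++ pool → j ∈ sel ++ pre ++ pool → i ≢ j → g i j ≡ e (f i) (f j)) → Unique (sel ++ pre ++ pool) →
      isos key g k r rs sel pre pool ≡ true →
      ∃ λ sel′ → sel′ ↭ sel ++ pre ++ pool × matOf (map f sel′) ≡ reverseAcc (matOf (map f sel)) (r ∷ map proj₂ rs)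
    iso-sound key g f [] sel [] ge u h = sel , ↭-reflexive (sym (++-identityʳ sel)) , refl
    iso-sound key g f ((k , r) ∷ rs) sel pool ge u h = isos-sound key g f k r rs sel [] pool ge u h
    isos-sound key g f k r rs sel pre (a ∷ as) ge u h with ∨-true h
    ... | inj₂ h₂ = let (s , p , q) = isos-sound key g f k r rs sel (a ∷ pre) as
                          (λ i j → ge (Perm.∈-resp-↭ mv i) (Perm.∈-resp-↭ mv j)) (Unique-↭ (↭-sym mv) u) h₂
                    in s , ↭-trans p mv , q
      where
      mv : sel ++ a ∷ pre ++ as ↭ sel ++ pre ++ a ∷ as
      mv = Perm.++⁺ˡ sel (↭-sym (Perm.shift a pre as))
    ... | inj₁ h₁ with ∧-true (proj₂ (∧-true {key a ≡ᵇ k} h₁))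
    ...   | k₁ , k₂ = let (s , p , q) = iso-sound key g f rs (a ∷ sel) (pre ++ as)
                            (λ i j → ge (Perm.∈-resp-↭ mv i) (Perm.∈-resp-↭ mv j)) (Unique-↭ (↭-sym mv) u) k₂
                      in s , ↭-trans p mv , trans q (cong (λ z → reverseAcc (z ∷ matOf (map f sel)) (map proj₂ rs)) rowEq)
      where
      mv : a ∷ sel ++ (pre ++ as) ↭ sel ++ pre ++ a ∷ as
      mv = ↭-sym (↭-trans (Perm.++⁺ˡ sel (Perm.shift a pre as)) (Perm.shift a sel (pre ++ as)))
      rows : ∀ K → (∀ {x} → x ∈ K → x ∈ sel) → map (e (f a)) (map f K) ≡ map (g a) K
      rows [] sub = refl
      rows (x ∷ K) sub = cong₂ _∷_ (sym (ge (Perm.∈-resp-↭ mv (here refl)) (∈-++⁺ˡ (sub (here refl)))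
          (λ eq → All.lookup (AllPairs.head (Unique-↭ (↭-sym mv) u)) (∈-++⁺ˡ (sub (here refl))) eq)))
          (rows K (sub ∘ there))
      rowEq : map (e (f a)) (map f sel) ≡ r
      rowEq = trans (rows sel id) (sym (eqRow-true r _ k₁))

    entry-matOf : ∀ d L i j → i < length L → j < length L → i ≢ j → entry (matOf L) i j ≡ e (nth d i L) (nth d j L)
    entry-matOf d L i j il jl ne with i <ᵇ j in eq
    ... | true = below L i j (<ᵇ-true i j eq) jl
      where
      below : ∀ L i j → i < j → j < length L → nth false (j ∸ suc i) (nth [] i (matOf L)) ≡ e (nth d i L) (nth d j L)
      below (x ∷ L) zero (suc j) _ (s≤s h) = nth-map (e x) j L h
      below (x ∷ L) (suc i) (suc j) (s≤s p) (s≤s h) = below L i j p h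
    ... | false = trans (below L j i (≤∧≢⇒< (≮⇒≥ λ p → case trans (sym eq) (lt p) of λ ()) (≢-sym ne)) il) (e-sym _ _)
      where
      lt : i < j → (i <ᵇ j) ≡ true
      lt p with i <ᵇ j | <⇒<ᵇ p
      ... | true | _ = refl
      below : ∀ L i j → i < j → j < length L → nth false (j ∸ suc i) (nth [] i (matOf L)) ≡ e (nth d i L) (nth d j L)
      below (x ∷ L) zero (suc j) _ (s≤s h) = nth-map (e x) j L h
      below (x ∷ L) (suc i) (suc j) (s≤s p) (s≤s h) = below L i j p h

    nth-upTo : ∀ (d : A) L → map (λ i → nth d i L) (upTo (length L)) ≡ L
    nth-upTo d L = trans (map-upTo _ (length L)) (go L)
      where
      go : ∀ L → applyUpTo (λ i → nth d i L) (length L) ≡ L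
      go [] = refl
      go (x ∷ L) = cong (x ∷_) (go L)

    isoMat-sound : ∀ L ks rs → isoMat (matOf L) ks rs ≡ true → ∃ λ L′ → L′ ↭ L × matOf L′ ≡ reverse (map proj₂ rs)
    isoMat-sound [] ks [] h = [] , ↭-refl , refl
    isoMat-sound L@(d ∷ _) ks rs h =
      let (s , p , q) = iso-sound (λ i → nth 0 i ks) (entry (matOf L)) (λ i → nth d i L) rs [] (upTo (length L))
            (λ i j ne → entry-matOf d L _ _ (∈-upTo⁻ i) (∈-upTo⁻ j) ne)
            (Uniq.upTo⁺ (length L)) (subst (λ k → iso (λ i → nth 0 i ks) (entry (matOf L)) rs [] (upTo k) ≡ true) (length-matOf L) h)
      in map (λ i → nth d i L) s , ↭-trans (Perm.map⁺ _ p) (↭-reflexive (nth-upTo d L)) , q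
      where import Data.List.Relation.Unary.Unique.Propositional.Properties as Uniq

    -- v sees L in colour true and U in colour false, and every vertex of L has at least 9 neighbours of each colour.
    glue-sound : ∀ {P} → Avoids J5J5 P → ∀ v L U n gs → Unique (U ++ v ∷ L) → All P (U ++ v ∷ L) →
      All (λ l → e v l ≡ true) L → All (λ u → e u v ≡ false) U → length L ≡ n → length U ≡ 21 ∸ n →
      (∀ {l} → l ∈ L → 8 ≤ cnt (e l) L + cnt (λ u → e u l) U) →
      (∀ {l} → l ∈ L → 10 + cnt (e l) L ≤ n + cnt (λ u → not (e u l)) U) →
      glue n (matOf L) gs ≡ true → ⊥
    glue-sound {P} av v L U n gs u a vl uv refl lu deg₁ deg₀ h with ∧-true {every (valid n (degs (matOf L))) gs} h
    ... | h₁ , h₂ = case Run.Outcome.good out of λ ()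
      where
      open Run e J5J5 P never (v ∷ L) U using (row; wants; Outcome; stage-sound; Goals)
      rowEq : map (e v) L ≡ replicate (length L) true
      rowEq = map-constant (e v) true L vl
      rows : ∀ {w} → w ∈ U → row [] w ∈ falses (allRows J5J5 (matOf (v ∷ L)))
      rows {w} i = subst (λ b → b ∷ map (e w) L ∈ falses (allRows J5J5 (matOf (v ∷ L)))) (sym wv)
                     (falses-∈ (subst (λ b → b ∷ map (e w) L ∈ allRows J5J5 (matOf (v ∷ L))) wv
                       (allRows-complete av w (v ∷ L) (uniq′ i) (all′ i))))
        where
        wv : e w v ≡ false
        wv = All.lookup uv i
        uniq′ : ∀ {w} → w ∈ U → Unique (w ∷ v ∷ L)
        uniq′ i with ∈-∃++ i
        ... | X , Y , refl = unique-⊆ (refl ∷ sk X) (Unique-↭ (mv X Y) u)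
          where
          mv : ∀ {w} X Y → (X ++ w ∷ Y) ++ v ∷ L ↭ w ∷ X ++ (Y ++ v ∷ L)
          mv {w} X Y = ↭-trans (↭-reflexive (++-assoc X (w ∷ Y) (v ∷ L))) (Perm.shift w X (Y ++ v ∷ L))
          sk : ∀ X → v ∷ L ⊆ X ++ (Y ++ v ∷ L)
          sk X = Sub.++⁺ˡ X (Sub.++⁺ˡ Y ⊆-refl)
        all′ : ∀ {w} → w ∈ U → All P (w ∷ v ∷ L)
        all′ i = All.lookup a (∈-++⁺ˡ i) ∷ Allₚ.++⁻ʳ U a
      goalsOK : ∀ gs → every (valid n (degs (matOf L))) gs ≡ true → Goals av u a (map specGoal gs)
      goalsOK [] _ = []
      goalsOK (spec i b k ∷ gs) h with ∧-true {valid n (degs (matOf L)) (spec i b k)} h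
      ... | p , q with ∧-true {i <ᵇ n} p
      ...   | p₁ , p₂ = goodOne b (≤ᵇ-true k _ p₂) ∷ goalsOK gs q
        where
        il : i < length L
        il = <ᵇ-true i _ p₁
        l = nth v i L
        lL : l ∈ L
        lL = nth-∈ i L il
        dEq : nth 0 i (degs (matOf L)) ≡ cnt (e l) L
        dEq = trans (cong (nth 0 i) (degs-matOf L)) (nth-map _ i L il)
        goodOne : ∀ b → k ≤ (if b then 8 ∸ nth 0 i (degs (matOf L)) else (10 + nth 0 i (degs (matOf L))) ∸ n) →
                  k ≤ cnt (λ w → agree b (nth false i (map (e w) L))) U
        goodOne true le = ≤-trans le (≤-trans (≤-reflexive (cong (8 ∸_) dEq)) (≤-trans (m≤n+o⇒m∸n≤o 8 _ (deg₁ lL))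
                            (≤-reflexive (cnt-cong (λ w → sym (nth-map (e w) i L il)) U))))
        goodOne false le = ≤-trans le (≤-trans (≤-reflexive (cong (λ z → (10 + z) ∸ n) dEq)) (≤-trans (m≤n+o⇒m∸n≤o _ n (deg₀ lL))
                            (≤-reflexive (cnt-cong (λ w → cong not (sym (nth-map (e w) i L il))) U))))
      out : Outcome
      out = stage-sound av u a _ [] U _ ↭-refl rows
              (Allₚ.++⁺ (goalsOK gs h₁) (≤-reflexive (trans (sym lu) (sym (cnt-true U))) ∷ []))
              (subst (λ r → stage J5J5 never 0 (r ∷ matOf L) (falses (allRows J5J5 (r ∷ matOf L))) (map specGoal gs ++ everything (21 ∸ n) ∷ []) ≡ true)
                (sym rowEq) h₂)

-- The catalogues and the density thresholds.

module Catalogues where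
  open import Data.Nat
  open import Data.Nat.DivMod using (_/_; _%_)
  open import Data.Bool using (Bool; true; false; _∨_)
  open import Data.List hiding (sum; find)
  open import Data.Product using (_×_; _,_; proj₂)
  open import Relation.Binary.PropositionalEquality hiding ([_])
  open Search
  open SmallRamseyNumbers
  open Extension

  bits : ℕ → ℕ → Row
  bits zero n = []
  bits (suc l) n = (n % 2 ≡ᵇ 1) ∷ bits l (n / 2)

  decode : ℕ → List (ℕ × ℕ) → List (ℕ × Row)
  decode i [] = []
  decode i ((k , x) ∷ xs) = (k , bits i x) ∷ decode (suc i) xs

  record Rep : Set where
    constructor rep
    field
      rows : List (ℕ × ℕ)
      specs : List Spec

  anyOf : ∀ {X : Set} → (X → Bool) → List X → Bool
  anyOf p [] = false
  anyOf p (x ∷ xs) = p x ∨ anyOf p xs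

  -- The graphs on 11 (12) vertices with at least 24 (30) edges without J₄ and with J₅-free complement, as (oldest first)
  -- rows of lower triangular adjacency matrices with invariants of the vertices, each with the degree conditions that
  -- rule it out as a neighbourhood.
  reps11 : List Rep
  reps11 =
    rep ((976 , 0) ∷ (976 , 1) ∷ (908 , 1) ∷ (908 , 5) ∷ (523 , 3) ∷ (158 , 17) ∷ (285 , 41) ∷ (285 , 50) ∷ (285 , 145) ∷ (158 , 145) ∷ (285 , 329) ∷ [])
      (spec 4 false 3 ∷ spec 3 false 3 ∷ spec 2 false 3 ∷ spec 10 true 3 ∷ spec 9 true 3 ∷ []) ∷
    rep ((193 , 0) ∷ (193 , 1) ∷ (909 , 3) ∷ (193 , 1) ∷ (193 , 3) ∷ (69 , 18) ∷ (69 , 35) ∷ (69 , 38) ∷ (69 , 145) ∷ (69 , 148) ∷ (69 , 323) ∷ [])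
      (spec 3 false 3 ∷ spec 5 false 3 ∷ spec 2 false 3 ∷ spec 4 true 4 ∷ spec 0 true 4 ∷ []) ∷
    rep ((56 , 0) ∷ (445 , 1) ∷ (800 , 3) ∷ (56 , 2) ∷ (445 , 9) ∷ (800 , 7) ∷ (175 , 9) ∷ (201 , 37) ∷ (800 , 138) ∷ (800 , 165) ∷ (320 , 580) ∷ [])
      (spec 3 false 3 ∷ spec 10 true 3 ∷ spec 7 true 3 ∷ spec 4 true 3 ∷ spec 0 false 2 ∷ []) ∷
    rep ((59 , 0) ∷ (59 , 1) ∷ (23 , 3) ∷ (59 , 1) ∷ (59 , 3) ∷ (568 , 18) ∷ (568 , 19) ∷ (534 , 70) ∷ (534 , 83) ∷ (534 , 168) ∷ (534 , 553) ∷ [])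
      (spec 0 false 3 ∷ spec 3 false 3 ∷ spec 2 false 3 ∷ spec 1 false 3 ∷ spec 5 true 3 ∷ []) ∷
    rep ((794 , 0) ∷ (517 , 1) ∷ (454 , 3) ∷ (794 , 1) ∷ (517 , 5) ∷ (454 , 19) ∷ (548 , 10) ∷ (548 , 35) ∷ (43 , 138) ∷ (43 , 162) ∷ (49 , 579) ∷ [])
      (spec 3 false 3 ∷ spec 4 false 3 ∷ spec 8 false 3 ∷ spec 5 false 3 ∷ spec 9 true 3 ∷ []) ∷
    rep ((88 , 0) ∷ (415 , 1) ∷ (580 , 1) ∷ (712 , 5) ∷ (165 , 3) ∷ (135 , 9) ∷ (745 , 37) ∷ (165 , 19) ∷ (135 , 73) ∷ (745 , 273) ∷ (712 , 645) ∷ [])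
      (spec 9 false 3 ∷ spec 5 false 3 ∷ spec 2 false 3 ∷ spec 10 true 3 ∷ spec 6 true 3 ∷ []) ∷
    rep ((667 , 0) ∷ (795 , 1) ∷ (16 , 3) ∷ (951 , 2) ∷ (535 , 3) ∷ (502 , 9) ∷ (599 , 35) ∷ (938 , 73) ∷ (402 , 21) ∷ (510 , 265) ∷ (444 , 329) ∷ [])
      (spec 0 false 3 ∷ spec 8 false 2 ∷ spec 6 false 3 ∷ spec 1 false 3 ∷ spec 5 true 3 ∷ []) ∷
    rep ((986 , 0) ∷ (986 , 1) ∷ (761 , 3) ∷ (523 , 4) ∷ (523 , 5) ∷ (768 , 7) ∷ (307 , 36) ∷ (307 , 37) ∷ (175 , 7) ∷ (307 , 273) ∷ (307 , 323) ∷ [])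
      (spec 1 false 3 ∷ spec 8 false 2 ∷ spec 2 true 3 ∷ spec 0 false 3 ∷ spec 5 false 3 ∷ []) ∷
    rep ((204 , 0) ∷ (9 , 1) ∷ (9 , 3) ∷ (855 , 2) ∷ (855 , 5) ∷ (855 , 6) ∷ (855 , 11) ∷ (9 , 74) ∷ (9 , 139) ∷ (9 , 292) ∷ (9 , 561) ∷ [])
      (spec 10 true 2 ∷ spec 1 false 3 ∷ spec 0 false 3 ∷ spec 9 false 3 ∷ spec 8 false 3 ∷ []) ∷
    rep ((639 , 0) ∷ (421 , 1) ∷ (194 , 3) ∷ (716 , 1) ∷ (716 , 3) ∷ (261 , 10) ∷ (170 , 37) ∷ (170 , 70) ∷ (170 , 145) ∷ (261 , 145) ∷ (170 , 553) ∷ [])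
      (spec 10 true 2 ∷ spec 9 false 3 ∷ spec 3 false 3 ∷ spec 2 false 3 ∷ spec 7 true 3 ∷ []) ∷
    rep ((590 , 0) ∷ (659 , 1) ∷ (260 , 3) ∷ (590 , 1) ∷ (659 , 5) ∷ (260 , 19) ∷ (659 , 34) ∷ (659 , 25) ∷ (659 , 133) ∷ (659 , 161) ∷ (260 , 585) ∷ [])
      (spec 7 true 2 ∷ spec 10 true 2 ∷ spec 9 false 3 ∷ spec 6 false 3 ∷ spec 4 false 3 ∷ []) ∷
    rep ((193 , 0) ∷ (193 , 1) ∷ (909 , 3) ∷ (193 , 1) ∷ (193 , 3) ∷ (69 , 17) ∷ (69 , 37) ∷ (69 , 38) ∷ (69 , 145) ∷ (69 , 148) ∷ (69 , 323) ∷ [])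
      (spec 2 false 3 ∷ spec 4 false 3 ∷ spec 3 false 3 ∷ spec 1 false 3 ∷ spec 5 true 4 ∷ []) ∷
    []

  reps12 : List Rep
  reps12 =
    rep ((343 , 0) ∷ (343 , 1) ∷ (343 , 3) ∷ (343 , 4) ∷ (343 , 9) ∷ (343 , 9) ∷ (343 , 13) ∷ (343 , 67) ∷ (343 , 49) ∷ (343 , 147) ∷ (343 , 338) ∷ (343 , 339) ∷ [])
      (spec 7 false 3 ∷ spec 11 false 3 ∷ spec 10 false 3 ∷ spec 9 false 3 ∷ spec 8 false 3 ∷ []) ∷
    []


  isoTo : List Rep → Mat → Bool
  isoTo reps m = scan (keys m) reps
    where
    scan : List ℕ → List Rep → Bool
    scan ks rs = anyOf (λ r → isoMat m ks (decode 0 (Rep.rows r))) rs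

  -- `iso` selects the vertices in the stored order and puts each new one in front, so the matrix of
  -- a match is the reversal of the stored rows.
  repMat : Rep → Mat
  repMat r = reverse (map proj₂ (decode 0 (Rep.rows r)))

  glueAll : ℕ → List Rep → Bool
  glueAll n = every (λ r → glue n (repMat r) (Rep.specs r))

  hub : ℕ → List Goal
  hub n = goal hd 5 ∷ everything n ∷ []

  -- The thresholds 19, 22, 24 and 30 for 9, 10, 11 and 12 vertices come from Goodman's count:
  -- neighbourhoods with fewer edges keep the weight of every vertex below the average. For 9 and 10
  -- vertices the search finds no graph reaching the threshold; for 11 and 12 it finds only graphs
  -- of the catalogues.
  check9 : rooted J4J5 (dense 9 19 never) (hub (pred 9)) ≡ true
  check9 = refl

  check10 : rooted J4J5 (dense 10 22 never) (hub (pred 10)) ≡ true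
  check10 = refl

-- No graph of the catalogues extends to 22 vertices.

module Gluing where
  open import Data.Bool using (true)
  open import Relation.Binary.PropositionalEquality hiding ([_])
  open SmallRamseyNumbers
  open Extension
  open Catalogues

  glue11 : glueAll 11 reps11 ≡ true
  glue11 = refl

  glue12 : glueAll 12 reps12 ≡ true
  glue12 = refl

-- Completeness of the catalogues.

module Density where
  open import Data.Bool using (true)
  open import Data.Nat using (pred)
  open import Relation.Binary.PropositionalEquality hiding ([_])
  open SmallRamseyNumbers
  open Extension
  open Catalogues

  check12 : rooted J4J5 (dense 12 30 (isoTo reps12)) (hub (pred 12)) ≡ true
  check12 = refl

  check11 : rooted J4J5 (dense 11 24 (isoTo reps11)) (hub (pred 11)) ≡ true
  check11 = refl

-- Goodman's identity for monochromatic triangles.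

module GoodmanCount where
  open import Data.Nat
  open import Data.Nat.Properties
  open import Data.Nat.Tactic.RingSolver using (solve-∀)
  open import Data.Bool using (Bool; true; false; not)
  open import Data.Fin using (Fin)
  import Data.Fin as Fin
  open import Data.List hiding (sum; find)
  open import Data.Nat.ListAction using (sum)
  open import Data.List.Properties
  open import Relation.Nullary
  open import Relation.Binary.PropositionalEquality hiding ([_])
  open Search
  open SmallRamseyNumbers
  open Extension

  module _ {X : Set} where
    sum-cong : ∀ {g h : X → ℕ} → (∀ x → g x ≡ h x) → ∀ xs → sum (map g xs) ≡ sum (map h xs)
    sum-cong p xs = cong sum (map-cong p xs)

    sum-+ : ∀ (g h : X → ℕ) xs → sum (map (λ x → g x + h x) xs) ≡ sum (map g xs) + sum (map h xs)
    sum-+ g h [] = refl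
    sum-+ g h (x ∷ xs) rewrite sum-+ g h xs = rearrange (g x) (h x) _ _
      where
      rearrange : ∀ a b c d → a + b + (c + d) ≡ a + c + (b + d)
      rearrange = solve-∀

    sum-0 : ∀ (xs : List X) → sum (map (λ _ → 0) xs) ≡ 0
    sum-0 [] = refl
    sum-0 (x ∷ xs) = sum-0 xs

    sum-* : ∀ c (g : X → ℕ) xs → sum (map (λ x → c * g x) xs) ≡ c * sum (map g xs)
    sum-* c g [] = sym (*-zeroʳ c)
    sum-* c g (x ∷ xs) rewrite sum-* c g xs = sym (*-distribˡ-+ c (g x) _)

    sum-≤ : ∀ (g : X → ℕ) k xs → (∀ x → g x ≤ k) → sum (map g xs) ≤ k * length xs
    sum-≤ g k [] h = z≤n
    sum-≤ g k (x ∷ xs) h = ≤-trans (+-mono-≤ (h x) (sum-≤ g k xs h)) (≤-reflexive (sym (*-suc k (length xs))))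

    sum-filter : ∀ (p : X → Bool) (g : X → ℕ) xs → sum (map g (filterᵇ p xs)) ≡ sum (map (λ x → bit (p x) * g x) xs)
    sum-filter p g [] = refl
    sum-filter p g (x ∷ xs) with p x
    ... | true = cong₂ _+_ (sym (+-identityʳ (g x))) (sum-filter p g xs)
    ... | false = sum-filter p g xs

  sum-swap : ∀ {X Y : Set} (g : X → Y → ℕ) xs ys →
             sum (map (λ x → sum (map (g x) ys)) xs) ≡ sum (map (λ y → sum (map (λ x → g x y) xs)) ys)
  sum-swap g [] ys = sym (sum-0 ys)
  sum-swap g (x ∷ xs) ys = trans (cong (sum (map (g x) ys) +_) (sum-swap g xs ys)) (sym (sum-+ (g x) _ ys))

  module Goodman {n : ℕ} (e f : Fin n → Fin n → Bool) (e-sym : ∀ x y → e x y ≡ e y x) (f-sym : ∀ x y → f x y ≡ f y x)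
    (e-irr : ∀ x → e x x ≡ false) (f-irr : ∀ x → f x x ≡ false) (compl : ∀ x y → x ≢ y → f x y ≡ not (e x y)) where

    vs : List (Fin n)
    vs = allFin n

    S : (Fin n → ℕ) → ℕ
    S g = sum (map g vs)

    S₃ : (Fin n → Fin n → Fin n → ℕ) → ℕ
    S₃ g = S λ v → S λ x → S λ y → g v x y

    S₃-cong : ∀ {g h} → (∀ v x y → g v x y ≡ h v x y) → S₃ g ≡ S₃ h
    S₃-cong p = sum-cong (λ v → sum-cong (λ x → sum-cong (p v x) vs) vs) vs

    S₃-+ : ∀ g h → S₃ (λ v x y → g v x y + h v x y) ≡ S₃ g + S₃ h
    S₃-+ g h = trans (sum-cong (λ v → trans (sum-cong (λ x → sum-+ (g v x) (h v x) vs) vs) (sum-+ _ _ vs)) vs) (sum-+ _ _ vs)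

    S₃-swap : ∀ g → S₃ g ≡ S₃ (λ v x y → g x v y)
    S₃-swap g = sum-swap (λ v x → S (g v x)) vs vs

    S₃-rot : ∀ g → S₃ g ≡ S₃ (λ v x y → g x y v)
    S₃-rot g = trans (sum-cong (λ v → sum-swap (g v) vs vs) vs) (S₃-swap (λ v x y → g v y x)) 

    E F D : Fin n → Fin n → ℕ
    E x y = bit (e x y)
    F x y = bit (f x y)
    D x y = bit (not (does (x Fin.≟ y)))

    E+F : ∀ x y → E x y + F x y ≡ D x y
    E+F x y with x Fin.≟ y
    ... | yes refl rewrite e-irr x | f-irr x = refl
    ... | no ne rewrite compl x y ne with e x y
    ...   | true = refl
    ...   | false = refl

    -- No vertex is joined to `v` in both colours, so the two ends of a mixed angle are distinct
    -- automatically.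
    EF-D : ∀ v x y → E v x * F v y * D x y ≡ E v x * F v y
    EF-D v x y with x Fin.≟ y
    ... | no ne = *-identityʳ _
    ... | yes refl with v Fin.≟ x
    ...   | yes refl rewrite e-irr v = refl
    ...   | no ne rewrite compl v x ne with e v x
    ...     | true = refl
    ...     | false = refl

    mixed : ℕ
    mixed = S λ v → cnt (e v) vs * cnt (f v) vs

    mixed₃ : S₃ (λ v x y → E v x * F v y) ≡ mixed
    mixed₃ = sum-cong (λ v → trans (sum-cong (λ x → sum-* (E v x) (F v) vs) vs)
               (trans (sum-cong (λ x → *-comm (E v x) _) vs) (trans (sum-* (S (F v)) (E v) vs) (*-comm (S (F v)) (S (E v)))))) vs

    mono : (Fin n → Fin n → ℕ) → ℕ
    mono G = S₃ λ v x y → G v x * (G v y * G x y)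

    -- A triangle with both colours has exactly two vertices at which its edges differ, so `mixed`
    -- counts it twice; its six orderings explain the factor 3. Formally the product of three
    -- factors E + F is expanded, and one copy of `mixed` goes to each position of the edge whose
    -- colour is not prescribed.
    goodman : mono E + mono F + 3 * mixed ≡ S₃ (λ v x y → D v x * D v y * D x y)
    goodman = begin
      mono E + mono F + 3 * mixed
        ≡⟨ cong (λ z → mono E + mono F + z) (three mixed) ⟩
      mono E + mono F + (mixed + mixed + mixed)
        ≡⟨ cong (λ z → mono E + mono F + z) (cong₂ _+_ (cong₂ _+_ (trans (sym mixed₃) (sym EFD)) (trans (sym mixed₃) (sym FED))) corners) ⟩
      mono E + mono F + (S₃ efd + S₃ fed + (S₃ eef + S₃ ffe))
        ≡⟨ sym (trans (S₃-+ _ _) (cong₂ _+_ (S₃-+ _ _) (trans (S₃-+ _ _) (cong₂ _+_ (S₃-+ _ _) (S₃-+ _ _))))) ⟩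
      S₃ (λ v x y → E v x * (E v y * E x y) + F v x * (F v y * F x y) + (efd v x y + fed v x y + (eef v x y + ffe v x y)))
        ≡⟨ S₃-cong pointwise ⟩
      S₃ (λ v x y → D v x * D v y * D x y) ∎
      where
      open ≡-Reasoning
      three : ∀ m → 3 * m ≡ m + m + m
      three = solve-∀
      efd fed eef ffe efe eff : Fin n → Fin n → Fin n → ℕ
      efd v x y = E v x * F v y * D x y
      fed v x y = F v x * E v y * D x y
      eef v x y = E v x * E v y * F x y
      ffe v x y = F v x * F v y * E x y
      efe v x y = E v x * F v y * E x y
      eff v x y = E v x * F v y * F x y
      EFD : S₃ efd ≡ S₃ (λ v x y → E v x * F v y)
      EFD = S₃-cong EF-D
      D-sym : ∀ x y → D x y ≡ D y x
      D-sym x y = trans (sym (E+F x y)) (trans (cong₂ _+_ (cong bit (e-sym x y)) (cong bit (f-sym x y))) (E+F y x))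
      FED : S₃ fed ≡ S₃ (λ v x y → E v x * F v y)
      FED = trans (sum-cong (λ v → sum-swap (λ x y → fed v x y) vs vs) vs)
              (trans (S₃-cong (λ v x y → trans (cong (F v y * E v x *_) (D-sym y x)) (cong (_* D x y) (*-comm (F v y) _)))) EFD)
      -- The edge closing a mixed angle agrees with one of its sides, and the triangle is renamed so
      -- that the vertex common to the two equal edges comes first.
      corners : mixed ≡ S₃ eef + S₃ ffe
      corners = begin
        mixed ≡⟨ trans (sym mixed₃) (sym EFD) ⟩
        S₃ efd ≡⟨ S₃-cong (λ v x y → trans (cong (E v x * F v y *_) (sym (E+F x y))) (*-distribˡ-+ (E v x * F v y) _ _)) ⟩
        S₃ (λ v x y → efe v x y + eff v x y) ≡⟨ S₃-+ efe eff ⟩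
        S₃ efe + S₃ eff ≡⟨ cong₂ _+_ (trans (S₃-swap efe) (S₃-cong λ v x y →
            trans (cong (λ z → z * F x y * E v y) (cong bit (e-sym x v))) (abc (E v x) (F x y) (E v y))))
            (trans (S₃-rot eff) (S₃-cong λ v x y →
            trans (cong₂ (λ a b → E x y * a * b) (cong bit (f-sym x v)) (cong bit (f-sym y v))) (cab (E x y) (F v x) (F v y)))) ⟩
        S₃ eef + S₃ ffe ∎
        where
        abc : ∀ a b c → a * b * c ≡ a * c * b
        abc = solve-∀
        cab : ∀ c a b → c * a * b ≡ a * b * c
        cab = solve-∀
      pointwise : ∀ v x y → E v x * (E v y * E x y) + F v x * (F v y * F x y) + (efd v x y + fed v x y + (eef v x y + ffe v x y))
                  ≡ D v x * D v y * D x y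
      pointwise v x y rewrite sym (E+F v x) | sym (E+F v y) | sym (E+F x y) = expand (E v x) (E v y) (E x y) (F v x) (F v y) (F x y)
        where
        expand : ∀ a b c p q r → a * (b * c) + p * (q * r) + (a * q * (c + r) + p * b * (c + r) + (a * b * r + p * q * c)) ≡ (a + p) * (b + q) * (c + r)
        expand = solve-∀

-- Every two-colouring of K₂₂ contains a monochromatic J₅.

module NoColouring22 where
  open import Data.Nat
  open import Data.Nat.Properties
  open import Data.Bool using (Bool; true; false; not)
  open import Data.Fin using (Fin; zero; suc)
  import Data.Fin as Fin
  import Data.Fin.Properties as Finₚ
  open import Data.List hiding (sum; find)
  open import Data.Nat.ListAction using (sum)
  open import Data.List.Properties
  open import Data.List.Relation.Unary.All using (All; []; _∷_)
  import Data.List.Relation.Unary.All as All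
  open import Data.List.Relation.Unary.Any using (here; there)
  open import Data.List.Relation.Unary.AllPairs using ([]; _∷_)
  open import Data.List.Relation.Unary.Unique.Propositional using (Unique)
  import Data.List.Relation.Unary.Unique.Propositional.Properties as Uniq
  open import Data.List.Relation.Binary.Permutation.Propositional using (_↭_; ↭-refl; ↭-sym; ↭-trans; ↭-reflexive)
  import Data.List.Relation.Binary.Permutation.Propositional.Properties as Perm
  open import Data.List.Relation.Binary.Sublist.Propositional using ([]; _∷_)
  open import Data.List.Membership.Propositional using (_∈_)
  open import Data.List.Membership.Propositional.Properties
  open import Data.Product using (∃; _×_; _,_)
  open import Data.Sum using (_⊎_; inj₁; inj₂)
  open import Data.Unit using (⊤; tt)
  open import Data.Empty using (⊥; ⊥-elim)
  open import Function using (_∘_; case_of_)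
  open import Relation.Nullary
  open import Relation.Nullary.Decidable using (toWitness)
  open import Relation.Binary.PropositionalEquality hiding ([_])
  open Search
  open SmallRamseyNumbers
  open Extension
  open Catalogues
  open Gluing
  open Density
  open GoodmanCount

  lack-cong : ∀ {X : Set} {g h : X → X → Bool} x C → All (x ≢_) C → (∀ x y → x ≢ y → g x y ≡ h x y) → lack g x C ≡ lack h x C
  lack-cong x [] [] p = refl
  lack-cong x (y ∷ C) (n ∷ ns) p = cong₂ _+_ (cong pen (p x y n)) (lack-cong x C ns p)

  miss-cong : ∀ {X : Set} {g h : X → X → Bool} C → Unique C → (∀ x y → x ≢ y → g x y ≡ h x y) → miss g C ≡ miss h C
  miss-cong [] [] p = refl
  miss-cong (x ∷ C) (n ∷ u) p = cong₂ _+_ (lack-cong x C n p) (miss-cong C u p)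

  -- Every s distinct elements satisfying P miss at least m pairs of g.
  Few : ∀ {X : Set} → (X → X → Bool) → (X → Set) → ℕ → ℕ → Set
  Few g P s m = ∀ C → Unique C → All P C → length C ≡ s → m ≤ miss g C

  lack-0 : ∀ {X : Set} (g : X → X → Bool) x C → All (λ y → g x y ≡ true) C → lack g x C ≡ 0
  lack-0 g x [] [] = refl
  lack-0 g x (y ∷ C) (p ∷ ps) rewrite p = lack-0 g x C ps

  anyOf-witness : ∀ {X : Set} (p : X → Bool) xs → anyOf p xs ≡ true → ∃ λ x → x ∈ xs × p x ≡ true
  anyOf-witness p (x ∷ xs) h with ∨-true h
  ... | inj₁ q = x , here refl , q
  ... | inj₂ q = let (y , i , r) = anyOf-witness p xs q in y , there i , r

  filter-split : ∀ {X : Set} (p : X → Bool) xs → xs ↭ filterᵇ p xs ++ filterᵇ (not ∘ p) xs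
  filter-split p [] = ↭-refl
  filter-split p (x ∷ xs) with p x
  ... | true = _↭_.prep x (filter-split p xs)
  ... | false = ↭-trans (_↭_.prep x (filter-split p xs)) (↭-sym (Perm.shift x (filterᵇ p xs) _))

  length-filterᵇ : ∀ {X : Set} (p : X → Bool) xs → length (filterᵇ p xs) ≡ cnt p xs
  length-filterᵇ p [] = refl
  length-filterᵇ p (x ∷ xs) with p x
  ... | true = cong suc (length-filterᵇ p xs)
  ... | false = length-filterᵇ p xs

  filterᵇ-All : ∀ {X : Set} (p : X → Bool) xs → All (λ x → p x ≡ true) (filterᵇ p xs)
  filterᵇ-All p [] = []
  filterᵇ-All p (x ∷ xs) with p x in eq
  ... | true = eq ∷ filterᵇ-All p xs
  ... | false = filterᵇ-All p xs

  cnt-filter : ∀ {X : Set} (q p : X → Bool) xs → cnt q (filterᵇ p xs) ≡ sum (map (λ x → bit (p x) * bit (q x)) xs)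
  cnt-filter q p xs = sum-filter p (bit ∘ q) xs

  distinct : ∀ {n} → Fin n → Fin n → Bool
  distinct x y = not (does (x Fin.≟ y))

  record Facts (n : ℕ) : Set where
    field
      size : length (allFin n) ≡ 22
      alone : ∀ v → filterᵇ (not ∘ distinct v) (allFin n) ≡ v ∷ []
      ones : ∀ v → sum (map (λ x → bit (distinct v x)) (allFin n)) ≡ 21
      -- The ordered triples of distinct vertices: 9240 = 22 · 21 · 20.
      triples : sum (map (λ v → sum (map (λ x → sum (map (λ y → bit (distinct v x) * bit (distinct v y) * bit (distinct x y))
                  (allFin n))) (allFin n))) (allFin n)) ≡ 9240

  -- Keeping the number of vertices abstract stops the sums below from being unfolded.
  facts : Facts 22
  facts = record
    { size = refl
    ; alone = toWitness {a? = Finₚ.all? (λ v → ≡-dec Fin._≟_ (filterᵇ (not ∘ distinct v) (allFin 22)) (v ∷ []))} tt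
    ; ones = toWitness {a? = Finₚ.all? (λ v → sum (map (λ x → bit (distinct v x)) (allFin 22)) ≟ 21)} tt
    ; triples = refl }

  record TwoColouring (n : ℕ) : Set where
    V : Set
    V = Fin n
    field
      e f : V → V → Bool
      e-sym : ∀ x y → e x y ≡ e y x
      f-sym : ∀ x y → f x y ≡ f y x
      e-irr : ∀ x → e x x ≡ false
      f-irr : ∀ x → f x x ≡ false
      compl : ∀ x y → x ≢ y → f x y ≡ not (e x y)
      e-few : Few e (λ _ → ⊤) 5 2
      f-few : Few f (λ _ → ⊤) 5 2

  flip-colours : ∀ {n} → TwoColouring n → TwoColouring n
  flip-colours c = record
    { e = f ; f = e ; e-sym = f-sym ; f-sym = e-sym ; e-irr = f-irr ; f-irr = e-irr
    ; compl = λ x y n → trans (sym (not-involutive (e x y))) (cong not (sym (compl x y n)))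
    ; e-few = f-few ; f-few = e-few }
    where
    open TwoColouring c
    open import Data.Bool.Properties using (not-involutive)

  module OneColour {order : ℕ} (facts : Facts order) (c : TwoColouring order) where
    open TwoColouring c
    open Facts facts

    vertices : List V
    vertices = allFin order

    open Sound e
    open Graph e e-sym e-irr

    anti-few : Few (adj false) (λ _ → ⊤) 5 2
    anti-few C u a l = ≤-trans (f-few C u a l) (≤-reflexive (miss-cong C u compl))

    free₅ : ∀ {P} → Avoids J5J5 P
    free₅ = avoids (λ C u a l → e-few C u (All.universal (λ _ → tt) C) l) (λ C u a l → anti-few C u (All.universal (λ _ → tt) C) l) (λ ()) (λ ())

    others : V → List V
    others v = filterᵇ (distinct v) vertices

    N M : V → List V
    N v = filterᵇ (e v) vertices
    M v = filterᵇ (not ∘ e v) (others v)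

    deg : V → ℕ
    deg v = cnt (e v) vertices

    -- Adding `v` to a J₄ among its neighbours would give a J₅ of the same colour.
    neighbourly : ∀ v → Avoids J4J5 (λ x → e v x ≡ true)
    neighbourly v = avoids
      (λ C u a l → ≤-trans (e-few (v ∷ C) (All.map (λ {x} p eq → case trans (sym p) (trans (cong (e v) (sym eq)) (e-irr v)) of λ ()) a ∷ u)
                       (All.universal (λ _ → tt) _) (cong suc l)) (≤-reflexive (cong (_+ miss e C) (lack-0 e v C a))))
      (λ C u a l → anti-few C u (All.universal (λ _ → tt) C) l) (λ ()) (λ ())

    N-unique : ∀ v → Unique (N v)
    N-unique v = Uniq.filter⁺ _ (Uniq.allFin⁺ order)

    deg≤12 : ∀ v → deg v ≤ 12
    deg≤12 v = ≤-trans (≤-reflexive (sym (length-filterᵇ (e v) vertices)))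
                 (J4J5-bound e (neighbourly v) (N v) (N-unique v) (filterᵇ-All (e v) vertices))

    -- The degree sum is twice a number of edges, so missing the threshold 2E costs two, not one.
    -- The final count depends on this.
    even-bound : ∀ v E → (E + E ≤ degSum (N v) → ⊥) → degSum (N v) ≤ pred E + pred E
    even-bound v E h rewrite degSum-edges (N v) with E ≤? edges (matOf (N v))
    ... | yes p = ⊥-elim (h (+-mono-≤ p p))
    ... | no np with E
    ...   | zero = ⊥-elim (np z≤n)
    ...   | suc E′ = +-mono-≤ (s≤s⁻¹ (≰⇒> np)) (s≤s⁻¹ (≰⇒> np))

    sparse : ∀ v n E → rooted J4J5 (dense n E never) (hub (pred n)) ≡ true → deg v ≡ n → 4 * n < E + E → degSum (N v) ≤ pred E + pred E
    sparse v n E check d lt = even-bound v E λ big →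
      let (L , _ , h) = dense-sound (neighbourly v) n E never check (N v) (N-unique v) (filterᵇ-All (e v) vertices)
                          (trans (length-filterᵇ (e v) vertices) d) lt big
      in case h of λ ()

    all-split : ∀ v → vertices ↭ v ∷ (N v ++ M v)
    all-split v = ↭-trans (filter-split (distinct v) vertices) (↭-trans (Perm.++-comm (others v) _)
      (↭-trans (↭-reflexive (cong (_++ others v) (alone v))) (_↭_.prep v (↭-trans (filter-split (e v) (others v))
        (↭-reflexive (cong (_++ M v) (drop-v vertices)))))))
      where
      drop-v : ∀ xs → filterᵇ (e v) (filterᵇ (distinct v) xs) ≡ filterᵇ (e v) xs
      drop-v [] = refl
      drop-v (x ∷ xs) with v Fin.≟ x
      ... | yes refl rewrite e-irr v = drop-v xs
      ... | no ne with e v x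
      ...   | true = cong (x ∷_) (drop-v xs)
      ...   | false = drop-v xs

    M-false : ∀ v → All (λ u → e u v ≡ false) (M v)
    M-false v = All.map (λ {u} p → trans (e-sym u v) (not-true p)) (filterᵇ-All (not ∘ e v) (others v))

    no-rep : ∀ v n reps → length (N v) ≡ n → (∀ l → 9 ≤ deg l) → glueAll n reps ≡ true → n ≤ 21 →
             ∀ L → L ↭ N v → isoTo reps (matOf L) ≡ true → ⊥
    no-rep v n reps ln deg≥9 gl n≤ L LN h with anyOf-witness _ reps h
    ... | r , i , isor with isoMat-sound L (keys (matOf L)) (decode 0 (Rep.rows r)) isor
    ...   | K , KL , mK = glue-sound free₅ v K (M v) n (Rep.specs r) (Unique-↭ everyone (Uniq.allFin⁺ order)) (All.universal (λ _ → tt) _)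
              (All-↭ (↭-sym KN) (filterᵇ-All (e v) vertices)) (M-false v) lK lM d₁ d₀
              (subst (λ m → glue n m (Rep.specs r) ≡ true) (sym mK) (All.lookup (every-true _ reps gl) i))
      where
      KN : K ↭ N v
      KN = ↭-trans KL LN
      lK : length K ≡ n
      lK = trans (Perm.↭-length KN) ln
      everyone : vertices ↭ M v ++ v ∷ K
      everyone = ↭-trans (all-split v) (↭-trans (_↭_.prep v (↭-trans (Perm.++⁺ʳ (M v) (↭-sym KN)) (Perm.++-comm K (M v)))) (↭-sym (Perm.shift v (M v) K)))
      total : 21 ≡ n + length (M v)
      total = suc-injective (trans (sym size) (trans (Perm.↭-length (all-split v)) (cong suc (trans (length-++ (N v)) (cong (_+ length (M v)) ln)))))
      lM : length (M v) ≡ 21 ∸ n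
      lM = sym (trans (cong (_∸ n) total) (m+n∸m≡n n (length (M v))))
      degK : ∀ {l} → l ∈ K → deg l ≡ suc (cnt (e l) K + cnt (λ u → e u l) (M v))
      degK {l} i = trans (cnt-↭ (e l) (all-split v)) (cong₂ _+_ (cong bit (trans (e-sym l v) (All.lookup (All-↭ (↭-sym KN) (filterᵇ-All (e v) vertices)) i)))
        (trans (cnt-++ (e l) (N v) (M v)) (cong₂ _+_ (cnt-↭ (e l) (↭-sym KN)) (cnt-cong (e-sym l) (M v)))))
      d₁ : ∀ {l} → l ∈ K → 8 ≤ cnt (e l) K + cnt (λ u → e u l) (M v)
      d₁ {l} i = s≤s⁻¹ (≤-trans (deg≥9 l) (≤-reflexive (degK i)))
      d₀ : ∀ {l} → l ∈ K → 10 + cnt (e l) K ≤ n + cnt (λ u → not (e u l)) (M v)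
      -- The upper bound 12 for the degree in colour true is the lower bound 9 for the other colour,
      -- as the two degrees sum to 21.
      d₀ {l} i = +-cancelʳ-≤ m₁ (10 + k) (n + m₀) (begin
        10 + k + m₁ ≡⟨ +-assoc 10 k m₁ ⟩
        10 + (k + m₁) ≤⟨ +-monoʳ-≤ 10 (s≤s⁻¹ (≤-trans (≤-reflexive (sym (degK i))) (deg≤12 l))) ⟩
        21 ≡⟨ total ⟩
        n + length (M v) ≡⟨ cong (n +_) (sym (trans (+-comm m₀ m₁) (count-split (λ u → e u l) (M v)))) ⟩
        n + (m₀ + m₁) ≡⟨ sym (+-assoc n m₀ m₁) ⟩
        n + m₀ + m₁ ∎)
        where
        open ≤-Reasoning
        k = cnt (e l) K
        m₁ = cnt (λ u → e u l) (M v)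
        m₀ = cnt (λ u → not (e u l)) (M v)

    sparse-glue : ∀ v n E reps → rooted J4J5 (dense n E (isoTo reps)) (hub (pred n)) ≡ true → glueAll n reps ≡ true → (∀ l → 9 ≤ deg l) →
      deg v ≡ n → n ≤ 21 → 4 * n < E + E → degSum (N v) ≤ pred E + pred E
    sparse-glue v n E reps check gl deg≥9 d n≤ lt = even-bound v E λ big →
      let ln = trans (length-filterᵇ (e v) vertices) d
          (L , LN , h) = dense-sound (neighbourly v) n E (isoTo reps) check (N v) (N-unique v) (filterᵇ-All (e v) vertices) ln lt big
      in no-rep v n reps ln deg≥9 gl n≤ L LN h

    sparse9 : ∀ v → deg v ≡ 9 → degSum (N v) ≤ 36
    sparse9 v d = sparse v 9 19 check9 d (m≤m+n 37 1)

    sparse10 : ∀ v → deg v ≡ 10 → degSum (N v) ≤ 42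
    sparse10 v d = sparse v 10 22 check10 d (m≤m+n 41 3)

    sparse11 : (∀ l → 9 ≤ deg l) → ∀ v → deg v ≡ 11 → degSum (N v) ≤ 46
    sparse11 deg≥9 v d = sparse-glue v 11 24 reps11 check11 glue11 deg≥9 d (m≤m+n 11 10) (m≤m+n 45 3)

    sparse12 : (∀ l → 9 ≤ deg l) → ∀ v → deg v ≡ 12 → degSum (N v) ≤ 58
    sparse12 deg≥9 v d = sparse-glue v 12 30 reps12 check12 glue12 deg≥9 d (m≤m+n 12 9) (m≤m+n 49 11)

    local : (∀ l → 9 ≤ deg l) → ∀ v →
      (deg v ≡ 9 × degSum (N v) ≤ 36) ⊎ (deg v ≡ 10 × degSum (N v) ≤ 42) ⊎ (deg v ≡ 11 × degSum (N v) ≤ 46) ⊎ (deg v ≡ 12 × degSum (N v) ≤ 58)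
    local deg≥9 v with deg v in d | deg≥9 v | deg≤12 v
    ... | 9 | _ | _ = inj₁ (refl , sparse9 v d)
    ... | 10 | _ | _ = inj₂ (inj₁ (refl , sparse10 v d))
    ... | 11 | _ | _ = inj₂ (inj₂ (inj₁ (refl , sparse11 deg≥9 v d)))
    ... | 12 | _ | _ = inj₂ (inj₂ (inj₂ (refl , sparse12 deg≥9 v d)))
    ... | 0 | () | _
    ... | 1 | s≤s () | _
    ... | 2 | s≤s (s≤s ()) | _
    ... | 3 | s≤s (s≤s (s≤s ())) | _
    ... | 4 | s≤s (s≤s (s≤s (s≤s ()))) | _
    ... | 5 | s≤s (s≤s (s≤s (s≤s (s≤s ())))) | _
    ... | 6 | s≤s (s≤s (s≤s (s≤s (s≤s (s≤s ()))))) | _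
    ... | 7 | s≤s (s≤s (s≤s (s≤s (s≤s (s≤s (s≤s ())))))) | _
    ... | 8 | s≤s (s≤s (s≤s (s≤s (s≤s (s≤s (s≤s (s≤s ()))))))) | _
    ... | suc (suc (suc (suc (suc (suc (suc (suc (suc (suc (suc (suc (suc n)))))))))))) | _ | le = ⊥-elim (<⇒≱ (m≤m+n 13 n) le)

    degSum-N : ∀ v → degSum (N v) ≡ sum (map (λ x → sum (map (λ y → bit (e v x) * (bit (e v y) * bit (e x y))) vertices)) vertices)
    degSum-N v = trans (cong sum (map-cong (λ x → cnt-filter (e x) (e v) vertices) (N v)))
      (trans (sum-filter (e v) _ vertices) (sum-cong (λ x → sym (sum-* (bit (e v x)) _ vertices)) vertices))

  no-colouring : ∀ {n} → Facts n → TwoColouring n → ⊥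
  no-colouring facts c = <⇒≱ (m≤m+n 9197 43) (≤-trans (≤-reflexive (sym total)) small)
    where
    open TwoColouring c
    open Facts facts
    module R = OneColour facts c
    module B = OneColour facts (flip-colours c)
    open Goodman e f e-sym f-sym e-irr f-irr compl
    open Graph e e-sym e-irr using () renaming (degSum to degSumR)
    open Graph f f-sym f-irr using () renaming (degSum to degSumB)
    degs-21 : ∀ v → R.deg v + B.deg v ≡ 21
    degs-21 v = trans (sym (sum-+ (E v) (F v) vs)) (trans (sum-cong (E+F v) vs) (ones v))
    R≥9 : ∀ v → 9 ≤ R.deg v
    R≥9 v = +-cancelʳ-≤ 12 9 _ (≤-trans (≤-reflexive (sym (degs-21 v))) (+-monoʳ-≤ (R.deg v) (B.deg≤12 v)))
    B≥9 : ∀ v → 9 ≤ B.deg v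
    B≥9 v = +-cancelˡ-≤ 12 9 _ (≤-trans (≤-reflexive (sym (degs-21 v))) (+-monoˡ-≤ (B.deg v) (R.deg≤12 v)))
    weight : V → ℕ
    weight v = degSumR (R.N v) + degSumB (B.N v) + 3 * (R.deg v * B.deg v)
    -- The degrees sum to 21 and lie between 9 and 12, so they are 9 and 12 or 10 and 11. Both
    -- possibilities give the same maximum: 36 + 58 + 3 · 108 = 42 + 46 + 3 · 110 = 418. By
    -- Goodman's identity the average is 9240 / 22 = 420.
    local-weight : ∀ v → weight v ≤ 418
    local-weight v with R.deg v | B.deg v | degs-21 v | R.local R≥9 v | B.local B≥9 v
    ... | _ | _ | d | inj₁ (refl , a) | inj₂ (inj₂ (inj₂ (refl , b))) = +-monoˡ-≤ 324 (+-mono-≤ a b)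
    ... | _ | _ | d | inj₂ (inj₁ (refl , a)) | inj₂ (inj₂ (inj₁ (refl , b))) = +-monoˡ-≤ 330 (+-mono-≤ a b)
    ... | _ | _ | d | inj₂ (inj₂ (inj₁ (refl , a))) | inj₂ (inj₁ (refl , b)) = +-monoˡ-≤ 330 (+-mono-≤ a b)
    ... | _ | _ | d | inj₂ (inj₂ (inj₂ (refl , a))) | inj₁ (refl , b) = +-monoˡ-≤ 324 (+-mono-≤ a b)
    ... | _ | _ | () | inj₁ (refl , a) | inj₁ (refl , b)
    ... | _ | _ | () | inj₁ (refl , a) | inj₂ (inj₁ (refl , b))
    ... | _ | _ | () | inj₁ (refl , a) | inj₂ (inj₂ (inj₁ (refl , b)))
    ... | _ | _ | () | inj₂ (inj₁ (refl , a)) | inj₁ (refl , b)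
    ... | _ | _ | () | inj₂ (inj₁ (refl , a)) | inj₂ (inj₁ (refl , b))
    ... | _ | _ | () | inj₂ (inj₁ (refl , a)) | inj₂ (inj₂ (inj₂ (refl , b)))
    ... | _ | _ | () | inj₂ (inj₂ (inj₁ (refl , a))) | inj₁ (refl , b)
    ... | _ | _ | () | inj₂ (inj₂ (inj₁ (refl , a))) | inj₂ (inj₂ (inj₁ (refl , b)))
    ... | _ | _ | () | inj₂ (inj₂ (inj₁ (refl , a))) | inj₂ (inj₂ (inj₂ (refl , b)))
    ... | _ | _ | () | inj₂ (inj₂ (inj₂ (refl , a))) | inj₂ (inj₁ (refl , b))
    ... | _ | _ | () | inj₂ (inj₂ (inj₂ (refl , a))) | inj₂ (inj₂ (inj₁ (refl , b)))
    ... | _ | _ | () | inj₂ (inj₂ (inj₂ (refl , a))) | inj₂ (inj₂ (inj₂ (refl , b)))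
    small : S weight ≤ 9196
    small = ≤-trans (sum-≤ weight 418 vs local-weight) (≤-reflexive (cong (418 *_) size))
    total : S weight ≡ 9240
    total = trans (sum-+ _ _ vs) (trans (cong₂ _+_ (trans (sum-+ _ _ vs) (cong₂ _+_ (sum-cong R.degSum-N vs) (sum-cong B.degSum-N vs)))
              (sum-* 3 _ vs)) (trans goodman triples))

-- Gallai's theorem on colourings without rainbow triangles.

module GallaiPartitions where
  open import Data.Nat using (ℕ; _<_)
  open import Data.Nat.Properties
  open import Data.Nat.Induction using (Acc; acc)
  open import Data.Bool using (Bool; true; false; if_then_else_)
  open import Data.Fin using (Fin)
  import Data.Fin as Fin
  open import Data.List hiding (sum; find)
  open import Data.List.Properties using (filter-notAll)
  open import Data.List.Relation.Unary.All using (All; []; _∷_)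
  import Data.List.Relation.Unary.All as All
  open import Data.List.Relation.Unary.Any using (Any; here; there)
  import Data.List.Relation.Unary.Any as Any
  open import Data.List.Relation.Unary.AllPairs using ([]; _∷_)
  open import Data.List.Relation.Unary.Unique.Propositional using (Unique)
  open import Data.List.Membership.Propositional using (_∈_; lose; find)
  open import Data.List.Membership.Propositional.Properties
  open import Data.Product using (∃; _×_; _,_; proj₁; proj₂)
  open import Data.Sum using (_⊎_; inj₁; inj₂)
  open import Data.Empty using (⊥-elim)
  open import Function using (_∘_; id; case_of_)
  open import Relation.Nullary
  open import Relation.Nullary.Decidable using (_×-dec_; _⊎-dec_; ¬?; dec-true; dec-false)
  open import Relation.Binary.PropositionalEquality hiding ([_])

  module Decompose {n k : ℕ} (c : Fin n → Fin n → Fin k) (c-sym : ∀ x y → c x y ≡ c y x)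
    (no-rainbow : ∀ {x y z} → x ≢ y → y ≢ z → x ≢ z → c x y ≢ c x z → c y z ≡ c x y ⊎ c y z ≡ c x z) where

    V : Set
    V = Fin n

    Colour : Set
    Colour = Fin k

    touched : Colour → V → List V → (V → V) → V → Set
    touched i v L κ x = Any (λ y → κ y ≡ κ x × c v y ≡ i) L

    touched? : ∀ i v L κ x → Dec (touched i v L κ x)
    touched? i v L κ x = Any.any? (λ y → (κ y Fin.≟ κ x) ×-dec (c v y Fin.≟ i)) L

    fuse : Colour → V → List V → (V → V) → V → V
    fuse i v L κ x = if does (x Fin.≟ v) then v else (if does (touched? i v L κ x) then v else κ x)

    -- The vertices are inserted one by one; each becomes the representative of all earlier
    -- components that it meets in colour `i`.
    comp : Colour → List V → V → V
    comp i [] = id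
    comp i (v ∷ L) = fuse i v L (comp i L)

    -- `constant` takes the place of paths: whatever does not change along an edge of colour `i`
    -- depends only on the component.
    record Components (i : Colour) (L : List V) (κ : V → V) : Set₁ where
      field
        inside : ∀ {x} → x ∈ L → κ x ∈ L
        idem : ∀ {x} → x ∈ L → κ (κ x) ≡ κ x
        edge : ∀ {x y} → x ∈ L → y ∈ L → x ≢ y → c x y ≡ i → κ x ≡ κ y
        constant : ∀ {A : Set} (f : V → A) → (∀ {x y} → x ∈ L → y ∈ L → x ≢ y → c x y ≡ i → f x ≡ f y) → ∀ {x} → x ∈ L → f x ≡ f (κ x)

    components : ∀ i L → Unique L → Components i L (comp i L)
    components i [] _ = record { inside = λ () ; idem = λ () ; edge = λ () ; constant = λ _ _ () }
    components i (v ∷ L) (v∉ ∷ u) = record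
      { inside = λ m → inside′ m ; idem = idem′ ; edge = edge′ ; constant = constant′ }
      where
      κ = comp i L
      κ′ = comp i (v ∷ L)
      open Components (components i L u)

      at-v : κ′ v ≡ v
      at-v = cong (λ z → if z then v else (if does (touched? i v L κ v) then v else κ v)) (dec-true (v Fin.≟ v) refl)

      ≢v : ∀ {x} → x ∈ L → x ≢ v
      ≢v m refl = All.lookup v∉ m refl

      at-touched : ∀ {x} → touched i v L κ x → κ′ x ≡ v
      at-touched {x} t = trans (cong (λ z → if does (x Fin.≟ v) then v else (if z then v else κ x)) (dec-true (touched? i v L κ x) t))
                           (either (does (x Fin.≟ v)))
        where
        either : ∀ b → (if b then v else v) ≡ v
        either true = refl
        either false = refl

      at-rest : ∀ {x} → x ≢ v → ¬ touched i v L κ x → κ′ x ≡ κ x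
      at-rest {x} ne nt = trans (cong (λ z → if z then v else (if does (touched? i v L κ x) then v else κ x)) (dec-false (x Fin.≟ v) ne))
                            (cong (λ z → if z then v else κ x) (dec-false (touched? i v L κ x) nt))

      move : ∀ {x y} → κ x ≡ κ y → touched i v L κ x → touched i v L κ y
      move e = Any.map λ (p , q) → trans p e , q

      inside′ : ∀ {x} → x ∈ v ∷ L → κ′ x ∈ v ∷ L
      inside′ (here refl) = here at-v
      inside′ {x} (there m) = case touched? i v L κ x of λ
        { (yes t) → here (at-touched t)
        ; (no nt) → there (subst (_∈ L) (sym (at-rest (≢v m) nt)) (inside m)) }

      idem′ : ∀ {x} → x ∈ v ∷ L → κ′ (κ′ x) ≡ κ′ x
      idem′ (here refl) = cong κ′ at-v
      idem′ {x} (there m) = case touched? i v L κ x of λ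
        { (yes t) → trans (cong κ′ (at-touched t)) (trans at-v (sym (at-touched t)))
        ; (no nt) → trans (cong κ′ (at-rest (≢v m) nt))
            (trans (at-rest (≢v (inside m)) (nt ∘ move (idem m))) (trans (idem m) (sym (at-rest (≢v m) nt)))) }

      edge-v : ∀ {y} → y ∈ L → c v y ≡ i → κ′ y ≡ v
      edge-v m e = at-touched (lose m (refl , e))

      edge′ : ∀ {x y} → x ∈ v ∷ L → y ∈ v ∷ L → x ≢ y → c x y ≡ i → κ′ x ≡ κ′ y
      edge′ (here refl) (here refl) ne e = ⊥-elim (ne refl)
      edge′ (here refl) (there m) ne e = trans at-v (sym (edge-v m e))
      edge′ {x} (there m) (here refl) ne e = trans (edge-v m (trans (c-sym v x) e)) (sym at-v)
      edge′ {x} {y} (there m) (there m′) ne e = case touched? i v L κ x of λ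
        { (yes t) → trans (at-touched t) (sym (at-touched (move q t)))
        ; (no nt) → trans (at-rest (≢v m) nt) (trans q (sym (at-rest (≢v m′) (nt ∘ move (sym q))))) }
        where q = edge m m′ ne e

      constant′ : ∀ {A : Set} (f : V → A) → (∀ {x y} → x ∈ v ∷ L → y ∈ v ∷ L → x ≢ y → c x y ≡ i → f x ≡ f y) → ∀ {x} → x ∈ v ∷ L → f x ≡ f (κ′ x)
      constant′ f h (here refl) = cong f (sym at-v)
      constant′ f h {x} (there m) = case touched? i v L κ x of λ
        { (no nt) → trans (con m) (cong f (sym (at-rest (≢v m) nt)))
        ; (yes t) → let (y , my , (q , e)) = find t in
            trans (trans (con m) (trans (cong f (sym q)) (sym (con my))))
              (trans (h (there my) (here refl) (≢v my) (trans (c-sym y v) e)) (cong f (sym (at-touched t)))) }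
        where
        con : ∀ {z} → z ∈ L → f z ≡ f (κ z)
        con = constant f (λ a b → h (there a) (there b))

    -- Two components of a colour are joined in a single colour.
    homogeneous : ∀ i L → Unique L → let κ = comp i L in
      ∀ {x x′ y} → x ∈ L → x′ ∈ L → y ∈ L → κ x ≡ κ x′ → κ x ≢ κ y → c x y ≡ c x′ y
    homogeneous i L u {x} {x′} {y} mx mx′ my e ne = trans (value refl) (trans (trans (con mx) (trans (cong f e) (sym (con mx′)))) (sym (value (sym e))))
      where
      κ = comp i L
      open Components (components i L u)
      -- On the component of `x` this is the colour towards `y`, elsewhere a fixed default. It does
      -- not change along edges of colour `i`: if a and b are joined by `i` and neither is joined to
      -- y by `i`, the triangle a, b, y would otherwise be rainbow.
      f : V → Colour
      f z = if does (κ z Fin.≟ κ x) then c z y else c x y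
      value : ∀ {z} → κ z ≡ κ x → c z y ≡ f z
      value {z} e with κ z Fin.≟ κ x
      ... | yes _ = refl
      ... | no d = ⊥-elim (d e)
      other : ∀ {z} → κ z ≢ κ x → f z ≡ c x y
      other {z} d with κ z Fin.≟ κ x
      ... | yes e = ⊥-elim (d e)
      ... | no _ = refl
      con : ∀ {z} → z ∈ L → f z ≡ f (κ z)
      con = constant f step
        where
        step : ∀ {a b} → a ∈ L → b ∈ L → a ≢ b → c a b ≡ i → f a ≡ f b
        step {a} {b} ma mb d ab with κ a Fin.≟ κ x
        ... | no o = sym (other λ q → o (trans (edge ma mb d ab) q))
        ... | yes o = trans same (value {b} o′)
          where
          o′ = trans (sym (edge ma mb d ab)) o
          a≢y : a ≢ y
          a≢y refl = ne (sym o)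
          b≢y : b ≢ y
          b≢y refl = ne (sym o′)
          ay : c a y ≢ i
          ay q = ne (trans (sym o) (edge ma my a≢y q))
          by : c b y ≢ i
          by q = ne (trans (sym o′) (edge mb my b≢y q))
          same : c a y ≡ c b y
          same with no-rainbow d b≢y a≢y (λ q → ay (trans (sym q) ab))
          ... | inj₁ q = ⊥-elim (by (trans q ab))
          ... | inj₂ q = sym q

    Within : Colour → Colour → Colour → Set
    Within R B i = i ≡ R ⊎ i ≡ B

    within? : ∀ R B i → Dec (Within R B i)
    within? R B i = (i Fin.≟ R) ⊎-dec (i Fin.≟ B)

    TwoColoured : List V → Set
    TwoColoured L = ∃ λ R → ∃ λ B → ∀ {x y} → x ∈ L → y ∈ L → x ≢ y → Within R B (c x y)

    -- A colour that occurs in `L` without connecting it. The cut gives at least two components; the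
    -- occurrence of the colour makes one of them have two vertices, so contracting the components
    -- shortens the list.
    record Split (L : List V) : Set where
      field
        colour : Colour
        side : V → Bool
        {a b p q} : V
        a∈ : a ∈ L
        b∈ : b ∈ L
        a-in : side a ≡ true
        b-out : side b ≡ false
        cut : ∀ {x y} → x ∈ L → y ∈ L → side x ≡ true → side y ≡ false → c x y ≢ colour
        p∈ : p ∈ L
        q∈ : q ∈ L
        p≢q : p ≢ q
        used : c p q ≡ colour

    is : V → V → Bool
    is v x = does (x Fin.≟ v)

    is-self : ∀ v → is v v ≡ true
    is-self v with v Fin.≟ v
    ... | yes _ = refl
    ... | no ne = ⊥-elim (ne refl)

    is-other : ∀ {v x} → x ≢ v → is v x ≡ false
    is-other {v} {x} ne with x Fin.≟ v
    ... | yes e = ⊥-elim (ne e)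
    ... | no _ = refl

    is⇒≡ : ∀ {v x} → is v x ≡ true → x ≡ v
    is⇒≡ {v} {x} h with x Fin.≟ v
    ... | yes e = e

    isnt⇒≢ : ∀ {v x} → is v x ≡ false → x ≢ v
    isnt⇒≢ {v} h refl with v Fin.≟ v
    isnt⇒≢ () refl | yes _
    ... | no ne = ne refl

    -- A vertex of L which misses a used colour splits L.
    isolate : ∀ {L} v w j {p q} → v ∈ L → w ∈ L → w ≢ v → p ∈ L → q ∈ L → p ≢ q → c p q ≡ j →
              (∀ {y} → y ∈ L → y ≢ v → c v y ≢ j) → Split L
    isolate v w j v∈ w∈ w≢v p∈ q∈ p≢q e miss = record
      { colour = j ; side = is v ; a∈ = v∈ ; b∈ = w∈ ; a-in = is-self v ; b-out = is-other w≢v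
      ; cut = λ { {x} {y} x∈ y∈ sx sy → subst (λ z → c z y ≢ j) (sym (is⇒≡ sx)) (miss y∈ (isnt⇒≢ sy)) }
      ; p∈ = p∈ ; q∈ = q∈ ; p≢q = p≢q ; used = e }

    edge-outside? : ∀ R B L → (∃ λ x → ∃ λ y → x ∈ L × y ∈ L × x ≢ y × ¬ Within R B (c x y)) ⊎
                               (∀ {x y} → x ∈ L → y ∈ L → x ≢ y → Within R B (c x y))
    edge-outside? R B L with Any.any? (λ x → Any.any? (λ y → ¬? (x Fin.≟ y) ×-dec ¬? (within? R B (c x y))) L) L
    ... | yes h = let (x , mx , h′) = find h ; (y , my , (ne , nw)) = find h′ in inj₁ (x , y , mx , my , ne , nw)
    ... | no h = inj₂ λ {x} {y} mx my ne → case within? R B (c x y) of λ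
            { (yes w) → w ; (no nw) → ⊥-elim (h (lose mx (lose my (ne , nw)))) }

    -- Induction on the vertices. If the new vertex destroys the property of the others, some vertex
    -- misses a colour in use and is cut off by it. The substantial case is a colour `i`
    -- disconnecting the others while the new vertex sends `i` into every component: then it uses at
    -- most one further colour.
    dichotomy : ∀ v L → Unique (v ∷ L) → TwoColoured (v ∷ L) ⊎ Split (v ∷ L)
    dichotomy v [] u = inj₁ (c v v , c v v , λ { (here refl) (here refl) ne → ⊥-elim (ne refl) })
    dichotomy v (w ∷ L₀) (v∉ ∷ u) with dichotomy w L₀ u
    ... | inj₁ (R , B , two) = extend
      where
      L = w ∷ L₀
      v≢ : ∀ {y} → y ∈ L → y ≢ v
      v≢ m refl = All.lookup v∉ m refl
      both : ∀ {R′ B′} → (∀ {y} → y ∈ L → Within R′ B′ (c v y)) → (∀ {x y} → x ∈ L → y ∈ L → x ≢ y → Within R′ B′ (c x y)) →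
             TwoColoured (v ∷ L)
      both {R′} {B′} vs ls = R′ , B′ , λ
        { (here refl) (here refl) ne → ⊥-elim (ne refl)
        ; (here refl) (there m) ne → vs m
        ; {x} (there m) (here refl) ne → subst (Within R′ B′) (c-sym v x) (vs m)
        ; (there m) (there m′) ne → ls m m′ ne }
      extend : TwoColoured (v ∷ L) ⊎ Split (v ∷ L)
      extend with Any.any? (λ x → ¬? (within? R B (c v x))) L
      ... | no h = inj₁ (both (λ {y} m → case within? R B (c v y) of λ { (yes q) → q ; (no nq) → ⊥-elim (h (lose m nq)) }) two)
      ... | yes h with find h
      ...   | x , mx , nw with Any.any? (λ y → ¬? (c v y Fin.≟ c v x)) L
      ...     | yes h′ with find h′
      -- Inside `L` the vertex `y` sees only `R` and `B`, and its edge to `v` has another colour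
      -- than `c v x`; so `y` misses that colour.
      ...       | y , my , ny = inj₂ (isolate y v (c v x) (there my) (here refl) (≢-sym (v≢ my)) (here refl) (there mx) (≢-sym (v≢ mx)) refl λ
                      { (here refl) ne q → ny (trans (c-sym v y) q)
                      ; (there mz) ne q → nw (subst (Within R B) q (two my mz (≢-sym ne))) })
      extend | yes h | x , mx , nw | no h′ with edge-outside? (c v x) (c v x) L
      ...       | inj₂ mono = inj₁ (both (λ {y} m → inj₁ (same m)) mono)
        where
        same : ∀ {y} → y ∈ L → c v y ≡ c v x
        same {y} m with c v y Fin.≟ c v x
        ... | yes q = q
        ... | no nq = ⊥-elim (h′ (lose m nq))
      ...       | inj₁ (p , q , mp , mq , ne , nj) = inj₂ (isolate v x (c p q) (here refl) (there mx) (v≢ mx) (there mp) (there mq) ne refl λ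
                      { (here refl) d → ⊥-elim (d refl) ; (there mz) _ q′ → nj (inj₁ (trans (sym q′) (same mz))) })
        where
        same : ∀ {y} → y ∈ L → c v y ≡ c v x
        same {y} m with c v y Fin.≟ c v x
        ... | yes q = q
        ... | no nq = ⊥-elim (h′ (lose m nq))
    ... | inj₂ s = extend
      where
      L = w ∷ L₀
      open Split s renaming (colour to i)
      κ = comp i L
      open Components (components i L u) using (constant; edge)
      v≢ : ∀ {y} → y ∈ L → y ≢ v
      v≢ m refl = All.lookup v∉ m refl
      apart : κ a ≢ κ b
      apart e = case trans (sym a-in) (trans (con a∈) (trans (cong side e) (trans (sym (con b∈)) b-out))) of λ ()
        where
        con : ∀ {x} → x ∈ L → side x ≡ side (κ x)
        con = constant side λ {x} {y} mx my ne e → go x y mx my e (side x) (side y) refl refl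
          where
          go : ∀ x y → x ∈ L → y ∈ L → c x y ≡ i → ∀ s t → side x ≡ s → side y ≡ t → s ≡ t
          go x y mx my e true true _ _ = refl
          go x y mx my e false false _ _ = refl
          go x y mx my e true false p q = ⊥-elim (cut mx my p q e)
          go x y mx my e false true p q = ⊥-elim (cut my mx q p (trans (c-sym y x) e))
      far : ∀ {x y} → x ∈ L → y ∈ L → κ x ≢ κ y → c x y ≢ i
      far {x} {y} mx my ne e = ne (edge mx my (λ { refl → ne refl }) e)
      a≢b : a ≢ b
      a≢b refl = apart refl
      elsewhere : ∀ x → ∃ λ y → y ∈ L × κ y ≢ κ x
      elsewhere x with κ a Fin.≟ κ x
      ... | no ne = a , a∈ , ne
      ... | yes e = b , b∈ , λ q → apart (trans e (sym q))
      hom = homogeneous i L u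

      third : ∀ {x y} → x ∈ L → y ∈ L → κ x ≢ κ y → c v x ≢ i → c v y ≡ i → c x y ≡ c v x
      third {x} {y} mx my ne nx ey with no-rainbow (≢-sym (v≢ mx)) (λ { refl → ne refl }) (≢-sym (v≢ my)) (λ q → nx (trans q ey))
      ... | inj₁ q = q
      ... | inj₂ q = ⊥-elim (far mx my ne (trans q ey))

      extend : TwoColoured (v ∷ L) ⊎ Split (v ∷ L)
      extend with Any.any? (λ x → ¬? (touched? i v L κ x)) L
      ... | yes h with find h
      -- A component that `v` does not meet in colour `i` remains cut off.
      ...   | x , mx , nt = inj₂ record
              { colour = i ; side = inX ; a = x ; b = v ; a∈ = there mx ; b∈ = here refl ; a-in = x-in ; b-out = v-out
              ; cut = cut′ ; p∈ = there p∈ ; q∈ = there q∈ ; p≢q = p≢q ; used = used }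
        where
        inX : V → Bool
        inX z = if does (z Fin.≟ v) then false else does (κ z Fin.≟ κ x)
        v-out : inX v ≡ false
        v-out with v Fin.≟ v
        ... | yes _ = refl
        ... | no ne = ⊥-elim (ne refl)
        x-in : inX x ≡ true
        x-in with x Fin.≟ v
        ... | yes e = ⊥-elim (v≢ mx e)
        ... | no _ with κ x Fin.≟ κ x
        ...   | yes _ = refl
        ...   | no ne = ⊥-elim (ne refl)
        in⇒ : ∀ z → inX z ≡ true → κ z ≡ κ x
        in⇒ z h with z Fin.≟ v
        ... | no _ with κ z Fin.≟ κ x
        ...   | yes e = e
        out⇒ : ∀ {z} → z ∈ L → inX z ≡ false → κ z ≢ κ x
        out⇒ {z} m h e with z Fin.≟ v
        ... | yes q = v≢ m q
        ... | no _ with κ z Fin.≟ κ x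
        ...   | no ne = ne e
        cut′ : ∀ {y z} → y ∈ v ∷ L → z ∈ v ∷ L → inX y ≡ true → inX z ≡ false → c y z ≢ i
        cut′ (here refl) mz iy iz e = case trans (sym iy) v-out of λ ()
        cut′ {y} (there my) (here refl) iy iz e = nt (lose my (in⇒ y iy , trans (c-sym v y) e))
        cut′ {y} {z} (there my) (there mz) iy iz e = far my mz (λ q → out⇒ {z} mz iz (trans (sym q) (in⇒ y iy))) e
      extend | no allt with Any.any? (λ x → ¬? (c v x Fin.≟ i)) L
      -- Here all edges at `v` have colour `i`, while `a` and `b` lie in different components and
      -- are joined in another colour, which `v` misses.
      ...   | no h = inj₂ (isolate v a (c a b) (here refl) (there a∈) (v≢ a∈) (there a∈) (there b∈) a≢b refl λ
                { (here refl) d → ⊥-elim (d refl)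
                ; {y} (there my) _ q → case c v y Fin.≟ i of λ
                   { (yes e) → far a∈ b∈ apart (trans (sym q) e) ; (no ne) → h (lose my ne) } })
      ...   | yes h with find h
      ...     | x , mx , nx = finish (edge-outside? i j L)
        where
        j = c v x
        touch : ∀ {z} → z ∈ L → ∃ λ y → y ∈ L × κ y ≡ κ z × c v y ≡ i
        touch {z} mz with touched? i v L κ z
        ... | yes t = let (y , my , p) = find t in y , my , p
        ... | no nt = ⊥-elim (allt (lose mz nt))
        -- By `third` the colours of `v x` and `v z` reappear on edges from `x` and `z` to vertices
        -- of other components that `v` meets in `i`. If `x` and `z` lie in different components,
        -- both edges run between these two; otherwise both lead to one vertex elsewhere. Either way
        -- they belong to one pair of components, which is joined in a single colour.
        vs : ∀ {z} → z ∈ L → Within i j (c v z)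
        vs {z} mz with c v z Fin.≟ i
        ... | yes e = inj₁ e
        ... | no nz with κ x Fin.≟ κ z
        ...   | no d = inj₂ (trans (sym zy′) (trans (trans (c-sym z y′) (hom my′ mx mz e′ (λ q → d (trans (sym e′) q)))) (trans (c-sym x z)
                         (trans (sym (hom my mz mx e (λ q → d (sym (trans (sym e) q))))) (trans (c-sym y x) xy)))))
          where
          tz = touch mz
          y = proj₁ tz
          my = proj₁ (proj₂ tz)
          e = proj₁ (proj₂ (proj₂ tz))
          tx = touch mx
          y′ = proj₁ tx
          my′ = proj₁ (proj₂ tx)
          e′ = proj₁ (proj₂ (proj₂ tx))
          xy : c x y ≡ j
          xy = third mx my (λ q → d (trans q e)) nx (proj₂ (proj₂ (proj₂ tz)))
          zy′ : c z y′ ≡ c v z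
          zy′ = third mz my′ (λ q → d (sym (trans q e′))) nz (proj₂ (proj₂ (proj₂ tx)))
        ...   | yes s′ = inj₂ (trans (sym (third mz my (λ q → dw (trans (sym e) (trans (sym q) (sym s′)))) nz ey))
                           (trans (hom mz mx my (sym s′) (λ q → dw (trans (sym e) (trans (sym q) (sym s′))))) (third mx my (λ q → dw (trans (sym e) (sym q))) nx ey)))
          where
          w′ = proj₁ (elsewhere x)
          mw = proj₁ (proj₂ (elsewhere x))
          dw = proj₂ (proj₂ (elsewhere x))
          tw = touch mw
          y = proj₁ tw
          my = proj₁ (proj₂ tw)
          e = proj₁ (proj₂ (proj₂ tw))
          ey = proj₂ (proj₂ (proj₂ tw))
        finish : (∃ λ p → ∃ λ q → p ∈ L × q ∈ L × p ≢ q × ¬ Within i j (c p q)) ⊎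
                 (∀ {x y} → x ∈ L → y ∈ L → x ≢ y → Within i j (c x y)) → TwoColoured (v ∷ L) ⊎ Split (v ∷ L)
        finish (inj₂ two) = inj₁ (i , j , λ
          { (here refl) (here refl) ne → ⊥-elim (ne refl)
          ; (here refl) (there m) ne → vs m
          ; {z} (there m) (here refl) ne → subst (Within i j) (c-sym v z) (vs m)
          ; (there m) (there m′) ne → two m m′ ne })
        finish (inj₁ (p , q , mp , mq , ne , nw)) = inj₂ (isolate v x (c p q) (here refl) (there mx) (v≢ mx) (there mp) (there mq) ne refl λ
          { (here refl) d → ⊥-elim (d refl) ; (there mz) _ e → nw (subst (Within i j) e (vs mz)) })

    record Partition (L : List V) : Set where
      field
        label : V → V
        R B : Colour
        {a b} : V
        a∈ : a ∈ L
        b∈ : b ∈ L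
        a≁b : label a ≢ label b
        hom : ∀ {x x′ y} → x ∈ L → x′ ∈ L → y ∈ L → label x ≡ label x′ → label x ≢ label y → c x y ≡ c x′ y
        two : ∀ {x y} → x ∈ L → y ∈ L → label x ≢ label y → Within R B (c x y)

    -- Gallai's theorem: contract the components of a disconnected colour.
    partition-acc : ∀ L → Acc _<_ (length L) → Unique L → ∀ {a b} → a ∈ L → b ∈ L → a ≢ b → Partition L
    partition-acc (v ∷ L₀) (acc rec) u {a} {b} a∈ b∈ a≢b with dichotomy v L₀ u
    ... | inj₁ (R , B , two) = record
        { label = id ; R = R ; B = B ; a∈ = a∈ ; b∈ = b∈ ; a≁b = a≢b ; hom = λ { _ _ _ refl _ → refl } ; two = two }
    ... | inj₂ s = record
        { label = label ∘ κ ; R = R ; B = B ; a∈ = a₀∈ ; b∈ = b₀∈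
        ; a≁b = λ e → a≁b (trans (cong label (sym (rep a′∈))) (trans e (cong label (rep b′∈))))
        ; hom = λ {x} {x′} {y} mx mx′ my e ne → trans (contract mx my (λ q → ne (cong label q)))
            (trans (hom (reps mx) (reps mx′) (reps my) e ne) (sym (contract mx′ my (λ q → ne (trans e (cong label q))))))
        ; two = λ {x} {y} mx my ne → subst (Within R B) (sym (contract mx my (λ q → ne (cong label q)))) (two (reps mx) (reps my) ne) }
      where
      L = v ∷ L₀
      open Split s using () renaming (colour to i; a to p; b to q; a∈ to p∈; b∈ to q∈; a-in to p-in; b-out to q-out; side to side; cut to cut; p to r; q to t; p∈ to r∈; q∈ to t∈; p≢q to r≢t; used to rt)
      κ = comp i L
      open Components (components i L u)
      isRep? : ∀ x → Dec (κ x ≡ x)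
      isRep? x = κ x Fin.≟ x
      L′ = filter isRep? L
      rep : ∀ {x} → x ∈ L′ → κ x ≡ x
      rep m = proj₂ (∈-filter⁻ isRep? {xs = L} m)
      reps : ∀ {x} → x ∈ L → κ x ∈ L′
      reps m = ∈-filter⁺ isRep? (inside m) (idem m)
      con : ∀ {x} → x ∈ L → side x ≡ side (κ x)
      con = constant side λ {x} {y} mx my ne e → go x y mx my e (side x) (side y) refl refl
        where
        go : ∀ x y → x ∈ L → y ∈ L → c x y ≡ i → ∀ s t → side x ≡ s → side y ≡ t → s ≡ t
        go x y mx my e true true _ _ = refl
        go x y mx my e false false _ _ = refl
        go x y mx my e true false p q = ⊥-elim (cut mx my p q e)
        go x y mx my e false true p q = ⊥-elim (cut my mx q p (trans (c-sym y x) e))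
      apart : κ p ≢ κ q
      apart e = case trans (sym p-in) (trans (con p∈) (trans (cong side e) (trans (sym (con q∈)) q-out))) of λ ()
      smaller : length L′ < length L
      smaller = filter-notAll isRep? L missing
        where
        missing : Any (λ x → ¬ κ x ≡ x) L
        missing with isRep? r | isRep? t
        ... | no d | _ = lose r∈ d
        ... | yes _ | no d = lose t∈ d
        ... | yes d | yes d′ = ⊥-elim (r≢t (trans (sym d) (trans (edge r∈ t∈ r≢t rt) d′)))
      ih : Partition L′
      ih = partition-acc L′ (rec smaller) (Uniq.filter⁺ isRep? u) (reps p∈) (reps q∈) apart
        where import Data.List.Relation.Unary.Unique.Propositional.Properties as Uniq
      open Partition ih using (label; R; B; hom; two; a≁b) renaming (a to a₀; b to b₀; a∈ to a′∈; b∈ to b′∈)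
      a₀∈ : a₀ ∈ L
      a₀∈ = proj₁ (∈-filter⁻ isRep? {xs = L} a′∈)
      b₀∈ : b₀ ∈ L
      b₀∈ = proj₁ (∈-filter⁻ isRep? {xs = L} b′∈)
      contract : ∀ {x y} → x ∈ L → y ∈ L → κ x ≢ κ y → c x y ≡ c (κ x) (κ y)
      contract {x} {y} mx my ne = trans (homogeneous i L u mx (inside mx) my (sym (idem mx)) ne)
        (trans (c-sym (κ x) y) (trans (homogeneous i L u my (inside my) (inside mx) (sym (idem my)) (λ q → ne (sym (trans q (idem mx)))))
          (c-sym (κ y) (κ x))))

-- States of a colour and counts of missing pairs.

module States where
  open import Data.Nat using (ℕ; zero; suc; _≤_; z≤n; _+_; s≤s⁻¹)
  open import Data.Nat.Properties
  open import Data.Bool using (Bool; true; false; _∧_)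
  open import Data.List hiding (sum; find)
  open import Data.List.Properties
  open import Data.List.Relation.Unary.All using (All; []; _∷_)
  open import Data.List.Relation.Unary.AllPairs using ([]; _∷_)
  open import Data.List.Relation.Binary.Sublist.Propositional using (_⊆_; []; _∷_; ⊆-refl; minimum) renaming (_∷ʳ_ to omit)
  open import Data.List.Membership.Propositional.Properties
  open import Data.Product using (∃; _×_; _,_)
  open import Data.Empty using (⊥)
  open import Relation.Nullary
  open import Relation.Binary.PropositionalEquality hiding ([_])
  open Search
  open SmallRamseyNumbers
  open NoColouring22 using (lack-0)

  -- E₃, E₂, E₁ exclude J₅, J₄, J₃; T and O exclude triangles and edges.
  data State : Set where
    O E₁ T E₂ E₃ : State

  order gaps : State → ℕ
  order O = 2
  order E₁ = 3
  order T = 3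
  order E₂ = 4
  order E₃ = 5
  gaps O = 0
  gaps E₁ = 1
  gaps T = 0
  gaps E₂ = 1
  gaps E₃ = 1

  lack-⊆ : ∀ {X : Set} (f : X → X → Bool) x {C D} → D ⊆ C → lack f x D ≤ lack f x C
  lack-⊆ f x [] = z≤n
  lack-⊆ f x (omit y s) = ≤-trans (lack-⊆ f x s) (m≤n+m _ (pen (f x y)))
  lack-⊆ f x (refl ∷ s) = +-monoʳ-≤ _ (lack-⊆ f x s)

  -- Deleting an end of the missing edge.
  shrink-list : ∀ {X : Set} (f : X → X → Bool) C → miss f C ≤ 1 → ∀ {s} → length C ≡ suc s → ∃ λ D → D ⊆ C × length D ≡ s × miss f D ≡ 0
  shrink-list f (x ∷ []) m refl = [] , minimum _ , refl , refl
  shrink-list f (x ∷ C@(_ ∷ _)) m {suc s} l with lack f x C in eq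
  ... | suc a = C , omit x ⊆-refl , suc-injective l , n≤0⇒n≡0 (≤-trans (m≤n+m _ a) (s≤s⁻¹ m))
  ... | zero with shrink-list f C m {s} (suc-injective l)
  ...   | D , i , l′ , m′ = x ∷ D , refl ∷ i , cong suc l′ ,
          cong₂ _+_ (n≤0⇒n≡0 (≤-trans (lack-⊆ f x i) (≤-reflexive eq))) m′

  lack-++ : ∀ {X : Set} (f : X → X → Bool) x C D → lack f x (C ++ D) ≡ lack f x C + lack f x D
  lack-++ f x [] D = refl
  lack-++ f x (y ∷ C) D = trans (cong (pen (f x y) +_) (lack-++ f x C D)) (sym (+-assoc (pen (f x y)) _ _))

  miss-++ : ∀ {X : Set} (f : X → X → Bool) C D → All (λ x → All (λ y → f x y ≡ true) D) C → miss f (C ++ D) ≡ miss f C + miss f D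
  miss-++ f [] D [] = refl
  miss-++ f (x ∷ C) D (p ∷ ps) = trans (cong₂ _+_ (trans (lack-++ f x C D) (trans (cong (lack f x C +_) (lack-0 f x D p)) (+-identityʳ _))) (miss-++ f C D ps))
    (sym (+-assoc (lack f x C) _ _))

  ∧-intro : ∀ {a b} → a ≡ true → b ≡ true → a ∧ b ≡ true
  ∧-intro refl refl = refl

  true≢false : ∀ {b : Bool} → b ≡ true → b ≡ false → ⊥
  true≢false refl ()

module ListLemmas where
  open import Data.Nat using (zero; suc; _+_)
  open import Data.Nat.Properties
  open import Data.Bool using (Bool)
  open import Data.Fin using (Fin)
  import Data.Fin as Fin
  open import Data.List hiding (sum; find)
  open import Data.List.Properties
  open import Data.List.Relation.Unary.All using (All; []; _∷_)
  import Data.List.Relation.Unary.All as All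
  open import Data.List.Relation.Unary.AllPairs using ([]; _∷_)
  open import Data.List.Relation.Unary.Unique.Propositional using (Unique)
  open import Data.List.Membership.Propositional.Properties
  open import Data.Empty using (⊥-elim)
  open import Relation.Nullary
  open import Relation.Binary.PropositionalEquality hiding ([_])
  open Search
  open SmallRamseyNumbers
  open NoColouring22
  open States

  lack-cong′ : ∀ {X : Set} {P : X → Set} {g h : X → X → Bool} {x} C → P x → All P C → All (x ≢_) C →
               (∀ {x y} → P x → P y → x ≢ y → g x y ≡ h x y) → lack g x C ≡ lack h x C
  lack-cong′ [] px [] [] p = refl
  lack-cong′ (y ∷ C) px (py ∷ pc) (n ∷ ns) p = cong₂ _+_ (cong pen (p px py n)) (lack-cong′ C px pc ns p)

  miss-cong′ : ∀ {X : Set} {P : X → Set} {g h : X → X → Bool} C → Unique C → All P C →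
               (∀ {x y} → P x → P y → x ≢ y → g x y ≡ h x y) → miss g C ≡ miss h C
  miss-cong′ [] [] [] p = refl
  miss-cong′ (x ∷ C) (n ∷ u) (px ∷ pc) p = cong₂ _+_ (lack-cong′ C px pc n p) (miss-cong′ C u pc p)

  lookup-injective : ∀ {X : Set} {L : List X} → Unique L → ∀ i j → lookup L i ≡ lookup L j → i ≡ j
  lookup-injective (n ∷ u) Fin.zero Fin.zero e = refl
  lookup-injective (n ∷ u) Fin.zero (Fin.suc j) e = ⊥-elim (All.lookup n (∈-lookup j) e)
  lookup-injective (n ∷ u) (Fin.suc i) Fin.zero e = ⊥-elim (All.lookup n (∈-lookup i) (sym e))
  lookup-injective (n ∷ u) (Fin.suc i) (Fin.suc j) e = cong Fin.suc (lookup-injective u i j e)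

  lack-map : ∀ {X Y : Set} (f : X → Y) (g : Y → Y → Bool) x C → lack g (f x) (map f C) ≡ lack (λ a b → g (f a) (f b)) x C
  lack-map f g x [] = refl
  lack-map f g x (y ∷ C) = cong (pen (g (f x) (f y)) +_) (lack-map f g x C)

  miss-map : ∀ {X Y : Set} (f : X → Y) (g : Y → Y → Bool) C → miss g (map f C) ≡ miss (λ a b → g (f a) (f b)) C
  miss-map f g [] = refl
  miss-map f g (x ∷ C) = cong₂ _+_ (lack-map f g x C) (miss-map f g C)

module ClassSizes where
  open import Data.Nat using (ℕ; _≤_; z≤n; s≤s; _+_; _*_)
  open import Data.Nat.Properties
  open import Data.Nat.Tactic.RingSolver using (solve-∀)
  open import Relation.Nullary
  open import Relation.Binary.PropositionalEquality hiding ([_])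
  open States
  open ListLemmas

  -- `x₀` will bound a class without edges of the two colours between classes; `x₁` is the bound
  -- when these colours are merely without J₃.
  record Sizes (x₀ x₁ : ℕ) : Set where
    field
      two≤ : 2 ≤ x₀
      lower : x₀ ≤ x₁
      upper : x₁ ≤ x₀ + x₀

    one≤ : 1 ≤ x₀
    one≤ = ≤-trans (s≤s z≤n) two≤

    three : 3 * x₀ ≡ x₀ + x₀ + x₀
    three = eq x₀
      where
      eq : ∀ x → 3 * x ≡ x + x + x
      eq = solve-∀

    plus-one : x₁ + 1 ≤ 3 * x₀
    plus-one = ≤-trans (+-mono-≤ upper one≤) (≤-reflexive (sym three))

module Filters where
  open import Data.Nat using (_≤_; z≤n; s≤s; _+_)
  open import Data.Nat.Properties
  open import Data.Bool using (Bool; true; false)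
  open import Data.List using ([]; _∷_; filterᵇ)
  open import Data.List.Relation.Unary.All using (All; []; _∷_)
  import Data.List.Relation.Unary.All as All
  open import Data.List.Relation.Unary.Any using (here; there)
  open import Data.List.Relation.Unary.AllPairs using ([]; _∷_)
  open import Data.List.Relation.Unary.Unique.Propositional using (Unique)
  open import Data.List.Membership.Propositional using (_∈_)
  open import Function using (_∘_)
  open import Relation.Nullary
  open import Relation.Binary.PropositionalEquality hiding ([_])
  open Search using (lack; pen)
  open NoColouring22 using (lack-0)
  open States
  open ListLemmas
  open ClassSizes

  lack-≤1 : ∀ {X : Set} (f : X → X → Bool) w z C → Unique C → (∀ {y} → y ∈ C → y ≢ z → f w y ≡ true) → Dec (z ∈ C) → lack f w C ≤ 1
  lack-≤1 f w z C u h (no z∉) = ≤-trans (≤-reflexive (lack-0 f w C (All.tabulate λ {y} m → h m λ { refl → z∉ m }))) z≤n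
  lack-≤1 f w z (_ ∷ C) (n ∷ u) h (yes (here refl)) =
    ≤-trans (+-monoʳ-≤ (pen (f w z)) (≤-reflexive (lack-0 f w C (All.tabulate λ {y} m → h (there m) λ { refl → All.lookup n m refl })))) (bound (f w z))
    where
    bound : ∀ b → pen b + 0 ≤ 1
    bound true = z≤n
    bound false = s≤s z≤n
  lack-≤1 f w z (x ∷ C) (n ∷ u) h (yes (there m)) rewrite h (here refl) (λ { refl → All.lookup n m refl }) = lack-≤1 f w z C u (h ∘ there) (yes m)

  filterᵇ-cong : ∀ {X : Set} {p q : X → Bool} → (∀ x → p x ≡ q x) → ∀ xs → filterᵇ p xs ≡ filterᵇ q xs
  filterᵇ-cong h [] = refl
  filterᵇ-cong {p = p} {q} h (x ∷ xs) with p x | q x | h x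
  ... | true | _ | refl = cong (x ∷_) (filterᵇ-cong h xs)
  ... | false | _ | refl = filterᵇ-cong h xs

-- The table of bounds and its linear inequalities.

module Beta where
  open import Data.Nat using (ℕ; zero; suc; _≤_; _<_; z≤n; s≤s; _+_; _*_; _^_; _≤ᵇ_; >-nonZero)
  open import Data.Nat.Properties
  open import Data.Nat.Tactic.RingSolver using (solve-∀)
  open import Data.Bool using (Bool; true; false; _∧_)
  open import Data.Product using (_×_; _,_; proj₁; proj₂)
  open import Data.Empty using (⊥-elim)
  open import Relation.Binary.PropositionalEquality
  open Search using (∧-true)
  open Extension using (≤ᵇ-true)
  open ClassSizes using (Sizes)

  double : ℕ → ℕ
  double zero = 0
  double (suc j) = suc (suc (double j))

  -- The extremal sizes for m colours in state E₃, at most one in state T (flag τ) and some in state E₁ (flag ε); a colour in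
  -- state E₂ costs a factor 3.
  u : ℕ → Bool → Bool → ℕ
  u 0 false false = 1
  u 0 false true = 2
  u 0 true false = 2
  u 0 true true = 4
  u 1 false false = 4
  u 1 false true = 7
  u 1 true false = 11
  u 1 true true = 21
  u 2 false false = 21
  u 2 false true = 34
  u 2 true false = 47
  u 2 true true = 85
  u 3 false false = 68
  u 3 false true = 119
  u 3 true false = 195
  u 3 true true = 357
  u (suc (suc m@(suc (suc _)))) τ ε = 17 * u m τ ε

  β : ℕ → ℕ → Bool → Bool → ℕ
  β m a τ ε = 3 ^ a * u m τ ε

  -- Since u is multiplied by 17 every two steps, linear inequalities need only be checked for m ≤ 3.
  module Rule (p q k δ c : ℕ) (τ₁ ε₁ τ₂ ε₂ τ ε : Bool) where

    left : ℕ → ℕ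
    left m = p * u m τ₁ ε₁ + q * u m τ₂ ε₂ + k

    check : ℕ → Bool
    check m = left m ≤ᵇ c * u (m + δ) τ ε

    checks : Bool
    checks = check 0 ∧ check 1 ∧ check 2 ∧ check 3

    factor : ∀ p q k t a b → p * (t * a) + q * (t * b) + t * k ≡ t * (p * a + q * b + k)
    factor = solve-∀

    swap : ∀ t c x → t * (c * x) ≡ c * (t * x)
    swap = solve-∀

    level : checks ≡ true → ∀ m → left m ≤ c * u (m + δ) τ ε
    level h 0 = ≤ᵇ-true _ _ (proj₁ (∧-true h))
    level h 1 = ≤ᵇ-true _ _ (proj₁ (∧-true (proj₂ (∧-true {check 0} h))))
    level h 2 = ≤ᵇ-true _ _ (proj₁ (∧-true (proj₂ (∧-true {check 1} (proj₂ (∧-true {check 0} h))))))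
    level h 3 = ≤ᵇ-true _ _ (proj₂ (∧-true {check 2} (proj₂ (∧-true {check 1} (proj₂ (∧-true {check 0} h))))))
    level h (suc (suc m@(suc (suc _)))) = begin
      p * (17 * u m τ₁ ε₁) + q * (17 * u m τ₂ ε₂) + k ≤⟨ +-monoʳ-≤ (p * (17 * u m τ₁ ε₁) + q * (17 * u m τ₂ ε₂)) (m≤m+n k (16 * k)) ⟩
      p * (17 * u m τ₁ ε₁) + q * (17 * u m τ₂ ε₂) + 17 * k ≡⟨ factor p q k 17 (u m τ₁ ε₁) (u m τ₂ ε₂) ⟩
      17 * left m ≤⟨ *-monoʳ-≤ 17 (level h m) ⟩
      17 * (c * u (m + δ) τ ε) ≡⟨ swap 17 c (u (m + δ) τ ε) ⟩
      c * (17 * u (m + δ) τ ε) ∎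
      where open ≤-Reasoning

    rule : checks ≡ true → ∀ a m → p * β m a τ₁ ε₁ + q * β m a τ₂ ε₂ + k ≤ c * β (m + δ) a τ ε
    rule h a m = begin
      p * (t * u m τ₁ ε₁) + q * (t * u m τ₂ ε₂) + k ≤⟨ +-monoʳ-≤ (p * (t * u m τ₁ ε₁) + q * (t * u m τ₂ ε₂)) (m≤n*m k t ⦃ >-nonZero (m^n>0 3 a) ⦄) ⟩
      p * (t * u m τ₁ ε₁) + q * (t * u m τ₂ ε₂) + t * k ≡⟨ factor p q k t (u m τ₁ ε₁) (u m τ₂ ε₂) ⟩
      t * left m ≤⟨ *-monoʳ-≤ t (level h m) ⟩
      t * (c * u (m + δ) τ ε) ≡⟨ swap t c (u (m + δ) τ ε) ⟩
      c * β (m + δ) a τ ε ∎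
      where
      open ≤-Reasoning
      t = 3 ^ a

  open Rule using (checks; rule) public

  -- The coefficients of β m a τ ε and β m a τ true on the left and of β (m + δ) a τ′ ε on the right.
  module Flagged (p q k δ c : ℕ) (f g : Bool → Bool) where
    flagged : checks p q k δ c (f false) false (f false) true (g false) false ≡ true → checks p q k δ c (f false) true (f false) true (g false) true ≡ true →
              checks p q k δ c (f true) false (f true) true (g true) false ≡ true → checks p q k δ c (f true) true (f true) true (g true) true ≡ true →
              ∀ τ ε a m → p * β m a (f τ) ε + q * β m a (f τ) true + k ≤ c * β (m + δ) a (g τ) ε
    flagged h₁ h₂ h₃ h₄ false false = rule p q k δ c _ _ _ _ _ _ h₁
    flagged h₁ h₂ h₃ h₄ false true = rule p q k δ c _ _ _ _ _ _ h₂
    flagged h₁ h₂ h₃ h₄ true false = rule p q k δ c _ _ _ _ _ _ h₃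
    flagged h₁ h₂ h₃ h₄ true true = rule p q k δ c _ _ _ _ _ _ h₄

  open Flagged using (flagged) public

  β-sizes : ∀ τ ε a m → 2 ≤ β m a τ ε → Sizes (β m a τ ε) (β m a τ true)
  β-sizes τ ε a m h = record
    { two≤ = h
    ; lower = ≤-trans (≤-reflexive (cong (λ z → β z a τ ε) (sym (+-identityʳ m)))) (up τ ε)
    ; upper = ≤-trans (≤-reflexive (e₃ (β m a τ ε) (β m a τ true))) (≤-trans (flagged 0 1 0 0 2 (λ t → t) (λ t → t) refl refl refl refl τ ε a m) (≤-reflexive (trans (cong (λ z → 2 * β z a τ ε) (+-identityʳ m)) (e₄ (β m a τ ε))))) }
    where
    e₁ : ∀ x y → x ≡ 1 * x + 0 * y + 0
    e₁ = solve-∀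
    e₂ : ∀ x → 1 * x ≡ x
    e₂ = solve-∀
    e₃ : ∀ x y → y ≡ 0 * x + 1 * y + 0
    e₃ = solve-∀
    e₄ : ∀ x → 2 * x ≡ x + x
    e₄ = solve-∀
    up : ∀ τ ε → β (m + 0) a τ ε ≤ β m a τ true
    up τ ε rewrite +-identityʳ m = ≤-trans (≤-reflexive (e₁ (β m a τ ε) (β m a τ true))) (≤-trans (mono τ ε) (≤-reflexive (trans (cong (λ z → 1 * β z a τ true) (+-identityʳ m)) (e₂ _))))
      where
      mono : ∀ τ ε → 1 * β m a τ ε + 0 * β m a τ true + 0 ≤ 1 * β (m + 0) a τ true
      mono false false = rule 1 0 0 0 1 false false false true false true refl a m
      mono false true = rule 1 0 0 0 1 false true false true false true refl a m
      mono true false = rule 1 0 0 0 1 true false true true true true refl a m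
      mono true true = rule 1 0 0 0 1 true true true true true true refl a m

  β≥1 : ∀ m a τ ε → 1 ≤ β m a τ ε
  β≥1 m a τ ε = ≤-trans (≤-trans (m≤n+m 1 (0 * β m a τ ε + 0 * β m a τ true)) (flagged 0 0 1 0 1 (λ t → t) (λ t → t) refl refl refl refl τ ε a m))
    (≤-reflexive (trans (*-identityˡ _) (cong (λ z → β z a τ ε) (+-identityʳ m))))

  -- This separates sets carrying only two colours, which the Ramsey numbers bound directly, from
  -- the general case, whose estimates absorb constants by means of `2 ≤ x₀`.
  β≡1 : ∀ m a τ ε → β m a τ ε < 2 → m ≡ 0 × a ≡ 0 × τ ≡ false × ε ≡ false
  β≡1 m (suc a) τ ε h = ⊥-elim (<⇒≱ h (≤-trans (n≤1+n 2)
    (≤-trans (*-monoʳ-≤ 3 (β≥1 m a τ ε)) (≤-reflexive (sym (*-assoc 3 (3 ^ a) _))))))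
  β≡1 m zero τ ε h = go m τ ε (≤-trans (≤-reflexive (cong suc (sym (*-identityˡ (u m τ ε))))) h)
    where
    big : ∀ m τ ε → 2 ≤ u (2 + m) τ ε
    big 0 false false = s≤s (s≤s z≤n)
    big 0 false true = s≤s (s≤s z≤n)
    big 0 true false = s≤s (s≤s z≤n)
    big 0 true true = s≤s (s≤s z≤n)
    big 1 false false = s≤s (s≤s z≤n)
    big 1 false true = s≤s (s≤s z≤n)
    big 1 true false = s≤s (s≤s z≤n)
    big 1 true true = s≤s (s≤s z≤n)
    big (suc (suc m)) τ ε = ≤-trans (big m τ ε) (m≤m+n _ _)
    go : ∀ m τ ε → u m τ ε < 2 → m ≡ 0 × 0 ≡ 0 × τ ≡ false × ε ≡ false
    go 0 false false h = refl , refl , refl , refl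
    go 0 false true (s≤s (s≤s ()))
    go 0 true false (s≤s (s≤s ()))
    go 0 true true (s≤s (s≤s ()))
    go 1 false false (s≤s (s≤s ()))
    go 1 false true (s≤s (s≤s ()))
    go 1 true false (s≤s (s≤s ()))
    go 1 true true (s≤s (s≤s ()))
    go (suc (suc m)) τ ε h = ⊥-elim (<⇒≱ h (big m τ ε))

-- Inequalities for joins and prime partitions; profiles of assignments.

module Profiles where
  open import Data.Nat using (ℕ; suc; _≤_; _+_; _*_; _^_; _⊔_)
  open import Data.Nat.Properties
  open import Data.Nat.Tactic.RingSolver using (solve-∀)
  open import Data.Bool using (Bool; true; false; if_then_else_)
  open import Data.Fin using (Fin)
  import Data.Fin as Fin
  open import Data.List using ([]; _∷_; allFin)
  open import Data.List.Relation.Unary.All using (All; []; _∷_)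
  import Data.List.Relation.Unary.All as All
  open import Data.List.Relation.Unary.Any using (here; there)
  open import Data.List.Relation.Unary.AllPairs using ([]; _∷_)
  open import Data.List.Relation.Unary.Unique.Propositional using (Unique)
  import Data.List.Relation.Unary.Unique.Propositional.Properties as Uniq
  open import Data.List.Membership.Propositional using (_∈_)
  open import Data.List.Membership.Propositional.Properties using (∈-allFin)
  open import Data.Product using (∃; _×_; _,_; proj₁; proj₂)
  open import Data.Empty using (⊥-elim)
  open import Function using (_∘_; case_of_)
  open import Relation.Nullary
  open import Relation.Nullary.Decidable using (dec-true; dec-false)
  open import Relation.Binary.PropositionalEquality hiding ([_])
  open Search using (bit; cnt)
  open States
  open Filters
  open GallaiPartitions
  open Beta

  Flag : Set
  Flag = Bool → Bool

  keep-flag : Flag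
  keep-flag t = t

  fact : ∀ p q k δ (f g : Flag) →
    checks p q k δ 1 (f false) false (f false) true (g false) false ≡ true → checks p q k δ 1 (f false) true (f false) true (g false) true ≡ true →
    checks p q k δ 1 (f true) false (f true) true (g true) false ≡ true → checks p q k δ 1 (f true) true (f true) true (g true) true ≡ true →
    ∀ τ ε a m → p * β m a (f τ) ε + q * β m a (f τ) true + k ≤ β (δ + m) a (g τ) ε
  fact p q k δ f g h₁ h₂ h₃ h₄ τ ε a m = ≤-trans (flagged p q k δ 1 f g h₁ h₂ h₃ h₄ τ ε a m)
    (≤-reflexive (trans (*-identityˡ _) (cong (λ z → β z a (g τ) ε) (+-comm m δ))))

  β-suc : ∀ m a τ ε → 3 * β m a τ ε ≡ β m (suc a) τ ε
  β-suc m a τ ε = sym (*-assoc 3 (3 ^ a) (u m τ ε))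

  fact₃ : ∀ p q k δ (f g : Flag) →
    checks p q k δ 3 (f false) false (f false) true (g false) false ≡ true → checks p q k δ 3 (f false) true (f false) true (g false) true ≡ true →
    checks p q k δ 3 (f true) false (f true) true (g true) false ≡ true → checks p q k δ 3 (f true) true (f true) true (g true) true ≡ true →
    ∀ τ ε a m → p * β m a (f τ) ε + q * β m a (f τ) true + k ≤ β (δ + m) (suc a) (g τ) ε
  fact₃ p q k δ f g h₁ h₂ h₃ h₄ τ ε a m = ≤-trans (flagged p q k δ 3 f g h₁ h₂ h₃ h₄ τ ε a m)
    (≤-reflexive (trans (β-suc (m + δ) a (g τ) ε) (cong (λ z → β z (suc a) (g τ) ε) (+-comm m δ))))

  off on : Flag
  off _ = false
  on _ = true

  -- The names list the state of the joining colour in the whole set and then in the two sides; `1`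
  -- stands for a side with a single vertex.
  E₃-E₂O : ∀ ε a m → 3 * β m a true ε + β m a true ε ≤ β (suc m) a true ε
  E₃-E₂O ε a m = ≤-trans (≤-reflexive (eq (β m a true ε) (β m a true true))) (fact 4 0 0 1 on on refl refl refl refl true ε a m)
    where
    eq : ∀ x y → 3 * x + x ≡ 4 * x + 0 * y + 0
    eq = solve-∀

  E₃-E₁E₁ : ∀ τ ε a m → β m a τ true + β m a τ true ≤ β (suc m) a τ ε
  E₃-E₁E₁ τ ε a m = ≤-trans (≤-reflexive (eq (β m a τ ε) (β m a τ true))) (fact 0 2 0 1 keep-flag keep-flag refl refl refl refl τ ε a m)
    where
    eq : ∀ x y → y + y ≡ 0 * x + 2 * y + 0
    eq = solve-∀

  E₃-E₂1 : ∀ ε a m → 3 * β m a false ε + 1 ≤ β (suc m) a false ε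
  E₃-E₂1 ε a m = ≤-trans (≤-reflexive (eq (β m a false ε) (β m a false true))) (fact 3 0 1 1 off off refl refl refl refl false ε a m)
    where
    eq : ∀ x y → 3 * x + 1 ≡ 3 * x + 0 * y + 1
    eq = solve-∀

  -- Sharp in the table: 47 + 21 = 68, and 85 + 34 = 119 when colours without J₃ occur.
  E₃-TO : ∀ ε a m → β m a true ε + β m a false ε ≤ β (suc m) a false ε
  E₃-TO ε a m = ≤-trans (≤-reflexive (eq (β m a true ε) (β m a false ε))) (≤-trans (cases ε) (≤-reflexive (trans (*-identityˡ _) (cong (λ z → β z a false ε) (+-comm m 1)))))
    where
    eq : ∀ x y → x + y ≡ 1 * x + 1 * y + 0
    eq = solve-∀
    cases : ∀ ε → 1 * β m a true ε + 1 * β m a false ε + 0 ≤ 1 * β (m + 1) a false ε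
    cases false = rule 1 1 0 1 1 true false false false false false refl a m
    cases true = rule 1 1 0 1 1 true true false true false true refl a m

  E₂-E₁1 : ∀ τ ε a m → β m a τ true + 1 ≤ β m (suc a) τ ε
  E₂-E₁1 τ ε a m = ≤-trans (≤-reflexive (eq (β m a τ ε) (β m a τ true))) (fact₃ 0 1 1 0 keep-flag keep-flag refl refl refl refl τ ε a m)
    where
    eq : ∀ x y → y + 1 ≡ 0 * x + 1 * y + 1
    eq = solve-∀

  T-OO : ∀ ε a m → β m a false ε + β m a false ε ≤ β m a true ε
  T-OO ε a m = ≤-trans (≤-reflexive (eq (β m a false ε) (β m a false true))) (fact 2 0 0 0 off on refl refl refl refl true ε a m)
    where
    eq : ∀ x y → x + x ≡ 2 * x + 0 * y + 0
    eq = solve-∀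

  trim : ∀ {x y} → x + 0 ≤ y → x ≤ y
  trim {x} h = ≤-trans (≤-reflexive (sym (+-identityʳ x))) h

  -- The seven linear forms result from the cases of a prime partition with both colours in state
  -- E₃, after all maxima have been expanded. From `m` = 2 on the first one is an equality by the
  -- definition of `u`.
  prime-33 : ∀ τ ε a m → let x = β m a τ ε ; y = β m a τ true ; Y = β (2 + m) a τ ε in
    (17 * x + 0 * y ≤ Y) × (0 * x + 9 * y ≤ Y) × (4 * x + 7 * y ≤ Y) × (11 * x + 3 * y ≤ Y) × (12 * x + 2 * y ≤ Y) × (7 * x + 5 * y ≤ Y) × (9 * x + 4 * y ≤ Y)
  prime-33 τ ε a m =
      trim (fact 17 0 0 2 keep-flag keep-flag refl refl refl refl τ ε a m)
    , trim (fact 0 9 0 2 keep-flag keep-flag refl refl refl refl τ ε a m)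
    , trim (fact 4 7 0 2 keep-flag keep-flag refl refl refl refl τ ε a m)
    , trim (fact 11 3 0 2 keep-flag keep-flag refl refl refl refl τ ε a m)
    , trim (fact 12 2 0 2 keep-flag keep-flag refl refl refl refl τ ε a m)
    , trim (fact 7 5 0 2 keep-flag keep-flag refl refl refl refl τ ε a m)
    , trim (fact 9 4 0 2 keep-flag keep-flag refl refl refl refl τ ε a m)

  prime-23 : ∀ τ ε a m → 9 * β m a τ ε ⊔ (3 * β m a τ true + 4 * β m a τ ε) ≤ β (suc m) (suc a) τ ε
  prime-23 τ ε a m = ⊔-lub
    (≤-trans (≤-reflexive (eq (β m a τ ε) (β m a τ true))) (fact₃ 9 0 0 1 keep-flag keep-flag refl refl refl refl τ ε a m))
    (≤-trans (≤-reflexive (eq′ (β m a τ ε) (β m a τ true))) (fact₃ 4 3 0 1 keep-flag keep-flag refl refl refl refl τ ε a m))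
    where
    eq : ∀ x y → 9 * x ≡ 9 * x + 0 * y + 0
    eq = solve-∀
    eq′ : ∀ x y → 3 * y + 4 * x ≡ 4 * x + 3 * y + 0
    eq′ = solve-∀

  prime-T3 : ∀ ε a m → 9 * β m a false ε ⊔ (3 * β m a false true + 4 * β m a false ε) ≤ β (suc m) a true ε
  prime-T3 ε a m = ⊔-lub
    (≤-trans (≤-reflexive (eq (β m a false ε) (β m a false true))) (fact 9 0 0 1 off on refl refl refl refl true ε a m))
    (≤-trans (≤-reflexive (eq′ (β m a false ε) (β m a false true))) (fact 4 3 0 1 off on refl refl refl refl true ε a m))
    where
    eq : ∀ x y → 9 * x ≡ 9 * x + 0 * y + 0
    eq = solve-∀
    eq′ : ∀ x y → 3 * y + 4 * x ≡ 4 * x + 3 * y + 0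
    eq′ = solve-∀

  prime-T2 : ∀ ε a m → 6 * β m a false ε ≤ β m (suc a) true ε
  prime-T2 ε a m = ≤-trans (≤-reflexive (eq (β m a false ε) (β m a false true))) (fact₃ 6 0 0 0 off on refl refl refl refl true ε a m)
    where
    eq : ∀ x y → 6 * x ≡ 6 * x + 0 * y + 0
    eq = solve-∀

  isE₃ isE₂ isT : State → Bool
  isE₃ E₃ = true
  isE₃ _ = false
  isE₂ E₂ = true
  isE₂ _ = false
  isT T = true
  isT _ = false

  module Assignments {k : ℕ} where

    Assignment : Set
    Assignment = Fin k → State

    _[_≔_] : Assignment → Fin k → State → Assignment
    (σ [ i ≔ s ]) j = if does (j Fin.≟ i) then s else σ j

    at-same : ∀ σ i s → (σ [ i ≔ s ]) i ≡ s
    at-same σ i s = cong (λ b → if b then s else σ i) (dec-true (i Fin.≟ i) refl)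

    at-other : ∀ σ {i j} s → j ≢ i → (σ [ i ≔ s ]) j ≡ σ j
    at-other σ {i} {j} s ne = cong (λ b → if b then s else σ j) (dec-false (j Fin.≟ i) ne)

    count : (State → Bool) → Assignment → ℕ
    count f σ = cnt (f ∘ σ) (allFin k)

    count-update : ∀ f σ i s → count f (σ [ i ≔ s ]) + bit (f (σ i)) ≡ count f σ + bit (f s)
    count-update f σ i s = go (allFin k) (Uniq.allFin⁺ k) (∈-allFin i)
      where
      σ′ = σ [ i ≔ s ]
      same : ∀ xs → All (i ≢_) xs → cnt (f ∘ σ′) xs ≡ cnt (f ∘ σ) xs
      same [] [] = refl
      same (x ∷ xs) (ne ∷ ns) = cong₂ _+_ (cong (bit ∘ f) (at-other σ s (≢-sym ne))) (same xs ns)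
      rot : ∀ a b c → a + b + c ≡ c + b + a
      rot = solve-∀
      go : ∀ xs → Unique xs → i ∈ xs → cnt (f ∘ σ′) xs + bit (f (σ i)) ≡ cnt (f ∘ σ) xs + bit (f s)
      go (x ∷ xs) (n ∷ _) (here refl) = trans (cong₂ (λ a b → a + b + bit (f (σ i))) (cong (bit ∘ f) (at-same σ i s)) (same xs n)) (rot (bit (f s)) (cnt (f ∘ σ) xs) (bit (f (σ i))))
      go (x ∷ xs) (n ∷ un) (there m) = trans (+-assoc (bit (f (σ′ x))) _ _) (trans (cong₂ _+_ (cong (bit ∘ f) (at-other σ s (All.lookup n m))) (go xs un m)) (sym (+-assoc (bit (f (σ x))) _ _)))

    -- The field `t≡` allows at most one colour in state T. The field `e≡` works in one direction
    -- only: `ε` may be true without any colour in state E₁, so removing such a colour never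
    -- requires lowering the flag.
    record Profile (σ : Assignment) (m a : ℕ) (τ ε : Bool) : Set where
      field
        m≡ : count isE₃ σ ≡ m
        a≡ : count isE₂ σ ≡ a
        t≡ : count isT σ ≡ bit τ
        e≡ : ε ≡ false → ∀ i → σ i ≢ E₁

    open Profile

    no-E₁ : ∀ {σ i s} → (∀ j → σ j ≢ E₁) → s ≢ E₁ → ∀ j → (σ [ i ≔ s ]) j ≢ E₁
    no-E₁ {σ} {i} {s} h hs j with does (j Fin.≟ i)
    ... | true = hs
    ... | false = h j

    drop-E₃ : ∀ {σ m a τ ε i} → Profile σ m a τ ε → σ i ≡ E₃ → ∃ λ m′ → m ≡ suc m′ × Profile (σ [ i ≔ O ]) m′ a τ ε
    drop-E₃ {σ} {i = i} p s with count-update isE₃ σ i O | count-update isE₂ σ i O | count-update isT σ i O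
    ... | x | y | z rewrite s = _ , trans (sym (m≡ p)) (trans (sym (+-identityʳ _)) (trans (sym x) (+-comm _ 1))) , record
      { m≡ = refl ; a≡ = trans (sym (+-identityʳ _)) (trans y (trans (+-identityʳ _) (a≡ p)))
      ; t≡ = trans (sym (+-identityʳ _)) (trans z (trans (+-identityʳ _) (t≡ p))) ; e≡ = λ h → no-E₁ {i = i} {s = O} (e≡ p h) λ () }

    drop-E₂ : ∀ {σ m a τ ε i} → Profile σ m a τ ε → σ i ≡ E₂ → ∃ λ a′ → a ≡ suc a′ × Profile (σ [ i ≔ O ]) m a′ τ ε
    drop-E₂ {σ} {i = i} p s with count-update isE₃ σ i O | count-update isE₂ σ i O | count-update isT σ i O
    ... | x | y | z rewrite s = _ , trans (sym (a≡ p)) (trans (sym (+-identityʳ _)) (trans (sym y) (+-comm _ 1))) , record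
      { m≡ = trans (sym (+-identityʳ _)) (trans x (trans (+-identityʳ _) (m≡ p))) ; a≡ = refl
      ; t≡ = trans (sym (+-identityʳ _)) (trans z (trans (+-identityʳ _) (t≡ p))) ; e≡ = λ h → no-E₁ {i = i} {s = O} (e≡ p h) λ () }

    drop-T : ∀ {σ m a τ ε i} → Profile σ m a τ ε → σ i ≡ T → τ ≡ true × Profile (σ [ i ≔ O ]) m a false ε
    drop-T {σ} {τ = τ} {i = i} p s with count-update isE₃ σ i O | count-update isE₂ σ i O | count-update isT σ i O | t≡ p
    ... | x | y | z | t rewrite s = go τ (trans (sym (+-comm _ 1)) (trans z (trans (+-identityʳ _) t)))
      where
      go : ∀ τ → suc (count isT (σ [ i ≔ O ])) ≡ bit τ → τ ≡ true × Profile (σ [ i ≔ O ]) _ _ false _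
      go true h = refl , record { m≡ = trans (sym (+-identityʳ _)) (trans x (trans (+-identityʳ _) (m≡ p)))
        ; a≡ = trans (sym (+-identityʳ _)) (trans y (trans (+-identityʳ _) (a≡ p))) ; t≡ = suc-injective h ; e≡ = λ h → no-E₁ {i = i} {s = O} (e≡ p h) λ () }

    add-E₂ : ∀ {σ m a τ ε i} → Profile σ m a τ ε → σ i ≡ O → Profile (σ [ i ≔ E₂ ]) m (suc a) τ ε
    add-E₂ {σ} {i = i} p s with count-update isE₃ σ i E₂ | count-update isE₂ σ i E₂ | count-update isT σ i E₂
    ... | x | y | z rewrite s = record
      { m≡ = trans (sym (+-identityʳ _)) (trans x (trans (+-identityʳ _) (m≡ p)))
      ; a≡ = trans (sym (+-identityʳ _)) (trans y (trans (+-comm _ 1) (cong suc (a≡ p))))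
      ; t≡ = trans (sym (+-identityʳ _)) (trans z (trans (+-identityʳ _) (t≡ p))) ; e≡ = λ h → no-E₁ {i = i} {s = E₂} (e≡ p h) λ () }

    add-T : ∀ {σ m a ε i} → Profile σ m a false ε → σ i ≡ O → Profile (σ [ i ≔ T ]) m a true ε
    add-T {σ} {i = i} p s with count-update isE₃ σ i T | count-update isE₂ σ i T | count-update isT σ i T
    ... | x | y | z rewrite s = record
      { m≡ = trans (sym (+-identityʳ _)) (trans x (trans (+-identityʳ _) (m≡ p)))
      ; a≡ = trans (sym (+-identityʳ _)) (trans y (trans (+-identityʳ _) (a≡ p)))
      ; t≡ = trans (sym (+-identityʳ _)) (trans z (trans (+-comm _ 1) (cong suc (t≡ p)))) ; e≡ = λ h → no-E₁ {i = i} {s = T} (e≡ p h) λ () }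

    add-E₁ : ∀ {σ m a τ ε i} → Profile σ m a τ ε → σ i ≡ O → Profile (σ [ i ≔ E₁ ]) m a τ true
    add-E₁ {σ} {i = i} p s with count-update isE₃ σ i E₁ | count-update isE₂ σ i E₁ | count-update isT σ i E₁
    ... | x | y | z rewrite s = record
      { m≡ = trans (sym (+-identityʳ _)) (trans x (trans (+-identityʳ _) (m≡ p)))
      ; a≡ = trans (sym (+-identityʳ _)) (trans y (trans (+-identityʳ _) (a≡ p)))
      ; t≡ = trans (sym (+-identityʳ _)) (trans z (trans (+-identityʳ _) (t≡ p))) ; e≡ = λ () }

    all-O : ∀ {σ} → Profile σ 0 0 false false → ∀ i → σ i ≡ O
    all-O {σ} p i with σ i in eq
    ... | O = refl
    ... | E₁ = ⊥-elim (e≡ p refl i eq)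
    ... | T = case proj₁ (drop-T p eq) of λ ()
    ... | E₂ = case proj₁ (proj₂ (drop-E₂ p eq)) of λ ()
    ... | E₃ = case proj₁ (proj₂ (drop-E₃ p eq)) of λ ()

-- Moving chosen list elements to the front.

module Fronts where
  open import Data.Nat.Properties
  open import Data.List using (_∷_; _++_)
  open import Data.List.Relation.Unary.All using (_∷_)
  open import Data.List.Relation.Unary.Any using (here; there)
  open import Data.List.Relation.Unary.AllPairs using (_∷_)
  open import Data.List.Membership.Propositional using (_∈_)
  open import Data.List.Membership.Propositional.Properties using (∈-∃++)
  open import Data.List.Relation.Binary.Permutation.Propositional using (_↭_; ↭-trans; prep)
  open import Data.List.Relation.Binary.Permutation.Propositional.Properties using (shift; ∈-resp-↭)
  open import Data.Product using (∃; _,_)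
  open import Data.Empty using (⊥-elim)
  open import Function using (_∘_)
  open import Relation.Nullary
  open import Relation.Binary.PropositionalEquality hiding ([_])
  open States
  open Filters

  to-front : ∀ {X : Set} {p : X} {C} → p ∈ C → ∃ λ C′ → C ↭ p ∷ C′
  to-front m with ∈-∃++ m
  ... | ys , zs , refl = ys ++ zs , shift _ ys zs

  tail-∈ : ∀ {X : Set} {p q : X} {C} → q ∈ p ∷ C → q ≢ p → q ∈ C
  tail-∈ (here e) ne = ⊥-elim (ne e)
  tail-∈ (there m) ne = m

  two-front : ∀ {X : Set} {p q : X} {C} → p ∈ C → q ∈ C → p ≢ q → ∃ λ C′ → C ↭ p ∷ q ∷ C′
  two-front m m′ ne with to-front m
  ... | C′ , s with to-front (tail-∈ (∈-resp-↭ s m′) (ne ∘ sym))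
  ...   | C″ , s′ = C″ , ↭-trans s (prep _ s′)

-- Closed forms of the bounds along odd and even numbers of colours.

module Periods where
  open import Data.Nat using (zero; suc; _+_; _*_; _^_)
  open import Data.Nat.Properties
  open import Data.Nat.Tactic.RingSolver using (solve-∀)
  open import Data.Bool using (true; false)
  open import Relation.Nullary
  open import Relation.Binary.PropositionalEquality hiding ([_])
  open States
  open Beta
  open Profiles
  open Fronts

  -- Without a triangle-free colour the period starts already at one colour: 68 = 17 · 4 and 119 =
  -- 17 · 7.
  β-odd : ∀ j ε → β (suc (double j)) 0 false ε ≡ u 1 false ε * 17 ^ j
  β-odd j ε = trans (*-identityˡ _) (go j ε)
    where
    swap : ∀ a b → 17 * (a * b) ≡ a * (17 * b)
    swap = solve-∀
    go : ∀ j ε → u (suc (double j)) false ε ≡ u 1 false ε * 17 ^ j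
    go 0 false = refl
    go 0 true = refl
    go 1 false = refl
    go 1 true = refl
    go (suc (suc j)) ε = trans (cong (17 *_) (go (suc j) ε)) (swap (u 1 false ε) (17 ^ suc j))

  -- The period starts at two colours, because 21 exceeds 17 · 1.
  u-period : ∀ b j τ ε → u (2 + b + double j) τ ε ≡ u (2 + b) τ ε * 17 ^ j
  u-period b zero τ ε = trans (cong (λ m → u (2 + m) τ ε) (+-identityʳ b)) (sym (*-identityʳ _))
  u-period b (suc j) τ ε = trans (cong (λ m → u (2 + m) τ ε) (trans (+-suc b _) (cong suc (+-suc b _)))) (trans (cong (17 *_) (u-period b j τ ε)) (swap (u (2 + b) τ ε) (17 ^ j)))
    where
    swap : ∀ a b → 17 * (a * b) ≡ a * (17 * b)
    swap = solve-∀

  β-even : ∀ j τ ε → β (double (suc j)) 0 τ ε ≡ u 2 τ ε * 17 ^ j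
  β-even j τ ε = trans (*-identityˡ _) (u-period 0 j τ ε)

-- Lower bounds: the Paley colouring, the colouring of K₂₁ and substitution.

module LowerBound where
  open import Data.Nat using (ℕ; zero; suc; _≤_; s≤s; _+_; _*_; _∸_; _^_; ∣_-_∣; _≡ᵇ_)
  open import Data.Nat.Properties
  open import Data.Nat.DivMod using (_/_; _%_)
  open import Data.Bool using (Bool; true; false; not; _∧_; _∨_; if_then_else_)
  open import Data.Fin using (Fin; zero; suc; toℕ; remQuot; combine; inject≤)
  import Data.Fin as Fin
  import Data.Fin.Properties as Finₚ
  open import Data.Product using (∃; _×_; _,_; proj₁; proj₂)
  open import Data.Sum using (_⊎_; inj₁; inj₂; [_,_]′)
  open import Data.Empty using (⊥; ⊥-elim)
  open import Data.Unit using (tt)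
  open import Function using (_∘_; case_of_)
  open import Relation.Nullary
  open import Relation.Nullary.Decidable using (_→-dec_; dec-false; toWitness)
  import Data.Bool.Properties as Boolₚ
  open import Relation.Binary.PropositionalEquality hiding ([_])
  open Search using (∧-true; not-true)
  open States using (∧-intro; true≢false)
  open Beta using (double)
  open import Defs

  subgraph? : (G H : Graph 5) → Dec (∀ u v → G u v ≡ true → H u v ≡ true)
  subgraph? G H = Finₚ.all? λ u → Finₚ.all? λ v → (G u v Boolₚ.≟ true) →-dec (H u v Boolₚ.≟ true)

  H₁⊆ : ∀ w u v → H₁ u v ≡ true → graphOf w u v ≡ true
  H₁⊆ h₁ = λ _ _ e → e
  H₁⊆ h₂ = toWitness {a? = subgraph? H₁ H₂} tt
  H₁⊆ h₃ = toWitness {a? = subgraph? H₁ H₃} tt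

  record Avoids (w : Which) (k n : ℕ) : Set where
    field
      colour : Colouring k n
      symmetric : IsEdgeColouring colour
      gallai : Gallai colour
      free : ¬ MonoCopy (graphOf w) colour

  ¬arrows : ∀ {w k n} → Avoids w k n → ¬ GallaiArrows k (graphOf w) n
  ¬arrows A h = free (h colour symmetric gallai)
    where open Avoids A

  restrict : ∀ {w k m n} → n ≤ m → Avoids w k m → Avoids w k n
  restrict {n = n} h A = record
    { colour = λ x y → colour (ι x) (ι y)
    ; symmetric = λ x y ne → symmetric (ι x) (ι y) (ne ∘ inj)
    ; gallai = λ (x , y , z , xy , yz , xz , r) → gallai (ι x , ι y , ι z , xy ∘ inj , yz ∘ inj , xz ∘ inj , r)
    ; free = λ (a , f , f-inj , e) → free (a , ι ∘ f , f-inj ∘ inj , e) }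
    where
    open Avoids A
    ι : Fin n → Fin _
    ι x = inject≤ x h
    inj : ∀ {x y} → ι x ≡ ι y → x ≡ y
    inj {x} {y} = Finₚ.inject≤-injective h h x y

  two-equal : (a b d : Fin 2) → a ≡ b ⊎ b ≡ d ⊎ a ≡ d
  two-equal zero zero _ = inj₁ refl
  two-equal (suc zero) (suc zero) _ = inj₁ refl
  two-equal zero (suc zero) zero = inj₂ (inj₂ refl)
  two-equal zero (suc zero) (suc zero) = inj₂ (inj₁ refl)
  two-equal (suc zero) zero zero = inj₂ (inj₁ refl)
  two-equal (suc zero) zero (suc zero) = inj₂ (inj₂ refl)

  gallai₂ : ∀ {n} (c : Colouring 2 n) → Gallai c
  gallai₂ c (x , y , z , _ , _ , _ , p , q , r) = [ p , [ q , r ]′ ]′ (two-equal (c x y) (c y z) (c x z))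

  every : ∀ n → (Fin n → Bool) → Bool
  every zero p = true
  every (suc n) p = p zero ∧ every n (p ∘ suc)

  every-true : ∀ {n} {p : Fin n → Bool} → every n p ≡ true → ∀ x → p x ≡ true
  every-true {suc n} {p} h zero = proj₁ (∧-true {p zero} h)
  every-true {suc n} {p} h (suc x) = every-true {n} {p ∘ suc} (proj₂ (∧-true {p zero} h)) x

  infixr 4 _⇒_
  _⇒_ : Bool → Bool → Bool
  a ⇒ b = not a ∨ b

  apply : ∀ {a b} → (a ⇒ b) ≡ true → a ≡ true → b ≡ true
  apply h refl = h

  record TwoGraph (n : ℕ) : Set where
    field
      edge : Bool → Fin n → Fin n → Bool
      edge-sym : ∀ a x y → edge a x y ≡ edge a y x
      edge-not : ∀ x y → x ≢ y → edge false x y ≡ not (edge true x y)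

    colour₂ : Colouring 2 n
    colour₂ x y = if edge true x y then zero else suc zero

    colour₂-sym : ∀ x y → colour₂ x y ≡ colour₂ y x
    colour₂-sym x y = cong (λ b → if b then zero else suc zero) (edge-sym true x y)

    colour-edge : ∀ i → ∃ λ a → ∀ {x y} → x ≢ y → colour₂ x y ≡ i → edge a x y ≡ true
    colour-edge zero = true , λ {x} {y} ne e → on e
      where
      on : ∀ {x y} → colour₂ x y ≡ zero → edge true x y ≡ true
      on {x} {y} e with edge true x y
      ... | true = refl
    colour-edge (suc zero) = false , λ {x} {y} ne e → trans (edge-not x y ne) (off e)
      where
      off : ∀ {x y} → colour₂ x y ≡ suc zero → not (edge true x y) ≡ true
      off {x} {y} e with edge true x y
      ... | false = refl

    -- Each implication stops the enumeration below a pair or triple that is not monochromatic,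
    -- which keeps the evaluation feasible.
    K₄-check : Bool → Bool
    K₄-check a = every n λ x → every n λ y → edge a x y ⇒ every n λ z → edge a x z ∧ edge a y z ⇒ every n λ w →
      not (edge a x w ∧ edge a y w ∧ edge a z w)

    J₅-check : Bool → Bool
    J₅-check a = every n λ x → every n λ y → edge a x y ⇒ every n λ z → edge a x z ∧ edge a y z ⇒ every n λ v →
      edge a x v ∧ edge a y v ∧ edge a z v ⇒ every n λ w → edge a x w ∧ edge a y w ∧ edge a z w ⇒ does (v Fin.≟ w)

    module _ {a : Bool} where
      K₄-free : K₄-check a ≡ true → ∀ {x y z w} → edge a x y ≡ true → edge a x z ≡ true → edge a y z ≡ true → edge a x w ≡ true → edge a y w ≡ true → edge a z w ≡ true → ⊥
      K₄-free h {x} {y} {z} {w} xy xz yz xw yw zw = true≢false (∧-intro xw (∧-intro yw zw))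
        (not-true (every-true (apply {edge a x z ∧ edge a y z} (every-true (apply {edge a x y} (every-true (every-true h x) y) xy) z) (∧-intro xz yz)) w))

      J₅-free : J₅-check a ≡ true → ∀ {x y z v w} → edge a x y ≡ true → edge a x z ≡ true → edge a y z ≡ true → edge a x v ≡ true → edge a y v ≡ true → edge a z v ≡ true →
        edge a x w ≡ true → edge a y w ≡ true → edge a z w ≡ true → v ≡ w
      J₅-free h {x} {y} {z} {v} {w} xy xz yz xv yv zv xw yw zw = conclude (apply {edge a x w ∧ edge a y w ∧ edge a z w} (every-true
          (apply {edge a x v ∧ edge a y v ∧ edge a z v} (every-true (apply {edge a x z ∧ edge a y z} (every-true (apply {edge a x y} (every-true (every-true h x) y) xy) z) (∧-intro xz yz)) v)
            (∧-intro xv (∧-intro yv zv))) w) (∧-intro xw (∧-intro yw zw)))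
        where
        conclude : does (v Fin.≟ w) ≡ true → v ≡ w
        conclude e with v Fin.≟ w
        ... | yes q = q

  pattern 0F = zero
  pattern 1F = suc zero
  pattern 2F = suc (suc zero)
  pattern 3F = suc (suc (suc zero))
  pattern 4F = suc (suc (suc (suc zero)))

  -- The nonzero quadratic residues modulo 17. Since -1 = 16 is one of them, the absolute difference
  -- of two vertices can stand for their difference modulo 17.
  residue : ℕ → Bool
  residue 1 = true
  residue 2 = true
  residue 4 = true
  residue 8 = true
  residue 9 = true
  residue 13 = true
  residue 15 = true
  residue 16 = true
  residue _ = false

  paley : TwoGraph 17
  paley = record
    { edge = edge
    ; edge-sym = λ { true x y → cong residue (∣-∣-comm (toℕ x) (toℕ y)) ; false x y → cong non-residue (∣-∣-comm (toℕ x) (toℕ y)) }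
    ; edge-not = λ x y ne → apart (ne ∘ Finₚ.toℕ-injective ∘ ∣m-n∣≡0⇒m≡n) }
    where
    non-residue : ℕ → Bool
    non-residue zero = false
    non-residue d = not (residue d)
    edge : Bool → Fin 17 → Fin 17 → Bool
    edge true x y = residue ∣ toℕ x - toℕ y ∣
    edge false x y = non-residue ∣ toℕ x - toℕ y ∣
    apart : ∀ {d} → d ≢ 0 → non-residue d ≡ not (residue d)
    apart {zero} ne = ⊥-elim (ne refl)
    apart {suc d} ne = refl

  paley-K₄ : ∀ a → TwoGraph.K₄-check paley a ≡ true
  paley-K₄ true = refl
  paley-K₄ false = refl

  row : ℕ → ℕ
  row 0 = 1525330
  row 1 = 2001061
  row 2 = 1905994
  row 3 = 1715860
  row 4 = 1334569
  row 5 = 1620562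
  row 6 = 1143973
  row 7 = 1239370
  row 8 = 1430164
  row 9 = 1810729
  row 10 = 438365
  row 11 = 876730
  row 12 = 705908
  row 13 = 364264
  row 14 = 727505
  row 15 = 407458
  row 16 = 813893
  row 17 = 579211
  row 18 = 109847
  row 19 = 219694
  row 20 = 1023
  row _ = 0

  bitAt : ℕ → ℕ → Bool
  bitAt m zero = m % 2 ≡ᵇ 1
  bitAt m (suc j) = bitAt (m / 2) j

  graph₂₁-edge : Bool → Fin 21 → Fin 21 → Bool
  graph₂₁-edge true x y = bitAt (row (toℕ x)) (toℕ y)
  graph₂₁-edge false x y = not (does (x Fin.≟ y)) ∧ not (bitAt (row (toℕ x)) (toℕ y))

  _==_ : Bool → Bool → Bool
  true == b = b
  false == b = not b

  ==-≡ : ∀ a {b} → (a == b) ≡ true → a ≡ b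
  ==-≡ true refl = refl
  ==-≡ false {false} _ = refl

  -- A colouring of K₂₁ without K₅ minus an edge, found by computer; row x is the set of neighbours of x in the first colour.
  graph₂₁ : TwoGraph 21
  graph₂₁ = record
    { edge = graph₂₁-edge
    ; edge-sym = λ a x y → ==-≡ (graph₂₁-edge a x y) (every-true {21} {λ y → graph₂₁-edge a x y == graph₂₁-edge a y x} (every-true {21} {λ x → every 21 λ y → graph₂₁-edge a x y == graph₂₁-edge a y x} (symmetric a) x) y)
    ; edge-not = λ x y ne → cong (λ b → not b ∧ not (bitAt (row (toℕ x)) (toℕ y))) (dec-false (x Fin.≟ y) ne) }
    where
    symmetric : ∀ a → every 21 (λ x → every 21 λ y → graph₂₁-edge a x y == graph₂₁-edge a y x) ≡ true
    symmetric true = refl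
    symmetric false = refl

  graph₂₁-J₅ : ∀ a → TwoGraph.J₅-check graph₂₁ a ≡ true
  graph₂₁-J₅ true = refl
  graph₂₁-J₅ false = refl

  module Base {n : ℕ} (G : TwoGraph n) where
    open TwoGraph G

    base : ∀ w → (∀ a → K₄-check a ≡ true) → Avoids w 2 n
    base w h = record
      { colour = colour₂ ; symmetric = λ x y _ → colour₂-sym x y ; gallai = gallai₂ colour₂
      ; free = λ (i , f , inj , e) → let
          (a , to-edge) = colour-edge i
          at : ∀ u v → u ≢ v → H₁ u v ≡ true → edge a (f u) (f v) ≡ true
          at u v ne uv = to-edge (ne ∘ inj) (e u v (H₁⊆ w u v uv))
        in K₄-free (h a) (at 0F 1F (λ ()) refl) (at 0F 2F (λ ()) refl) (at 1F 2F (λ ()) refl) (at 0F 3F (λ ()) refl) (at 1F 3F (λ ()) refl) (at 2F 3F (λ ()) refl) }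

    base₃ : (∀ a → J₅-check a ≡ true) → Avoids h₃ 2 n
    base₃ h = record
      { colour = colour₂ ; symmetric = λ x y _ → colour₂-sym x y ; gallai = gallai₂ colour₂
      ; free = λ (i , f , inj , e) → let
          (a , to-edge) = colour-edge i
          at : ∀ u v → u ≢ v → H₃ u v ≡ true → edge a (f u) (f v) ≡ true
          at u v ne uv = to-edge (ne ∘ inj) (e u v uv)
        in case inj (J₅-free (h a) (at 0F 1F (λ ()) refl) (at 0F 2F (λ ()) refl) (at 1F 2F (λ ()) refl) (at 0F 3F (λ ()) refl) (at 1F 3F (λ ()) refl) (at 2F 3F (λ ()) refl)
          (at 0F 4F (λ ()) refl) (at 1F 4F (λ ()) refl) (at 2F 4F (λ ()) refl)) of λ () }

  module Substitute {N k n : ℕ} (w : Which) (G : TwoGraph N) (K₄ : ∀ a → TwoGraph.K₄-check G a ≡ true) (A : Avoids w k n) where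
    open TwoGraph G
    open Avoids A

    block : Fin (N * n) → Fin N
    block x = proj₁ (remQuot {N} n x)

    rest : Fin (N * n) → Fin n
    rest x = proj₂ (remQuot {N} n x)

    same : ∀ {x y} → block x ≡ block y → rest x ≡ rest y → x ≡ y
    same {x} {y} p q = trans (sym (Finₚ.combine-remQuot {N} n x)) (trans (cong₂ combine p q) (Finₚ.combine-remQuot {N} n y))

    new : Fin 2 → Fin (2 + k)
    new i = i Fin.↑ˡ k

    old : Fin k → Fin (2 + k)
    old i = 2 Fin.↑ʳ i

    mix : ∀ {x y} → Dec (block x ≡ block y) → Fin (2 + k)
    mix {x} {y} (yes _) = old (colour (rest x) (rest y))
    mix {x} {y} (no _) = new (colour₂ (block x) (block y))

    c : Colouring (2 + k) (N * n)
    c x y = mix {x} {y} (block x Fin.≟ block y)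

    c-same : ∀ {x y} → block x ≡ block y → c x y ≡ old (colour (rest x) (rest y))
    c-same {x} {y} e with block x Fin.≟ block y
    ... | yes _ = refl
    ... | no ne = ⊥-elim (ne e)

    c-apart : ∀ {x y} → block x ≢ block y → c x y ≡ new (colour₂ (block x) (block y))
    c-apart {x} {y} ne with block x Fin.≟ block y
    ... | yes e = ⊥-elim (ne e)
    ... | no _ = refl

    old≢new : ∀ {i j} → old i ≢ new j
    old≢new {i} {zero} ()
    old≢new {i} {suc zero} ()

    old-injective : ∀ {i j} → old i ≡ old j → i ≡ j
    old-injective refl = refl

    new-injective : ∀ {i j} → new i ≡ new j → i ≡ j
    new-injective {i} {j} = Finₚ.↑ˡ-injective k i j

    c-sym : IsEdgeColouring c
    c-sym x y ne with block x Fin.≟ block y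
    ... | yes e = trans (cong old (symmetric (rest x) (rest y) (ne ∘ same e))) (sym (c-same (sym e)))
    ... | no d = trans (cong new (colour₂-sym (block x) (block y))) (sym (c-apart (d ∘ sym)))

    -- Two vertices of one block see a vertex outside it in the same colour. Three different blocks
    -- see only the two new colours, and a triangle inside a block comes from the substituted
    -- colouring.
    c-gallai : Gallai c
    c-gallai (x , y , z , xy , yz , xz , p , q , r) = cases (block x Fin.≟ block y) (block y Fin.≟ block z) (block x Fin.≟ block z)
      where
      cases : Dec (block x ≡ block y) → Dec (block y ≡ block z) → Dec (block x ≡ block z) → ⊥
      cases (yes e) (yes e′) _ = gallai (rest x , rest y , rest z , xy ∘ same e , yz ∘ same e′ , xz ∘ same (trans e e′) ,
        (λ h → p (trans (c-same e) (trans (cong old h) (sym (c-same e′))))) ,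
        (λ h → q (trans (c-same e′) (trans (cong old h) (sym (c-same (trans e e′)))))) ,
        (λ h → r (trans (c-same e) (trans (cong old h) (sym (c-same (trans e e′)))))))
      cases (yes e) (no d) _ = q (trans (c-apart d) (trans (cong (λ b → new (colour₂ b (block z))) (sym e)) (sym (c-apart (λ h → d (trans (sym e) h))))))
      cases (no d) (yes e) _ = r (trans (c-apart d) (trans (cong (λ b → new (colour₂ (block x) b)) e) (sym (c-apart (λ h → d (trans h (sym e)))))))
      cases (no d) (no d′) (yes e) = p (trans (c-apart d) (trans (cong new (trans (colour₂-sym (block x) (block y)) (cong (colour₂ (block y)) e))) (sym (c-apart d′))))
      cases (no d) (no d′) (no d″) = [ (λ h → p (join d d′ h)) , [ (λ h → q (join d′ d″ h)) , (λ h → r (join d d″ h)) ]′ ]′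
          (two-equal (colour₂ (block x) (block y)) (colour₂ (block y) (block z)) (colour₂ (block x) (block z)))
        where
        join : ∀ {x y x′ y′} → block x ≢ block y → block x′ ≢ block y′ → colour₂ (block x) (block y) ≡ colour₂ (block x′) (block y′) → c x y ≡ c x′ y′
        join d d′ h = trans (c-apart d) (trans (cong new h) (sym (c-apart d′)))

    H = graphOf w

    inside : ∀ {x y i} → c x y ≡ old i → block x ≡ block y × colour (rest x) (rest y) ≡ i
    inside {x} {y} e with block x Fin.≟ block y
    ... | yes h = h , old-injective e
    ... | no _ = ⊥-elim (old≢new (sym e))

    across : ∀ {x y i} → c x y ≡ new i → block x ≢ block y × colour₂ (block x) (block y) ≡ i
    across {x} {y} e with block x Fin.≟ block y
    ... | yes _ = ⊥-elim (old≢new e)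
    ... | no h = h , new-injective e

    -- An edge of a new colour joins different blocks, so the K₄ inside the graph would project to a
    -- monochromatic K₄ of `G`.
    new-free : ∀ i (f : Fin 5 → Fin (N * n)) → (∀ u v → H u v ≡ true → c (f u) (f v) ≡ new i) → ⊥
    new-free i f e = K₄-free (K₄ a) (at 0F 1F refl) (at 0F 2F refl) (at 1F 2F refl) (at 0F 3F refl) (at 1F 3F refl) (at 2F 3F refl)
      where
      a = proj₁ (colour-edge i)
      at : ∀ u v → H₁ u v ≡ true → edge a (block (f u)) (block (f v)) ≡ true
      at u v uv = let (d , h) = across (e u v (H₁⊆ w u v uv)) in proj₂ (colour-edge i) d h

    c-free : ¬ MonoCopy H c
    c-free (zero , f , _ , e) = new-free zero f e
    c-free (suc zero , f , _ , e) = new-free (suc zero) f e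
    c-free (suc (suc i) , f , inj , e) = free (i , rest ∘ f , (λ {u} {v} h → inj (same (trans (sym (centre u)) (centre v)) h)) , λ u v uv → proj₂ (inside (e u v uv)))
      where
      -- Vertex 0 is adjacent to all others.
      centre : ∀ v → block (f 0F) ≡ block (f v)
      centre 0F = refl
      centre 1F = proj₁ (inside {f 0F} {f 1F} {i} (e 0F 1F (H₁⊆ w 0F 1F refl)))
      centre 2F = proj₁ (inside {f 0F} {f 2F} {i} (e 0F 2F (H₁⊆ w 0F 2F refl)))
      centre 3F = proj₁ (inside {f 0F} {f 3F} {i} (e 0F 3F (H₁⊆ w 0F 3F refl)))
      centre 4F = proj₁ (inside {f 0F} {f 4F} {i} (e 0F 4F (H₁⊆ w 0F 4F refl)))

    substituted : Avoids w (2 + k) (N * n)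
    substituted = record { colour = c ; symmetric = c-sym ; gallai = c-gallai ; free = c-free }

  base₁ : ∀ w → Avoids w 1 4
  base₁ w = record
    { colour = λ _ _ → zero ; symmetric = λ _ _ _ → refl ; gallai = λ (_ , _ , _ , _ , _ , _ , p , _) → p refl
    ; free = λ (_ , f , inj , _) → case Finₚ.injective⇒≤ {f = f} inj of λ { (s≤s (s≤s (s≤s (s≤s ())))) } }

  base₂ : ∀ w → Avoids w 2 (r₂ w ∸ 1)
  base₂ h₁ = Base.base paley h₁ paley-K₄
  base₂ h₂ = Base.base paley h₂ paley-K₄
  base₂ h₃ = Base.base₃ graph₂₁ graph₂₁-J₅

  swap : ∀ a b → a * (17 * b) ≡ 17 * (a * b)
  swap a b = trans (sym (*-assoc a 17 b)) (trans (cong (_* b) (*-comm a 17)) (*-assoc 17 a b))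

  iterated : ∀ {w k n} j → Avoids w k n → Avoids w (double j + k) (n * 17 ^ j)
  iterated {n = n} zero A = subst (Avoids _ _) (sym (*-identityʳ n)) A
  iterated {w} {k} {n} (suc j) A = subst (Avoids w _) (sym (swap n (17 ^ j))) (Substitute.substituted w paley paley-K₄ (iterated j A))

  irreflexive : ∀ w u v → graphOf w u v ≡ true → u ≢ v
  irreflexive w u v e refl = true≢false e (diagonal w u)
    where
    diagonal : ∀ w u → graphOf w u u ≡ false
    diagonal h₁ = toWitness {a? = Finₚ.all? λ u → H₁ u u Boolₚ.≟ false} tt
    diagonal h₂ = toWitness {a? = Finₚ.all? λ u → H₂ u u Boolₚ.≟ false} tt
    diagonal h₃ = toWitness {a? = Finₚ.all? λ u → H₃ u u Boolₚ.≟ false} tt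

-- Upper bounds: sets of vertices, monochromatic subgraphs and joins.

module UpperBound where
  open import Data.Nat using (ℕ; zero; suc; _≤_; _<_; z≤n; s≤s; _+_; _*_; _≤?_; s≤s⁻¹; _⊔_; _^_)
  open import Data.Nat.Properties
  open import Data.Bool using (Bool; true; false; not; _∧_; _∨_)
  open import Data.Fin using (Fin)
  import Data.Fin as Fin
  import Data.Fin.Properties as Finₚ
  open import Data.List using (List; []; _∷_; length; map; filterᵇ; allFin; _++_; take; lookup; cartesianProductWith)
  open import Data.Nat.ListAction using (sum)
  open import Data.List.Properties using (length-++; length-map; length-take; length-tabulate)
  open import Data.List.Relation.Unary.All using (All; []; _∷_)
  import Data.List.Relation.Unary.All as All
  import Data.List.Relation.Unary.All.Properties as Allₚ
  open import Data.List.Relation.Unary.Any using (Any; here; there)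
  import Data.List.Relation.Unary.Any as Any
  open import Data.List.Relation.Unary.AllPairs using ([]; _∷_)
  import Data.List.Relation.Unary.AllPairs as AllPairs
  open import Data.List.Relation.Unary.Unique.Propositional using (Unique)
  import Data.List.Relation.Unary.Unique.Propositional.Properties as Uniq
  open import Data.List.Relation.Binary.Sublist.Propositional using ([]; _∷_) renaming (_∷ʳ_ to omit)
  import Data.List.Relation.Binary.Sublist.Propositional.Properties as Sublist
  open import Data.List.Membership.Propositional using (_∈_; lose; find; _∉_)
  open import Data.List.Membership.Propositional.Properties using (∈-allFin; ∈-lookup; ∈-cartesianProductWith⁺; ∈-++⁺ˡ)
  open import Data.Product using (∃; _×_; _,_; proj₁; proj₂)
  open import Data.Sum using (_⊎_; inj₁; inj₂; [_,_]′)
  import Data.Sum as Sum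
  open import Data.Empty using (⊥; ⊥-elim)
  open import Function using (_∘_; id; case_of_)
  open import Relation.Nullary
  open import Relation.Nullary.Decidable using (_×-dec_; ¬?; dec-true; dec-false)
  open import Relation.Binary.PropositionalEquality hiding ([_])
  open import Data.Unit using (⊤)
  open States
  open import Data.Nat.Tactic.RingSolver using (solve-∀)
  open ListLemmas
  open ClassSizes
  open import Data.List.Relation.Binary.Permutation.Propositional using (_↭_; ↭-sym; ↭-trans; prep)
  open import Data.List.Relation.Binary.Permutation.Propositional.Properties using (shift; ∈-resp-↭; ↭-length)
  open Filters
  open Fronts
  open import Data.Nat.Induction using (<-wellFounded; Acc; acc)
  open GallaiPartitions
  open Beta
  open Profiles
  open Periods
  open import Defs using (MonoCopy; H₂; H₃; h₃)
  open Search using (module Sound; pen; lack; miss; bit; cnt; ∧-true; ∨-true; not-true; Unique-↭; All-↭)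
  open SmallRamseyNumbers using (J4J5-bound; J4J4-bound; K3J5-bound; K3J4-bound; K3K4-bound)
  open NoColouring22 using (facts; no-colouring; TwoColouring; Few; distinct; filterᵇ-All; length-filterᵇ; lack-0; miss-cong)
  open LowerBound using (0F; 1F; 2F; 3F; 4F; irreflexive)

  module Coloured {n k : ℕ} (c : Fin n → Fin n → Fin k) (c-sym : ∀ x y → c x y ≡ c y x) where
    V Colour : Set
    V = Fin n
    Colour = Fin k

    Subset : Set
    Subset = V → Bool

    vs : List V
    vs = allFin n

    infix 4 _∈ₛ_ _⊑_
    _∈ₛ_ : V → Subset → Set
    x ∈ₛ S = S x ≡ true

    _⊑_ : Subset → Subset → Set
    P ⊑ Q = ∀ {x} → x ∈ₛ P → x ∈ₛ Q

    size : Subset → ℕ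
    size S = cnt S vs

    in? : ∀ x S → Dec (x ∈ₛ S)
    in? x S = S x Data.Bool.≟ true

    cnt-cover : ∀ (S P Q : Subset) → (∀ {x} → x ∈ₛ S → x ∈ₛ P ⊎ x ∈ₛ Q) → ∀ xs → cnt S xs ≤ cnt P xs + cnt Q xs
    cnt-cover S P Q h [] = z≤n
    cnt-cover S P Q h (x ∷ xs) = ≤-trans (+-mono-≤ (one x) (cnt-cover S P Q h xs)) (≤-reflexive (+-exchange (bit (P x)) (bit (Q x)) _ _))
      where
      one : ∀ x → bit (S x) ≤ bit (P x) + bit (Q x)
      one x with S x in eq
      ... | false = z≤n
      ... | true with h eq
      ...   | inj₁ p rewrite p = s≤s z≤n
      ...   | inj₂ q rewrite q = m≤n+m 1 _
      +-exchange : ∀ a b c d → a + b + (c + d) ≡ a + c + (b + d)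
      +-exchange a b c d = trans (+-assoc a b _) (trans (cong (a +_) (trans (sym (+-assoc b c d)) (trans (cong (_+ d) (+-comm b c)) (+-assoc c b d)))) (sym (+-assoc a c _)))

    size-cover : ∀ {S P Q} → (∀ {x} → x ∈ₛ S → x ∈ₛ P ⊎ x ∈ₛ Q) → size S ≤ size P + size Q
    size-cover {S} {P} {Q} h = cnt-cover S P Q h vs

    size-mono : ∀ {P Q} → P ⊑ Q → size P ≤ size Q
    size-mono {P} {Q} h = ≤-trans (cnt-cover P Q (λ _ → false) (inj₁ ∘ h) vs) (≤-reflexive (trans (cong (size Q +_) (none vs)) (+-identityʳ _)))
      where
      none : ∀ xs → cnt {A = V} (λ _ → false) xs ≡ 0
      none [] = refl
      none (_ ∷ xs) = none xs

    size-cover₃ : ∀ {S P Q U} → (∀ {x} → x ∈ₛ S → x ∈ₛ P ⊎ x ∈ₛ Q ⊎ x ∈ₛ U) → size S ≤ size P + size Q + size U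
    size-cover₃ {S} {P} {Q} {U} h = ≤-trans (size-cover {S} {P} {λ x → Q x ∨ U x} (λ m → [ inj₁ , [ (λ q → inj₂ (left q)) , (λ u → inj₂ (right u)) ]′ ]′ (h m)))
      (≤-trans (+-monoʳ-≤ (size P) (size-cover {λ x → Q x ∨ U x} {Q} {U} ∨-true)) (≤-reflexive (sym (+-assoc (size P) _ _))))
      where
      left : ∀ {a b} → a ≡ true → a ∨ b ≡ true
      left refl = refl
      right : ∀ {a b} → b ≡ true → a ∨ b ≡ true
      right {true} _ = refl
      right {false} h = h

    cnt-< : ∀ (P Q : Subset) → P ⊑ Q → ∀ {x} xs → x ∈ xs → x ∈ₛ Q → P x ≡ false → cnt P xs < cnt Q xs
    cnt-< P Q h (x ∷ xs) (here refl) q p rewrite p | q = s≤s (mono xs)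
      where
      mono : ∀ xs → cnt P xs ≤ cnt Q xs
      mono [] = z≤n
      mono (y ∷ ys) = +-mono-≤ (step y) (mono ys)
        where
        step : ∀ y → bit (P y) ≤ bit (Q y)
        step y with P y in eq
        ... | false = z≤n
        ... | true rewrite h eq = s≤s z≤n
    cnt-< P Q h (y ∷ xs) (there m) q p = +-mono-≤-< (step y) (cnt-< P Q h xs m q p)
      where
      step : ∀ y → bit (P y) ≤ bit (Q y)
      step y with P y in eq
      ... | false = z≤n
      ... | true rewrite h eq = s≤s z≤n

    size-< : ∀ {P Q x} → P ⊑ Q → x ∈ₛ Q → P x ≡ false → size P < size Q
    size-< {P} {Q} {x} h q p = cnt-< P Q h vs (∈-allFin x) q p

    elements : Subset → List V
    elements S = filterᵇ S vs

    elements-unique : ∀ S → Unique (elements S)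
    elements-unique S = Uniq.filter⁺ _ (Uniq.allFin⁺ n)

    elements-all : ∀ S → All (_∈ₛ S) (elements S)
    elements-all S = filterᵇ-All S vs

    ∈-elements : ∀ {S x} → x ∈ₛ S → x ∈ elements S
    ∈-elements {S} {x} h = go vs (∈-allFin x)
      where
      go : ∀ xs → x ∈ xs → x ∈ filterᵇ S xs
      go (x ∷ xs) (here refl) rewrite h = here refl
      go (y ∷ xs) (there m) with S y
      ... | true = there (go xs m)
      ... | false = go xs m

    elements-∈ : ∀ {S x} → x ∈ elements S → x ∈ₛ S
    elements-∈ {S} m = All.lookup (elements-all S) m

    size-elements : ∀ S → length (elements S) ≡ size S
    size-elements S = length-filterᵇ S vs

    just : V → Subset
    just v x = does (x Fin.≟ v)

    just-∈ : ∀ v → v ∈ₛ just v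
    just-∈ v = dec-true (v Fin.≟ v) refl

    just-≡ : ∀ {v x} → x ∈ₛ just v → x ≡ v
    just-≡ {v} {x} h with x Fin.≟ v
    ... | yes e = e

    size-subsingleton : ∀ S → (∀ {x y} → x ∈ₛ S → y ∈ₛ S → x ≡ y) → size S ≤ 1
    size-subsingleton S h = ≤-trans (≤-reflexive (sym (size-elements S))) (go (elements S) (elements-unique S) (elements-all S))
      where
      go : ∀ L → Unique L → All (_∈ₛ S) L → length L ≤ 1
      go [] u a = z≤n
      go (x ∷ []) u a = s≤s z≤n
      go (x ∷ y ∷ L) ((ne ∷ _) ∷ _) (p ∷ q ∷ _) = ⊥-elim (ne (h p q))

    size-just : ∀ v → size (just v) ≤ 1
    size-just v = size-subsingleton (just v) λ p q → trans (just-≡ p) (sym (just-≡ q))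

    member? : ∀ S → (∃ λ x → x ∈ₛ S) ⊎ (∀ {x} → ¬ x ∈ₛ S)
    member? S with Finₚ.any? (λ x → in? x S)
    ... | yes h = inj₁ h
    ... | no h = inj₂ λ {x} p → h (x , p)

    size-empty : ∀ S → (∀ {x} → ¬ x ∈ₛ S) → size S ≡ 0
    size-empty S h = n≤0⇒n≡0 (≤-trans (≤-reflexive (sym (size-elements S))) (go (elements S) (elements-all S)))
      where
      go : ∀ L → All (_∈ₛ S) L → length L ≤ 0
      go [] _ = z≤n
      go (x ∷ L) (p ∷ _) = ⊥-elim (h p)

    adjacent : Colour → V → V → Bool
    adjacent i x y = does (c x y Fin.≟ i)

    adjacent-true : ∀ {i x y} → c x y ≡ i → adjacent i x y ≡ true
    adjacent-true {i} {x} {y} e = dec-true (c x y Fin.≟ i) e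

    adjacent-≡ : ∀ {i x y} → adjacent i x y ≡ true → c x y ≡ i
    adjacent-≡ {i} {x} {y} h with c x y Fin.≟ i
    ... | yes e = e

    record Has (i : Colour) (s d : ℕ) (S : Subset) : Set where
      constructor has
      field
        list : List V
        unique : Unique list
        inside : All (_∈ₛ S) list
        count : length list ≡ s
        few : miss (adjacent i) list ≤ d

    tuples : ℕ → List (List V)
    tuples zero = [] ∷ []
    tuples (suc s) = cartesianProductWith _∷_ vs (tuples s)

    ∈-tuples : ∀ C → C ∈ tuples (length C)
    ∈-tuples [] = here refl
    ∈-tuples (x ∷ C) = ∈-cartesianProductWith⁺ _∷_ (∈-allFin x) (∈-tuples C)

    -- All later case distinctions on the presence of a subgraph rest on this enumeration of tuples.
    has? : ∀ i s d S → Dec (Has i s d S)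
    has? i s d S with Any.any? (λ C → AllPairs.allPairs? (λ x y → ¬? (x Fin.≟ y)) C ×-dec (All.all? (λ x → in? x S) C ×-dec
                        ((length C Data.Nat.≟ s) ×-dec (miss (adjacent i) C ≤? d)))) (tuples s)
    ... | yes h = let (C , _ , (u , a , l , m)) = find h in yes (has C u a l m)
    ... | no h = no λ { (has C u a refl m) → h (lose (∈-tuples C) (u , a , refl , m)) }

    -- The states form a chain: excluding an edge excludes J₃, and this in turn excludes K₃, J₄ and
    -- J₅.
    Ok : Colour → State → Subset → Set
    Ok i s S = ¬ Has i (order s) (gaps s) S

    has-⊑ : ∀ {i s d P Q} → P ⊑ Q → Has i s d P → Has i s d Q
    has-⊑ h (has C u a l m) = has C u (All.map h a) l m

    ok-⊑ : ∀ {i P Q} s → P ⊑ Q → Ok i s Q → Ok i s P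
    ok-⊑ s h f = f ∘ has-⊑ h

    has-weaken : ∀ {i s d S} → Has i s d S → Has i s (suc d) S
    has-weaken (has C u a l m) = has C u a l (m≤n⇒m≤1+n m)

    has-shrink : ∀ {i s S} → Has i (suc s) 1 S → Has i s 0 S
    has-shrink {i} (has C u a l m) with shrink-list (adjacent i) C m l
    ... | D , sub , l′ , m′ = has D (Sound.unique-⊆ {A = V} (λ _ _ → true) sub u) (Sublist.All-resp-⊆ sub a) l′ (≤-reflexive m′)

    ok-O-E₁ : ∀ {i S} → Ok i O S → Ok i E₁ S
    ok-O-E₁ f h = f (has-shrink h)

    ok-E₁-T : ∀ {i S} → Ok i E₁ S → Ok i T S
    ok-E₁-T f h = f (has-weaken h)

    ok-T-E₂ : ∀ {i S} → Ok i T S → Ok i E₂ S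
    ok-T-E₂ f h = f (has-shrink h)

    ok-E₂-E₃ : ∀ {i S} → Ok i E₂ S → Ok i E₃ S
    ok-E₂-E₃ f h = f (has-weaken (has-shrink h))

    ok-O-E₂ : ∀ {i S} → Ok i O S → Ok i E₂ S
    ok-O-E₂ {i} {S} f = ok-T-E₂ (ok-E₁-T (ok-O-E₁ {i} {S} f))

    ok-E₁-E₂ : ∀ {i S} → Ok i E₁ S → Ok i E₂ S
    ok-E₁-E₂ f = ok-T-E₂ (ok-E₁-T f)

    has-one : ∀ {i S x} → x ∈ₛ S → Has i 1 0 S
    has-one p = has _ ([] ∷ []) (p ∷ []) refl z≤n

    has-two : ∀ {i S x y} → x ∈ₛ S → y ∈ₛ S → x ≢ y → Has i 2 1 S
    has-two {i} {x = x} {y} p q ne = has (x ∷ y ∷ []) ((ne ∷ []) ∷ [] ∷ []) (p ∷ q ∷ []) refl (bound (adjacent i x y))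
      where
      bound : ∀ b → pen b + 0 + 0 ≤ 1
      bound true = z≤n
      bound false = s≤s z≤n

    has-edge : ∀ {i S x y} → x ∈ₛ S → y ∈ₛ S → x ≢ y → c x y ≡ i → Has i 2 0 S
    has-edge {i} {x = x} {y} p q ne e = has (x ∷ y ∷ []) ((ne ∷ []) ∷ [] ∷ []) (p ∷ q ∷ []) refl
      (≤-reflexive (trans (+-identityʳ _) (trans (+-identityʳ _) (cong pen (adjacent-true e)))))

    has-path : ∀ {i S x y z} → x ∈ₛ S → y ∈ₛ S → z ∈ₛ S → x ≢ y → x ≢ z → y ≢ z → c x y ≡ i → c x z ≡ i → Has i 3 1 S
    has-path {i} {x = x} {y} {z} p q r xy xz yz e e′ = has (x ∷ y ∷ z ∷ []) ((xy ∷ xz ∷ []) ∷ (yz ∷ []) ∷ [] ∷ []) (p ∷ q ∷ r ∷ []) refl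
      (subst (λ w → w + (pen (adjacent i y z) + 0 + 0) ≤ 1) (sym (lack-0 (adjacent i) x (y ∷ z ∷ []) (adjacent-true e ∷ adjacent-true e′ ∷ [])))
        (bound (adjacent i y z)))
      where
      bound : ∀ b → pen b + 0 + 0 ≤ 1
      bound true = z≤n
      bound false = s≤s z≤n

    small : ∀ {i S} → ¬ Has i 2 1 S → size S ≤ 1
    small {i} {S} h = size-subsingleton S λ {x} {y} p q → case x Fin.≟ y of λ { (yes e) → e ; (no ne) → ⊥-elim (h (has-two p q ne)) }

    edge-of : ∀ {i S} → Has i 2 0 S → ∃ λ x → ∃ λ y → x ∈ₛ S × y ∈ₛ S × x ≢ y × c x y ≡ i
    edge-of {i} (has (x ∷ y ∷ []) ((ne ∷ []) ∷ _) (p ∷ q ∷ []) refl m) with adjacent i x y in eq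
    ... | true = x , y , p , q , ne , adjacent-≡ eq
    edge-of {i} (has (x ∷ y ∷ []) ((ne ∷ []) ∷ _) (p ∷ q ∷ []) refl ()) | false

    Joined : Colour → Subset → Subset → Set
    Joined i P Q = ∀ {x y} → x ∈ₛ P → y ∈ₛ Q → x ≢ y × c x y ≡ i

    joined-sym : ∀ {i P Q} → Joined i P Q → Joined i Q P
    joined-sym j q p = let (ne , e) = j p q in ≢-sym ne , trans (c-sym _ _) e

    -- Orders and gaps add, as no pair between the sides is missing. Every reduction to smaller
    -- forbidden graphs is this lemma read backwards: J₅ arises from K₁ and J₄, from K₂ and J₃, or
    -- from K₃ and two arbitrary vertices.
    has-join : ∀ {i P Q S s d s′ d′} → P ⊑ S → Q ⊑ S → Joined i P Q → Has i s d P → Has i s′ d′ Q → Has i (s + s′) (d + d′) S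
    has-join {i} hp hq j (has C u a l m) (has D v b l′ m′) = has (C ++ D)
      (Uniq.++⁺ u v λ { (x∈ , y∈) → proj₁ (j (All.lookup a x∈) (All.lookup b y∈)) refl })
      (Allₚ.++⁺ (All.map hp a) (All.map hq b)) (trans (length-++ C) (cong₂ _+_ l l′))
      (≤-trans (≤-reflexive (miss-++ (adjacent i) C D (All.map (λ p → All.map (λ q → adjacent-true (proj₂ (j p q))) b) a))) (+-mono-≤ m m′))

    -- On a set with two colours `B` is the complement of `R`, which turns the results of the search
    -- into bounds on its size.
    module On (R B : Colour) (R≢B : R ≢ B) (Q : Subset) (two : ∀ {x y} → x ∈ₛ Q → y ∈ₛ Q → x ≢ y → c x y ≡ R ⊎ c x y ≡ B) where

      e : V → V → Bool
      e = adjacent R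

      anti : ∀ {x y} → x ∈ₛ Q → y ∈ₛ Q → x ≢ y → not (e x y) ≡ adjacent B x y
      anti {x} {y} p q ne with two p q ne
      ... | inj₁ r = trans (cong not (adjacent-true r)) (sym (dec-false (c x y Fin.≟ B) λ b → R≢B (trans (sym r) b)))
      ... | inj₂ b = trans (cong not (dec-false (c x y Fin.≟ R) λ r → R≢B (trans (sym r) b))) (sym (adjacent-true b))

      free-true : ∀ s d → ¬ Has R (2 + s) d Q → ∀ C → Unique C → All (_∈ₛ Q) C → length C ≡ 2 + s → suc d ≤ miss (adjacent R) C
      free-true s d h C u a l = ≰⇒> λ m → h (has C u a l m)

      free-false : ∀ s d → ¬ Has B (2 + s) d Q → ∀ C → Unique C → All (_∈ₛ Q) C → length C ≡ 2 + s → suc d ≤ miss (λ x y → not (e x y)) C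
      free-false s d h C u a l = ≰⇒> λ m → h (has C u a l (≤-trans (≤-reflexive (sym (miss-cong′ C u a anti))) m))

      ramsey : ∀ {F N} → (∀ {P} → Sound.Avoids e F P → ∀ L → Unique L → All P L → length L ≤ N) → Sound.Avoids e F (_∈ₛ Q) → size Q ≤ N
      ramsey bound av = ≤-trans (≤-reflexive (sym (size-elements Q))) (bound av (elements Q) (elements-unique Q) (elements-all Q))

      size-44 : Ok R E₂ Q → Ok B E₂ Q → size Q ≤ 9
      size-44 r b = ramsey (λ {P} → J4J4-bound e {P}) (Sound.avoids (free-true 2 1 r) (free-false 2 1 b) (λ ()) (λ ()))

      size-45 : Ok R E₂ Q → Ok B E₃ Q → size Q ≤ 12
      size-45 r b = ramsey (λ {P} → J4J5-bound e {P}) (Sound.avoids (free-true 2 1 r) (free-false 3 1 b) (λ ()) (λ ()))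

      size-T4 : Ok R T Q → Ok B E₂ Q → size Q ≤ 6
      size-T4 r b = ramsey (λ {P} → K3J4-bound e {P}) (Sound.avoids (λ C u a l → s≤s (free-true 1 0 r C u a l)) (free-false 2 1 b) (λ ()) (λ ()))

      size-T5 : Ok R T Q → Ok B E₃ Q → size Q ≤ 10
      size-T5 r b = ramsey (λ {P} → K3J5-bound e {P}) (Sound.avoids (λ C u a l → s≤s (free-true 1 0 r C u a l)) (free-false 3 1 b) (λ ()) (λ ()))

      size-T-K4 : Ok R T Q → ¬ Has B 4 0 Q → size Q ≤ 8
      size-T-K4 r b = ramsey (λ {P} → K3K4-bound e {P})
        (Sound.avoids (λ C u a l → s≤s (free-true 1 0 r C u a l)) (λ C u a l → s≤s (free-false 2 0 b C u a l)) (λ ()) (λ ()))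

      size-55 : Ok R E₃ Q → Ok B E₃ Q → size Q ≤ 21
      size-55 r b with size Q ≤? 21
      ... | yes p = p
      ... | no np = ⊥-elim (no-colouring facts colouring)
        where
        L = elements Q
        big : 22 ≤ length L
        big = ≤-trans (≰⇒> np) (≤-reflexive (sym (size-elements Q)))
        f : Fin 22 → V
        f i = lookup L (Fin.inject≤ i big)
        f-inj : ∀ {i j} → f i ≡ f j → i ≡ j
        f-inj {i} {j} e = Finₚ.inject≤-injective big big i j (lookup-injective (elements-unique Q) _ _ e)
        f∈ : ∀ i → f i ∈ₛ Q
        f∈ i = elements-∈ {Q} (∈-lookup (Fin.inject≤ i big))
        g : Colour → Fin 22 → Fin 22 → Bool
        g i x y = distinct x y ∧ adjacent i (f x) (f y)
        distinct-sym : ∀ x y → distinct {22} x y ≡ distinct y x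
        distinct-sym x y with x Fin.≟ y
        ... | yes refl = cong not (sym (dec-true (x Fin.≟ x) refl))
        ... | no ne = cong not (sym (dec-false (y Fin.≟ x) (ne ∘ sym)))
        g-sym : ∀ i x y → g i x y ≡ g i y x
        g-sym i x y = cong₂ _∧_ (distinct-sym x y) (cong (λ z → does (z Fin.≟ i)) (c-sym (f x) (f y)))
        distinct-irr : ∀ x → distinct {22} x x ≡ false
        distinct-irr x = cong not (dec-true (x Fin.≟ x) refl)
        distinct-ne : ∀ {x y} → x ≢ y → distinct {22} x y ≡ true
        distinct-ne {x} {y} ne = cong not (dec-false (x Fin.≟ y) ne)
        few : ∀ i → Ok i E₃ Q → Few (g i) (λ _ → ⊤) 5 2
        few i h C u a l = ≰⇒> λ m → h (has (map f C) (Uniq.map⁺ f-inj u) (Allₚ.map⁺ (All.universal f∈ C)) (trans (length-map f C) l)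
          (≤-trans (≤-reflexive (trans (miss-map f (adjacent i) C)
             (miss-cong C u λ x y ne → cong (_∧ adjacent i (f x) (f y)) (sym (distinct-ne ne))))) m))
        colouring : TwoColouring 22
        colouring = record
          { e = g R ; f = g B ; e-sym = g-sym R ; f-sym = g-sym B
          ; e-irr = λ x → cong (_∧ adjacent R (f x) (f x)) (distinct-irr x) ; f-irr = λ x → cong (_∧ adjacent B (f x) (f x)) (distinct-irr x)
          ; compl = λ x y ne → trans (cong (_∧ adjacent B (f x) (f y)) (distinct-ne ne))
              (trans (sym (anti (f∈ x) (f∈ y) (ne ∘ f-inj))) (cong (λ z → not (z ∧ adjacent R (f x) (f y))) (sym (distinct-ne ne))))
          ; e-few = few R r ; f-few = few B b }

    module _ {R B : Colour} (R≢B : R ≢ B) where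
      private
        Both : Subset → Set
        Both Q = ∀ {x y} → x ∈ₛ Q → y ∈ₛ Q → x ≢ y → c x y ≡ R ⊎ c x y ≡ B

      -- R(4,4) ≤ 18: one colour occurs 9 times at a vertex.
      K4-18 : ∀ Q → Both Q → 18 ≤ size Q → Has R 4 0 Q ⊎ Has B 4 0 Q
      K4-18 Q two big with has? R 4 0 Q | has? B 4 0 Q
      ... | yes h | _ = inj₁ h
      ... | no _ | yes h = inj₂ h
      ... | no nr | no nb with member? Q
      ...   | inj₂ none = ⊥-elim (<⇒≱ big (≤-trans (≤-reflexive (size-empty Q none)) z≤n))
      ...   | inj₁ (v , v∈) = ⊥-elim (<⇒≱ big (≤-trans cover (+-mono-≤ (+-mono-≤ (size-just v) redSmall) blueSmall)))
        where
        N : Colour → Subset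
        N i y = Q y ∧ (not (does (y Fin.≟ v)) ∧ adjacent i v y)
        N-in : ∀ {i y} → y ∈ₛ N i → y ∈ₛ Q × v ≢ y × c v y ≡ i
        N-in {i} {y} h with ∧-true {Q y} h
        ... | q , h′ with ∧-true {not (does (y Fin.≟ v))} h′
        ...   | ne , a = q , (λ { refl → true≢false (dec-true (y Fin.≟ y) refl) (not-true ne) }) , adjacent-≡ a
        N⊑ : ∀ {i} → N i ⊑ Q
        N⊑ h = proj₁ (N-in h)
        N-intro : ∀ {i y} → y ∈ₛ Q → v ≢ y → c v y ≡ i → y ∈ₛ N i
        N-intro {i} {y} q ne e = ∧-intro q (∧-intro (cong not (dec-false (y Fin.≟ v) (ne ∘ sym))) (adjacent-true e))
        cover : size Q ≤ size (just v) + size (N R) + size (N B)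
        cover = size-cover₃ {Q} {just v} {N R} {N B} λ {y} q → case v Fin.≟ y of λ
          { (yes refl) → inj₁ (just-∈ v)
          ; (no ne) → inj₂ ([ (λ e → inj₁ (N-intro q ne e)) , (λ e → inj₂ (N-intro q ne e)) ]′ (two v∈ q ne)) }
        joined : ∀ i → Joined i (just v) (N i)
        joined i p q = let (_ , ne , e) = N-in q in (λ { refl → ne (sym (just-≡ {v} p)) }) , subst (λ z → c z _ ≡ i) (sym (just-≡ {v} p)) e
        just⊑ : just v ⊑ Q
        just⊑ p = subst (_∈ₛ Q) (sym (just-≡ p)) v∈
        no-triangle : ∀ i → ¬ Has i 4 0 Q → Ok i T (N i)
        no-triangle i h t = h (has-join {P = just v} {Q = N i} just⊑ N⊑ (joined i) (has-one {x = v} (just-∈ v)) t)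
        redSmall : size (N R) ≤ 8
        redSmall = On.size-T-K4 R B R≢B (N R) (λ p q → two (N⊑ p) (N⊑ q)) (no-triangle R nr) (nb ∘ has-⊑ N⊑)
        blueSmall : size (N B) ≤ 8
        blueSmall = On.size-T-K4 B R (R≢B ∘ sym) (N B) (λ p q ne → Sum.swap (two (N⊑ p) (N⊑ q) ne)) (no-triangle B nb) (nr ∘ has-⊑ N⊑)

    module Join {i : Colour} {P Q S : Subset} (P⊑ : P ⊑ S) (Q⊑ : Q ⊑ S) (j : Joined i P Q) where

      excludes : ∀ {s s′ d d′} → ¬ Has i (s + s′) (d + d′) S → Has i s d P → ¬ Has i s′ d′ Q
      excludes h p q = h (has-join P⊑ Q⊑ j p q)

    module Parts (S : Subset) (label : V → V)
      (hom : ∀ {x x′ y} → x ∈ₛ S → x′ ∈ₛ S → y ∈ₛ S → label x ≡ label x′ → label x ≢ label y → c x y ≡ c x′ y) where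

      cl : V → Subset
      cl x y = S y ∧ does (label x Fin.≟ label y)

      cl-in : ∀ {x y} → y ∈ₛ cl x → y ∈ₛ S × label x ≡ label y
      cl-in {x} {y} h with ∧-true {S y} h
      ... | s , d with label x Fin.≟ label y
      ...   | yes e = s , e

      cl-intro : ∀ {x y} → y ∈ₛ S → label x ≡ label y → y ∈ₛ cl x
      cl-intro {x} {y} s e = ∧-intro s (dec-true (label x Fin.≟ label y) e)

      cl-self : ∀ {x} → x ∈ₛ S → x ∈ₛ cl x
      cl-self s = cl-intro s refl

      -- Unions of classes. The partition restricts to such sets, so the arguments about neighbours
      -- can be repeated inside a neighbourhood.
      record Closed (Q : Subset) : Set where
        constructor closed
        field
          sub : Q ⊑ S
          saturated : ∀ {x y} → x ∈ₛ Q → y ∈ₛ S → label x ≡ label y → y ∈ₛ Q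

      open Closed

      S-closed : Closed S
      S-closed = closed id λ _ q _ → q

      cl-closed : ∀ x → Closed (cl x)
      cl-closed x = closed (proj₁ ∘ cl-in {x}) λ p q e → cl-intro q (trans (proj₂ (cl-in {x} p)) e)

      cl⊑ : ∀ {Q x} → Closed Q → x ∈ₛ Q → cl x ⊑ Q
      cl⊑ {x = x} cQ p q = let (s , e) = cl-in {x} q in saturated cQ p s e

      nb : Colour → V → Subset → Subset
      nb i x Q y = Q y ∧ (not (does (label x Fin.≟ label y)) ∧ adjacent i x y)

      nb-in : ∀ {i x Q y} → y ∈ₛ nb i x Q → y ∈ₛ Q × label x ≢ label y × c x y ≡ i
      nb-in {i} {x} {Q} {y} h with ∧-true {Q y} h
      ... | q , h′ with ∧-true {not (does (label x Fin.≟ label y))} h′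
      ...   | ne , a = q , (λ e → true≢false (dec-true (label x Fin.≟ label y) e) (not-true ne)) , adjacent-≡ a

      nb-intro : ∀ {i x} Q {y} → y ∈ₛ Q → label x ≢ label y → c x y ≡ i → y ∈ₛ nb i x Q
      nb-intro {i} {x} Q {y} q ne e = ∧-intro q (∧-intro (cong not (dec-false (label x Fin.≟ label y) ne)) (adjacent-true e))

      nb⊑ : ∀ {i x Q} → nb i x Q ⊑ Q
      nb⊑ {i} {x} {Q} h = proj₁ (nb-in {i} {x} {Q} h)

      nb-closed : ∀ {i x Q} → Closed Q → x ∈ₛ S → Closed (nb i x Q)
      nb-closed {i} {x} {Q} cQ p = closed (sub cQ ∘ nb⊑ {i} {x} {Q}) λ {y} {z} h s e →
        let (q , ne , a) = nb-in {i} {x} {Q} h in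
        nb-intro Q (saturated cQ q s e) (λ e′ → ne (trans e′ (sym e)))
          (trans (c-sym x z) (trans (sym (hom (sub cQ q) s p e (λ e′ → ne (sym e′)))) (trans (c-sym y x) a)))

      nb-joined : ∀ {i x Q} → Closed Q → x ∈ₛ S → Joined i (cl x) (nb i x Q)
      nb-joined {i} {x} {Q} cQ p {a} {y} ca h =
        let (s , e) = cl-in {x} ca ; (q , ne , a′) = nb-in {i} {x} {Q} h in
        (λ { refl → ne e }) , trans (sym (hom p s (sub cQ q) e ne)) a′

      module Dir (R B : Colour) (two : ∀ {x y} → x ∈ₛ S → y ∈ₛ S → label x ≢ label y → c x y ≡ R ⊎ c x y ≡ B) where

        cover : ∀ {Q x y} → Closed Q → x ∈ₛ Q → y ∈ₛ Q → y ∈ₛ cl x ⊎ y ∈ₛ nb R x Q ⊎ y ∈ₛ nb B x Q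
        cover {Q} {x} {y} cQ p q = case label x Fin.≟ label y of λ
          { (yes e) → inj₁ (cl-intro (sub cQ q) e)
          ; (no ne) → inj₂ ([ (λ e → inj₁ (nb-intro Q q ne e)) , (λ e → inj₂ (nb-intro Q q ne e)) ]′ (two (sub cQ p) (sub cQ q) ne)) }

        size-three : ∀ {Q x} → Closed Q → x ∈ₛ Q → size Q ≤ size (cl x) + size (nb R x Q) + size (nb B x Q)
        size-three {Q} {x} cQ p = size-cover₃ {Q} {cl x} {nb R x Q} {nb B x Q} (cover cQ p)

        data Split (Q : Subset) : Set where
          single : ∀ {x} → x ∈ₛ Q → Q ⊑ cl x → Split Q
          tiny : size Q ≤ 2 → Split Q
          join : ∀ {P P′ p p′} → Closed P → Closed P′ → P ⊑ Q → P′ ⊑ Q → p ∈ₛ P → p′ ∈ₛ P′ →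
                 (∀ {y} → y ∈ₛ Q → y ∈ₛ P ⊎ y ∈ₛ P′) → Joined B P P′ → Split Q

        -- A set without path of two R-edges is a class, a B-join, or tiny: an R-edge between two classes is a whole component.
        split : ∀ {Q} → Closed Q → Ok R E₁ Q → Split Q
        split {Q} cQ ok with member? Q
        ... | inj₂ none = tiny (≤-trans (≤-reflexive (size-empty Q none)) z≤n)
        ... | inj₁ (x , p) with Finₚ.any? (λ y → in? y Q ×-dec ¬? (label x Fin.≟ label y))
        ...   | no h = single p λ {y} q → case label x Fin.≟ label y of λ
                  { (yes e) → cl-intro (sub cQ q) e ; (no ne) → ⊥-elim (h (y , q , ne)) }
        ...   | yes (y , q , ne) with member? (nb R x Q)
        ...     | inj₂ none = join {P = cl x} {P′ = nb B x Q} {x} {y} (cl-closed x) (nb-closed cQ (sub cQ p)) (cl⊑ cQ p) (nb⊑ {B} {x} {Q}) (cl-self (sub cQ p))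
                    (other y q ne) (λ {w} r → [ inj₁ , [ (λ b → ⊥-elim (none {w} b)) , inj₂ ]′ ]′ (cover cQ p r)) (nb-joined cQ (sub cQ p))
          where
          other : ∀ y → y ∈ₛ Q → label x ≢ label y → y ∈ₛ nb B x Q
          other y q ne = [ (λ e → ⊥-elim (none {y} (nb-intro Q q ne e))) , nb-intro Q q ne ]′ (two (sub cQ p) (sub cQ q) ne)
        ...     | inj₁ (z , h) with nb-in {R} {x} {Q} h
        ...       | r , d , xz = result (member? P′)
          where
          P P′ : Subset
          P w = just x w ∨ just z w
          P′ w = Q w ∧ not (P w)
          x≢z : x ≢ z
          x≢z refl = d refl
          P-cases : ∀ w → w ∈ₛ P → w ≡ x ⊎ w ≡ z
          P-cases w m = Sum.map (just-≡ {x}) (just-≡ {z}) (∨-true m)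
          x∈P : x ∈ₛ P
          x∈P rewrite just-∈ x = refl
          z∈P : z ∈ₛ P
          z∈P with just x z
          ... | true = refl
          ... | false = just-∈ z
          P⊑Q : P ⊑ Q
          P⊑Q {w} m = [ (λ { refl → p }) , (λ { refl → r }) ]′ (P-cases w m)
          P-closed : Closed P
          P-closed = closed (sub cQ ∘ P⊑Q) sat
            where
            sat : ∀ {a b} → a ∈ₛ P → b ∈ₛ S → label a ≡ label b → b ∈ₛ P
            sat {a} {b} m s e with P-cases a m
            ... | inj₁ refl = case b Fin.≟ x of λ
              { (yes eq) → subst (_∈ₛ P) (sym eq) x∈P
              ; (no ne) → ⊥-elim (ok (has-path r p (saturated cQ p s e) (≢-sym x≢z) (λ { refl → d e }) (≢-sym ne)
                      (trans (c-sym z x) xz) (trans (c-sym z b) (trans (sym (hom (sub cQ p) s (sub cQ r) e d)) xz)))) }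
            ... | inj₂ refl = case b Fin.≟ z of λ
              { (yes eq) → subst (_∈ₛ P) (sym eq) z∈P
              ; (no ne) → ⊥-elim (ok (has-path p r (saturated cQ r s e) x≢z (λ { refl → d (sym e) }) (≢-sym ne) xz
                      (trans (c-sym x b) (trans (sym (hom (sub cQ r) s (sub cQ p) e (≢-sym d))) (trans (c-sym z x) xz))))) }
          P′-in : ∀ w → w ∈ₛ P′ → w ∈ₛ Q × ¬ w ∈ₛ P
          P′-in w m with ∧-true {Q w} m
          ... | q , np = q , λ m′ → true≢false m′ (not-true np)
          P′-intro : ∀ {w} → w ∈ₛ Q → ¬ w ∈ₛ P → w ∈ₛ P′
          P′-intro {w} q np with P w in eq
          ... | true = ⊥-elim (np refl)
          ... | false = ∧-intro q refl
          P′⊑Q : P′ ⊑ Q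
          P′⊑Q {w} m = proj₁ (P′-in w m)
          P′-closed : Closed P′
          P′-closed = closed (sub cQ ∘ P′⊑Q) λ {a} m s e → let (q , np) = P′-in a m in
            P′-intro (saturated cQ q s e) (λ m′ → np (saturated P-closed m′ (sub cQ q) (sym e)))
          parts : ∀ {w} → w ∈ₛ Q → w ∈ₛ P ⊎ w ∈ₛ P′
          parts {w} q with in? w P
          ... | yes m = inj₁ m
          ... | no np = inj₂ (P′-intro q np)
          joined : Joined B P P′
          joined {a} {b} m m′ with P-cases a m | P′-in b m′
          ... | inj₁ refl | q , np with two (sub cQ p) (sub cQ q) (λ e → np (saturated P-closed {x} x∈P (sub cQ q) e))
          ...   | inj₂ e = (λ { refl → np x∈P }) , e
          ...   | inj₁ e = ⊥-elim (ok (has-path p r q x≢z (λ { refl → np x∈P }) (λ { refl → np z∈P }) xz e))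
          joined {a} {b} m m′ | inj₂ refl | q , np with two (sub cQ r) (sub cQ q) (λ e → np (saturated P-closed {z} z∈P (sub cQ q) e))
          ...   | inj₂ e = (λ { refl → np z∈P }) , e
          ...   | inj₁ e = ⊥-elim (ok (has-path r p q (≢-sym x≢z) (λ { refl → np z∈P }) (λ { refl → np x∈P }) (trans (c-sym z x) xz) e))
          result : (∃ λ w → w ∈ₛ P′) ⊎ (∀ {w} → ¬ w ∈ₛ P′) → Split Q
          result (inj₁ (w , m)) = join {P = P} {P′} {x} {w} P-closed P′-closed P⊑Q P′⊑Q x∈P m parts (λ {a} {b} → joined {a} {b})
          result (inj₂ none) = tiny (≤-trans (size-cover {Q} {just x} {just z} λ {a} m → [ ∨-true , (λ m′ → ⊥-elim (none {a} m′)) ]′ (parts m))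
                                 (+-mono-≤ (size-just x) (size-just z)))

        -- Bounds for the classes in Q without B-edge, without J₃ and without J₄ in colour B.
        Bound : ℕ → ℕ → ℕ → Subset → Set
        Bound a b d Q = ∀ {x} → x ∈ₛ Q → (Ok B O (cl x) → size (cl x) ≤ a) × (Ok B E₁ (cl x) → size (cl x) ≤ b) × (Ok B E₂ (cl x) → size (cl x) ≤ d)

        module Bounded {a b d : ℕ} (2≤a : 2 ≤ a) (2≤b : 2 ≤ b) where

          size-O : ∀ {Q} → Closed Q → Ok R E₁ Q → Ok B O Q → Bound a b d Q → size Q ≤ a
          size-O {Q} cQ r o bd with split cQ r
          ... | single {x} p h = ≤-trans (size-mono {Q} {cl x} h) (proj₁ (bd p) (ok-⊑ O (cl⊑ cQ p) o))
          ... | tiny h = ≤-trans h 2≤a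
          ... | join _ _ P⊑ P′⊑ p p′ _ j = ⊥-elim (let (ne , e) = j p p′ in o (has-edge (P⊑ p) (P′⊑ p′) ne e))

          size-E₁ : ∀ {Q} → Closed Q → Ok R E₁ Q → Ok B E₁ Q → Bound a b d Q → size Q ≤ b
          size-E₁ {Q} cQ r o bd with split cQ r
          ... | single {x} p h = ≤-trans (size-mono {Q} {cl x} h) (proj₁ (proj₂ (bd p)) (ok-⊑ E₁ (cl⊑ cQ p) o))
          ... | tiny h = ≤-trans h 2≤b
          ... | join {P} {P′} _ _ P⊑ P′⊑ p p′ cov j = ≤-trans (size-cover {Q} {P} {P′} cov) (≤-trans (+-mono-≤
                  (small {B} {P} λ h → Join.excludes {B} {P} {P′} {Q} P⊑ P′⊑ j {2} {1} {1} {0} o h (has-one p′))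
                  (small {B} {P′} λ h → Join.excludes {B} {P′} {P} {Q} P′⊑ P⊑ (joined-sym {B} {P} {P′} j) {2} {1} {1} {0} o h (has-one p))) 2≤b)

          -- In a join by `B`, an edge of colour `B` on one side leaves a single vertex on the
          -- other, and the first side has no J₃: `b + 1`. Otherwise both sides are free of `B`:
          -- `a + a`.
          size-E₂ : ∀ {m Q} → d ≤ m → b + 1 ≤ m → a + a ≤ m → Closed Q → Ok R E₁ Q → Ok B E₂ Q → Bound a b d Q → size Q ≤ m
          size-E₂ {m} {Q} dm bm am cQ r o bd with split cQ r
          ... | single {x} p h = ≤-trans (size-mono {Q} {cl x} h) (≤-trans (proj₂ (proj₂ (bd p)) (ok-⊑ E₂ (cl⊑ cQ p) o)) dm)
          ... | tiny h = ≤-trans h (≤-trans 2≤a (≤-trans (m≤m+n a a) am))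
          ... | join {P} {P′} cP cP′ P⊑ P′⊑ p p′ cov j with has? B 2 0 P | has? B 2 0 P′
          ...   | yes h | _ = ≤-trans (size-cover {Q} {P} {P′} cov) (≤-trans (+-mono-≤
                    (size-E₁ cP (ok-⊑ E₁ P⊑ r) (λ h′ → Join.excludes {B} {P} {P′} {Q} P⊑ P′⊑ j {3} {1} {1} {0} o h′ (has-one p′)) (bd ∘ P⊑))
                    (small {B} {P′} (Join.excludes {B} {P} {P′} {Q} P⊑ P′⊑ j {2} {2} {0} {1} o h))) bm)
          ...   | no _ | yes h = ≤-trans (size-cover {Q} {P} {P′} cov) (≤-trans (+-mono-≤
                    (small {B} {P} (Join.excludes {B} {P′} {P} {Q} P′⊑ P⊑ (joined-sym {B} {P} {P′} j) {2} {2} {0} {1} o h))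
                    (size-E₁ cP′ (ok-⊑ E₁ P′⊑ r) (λ h′ → Join.excludes {B} {P′} {P} {Q} P′⊑ P⊑ (joined-sym {B} {P} {P′} j) {3} {1} {1} {0} o h′ (has-one p)) (bd ∘ P′⊑)))
                    (≤-trans (≤-reflexive (+-comm 1 b)) bm))
          ...   | no h | no h′ = ≤-trans (size-cover {Q} {P} {P′} cov) (≤-trans (+-mono-≤
                    (size-O cP (ok-⊑ E₁ P⊑ r) h (bd ∘ P⊑)) (size-O cP′ (ok-⊑ E₁ P′⊑ r) h′ (bd ∘ P′⊑))) am)

          -- In a join by `B`, a J₃ on one side forbids edges of `B` on the other, and the first
          -- side has no J₄: `m + a`. Otherwise neither side has a J₃: `b + b`.
          size-E₃ : ∀ {m M Q} → d ≤ m → b + 1 ≤ m → a + a ≤ m → m + a ≤ M → b + b ≤ M → Closed Q → Ok R E₁ Q → Ok B E₃ Q →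
                    (∀ {x} → x ∈ₛ Q → Ok B E₂ (cl x)) → Bound a b d Q → size Q ≤ M
          size-E₃ {m} {M} {Q} dm bm am mM bM cQ r o cl₂ bd with split cQ r
          ... | single {x} p h = ≤-trans (size-mono {Q} {cl x} h) (≤-trans (proj₂ (proj₂ (bd p)) (cl₂ p)) (≤-trans dm (≤-trans (m≤m+n m a) mM)))
          ... | tiny h = ≤-trans h (≤-trans 2≤b (≤-trans (m≤m+n b b) bM))
          ... | join {P} {P′} cP cP′ P⊑ P′⊑ p p′ cov j with has? B 3 1 P | has? B 3 1 P′
          ...   | yes h | _ = ≤-trans (size-cover {Q} {P} {P′} cov) (≤-trans (+-mono-≤
                    (size-E₂ dm bm am cP (ok-⊑ E₁ P⊑ r) (λ h′ → Join.excludes {B} {P} {P′} {Q} P⊑ P′⊑ j {4} {1} {1} {0} o h′ (has-one p′)) (bd ∘ P⊑))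
                    (size-O cP′ (ok-⊑ E₁ P′⊑ r) (Join.excludes {B} {P} {P′} {Q} P⊑ P′⊑ j {3} {2} {1} {0} o h) (bd ∘ P′⊑))) mM)
          ...   | no _ | yes h = ≤-trans (size-cover {Q} {P} {P′} cov) (≤-trans (+-mono-≤
                    (size-O cP (ok-⊑ E₁ P⊑ r) (Join.excludes {B} {P′} {P} {Q} P′⊑ P⊑ (joined-sym {B} {P} {P′} j) {3} {2} {1} {0} o h) (bd ∘ P⊑))
                    (size-E₂ dm bm am cP′ (ok-⊑ E₁ P′⊑ r) (λ h′ → Join.excludes {B} {P′} {P} {Q} P′⊑ P⊑ (joined-sym {B} {P} {P′} j) {4} {1} {1} {0} o h′ (has-one p)) (bd ∘ P′⊑)))
                    (≤-trans (≤-reflexive (+-comm a m)) mM))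
          ...   | no h | no h′ = ≤-trans (size-cover {Q} {P} {P′} cov) (≤-trans (+-mono-≤
                    (size-E₁ cP (ok-⊑ E₁ P⊑ r) h (bd ∘ P⊑)) (size-E₁ cP′ (ok-⊑ E₁ P′⊑ r) h′ (bd ∘ P′⊑))) bM)

    -- Partitions in two colours: bounds for unions of classes.

    module Primes (S : Subset) (label : V → V)
      (hom : ∀ {x x′ y} → x ∈ₛ S → x′ ∈ₛ S → y ∈ₛ S → label x ≡ label x′ → label x ≢ label y → c x y ≡ c x′ y)
      (x₀ x₁ : ℕ) (sizes : Sizes x₀ x₁) where
      open Parts S label hom public
      open Sizes sizes

      -- Each colour without J₄ costs a factor 3, while a colour without J₃ only replaces `x₀` by
      -- `x₁`.
      record Bounds (R B : Colour) : Set where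
        field
          OO : ∀ {x} → x ∈ₛ S → Ok R O (cl x) → Ok B O (cl x) → size (cl x) ≤ x₀
          E₁E₁ : ∀ {x} → x ∈ₛ S → Ok R E₁ (cl x) → Ok B E₁ (cl x) → size (cl x) ≤ x₁
          OE₂ : ∀ {x} → x ∈ₛ S → Ok R O (cl x) → Ok B E₂ (cl x) → size (cl x) ≤ 3 * x₀
          E₂O : ∀ {x} → x ∈ₛ S → Ok R E₂ (cl x) → Ok B O (cl x) → size (cl x) ≤ 3 * x₀
          E₁E₂ : ∀ {x} → x ∈ₛ S → Ok R E₁ (cl x) → Ok B E₂ (cl x) → size (cl x) ≤ 3 * x₁
          E₂E₁ : ∀ {x} → x ∈ₛ S → Ok R E₂ (cl x) → Ok B E₁ (cl x) → size (cl x) ≤ 3 * x₁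
          E₂E₂ : ∀ {x} → x ∈ₛ S → Ok R E₂ (cl x) → Ok B E₂ (cl x) → size (cl x) ≤ 9 * x₀

      swap-bounds : ∀ {R B} → Bounds R B → Bounds B R
      swap-bounds b = record
        { OO = λ s p q → OO s q p ; E₁E₁ = λ s p q → E₁E₁ s q p ; OE₂ = λ s p q → E₂O s q p ; E₂O = λ s p q → OE₂ s q p
        ; E₁E₂ = λ s p q → E₂E₁ s q p ; E₂E₁ = λ s p q → E₁E₂ s q p ; E₂E₂ = λ s p q → E₂E₂ s q p }
        where open Bounds b

      record Setting (R B : Colour) : Set where
        field
          R≢B : R ≢ B
          two : ∀ {x y} → x ∈ₛ S → y ∈ₛ S → label x ≢ label y → c x y ≡ R ⊎ c x y ≡ B
          bounds : Bounds R B
          R₂ : ∀ {x} → x ∈ₛ S → Ok R E₂ (cl x)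
          B₂ : ∀ {x} → x ∈ₛ S → Ok B E₂ (cl x)

      swap-setting : ∀ {R B} → Setting R B → Setting B R
      swap-setting s = record { R≢B = R≢B ∘ sym ; two = λ p q ne → Sum.swap (two p q ne) ; bounds = swap-bounds bounds ; R₂ = B₂ ; B₂ = R₂ }
        where open Setting s

      OneColoured Flat : Colour → Colour → Subset → Set
      OneColoured R B Q = ∀ {x} → x ∈ₛ Q → Ok R O (cl x) ⊎ Ok B O (cl x)
      Flat R B Q = ∀ {x} → x ∈ₛ Q → Ok R O (cl x) × Ok B O (cl x)

      Free : Colour → Subset → Set
      Free i Q = ∀ {x} → x ∈ₛ Q → Ok i O (cl x)

      2≤x₁ : 2 ≤ x₁
      2≤x₁ = ≤-trans two≤ lower

      M₂₃ : ℕ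
      M₂₃ = 9 * x₀ ⊔ (3 * x₁ + 4 * x₀)

      module Basic {R B : Colour} (setting : Setting R B) where
        open Setting setting
        open Bounds bounds
        open Dir R B two public
        open Closed

        class-ok : ∀ {Q x i} s → Closed Q → x ∈ₛ Q → Ok i s Q → Ok i s (cl x)
        class-ok s cQ p = ok-⊑ s (cl⊑ cQ p)

        bound-O : ∀ {Q} → Closed Q → Ok R O Q → Bound x₀ x₁ (3 * x₀) Q
        bound-O cQ r p = OO (sub cQ p) r′ , E₁E₁ (sub cQ p) (ok-O-E₁ r′) , OE₂ (sub cQ p) r′
          where r′ = class-ok O cQ p r

        O-E₂ : ∀ {Q} → Closed Q → Ok R O Q → Ok B E₂ Q → size Q ≤ 3 * x₀
        O-E₂ cQ r b = Bounded.size-E₂ two≤ 2≤x₁ ≤-refl plus-one (≤-trans (m≤m+n _ x₀) (≤-reflexive (sym three))) cQ (ok-O-E₁ r) b (bound-O cQ r)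

        O-E₃ : ∀ {Q} → Closed Q → Ok R O Q → Ok B E₃ Q → size Q ≤ 4 * x₀
        O-E₃ cQ r b = Bounded.size-E₃ two≤ 2≤x₁ ≤-refl plus-one (≤-trans (m≤m+n _ x₀) (≤-reflexive (sym three)))
          (≤-reflexive (+-comm (3 * x₀) x₀)) (≤-trans (+-mono-≤ upper upper) (≤-reflexive (eq x₀))) cQ (ok-O-E₁ r) b (λ p → B₂ (sub cQ p)) (bound-O cQ r)
          where
          eq : ∀ x → x + x + (x + x) ≡ 4 * x
          eq = solve-∀

        three₁ : x₁ + x₁ ≤ 3 * x₁
        three₁ = ≤-trans (m≤m+n (x₁ + x₁) x₁) (≤-reflexive (eq x₁))
          where
          eq : ∀ x → x + x + x ≡ 3 * x
          eq = solve-∀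

        one₁ : x₁ + 1 ≤ x₁ + x₁
        one₁ = +-monoʳ-≤ x₁ (≤-trans one≤ lower)

        bound-E₁ : ∀ {Q} → Closed Q → Ok R E₁ Q → Bound x₁ x₁ (3 * x₁) Q
        bound-E₁ cQ r p = E₁E₁ (sub cQ p) r′ ∘ ok-O-E₁ , E₁E₁ (sub cQ p) r′ , E₁E₂ (sub cQ p) r′
          where r′ = class-ok E₁ cQ p r

        E₁-E₂ : ∀ {Q} → Closed Q → Ok R E₁ Q → Ok B E₂ Q → size Q ≤ 3 * x₁
        E₁-E₂ cQ r b = Bounded.size-E₂ 2≤x₁ 2≤x₁ ≤-refl (≤-trans one₁ three₁) three₁ cQ r b (bound-E₁ cQ r)

        E₁-E₃ : ∀ {Q} → Closed Q → Ok R E₁ Q → Ok B E₃ Q → size Q ≤ 4 * x₁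
        E₁-E₃ cQ r b = Bounded.size-E₃ 2≤x₁ 2≤x₁ ≤-refl (≤-trans one₁ three₁) three₁ (≤-reflexive (+-comm (3 * x₁) x₁))
          (≤-trans three₁ (m≤n+m _ x₁)) cQ r b (λ p → B₂ (sub cQ p)) (bound-E₁ cQ r)

        one-coloured-E₁-E₃ : ∀ {Q} → Closed Q → OneColoured R B Q → Ok R E₁ Q → Ok B E₃ Q → size Q ≤ (3 * x₀ ⊔ (x₁ + x₁)) + x₁
        one-coloured-E₁-E₃ {Q} cQ oc r b = Bounded.size-E₃ 2≤x₁ 2≤x₁ ≤-refl (≤-trans one₁ (m≤n⊔m (3 * x₀) _)) (m≤n⊔m (3 * x₀) _) ≤-refl
          (≤-trans (m≤n⊔m (3 * x₀) (x₁ + x₁)) (m≤m+n _ x₁)) cQ r b (λ p → B₂ (sub cQ p)) bd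
          where
          bd : Bound x₁ x₁ (3 * x₀ ⊔ (x₁ + x₁)) Q
          bd {x} p = E₁E₁ (sub cQ p) r′ ∘ ok-O-E₁ , E₁E₁ (sub cQ p) r′ , λ b₂ → [
              (λ rO → ≤-trans (OE₂ (sub cQ p) rO b₂) (m≤m⊔n _ _)) ,
              (λ bO → ≤-trans (E₁E₁ (sub cQ p) r′ (ok-O-E₁ bO)) (≤-trans (m≤m+n x₁ x₁) (m≤n⊔m (3 * x₀) _))) ]′ (oc p)
            where r′ = class-ok E₁ cQ p r

        flat-bound : ∀ {Q} → Closed Q → Flat R B Q → Bound x₀ x₀ x₀ Q
        flat-bound cQ fl p = (λ _ → h) , (λ _ → h) , (λ _ → h)
          where h = OO (sub cQ p) (proj₁ (fl p)) (proj₂ (fl p))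

        two-x₀ : x₀ + x₀ ≤ 2 * x₀
        two-x₀ = ≤-reflexive (cong (x₀ +_) (sym (+-identityʳ x₀)))

        flat-E₁-E₂ : ∀ {Q} → Closed Q → Flat R B Q → Ok R E₁ Q → Ok B E₂ Q → size Q ≤ 2 * x₀
        flat-E₁-E₂ cQ fl r b = Bounded.size-E₂ two≤ two≤ (m≤m+n x₀ _) (≤-trans (+-monoʳ-≤ x₀ one≤) two-x₀) two-x₀ cQ r b (flat-bound cQ fl)

        flat-E₁-E₃ : ∀ {Q} → Closed Q → Flat R B Q → Ok R E₁ Q → Ok B E₃ Q → size Q ≤ 3 * x₀
        flat-E₁-E₃ cQ fl r b = Bounded.size-E₃ two≤ two≤ (m≤m+n x₀ _) (≤-trans (+-monoʳ-≤ x₀ one≤) two-x₀) two-x₀ (≤-reflexive (eq x₀))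
          (≤-trans two-x₀ (*-monoˡ-≤ x₀ {2} {3} (s≤s (s≤s z≤n)))) cQ r b (λ p → B₂ (sub cQ p)) (flat-bound cQ fl)
          where
          eq : ∀ x → 2 * x + x ≡ 3 * x
          eq = solve-∀

        free-E₁-E₂ : ∀ {Q} → Closed Q → Free B Q → Ok R E₁ Q → Ok B E₂ Q → size Q ≤ x₁ + x₁
        free-E₁-E₂ {Q} cQ fr r b = Bounded.size-E₂ 2≤x₁ 2≤x₁ (m≤m+n x₁ x₁) one₁ ≤-refl cQ r b bd
          where
          bd : Bound x₁ x₁ x₁ Q
          bd p = (λ _ → h) , (λ _ → h) , (λ _ → h)
            where h = E₁E₁ (sub cQ p) (class-ok E₁ cQ p r) (ok-O-E₁ (fr p))

        free-O-E₂ : ∀ {Q} → Closed Q → Free B Q → Ok R O Q → Ok B E₂ Q → size Q ≤ 2 * x₀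
        free-O-E₂ cQ fr r b = flat-E₁-E₂ cQ (λ p → class-ok O cQ p r , fr p) (ok-O-E₁ r) b

        pure-pairs : ∀ {Q} → Closed Q → (∀ {x} → x ∈ₛ Q → ¬ Has R 2 1 (cl x)) → ∀ {x y} → x ∈ₛ Q → y ∈ₛ Q → x ≢ y → c x y ≡ R ⊎ c x y ≡ B
        pure-pairs cQ h {x} {y} p q ne = two (sub cQ p) (sub cQ q) λ e → h p (has-two (cl-self (sub cQ p)) (cl-intro (sub cQ q) e) ne)

        find-class : ∀ s d Q → (∃ λ x → x ∈ₛ Q × Has R s d (cl x)) ⊎ (∀ {x} → x ∈ₛ Q → ¬ Has R s d (cl x))
        find-class s d Q with Finₚ.any? (λ x → in? x Q ×-dec has? R s d (cl x))
        ... | yes h = inj₁ h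
        ... | no h = inj₂ λ {x} p q → h (x , p , q)

      module Half {R B : Colour} (setting : Setting R B) where
        open Setting setting
        open Bounds bounds
        open Closed
        open Basic setting

        -- If all classes are single vertices, the Ramsey number of J₄ gives 9, and `2 ≤ x₀`
        -- suffices. Otherwise a class with two vertices leaves no edge of the respective colour in
        -- either of its neighbourhoods, and the sum is x₀ + 2x₀ + 2x₀.
        flat-22 : ∀ {Q} → Closed Q → Flat R B Q → Ok R E₂ Q → Ok B E₂ Q → size Q ≤ 5 * x₀
        flat-22 {Q} cQ fl r b with find-class 2 1 Q
        ... | inj₂ none = ≤-trans (On.size-44 R B R≢B Q (pure-pairs cQ none) r b) (≤-trans (n≤1+n 9) (*-monoʳ-≤ 5 two≤))
        ... | inj₁ (x , p , h) = ≤-trans (size-three cQ p) (≤-trans (+-mono-≤ (+-mono-≤ (OO (sub cQ p) (proj₁ (fl p)) (proj₂ (fl p)))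
                (flat-E₁-E₂ cU (fl ∘ nb⊑ {R} {x} {Q}) (ok-O-E₁ (λ h′ → r (has-join (cl⊑ cQ p) (nb⊑ {R} {x} {Q}) (nb-joined cQ (sub cQ p)) h h′))) (ok-⊑ E₂ (nb⊑ {R} {x} {Q}) b)))
                (Basic.flat-E₁-E₂ (swap-setting setting) cW (λ q → let (u , v) = fl (nb⊑ {B} {x} {Q} q) in v , u)
                  (ok-O-E₁ (λ h′ → b (has-join (cl⊑ cQ p) (nb⊑ {B} {x} {Q}) (nb-joined cQ (sub cQ p)) (has-two₂ h) h′))) (ok-⊑ E₂ (nb⊑ {B} {x} {Q}) r)))
                (≤-reflexive (eq x₀)))
          where
          cU = nb-closed {R} {x} {Q} cQ (sub cQ p)
          cW = nb-closed {B} {x} {Q} cQ (sub cQ p)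
          eq : ∀ x → x + 2 * x + 2 * x ≡ 5 * x
          eq = solve-∀
          has-two₂ : ∀ {S} → Has R 2 1 S → Has B 2 1 S
          has-two₂ (has (x ∷ y ∷ []) ((ne ∷ []) ∷ _) (p ∷ q ∷ []) refl _) = has-two p q ne

        has-pair : ∀ {i S} j → Has i 2 0 S → Has j 2 1 S
        has-pair j h = let (x , y , p , q , ne , _) = edge-of h in has-two p q ne

        -- An edge of colour `R` in the class leaves at most one vertex in its red neighbourhood. If
        -- there is one, the class has no J₃ in `R`, so class and neighbour together number at most
        -- x₁ + 1 ≤ 3x₀; if there is none, the class has at most 3x₀ by itself.
        red-22 : ∀ {Q x} → Closed Q → x ∈ₛ Q → Has R 2 0 (cl x) → Ok B O (cl x) → Ok R E₂ Q → Ok B E₂ Q → size Q ≤ 6 * x₀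
        red-22 {Q} {x} cQ p h bO r b with member? (nb R x Q)
        ... | inj₂ none = ≤-trans (size-three cQ p) (≤-trans (+-mono-≤ (+-mono-≤ (E₂O (sub cQ p) (R₂ (sub cQ p)) bO) (≤-reflexive (size-empty _ none))) W-small)
                (≤-reflexive (eq x₀)))
          where
          eq : ∀ x → 3 * x + 0 + 3 * x ≡ 6 * x
          eq = solve-∀
          W-small : size (nb B x Q) ≤ 3 * x₀
          W-small = Basic.O-E₂ (swap-setting setting) (nb-closed cQ (sub cQ p)) (λ h′ → b (has-join (cl⊑ cQ p) (nb⊑ {B} {x} {Q}) (nb-joined cQ (sub cQ p)) (has-pair B h) h′)) (ok-⊑ E₂ (nb⊑ {B} {x} {Q}) r)
        ... | inj₁ (y , q) = ≤-trans (size-three cQ p) (≤-trans (+-mono-≤ (+-mono-≤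
                (E₁E₁ (sub cQ p) (λ h′ → r (has-join (cl⊑ cQ p) (nb⊑ {R} {x} {Q}) (nb-joined cQ (sub cQ p)) h′ (has-one {x = y} q))) (ok-O-E₁ bO))
                (small {R} λ h′ → r (has-join (cl⊑ cQ p) (nb⊑ {R} {x} {Q}) (nb-joined cQ (sub cQ p)) h h′))) W-small)
                (≤-trans (+-monoˡ-≤ (3 * x₀) plus-one) (≤-reflexive (eq x₀))))
          where
          eq : ∀ x → 3 * x + 3 * x ≡ 6 * x
          eq = solve-∀
          W-small : size (nb B x Q) ≤ 3 * x₀
          W-small = Basic.O-E₂ (swap-setting setting) (nb-closed cQ (sub cQ p)) (λ h′ → b (has-join (cl⊑ cQ p) (nb⊑ {B} {x} {Q}) (nb-joined cQ (sub cQ p)) (has-pair B h) h′)) (ok-⊑ E₂ (nb⊑ {B} {x} {Q}) r)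

      module Full {R B : Colour} (setting : Setting R B) where
        open Setting setting
        open Bounds bounds
        open Closed
        open Basic setting
        open Half setting public

        free-colour : ∀ {Q x} → x ∈ₛ Q → OneColoured R B Q → Has R 2 0 (cl x) → Ok B O (cl x)
        free-colour p oc h = [ (λ f → ⊥-elim (f h)) , id ]′ (oc p)

        one-coloured-22 : ∀ {Q} → Closed Q → OneColoured R B Q → Ok R E₂ Q → Ok B E₂ Q → size Q ≤ 6 * x₀
        one-coloured-22 {Q} cQ oc r b with find-class 2 0 Q
        ... | inj₁ (x , p , h) = red-22 cQ p h (free-colour p oc h) r b
        ... | inj₂ noR with Basic.find-class (swap-setting setting) 2 0 Q
        ...   | inj₁ (x , p , h) = Half.red-22 (swap-setting setting) cQ p h (noR p) b r
        ...   | inj₂ noB = ≤-trans (flat-22 cQ (λ p → noR p , noB p) r b) (*-monoˡ-≤ x₀ {5} {6} (n≤1+n 5))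

        nine : ∀ x → 3 * x + 6 * x ≡ 9 * x
        nine = solve-∀

        -- The cases are a class with an edge of `R`, a class with an edge of `B`, single vertices
        -- only, and flat classes of which one has two vertices. Only the second reaches the term
        -- 3x₁ + 4x₀ of the maximum.
        one-coloured-23 : ∀ {Q} → Closed Q → OneColoured R B Q → Ok R E₂ Q → Ok B E₃ Q → size Q ≤ M₂₃
        one-coloured-23 {Q} cQ oc r b with find-class 2 0 Q
        ... | inj₁ (x , p , h) = ≤-trans (≤-trans (size-three cQ p) (≤-trans (+-monoʳ-≤ _ W-small) head-small)) (m≤m⊔n _ _)
          where
          bO = free-colour p oc h
          cW = nb-closed {B} {x} {Q} cQ (sub cQ p)
          W-small : size (nb B x Q) ≤ 6 * x₀
          W-small = one-coloured-22 cW (oc ∘ nb⊑ {B} {x} {Q}) (ok-⊑ E₂ (nb⊑ {B} {x} {Q}) r)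
            (ok-T-E₂ λ h′ → b (has-join (cl⊑ cQ p) (nb⊑ {B} {x} {Q}) (nb-joined cQ (sub cQ p)) (has-pair B h) h′))
          head-small : size (cl x) + size (nb R x Q) + 6 * x₀ ≤ 9 * x₀
          head-small with member? (nb R x Q)
          ... | inj₂ none = ≤-trans (+-monoˡ-≤ (6 * x₀) (≤-trans (+-mono-≤ (E₂O (sub cQ p) (R₂ (sub cQ p)) bO) (≤-reflexive (size-empty _ none))) (≤-reflexive (+-identityʳ _)))) (≤-reflexive (nine x₀))
          ... | inj₁ (y , q) = ≤-trans (+-monoˡ-≤ (6 * x₀) (≤-trans (+-mono-≤
                  (E₁E₁ (sub cQ p) (λ h′ → r (has-join (cl⊑ cQ p) (nb⊑ {R} {x} {Q}) (nb-joined cQ (sub cQ p)) h′ (has-one {x = y} q))) (ok-O-E₁ bO))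
                  (small {R} λ h′ → r (has-join (cl⊑ cQ p) (nb⊑ {R} {x} {Q}) (nb-joined cQ (sub cQ p)) h h′))) plus-one)) (≤-reflexive (nine x₀))
        ... | inj₂ noR with Basic.find-class (swap-setting setting) 2 0 Q
        ...   | inj₁ (x , p , h) = ≤-trans (size-three cQ p) (rest (has? B 2 0 (nb B x Q)))
          where
          cU = nb-closed {R} {x} {Q} cQ (sub cQ p)
          cW = nb-closed {B} {x} {Q} cQ (sub cQ p)
          U-small : size (nb R x Q) ≤ 4 * x₀
          U-small = O-E₃ cU (λ h′ → r (has-join (cl⊑ cQ p) (nb⊑ {R} {x} {Q}) (nb-joined cQ (sub cQ p)) (has-pair R h) h′)) (ok-⊑ E₃ (nb⊑ {R} {x} {Q}) b)
          W₁ : Ok B E₁ (nb B x Q)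
          W₁ h′ = b (has-join (cl⊑ cQ p) (nb⊑ {B} {x} {Q}) (nb-joined cQ (sub cQ p)) h h′)
          rest : Dec (Has B 2 0 (nb B x Q)) → size (cl x) + size (nb R x Q) + size (nb B x Q) ≤ M₂₃
          -- An edge of `B` in the blue neighbourhood excludes a J₃ of `B` from the class, which
          -- lowers its bound from 3x₀ to x₁ but raises that of the neighbourhood from 2x₀ to 2x₁.
          rest (yes h′) = ≤-trans (+-mono-≤ (+-mono-≤ (E₁E₁ (sub cQ p) (ok-O-E₁ (noR p))
                  (λ h″ → b (has-join (nb⊑ {B} {x} {Q}) (cl⊑ cQ p) (joined-sym {B} {cl x} {nb B x Q} (nb-joined cQ (sub cQ p))) h′ h″))) U-small)
                  (Basic.free-E₁-E₂ (swap-setting setting) cW (noR ∘ nb⊑ {B} {x} {Q}) W₁ (ok-⊑ E₂ (nb⊑ {B} {x} {Q}) r)))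
                  (≤-trans (≤-reflexive (eq x₀ x₁)) (m≤n⊔m (9 * x₀) _))
            where
            eq : ∀ x y → y + 4 * x + (y + y) ≡ 3 * y + 4 * x
            eq = solve-∀
          rest (no h′) = ≤-trans (+-mono-≤ (+-mono-≤ (OE₂ (sub cQ p) (noR p) (B₂ (sub cQ p))) U-small)
                  (Basic.free-O-E₂ (swap-setting setting) cW (noR ∘ nb⊑ {B} {x} {Q}) h′ (ok-⊑ E₂ (nb⊑ {B} {x} {Q}) r)))
                  (≤-trans (≤-reflexive (eq x₀)) (m≤m⊔n (9 * x₀) _))
            where
            eq : ∀ x → 3 * x + 4 * x + 2 * x ≡ 9 * x
            eq = solve-∀
        ...   | inj₂ noB with find-class 2 1 Q
        ...     | inj₂ none = ≤-trans (On.size-45 R B R≢B Q (pure-pairs cQ none) r b)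
                    (≤-trans (≤-trans (m≤m+n 12 6) (*-monoʳ-≤ 9 two≤)) (m≤m⊔n _ _))
        ...     | inj₁ (x , p , h) = ≤-trans (≤-trans (size-three cQ p) (≤-trans (+-mono-≤ (+-mono-≤ (OO (sub cQ p) (noR p) (noB p))
                  (flat-E₁-E₃ cU (fl ∘ nb⊑ {R} {x} {Q}) (ok-O-E₁ λ h′ → r (has-join (cl⊑ cQ p) (nb⊑ {R} {x} {Q}) (nb-joined cQ (sub cQ p)) h h′)) (ok-⊑ E₃ (nb⊑ {R} {x} {Q}) b)))
                  (flat-22 cW (fl ∘ nb⊑ {B} {x} {Q}) (ok-⊑ E₂ (nb⊑ {B} {x} {Q}) r)
                    (ok-T-E₂ λ h′ → b (has-join (cl⊑ cQ p) (nb⊑ {B} {x} {Q}) (nb-joined cQ (sub cQ p)) (pair B h) h′)))) (≤-reflexive (eq x₀)))) (m≤m⊔n _ _)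
          where
          cU = nb-closed {R} {x} {Q} cQ (sub cQ p)
          cW = nb-closed {B} {x} {Q} cQ (sub cQ p)
          fl : Flat R B Q
          fl q = noR q , noB q
          pair : ∀ {S} j → Has R 2 1 S → Has j 2 1 S
          pair j (has (x ∷ y ∷ []) ((ne ∷ []) ∷ _) (p ∷ q ∷ []) refl _) = has-two p q ne
          eq : ∀ x → x + 3 * x + 5 * x ≡ 9 * x
          eq = solve-∀

    size-disjoint : ∀ {P Q U} → P ⊑ U → Q ⊑ U → (∀ {x} → x ∈ₛ P → ¬ x ∈ₛ Q) → size P + size Q ≤ size U
    size-disjoint {P} {Q} {U} p q d = go vs
      where
      one : ∀ x → bit (P x) + bit (Q x) ≤ bit (U x)
      one x with P x in eq | Q x in eq′
      ... | true | true = ⊥-elim (d eq eq′)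
      ... | true | false rewrite p eq = s≤s z≤n
      ... | false | true rewrite q eq′ = s≤s z≤n
      ... | false | false = z≤n
      swap : ∀ a b c d → a + b + (c + d) ≡ a + c + (b + d)
      swap = solve-∀
      go : ∀ xs → cnt P xs + cnt Q xs ≤ cnt U xs
      go [] = z≤n
      go (x ∷ xs) = ≤-trans (≤-reflexive (swap (bit (P x)) (cnt P xs) (bit (Q x)) (cnt Q xs))) (+-mono-≤ (one x) (go xs))

    size-just-≥ : ∀ v → 1 ≤ size (just v)
    size-just-≥ v = ≤-trans (∈-length′ (∈-elements {just v} {v} (just-∈ v))) (≤-reflexive (size-elements (just v)))
      where
      ∈-length′ : ∀ {L : List V} {x} → x ∈ L → 1 ≤ length L
      ∈-length′ (here _) = s≤s z≤n
      ∈-length′ (there _) = s≤s z≤n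

    fromList : List V → Subset
    fromList [] x = false
    fromList (y ∷ L) x = just y x ∨ fromList L x

    ∈-fromList : ∀ {x} L → x ∈ L → x ∈ₛ fromList L
    ∈-fromList (x ∷ L) (here refl) rewrite just-∈ x = refl
    ∈-fromList {x} (y ∷ L) (there m) with just y x
    ... | true = refl
    ... | false = ∈-fromList L m

    fromList-∈ : ∀ {x} L → x ∈ₛ fromList L → x ∈ L
    fromList-∈ {x} (y ∷ L) h with ∨-true {just y x} h
    ... | inj₁ p = here (just-≡ {y} p)
    ... | inj₂ q = there (fromList-∈ L q)

    fromList-≤ : ∀ L → size (fromList L) ≤ length L
    fromList-≤ [] = ≤-reflexive (size-empty (fromList []) λ ())
    fromList-≤ (y ∷ L) = ≤-trans (size-cover {fromList (y ∷ L)} {just y} {fromList L} (λ {x} → ∨-true {just y x})) (+-mono-≤ (size-just y) (fromList-≤ L))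

    fromList-≥ : ∀ L → Unique L → length L ≤ size (fromList L)
    fromList-≥ [] u = z≤n
    fromList-≥ (y ∷ L) (ny ∷ u) = ≤-trans (+-mono-≤ (size-just-≥ y) (fromList-≥ L u))
      (size-disjoint {just y} {fromList L} {fromList (y ∷ L)} (λ {x} p → ∈-fromList (y ∷ L) (here (just-≡ {y} p)))
        (λ {x} p → ∈-fromList (y ∷ L) (there (fromList-∈ L p))) λ {x} p q → All.lookup ny (fromList-∈ L q) (sym (just-≡ {y} p)))

    list-size : ∀ {P} C → Unique C → All (_∈ₛ P) C → length C ≤ size P
    list-size {P} C u a = ≤-trans (fromList-≥ C u) (size-mono {fromList C} {P} λ m → All.lookup a (fromList-∈ C m))

    clique-pair : ∀ {i} C → miss (adjacent i) C ≡ 0 → ∀ {p q} → p ∈ C → q ∈ C → p ≢ q → c p q ≡ i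
    clique-pair (x ∷ C) m (here refl) (here refl) ne = ⊥-elim (ne refl)
    clique-pair {i} (x ∷ C) m (here refl) (there j) ne = row C (m+n≡0⇒m≡0 _ m) j
      where
      row : ∀ C → lack (adjacent i) x C ≡ 0 → ∀ {q} → q ∈ C → c x q ≡ i
      row (y ∷ C) l (here refl) with adjacent i x y in eq
      ... | true = adjacent-≡ eq
      row (y ∷ C) l (there j) = row C (m+n≡0⇒n≡0 (pen (adjacent i x y)) l) j
    clique-pair (x ∷ C) m {p} (there j) (here refl) ne = trans (c-sym p x) (clique-pair (x ∷ C) m (here refl) (there j) (≢-sym ne))
    clique-pair {i} (x ∷ C) m (there j) (there j′) ne = clique-pair C (m+n≡0⇒n≡0 (lack (adjacent i) x C) m) j j′ ne

    -- Prime partitions, in which every vertex sees both colours outside its class.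

    module Prime (S : Subset) (label : V → V)
      (hom : ∀ {x x′ y} → x ∈ₛ S → x′ ∈ₛ S → y ∈ₛ S → label x ≡ label x′ → label x ≢ label y → c x y ≡ c x′ y)
      (x₀ x₁ : ℕ) (sizes : Sizes x₀ x₁) where
      open Primes S label hom x₀ x₁ sizes public
      open Sizes sizes

      Out : Colour → Set
      Out i = ∀ {x} → x ∈ₛ S → ∃ λ y → y ∈ₛ nb i x S

      cl-S : ∀ {x} → x ∈ₛ S → cl x ⊑ S
      cl-S p = cl⊑ S-closed p

      module _ {i : Colour} {x : V} (p : x ∈ₛ S) where
        around : ∀ {s d s′ d′} → ¬ Has i (s + s′) (d + d′) S → Has i s d (cl x) → ¬ Has i s′ d′ (nb i x S)
        around h a b = h (has-join (cl-S p) (nb⊑ {i} {x} {S}) (nb-joined S-closed p) a b)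

        around′ : ∀ {s d s′ d′} → ¬ Has i (s + s′) (d + d′) S → Has i s d (nb i x S) → ¬ Has i s′ d′ (cl x)
        around′ h b a = h (has-join (nb⊑ {i} {x} {S}) (cl-S p) (joined-sym {i} {cl x} {nb i x S} (nb-joined S-closed p)) b a)

        class-E₁ : Out i → Ok i E₂ S → Ok i E₁ (cl x)
        class-E₁ out ok h = around {3} {1} {1} {0} ok h (has-one (proj₂ (out p)))

        class-E₂ : Out i → Ok i E₃ S → Ok i E₂ (cl x)
        class-E₂ out ok h = around {4} {1} {1} {0} ok h (has-one (proj₂ (out p)))

      -- One inequality for each configuration around a class: `r₁` to `r₃` for a class with edges
      -- of both colours (`r₁` also for flat partitions), `r₄` and `r₅` for a class with edges of
      -- one colour.
      record Room (Y : ℕ) : Set where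
        field
          r₁ : 17 * x₀ ≤ Y
          r₂ : 9 * x₁ ≤ Y
          r₃ : 7 * x₁ + 4 * x₀ ≤ Y
          r₄ : 7 * x₀ + M₂₃ ≤ Y
          r₅ : x₁ + (3 * x₀ ⊔ (x₁ + x₁) + x₁) + M₂₃ ≤ Y

      module Setup {R B : Colour} (setting : Setting R B) (outR : Out R) (outB : Out B) where
        open Setting setting
        open Bounds bounds
        open Basic setting
        open Full setting public

        nbs-closed : ∀ i {x} → x ∈ₛ S → Closed (nb i x S)
        nbs-closed i p = nb-closed S-closed p

        top-22-red : Ok R E₂ S → Ok B E₂ S → ∀ {x} → x ∈ₛ S → Has R 2 0 (cl x) → size S ≤ 6 * x₀
        top-22-red r b {x} p h = ≤-trans (size-three S-closed p) (≤-trans (+-mono-≤ (+-mono-≤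
            (E₁E₁ p (class-E₁ p outR r) (class-E₁ p outB b)) (small {R} (around {R} p {2} {0} {2} {1} r h)))
            (Basic.O-E₂ (swap-setting setting) (nbs-closed B p) (around {B} p {2} {1} {2} {0} b (has-pair B h)) (ok-⊑ E₂ (nb⊑ {B} {x} {S}) r)))
            (≤-trans (+-monoˡ-≤ (3 * x₀) plus-one) (≤-reflexive (eq x₀))))
          where
          eq : ∀ x → 3 * x + 3 * x ≡ 6 * x
          eq = solve-∀

        top-23 : Ok R E₂ S → Ok B E₃ S → size S ≤ M₂₃
        top-23 r b with Finₚ.any? (λ x → in? x S ×-dec (has? R 2 0 (cl x) ×-dec has? B 2 0 (cl x)))
        ... | no none = one-coloured-23 S-closed oc r b
          where
          oc : OneColoured R B S
          oc {x} p with has? R 2 0 (cl x) | has? B 2 0 (cl x)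
          ... | no h | _ = inj₁ h
          ... | yes _ | no h = inj₂ h
          ... | yes h | yes h′ = ⊥-elim (none (x , p , h , h′))
        ... | yes (x , p , h , h′) = ≤-trans (size-three S-closed p) (≤-trans (rest (has? B 2 0 (nb B x S))) (m≤n⊔m (9 * x₀) _))
          where
          NR≤1 : size (nb R x S) ≤ 1
          NR≤1 = small {R} (around {R} p {2} {0} {2} {1} r h)
          rest : Dec (Has B 2 0 (nb B x S)) → size (cl x) + size (nb R x S) + size (nb B x S) ≤ 3 * x₁ + 4 * x₀
          rest (yes g) = ≤-trans (+-mono-≤ (+-mono-≤ (E₁E₁ p (class-E₁ p outR r) (around′ {B} p {2} {0} {3} {1} b g)) NR≤1)
              (Basic.E₁-E₂ (swap-setting setting) (nbs-closed B p) (around {B} p {2} {0} {3} {1} b h′) (ok-⊑ E₂ (nb⊑ {B} {x} {S}) r)))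
              (≤-trans (+-monoˡ-≤ (3 * x₁) (≤-trans plus-one (m≤n+m (3 * x₀) x₀))) (≤-reflexive (+-comm (4 * x₀) (3 * x₁))))
          rest (no g) = ≤-trans (+-mono-≤ (+-mono-≤ (E₁E₂ p (class-E₁ p outR r) (B₂ p)) NR≤1)
              (Basic.O-E₂ (swap-setting setting) (nbs-closed B p) g (ok-⊑ E₂ (nb⊑ {B} {x} {S}) r)))
              (≤-trans (≤-reflexive (+-assoc (3 * x₁) 1 _)) (+-monoʳ-≤ (3 * x₁) (+-monoˡ-≤ (3 * x₀) one≤)))

        module _ {Y : ℕ} (room : Room Y) (r : Ok R E₃ S) (b : Ok B E₃ S) where
          open Room room

          -- Each neighbourhood has no J₃ in its own colour. An edge of that colour in it lowers the
          -- class from J₄-free to J₃-free; without such an edge the neighbourhood itself has at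
          -- most 4x₀ vertices. The extreme sums are 9x₀ + 4x₀ + 4x₀ and x₁ + 4x₁ + 4x₁.
          both-33 : ∀ {x} → x ∈ₛ S → Has R 2 0 (cl x) → Has B 2 0 (cl x) → size S ≤ Y
          both-33 {x} p h h′ = ≤-trans (size-three S-closed p) (cases (has? R 2 0 (nb R x S)) (has? B 2 0 (nb B x S)))
            where
            R₁ : Ok R E₁ (nb R x S)
            R₁ = around {R} p {2} {0} {3} {1} r h
            B₁ : Ok B E₁ (nb B x S)
            B₁ = around {B} p {2} {0} {3} {1} b h′
            r∣ : Ok R E₃ (nb B x S)
            r∣ = ok-⊑ E₃ (nb⊑ {B} {x} {S}) r
            b∣ : Ok B E₃ (nb R x S)
            b∣ = ok-⊑ E₃ (nb⊑ {R} {x} {S}) b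
            cases : Dec (Has R 2 0 (nb R x S)) → Dec (Has B 2 0 (nb B x S)) → size (cl x) + size (nb R x S) + size (nb B x S) ≤ Y
            cases (yes g) (yes g′) = ≤-trans (+-mono-≤ (+-mono-≤ (E₁E₁ p (around′ {R} p {2} {0} {3} {1} r g) (around′ {B} p {2} {0} {3} {1} b g′))
                (E₁-E₃ (nbs-closed R p) R₁ b∣)) (Basic.E₁-E₃ (swap-setting setting) (nbs-closed B p) B₁ r∣)) (≤-trans (≤-reflexive (eq x₁)) r₂)
              where
              eq : ∀ x → x + 4 * x + 4 * x ≡ 9 * x
              eq = solve-∀
            cases (yes g) (no g′) = ≤-trans (+-mono-≤ (+-mono-≤ (E₁E₂ p (around′ {R} p {2} {0} {3} {1} r g) (B₂ p))
                (E₁-E₃ (nbs-closed R p) R₁ b∣)) (Basic.O-E₃ (swap-setting setting) (nbs-closed B p) g′ r∣)) (≤-trans (≤-reflexive (eq x₀ x₁)) r₃)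
              where
              eq : ∀ x y → 3 * y + 4 * y + 4 * x ≡ 7 * y + 4 * x
              eq = solve-∀
            cases (no g) (yes g′) = ≤-trans (+-mono-≤ (+-mono-≤ (E₂E₁ p (R₂ p) (around′ {B} p {2} {0} {3} {1} b g′))
                (O-E₃ (nbs-closed R p) g b∣)) (Basic.E₁-E₃ (swap-setting setting) (nbs-closed B p) B₁ r∣)) (≤-trans (≤-reflexive (eq x₀ x₁)) r₃)
              where
              eq : ∀ x y → 3 * y + 4 * x + 4 * y ≡ 7 * y + 4 * x
              eq = solve-∀
            cases (no g) (no g′) = ≤-trans (+-mono-≤ (+-mono-≤ (E₂E₂ p (R₂ p) (B₂ p))
                (O-E₃ (nbs-closed R p) g b∣)) (Basic.O-E₃ (swap-setting setting) (nbs-closed B p) g′ r∣)) (≤-trans (≤-reflexive (eq x₀)) r₁)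
              where
              eq : ∀ x → 9 * x + 4 * x + 4 * x ≡ 17 * x
              eq = solve-∀

          -- The class has two vertices, so its blue neighbourhood has no triangle in `B`; treating
          -- it as J₄-free gives `M₂₃`. An edge of `R` in the red neighbourhood decides between `r₅`
          -- and `r₄`.
          red-33 : OneColoured R B S → ∀ {x} → x ∈ₛ S → Has R 2 0 (cl x) → size S ≤ Y
          red-33 oc {x} p h = ≤-trans (size-three S-closed p) (cases (has? R 2 0 (nb R x S)))
            where
            bO : Ok B O (cl x)
            bO = free-colour p oc h
            W : size (nb B x S) ≤ M₂₃
            W = Full.one-coloured-23 (swap-setting setting) (nbs-closed B p) (Sum.swap ∘ oc ∘ nb⊑ {B} {x} {S})
                  (ok-T-E₂ (around {B} p {2} {1} {3} {0} b (has-pair B h))) (ok-⊑ E₃ (nb⊑ {B} {x} {S}) r)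
            cases : Dec (Has R 2 0 (nb R x S)) → size (cl x) + size (nb R x S) + size (nb B x S) ≤ Y
            cases (yes g) = ≤-trans (+-mono-≤ (+-mono-≤ (E₁E₁ p (around′ {R} p {2} {0} {3} {1} r g) (ok-O-E₁ bO))
                (one-coloured-E₁-E₃ (nbs-closed R p) (oc ∘ nb⊑ {R} {x} {S}) (around {R} p {2} {0} {3} {1} r h) (ok-⊑ E₃ (nb⊑ {R} {x} {S}) b))) W) r₅
            cases (no g) = ≤-trans (+-mono-≤ (+-mono-≤ (E₂O p (R₂ p) bO) (O-E₃ (nbs-closed R p) g (ok-⊑ E₃ (nb⊑ {R} {x} {S}) b))) W)
                (≤-trans (≤-reflexive (cong (_+ M₂₃) (eq x₀))) r₄)
              where
              eq : ∀ x → 3 * x + 4 * x ≡ 7 * x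
              eq = solve-∀

      first : V → List V → V
      first x [] = x
      first x (y ∷ _) = y

      lead : V → V
      lead x = first x (elements (cl x))

      lead-∈ : ∀ {x} → x ∈ₛ S → lead x ∈ₛ cl x
      lead-∈ {x} p = go (elements (cl x)) (elements-all (cl x)) (∈-elements {cl x} (cl-self p))
        where
        go : ∀ L → All (_∈ₛ cl x) L → x ∈ L → first x L ∈ₛ cl x
        go (y ∷ L) (a ∷ _) _ = a

      lead-cong : ∀ {x y} → x ∈ₛ S → y ∈ₛ S → label x ≡ label y → lead x ≡ lead y
      lead-cong {x} {y} p q e = go (elements (cl x)) (elements (cl y)) (filterᵇ-cong (λ z → cong (λ l → S z ∧ does (l Fin.≟ label z)) e) vs) (∈-elements {cl x} (cl-self p))
        where
        go : ∀ L M → L ≡ M → x ∈ L → first x L ≡ first y M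
        go (z ∷ L) .(z ∷ L) refl _ = refl

      Rep : Subset
      Rep x = S x ∧ does (lead x Fin.≟ x)

      Rep-in : ∀ {x} → x ∈ₛ Rep → x ∈ₛ S × lead x ≡ x
      Rep-in {x} h with ∧-true {S x} h
      ... | p , q with lead x Fin.≟ x
      ...   | yes e = p , e

      Rep-injective : ∀ {x y} → x ∈ₛ Rep → y ∈ₛ Rep → label x ≡ label y → x ≡ y
      Rep-injective p q e = let (s , l) = Rep-in p ; (s′ , l′) = Rep-in q in trans (sym l) (trans (lead-cong s s′ e) l′)

      lead-Rep : ∀ {x} → x ∈ₛ S → lead x ∈ₛ Rep
      lead-Rep {x} p = let (s , e) = cl-in {x} (lead-∈ p) in ∧-intro s (dec-true (lead (lead x) Fin.≟ lead x) (lead-cong s p (sym e)))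

      covered : ∀ L → (Q : Subset) → (∀ {y} → y ∈ₛ Q → Any (λ x → y ∈ₛ cl x) L) → size Q ≤ sum (map (size ∘ cl) L)
      covered [] Q h = ≤-reflexive (size-empty Q λ p → case h p of λ ())
      covered (x ∷ L) Q h = ≤-trans (size-cover {Q} {cl x} {Q′} split′) (+-monoʳ-≤ _ (covered L Q′ inL))
        where
        in-L? : ∀ y → Dec (Any (λ x → y ∈ₛ cl x) L)
        in-L? y = Any.any? (λ x → in? y (cl x)) L
        Q′ : Subset
        Q′ y = does (in-L? y)
        split′ : ∀ {y} → y ∈ₛ Q → y ∈ₛ cl x ⊎ y ∈ₛ Q′
        split′ {y} p with h p
        ... | here m = inj₁ m
        ... | there m = inj₂ (dec-true (in-L? y) m)
        inL : ∀ {y} → y ∈ₛ Q′ → Any (λ x → y ∈ₛ cl x) L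
        inL {y} p with in-L? y
        ... | yes m = m

      -- Flat partitions: why two colours give 17 and not 21.

      module FlatCase {R B : Colour} (setting : Setting R B) (r : Ok R E₃ S) (b : Ok B E₃ S) (flat : Flat R B S) where
        open Setting setting
        open Bounds bounds

        Double Single : Subset
        Double x = Rep x ∧ does (has? R 2 1 (cl x))
        Single x = Rep x ∧ not (does (has? R 2 1 (cl x)))

        Double-in : ∀ {x} → x ∈ₛ Double → x ∈ₛ Rep × Has R 2 1 (cl x)
        Double-in {x} h with ∧-true {Rep x} h
        ... | p , q with has? R 2 1 (cl x)
        ...   | yes e = p , e

        Single-in : ∀ {x} → x ∈ₛ Single → x ∈ₛ Rep × ¬ Has R 2 1 (cl x)
        Single-in {x} h with ∧-true {Rep x} h
        ... | p , q with has? R 2 1 (cl x)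
        ...   | no e = p , e

        single-or-double : ∀ {x} → x ∈ₛ Rep → x ∈ₛ Single ⊎ x ∈ₛ Double
        single-or-double {x} p = case has? R 2 1 (cl x) of λ
          { (yes h) → inj₂ (∧-intro p (dec-true (has? R 2 1 (cl x)) h)) ; (no h) → inj₁ (∧-intro p (cong not (dec-false (has? R 2 1 (cl x)) h))) }

        pairs : ∀ {x y} → x ∈ₛ Rep → y ∈ₛ Rep → x ≢ y → c x y ≡ R ⊎ c x y ≡ B
        pairs p q ne = two (proj₁ (Rep-in p)) (proj₁ (Rep-in q)) (ne ∘ Rep-injective p q)

        -- Doubling a vertex of a monochromatic K₄ gives J₅.
        clique-single : ∀ {i} → Ok i E₃ S → ∀ C → Unique C → All (_∈ₛ Rep) C → length C ≡ 4 → miss (adjacent i) C ≡ 0 → All (_∈ₛ Single) C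
        clique-single {i} ok C u a l m = All.tabulate λ {z} z∈ → case single-or-double (All.lookup a z∈) of λ
          { (inj₁ s) → s ; (inj₂ d) → ⊥-elim (no-double z z∈ (Double-in d)) }
          where
          no-double : ∀ z → z ∈ C → z ∈ₛ Rep × Has R 2 1 (cl z) → ⊥
          no-double z z∈ (zr , has (v ∷ w ∷ []) ((v≢w ∷ []) ∷ _) (v∈ ∷ w∈ ∷ []) refl _) = case v Fin.≟ z of λ
            { (yes refl) → twin w w∈ (≢-sym v≢w) ; (no ne) → twin v v∈ ne }
            where
            zS = proj₁ (Rep-in zr)
            twin : ∀ y → y ∈ₛ cl z → y ≢ z → ⊥
            twin y y∈ ne = ok (has (y ∷ C) (All.tabulate (λ {x} x∈ e → fresh x x∈ e) ∷ u) (proj₁ (cl-in {z} y∈) ∷ All.map (proj₁ ∘ Rep-in) a)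
                (cong suc l) (≤-trans (+-mono-≤ (lack-≤1 (adjacent i) y z C u adj (Any.any? (z Fin.≟_) C)) (≤-reflexive m)) ≤-refl))
              where
              e-label = proj₂ (cl-in {z} y∈)
              fresh : ∀ x → x ∈ C → y ≢ x
              fresh x x∈ refl = ne (Rep-injective (All.lookup a x∈) zr (sym e-label))
              adj : ∀ {x} → x ∈ C → x ≢ z → adjacent i y x ≡ true
              adj {x} x∈ x≢z = adjacent-true (trans (sym (hom zS (proj₁ (cl-in {z} y∈)) (proj₁ (Rep-in (All.lookup a x∈))) e-label
                (λ e → x≢z (Rep-injective (All.lookup a x∈) zr (sym e))))) (clique-pair C m z∈ x∈ (≢-sym x≢z)))

        record SingleClique (Q : Subset) : Set where
          field
            {i} : Colour
            C : List V
            ok : Ok i E₃ S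
            unique : Unique C
            inside : All (λ x → x ∈ₛ Q × x ∈ₛ Single) C
            four : length C ≡ 4
            clique : miss (adjacent i) C ≡ 0

        find-clique : ∀ {Q} → Q ⊑ Rep → 18 ≤ size Q → SingleClique Q
        find-clique {Q} sub big = [ make r , make b ]′ (K4-18 R≢B Q (λ p q → pairs (sub p) (sub q)) big)
          where
          make : ∀ {i} → Ok i E₃ S → Has i 4 0 Q → SingleClique Q
          make ok (has C u a l m) = record { C = C ; ok = ok ; unique = u ; four = l ; clique = n≤0⇒n≡0 m
            ; inside = All.zip (a , clique-single ok C u (All.map sub a) l (n≤0⇒n≡0 m)) }

        s d : ℕ
        s = size Single
        d = size Double

        Single⊑ : Single ⊑ Rep
        Single⊑ = proj₁ ∘ Single-in

        Double⊑ : Double ⊑ Rep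
        Double⊑ = proj₁ ∘ Double-in

        not-both : ∀ {x} → x ∈ₛ Single → ¬ x ∈ₛ Double
        not-both p q = proj₂ (Single-in p) (proj₂ (Double-in q))

        reps≤21 : s + d ≤ 21
        reps≤21 = ≤-trans (size-disjoint {Single} {Double} {Rep} Single⊑ Double⊑ not-both) (On.size-55 R B R≢B Rep pairs (ok-⊑ E₃ (proj₁ ∘ Rep-in) r) (ok-⊑ E₃ (proj₁ ∘ Rep-in) b))

        four-≤ : ∀ {Q} P → SingleClique Q → (∀ {x} → x ∈ₛ Q → x ∈ₛ Single → x ∈ₛ P) → 4 ≤ size P
        four-≤ P cq h = ≤-trans (≤-reflexive (sym four)) (list-size {P} C unique (All.map (λ (p , q) → h p q) inside))
          where open SingleClique cq

        d≤17 : d ≤ 17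
        d≤17 with d ≤? 17
        ... | yes p = p
        ... | no np = ⊥-elim (<⇒≱ (four-≤ {Double} (λ _ → false) (find-clique Double⊑ (≰⇒> np)) (λ q p → ⊥-elim (not-both p q)))
                        (≤-trans (≤-reflexive (size-empty (λ _ → false) λ ())) z≤n))

        -- The doubled representatives and `L` contain a monochromatic K₄ by R(4,4) ≤ 18. As a
        -- doubled vertex cannot occur in it, it lies entirely in `L`.
        module With (L : List V) (L-unique : Unique L) (L-single : All (_∈ₛ Single) L) (enough : 18 ≤ d + length L) where
          Q : Subset
          Q x = Double x ∨ fromList L x
          Q⊑ : Q ⊑ Rep
          Q⊑ {x} h = [ Double⊑ , (λ m → Single⊑ (All.lookup L-single (fromList-∈ L m))) ]′ (∨-true {Double x} h)
          found : SingleClique Q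
          found = find-clique {Q} Q⊑ (≤-trans enough (≤-trans (+-monoʳ-≤ d (fromList-≥ L L-unique))
            (size-disjoint {Double} {fromList L} {Q} (λ {x} p → cong (_∨ fromList L x) p)
              (λ {x} p → orʳ {Double x} p)
              λ p q → not-both (All.lookup L-single (fromList-∈ L q)) p)))
            where
            orʳ : ∀ {a b} → b ≡ true → a ∨ b ≡ true
            orʳ {true} _ = refl
            orʳ {false} h = h
          open SingleClique found public
          C-L : ∀ {x} → x ∈ C → x ∈ L
          C-L {x} m = let (q , sg) = All.lookup inside m in [ (λ dd → ⊥-elim (not-both sg dd)) , fromList-∈ L ]′ (∨-true {Double x} q)

          big : 4 ≤ length L
          big = ≤-trans (four-≤ (fromList L) found λ {x} q sg → [ (λ dd → ⊥-elim (not-both sg dd)) , id ]′ (∨-true {Double x} q)) (fromList-≤ L)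

          module _ (short : length L ≡ 4) where
            all-in : ∀ {x} → x ∈ L → x ∈ C
            all-in {x} m = case Any.any? (x Fin.≟_) C of λ { (yes i) → i ; (no x∉) → ⊥-elim (crowded x∉) }
              where
              just-L : just x ⊑ fromList L
              just-L {y} p = ∈-fromList {y} L (subst (_∈ L) (sym (just-≡ {x} {y} p)) m)
              C-fromL : fromList C ⊑ fromList L
              C-fromL {y} p = ∈-fromList {y} L (C-L (fromList-∈ {y} C p))
              C-size : 4 ≤ size (fromList C)
              C-size = ≤-trans (≤-reflexive (sym four)) (fromList-≥ C unique)
              L-size : size (fromList L) ≤ 4
              L-size = ≤-trans (fromList-≤ L) (≤-reflexive short)
              crowded : ¬ x ∈ C → ⊥
              crowded x∉ = <⇒≱ (+-mono-≤ (size-just-≥ x) C-size) (≤-trans (size-disjoint {just x} {fromList C} {fromList L} just-L C-fromL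
                (λ {y} p q → x∉ (subst (_∈ C) (just-≡ {x} {y} p) (fromList-∈ {y} C q)))) L-size)

            all-pairs : ∀ {x y} → x ∈ L → y ∈ L → x ≢ y → c x y ≡ i
            all-pairs p q ne = clique-pair C clique (all-in p) (all-in q) ne

        singles : List V
        singles = elements Single

        -- With 14 doubled vertices any four single ones form a monochromatic K₄. Among five single
        -- ones two such K₄ share the edge p₂p₃, hence have the same colour, and together they form
        -- a J₅.
        d≡14⇒s≤4 : 14 ≤ d → s ≤ 4
        d≡14⇒s≤4 h = go singles refl
          where
          go : ∀ L → singles ≡ L → s ≤ 4
          go [] e = ≤-trans (≤-reflexive (trans (sym (size-elements Single)) (cong length e))) z≤n
          go (p₁ ∷ []) e = ≤-trans (≤-reflexive (trans (sym (size-elements Single)) (cong length e))) (s≤s z≤n)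
          go (p₁ ∷ p₂ ∷ []) e = ≤-trans (≤-reflexive (trans (sym (size-elements Single)) (cong length e))) (s≤s (s≤s z≤n))
          go (p₁ ∷ p₂ ∷ p₃ ∷ []) e = ≤-trans (≤-reflexive (trans (sym (size-elements Single)) (cong length e))) (s≤s (s≤s (s≤s z≤n)))
          go (p₁ ∷ p₂ ∷ p₃ ∷ p₄ ∷ []) e = ≤-reflexive (trans (sym (size-elements Single)) (cong length e))
          go (p₁ ∷ p₂ ∷ p₃ ∷ p₄ ∷ p₅ ∷ L) e with subst Unique e (elements-unique Single) | subst (All (_∈ₛ Single)) e (elements-all Single)
          ... | (n₁₂ ∷ n₁₃ ∷ n₁₄ ∷ n₁₅ ∷ _) ∷ (n₂₃ ∷ n₂₄ ∷ n₂₅ ∷ _) ∷ (n₃₄ ∷ n₃₅ ∷ _) ∷ (n₄₅ ∷ _) ∷ _ | a₁ ∷ a₂ ∷ a₃ ∷ a₄ ∷ a₅ ∷ _ = ⊥-elim (A.ok j₅)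
            where
            module A = With (p₁ ∷ p₂ ∷ p₃ ∷ p₄ ∷ []) ((n₁₂ ∷ n₁₃ ∷ n₁₄ ∷ []) ∷ (n₂₃ ∷ n₂₄ ∷ []) ∷ (n₃₄ ∷ []) ∷ [] ∷ []) (a₁ ∷ a₂ ∷ a₃ ∷ a₄ ∷ []) (+-monoˡ-≤ 4 h)
            module Z = With (p₂ ∷ p₃ ∷ p₄ ∷ p₅ ∷ []) ((n₂₃ ∷ n₂₄ ∷ n₂₅ ∷ []) ∷ (n₃₄ ∷ n₃₅ ∷ []) ∷ (n₄₅ ∷ []) ∷ [] ∷ []) (a₂ ∷ a₃ ∷ a₄ ∷ a₅ ∷ []) (+-monoˡ-≤ 4 h)
            same : Z.i ≡ A.i
            same = trans (sym (Z.all-pairs refl (here refl) (there (here refl)) n₂₃)) (A.all-pairs refl (there (here refl)) (there (there (here refl))) n₂₃)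
            old : ∀ {x y} → x ∈ p₁ ∷ p₂ ∷ p₃ ∷ p₄ ∷ [] → y ∈ p₁ ∷ p₂ ∷ p₃ ∷ p₄ ∷ [] → x ≢ y → adjacent A.i x y ≡ true
            old p q ne = adjacent-true (A.all-pairs refl p q ne)
            new : ∀ {x} → x ∈ p₂ ∷ p₃ ∷ p₄ ∷ p₅ ∷ [] → x ≢ p₅ → adjacent A.i x p₅ ≡ true
            new p ne = adjacent-true (trans (Z.all-pairs refl p (there (there (there (here refl)))) ne) same)
            bound : ∀ b → pen b + 0 + 0 ≤ 1
            bound true = z≤n
            bound false = s≤s z≤n
            S∈ : ∀ {x} → x ∈ₛ Single → x ∈ₛ S
            S∈ = proj₁ ∘ Rep-in ∘ Single⊑
            few : miss (adjacent A.i) (p₂ ∷ p₃ ∷ p₄ ∷ p₁ ∷ p₅ ∷ []) ≤ 1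
            -- The order p₂, p₃, p₄, p₁, p₅ leaves p₁p₅, the only pair in neither K₄, to the end.
            few = ≤-trans (≤-reflexive (cong₂ _+_
                (lack-0 (adjacent A.i) p₂ (p₃ ∷ p₄ ∷ p₁ ∷ p₅ ∷ []) (old (there (here refl)) (there (there (here refl))) n₂₃ ∷ old (there (here refl)) (there (there (there (here refl)))) n₂₄
                  ∷ old (there (here refl)) (here refl) (≢-sym n₁₂) ∷ new (here refl) n₂₅ ∷ []))
                (cong₂ _+_ (lack-0 (adjacent A.i) p₃ (p₄ ∷ p₁ ∷ p₅ ∷ []) (old (there (there (here refl))) (there (there (there (here refl)))) n₃₄
                  ∷ old (there (there (here refl))) (here refl) (≢-sym n₁₃) ∷ new (there (here refl)) n₃₅ ∷ []))
                (cong₂ _+_ (lack-0 (adjacent A.i) p₄ (p₁ ∷ p₅ ∷ []) (old (there (there (there (here refl)))) (here refl) (≢-sym n₁₄) ∷ new (there (there (here refl))) n₄₅ ∷ [])) refl))))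
              (bound (adjacent A.i p₁ p₅))
            j₅ : Has A.i 5 1 S
            j₅ = has (p₂ ∷ p₃ ∷ p₄ ∷ p₁ ∷ p₅ ∷ [])
              ((n₂₃ ∷ n₂₄ ∷ ≢-sym n₁₂ ∷ n₂₅ ∷ []) ∷ (n₃₄ ∷ ≢-sym n₁₃ ∷ n₃₅ ∷ []) ∷ (≢-sym n₁₄ ∷ n₄₅ ∷ []) ∷ (n₁₅ ∷ []) ∷ [] ∷ [])
              (S∈ a₂ ∷ S∈ a₃ ∷ S∈ a₄ ∷ S∈ a₁ ∷ S∈ a₅ ∷ []) refl few

        -- Among `t` single vertices the forced K₄ would not find its four vertices.
        few-singles : ∀ t → 18 ≤ d + t → t ≤ 3 → s < t
        few-singles t e t≤3 with t ≤? s
        ... | no h = ≰⇒> h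
        ... | yes h = ⊥-elim (<⇒≱ (With.big (take t singles) (Uniq.take⁺ t (elements-unique Single)) (Allₚ.take⁺ t (elements-all Single))
                (≤-trans e (+-monoʳ-≤ d (≤-reflexive (sym len))))) (≤-trans (≤-reflexive len) t≤3))
          where
          len : length (take t singles) ≡ t
          len = trans (length-take t singles) (m≤n⇒m⊓n≡m (≤-trans h (≤-reflexive (sym (size-elements Single)))))

        -- Up to d = 13 the bound s + d ≤ 21 gives 21 + 13. For d = 14 it is 4 + 28, and from 15 on
        -- the single vertices disappear fast enough, down to 0 + 34 at d = 17. The value 34 is what
        -- 17 doubled vertices weigh.
        weight≤34 : s + 2 * d ≤ 34
        weight≤34 with d ≤? 13
        ... | yes h = ≤-trans (≤-reflexive (eq s d)) (+-mono-≤ reps≤21 h)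
          where
          eq : ∀ s d → s + 2 * d ≡ s + d + d
          eq = solve-∀
        ... | no h with d ≤? 14
        ...   | yes h′ = ≤-trans (+-mono-≤ (d≡14⇒s≤4 (≰⇒> h)) (*-monoʳ-≤ 2 h′)) (m≤m+n 32 2)
        ...   | no h′ with d ≤? 15
        ...     | yes h″ = +-mono-≤ (≤-trans (<⇒≤ (few-singles 3 (+-monoˡ-≤ 3 (≰⇒> h′)) ≤-refl)) (n≤1+n 3)) (*-monoʳ-≤ 2 h″)
        ...     | no h″ with d ≤? 16
        ...       | yes g = +-mono-≤ (<⇒≤ (few-singles 2 (+-monoˡ-≤ 2 (≰⇒> h″)) (n≤1+n 2))) (*-monoʳ-≤ 2 g)
        ...       | no g = +-mono-≤ (s≤s⁻¹ (few-singles 1 (+-monoˡ-≤ 1 (≰⇒> g)) (s≤s z≤n))) (*-monoʳ-≤ 2 d≤17)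

        total : ∀ L → All (_∈ₛ Rep) L → sum (map (size ∘ cl) L) ≤ cnt Single L + x₀ * cnt Double L
        total [] [] = z≤n
        total (x ∷ L) (p ∷ ps) with single-or-double p
        ... | inj₁ m = ≤-trans (+-mono-≤ (small {R} {cl x} (proj₂ (Single-in m))) (total L ps)) (step m)
          where
          step : x ∈ₛ Single → 1 + (cnt Single L + x₀ * cnt Double L) ≤ cnt Single (x ∷ L) + x₀ * cnt Double (x ∷ L)
          step m rewrite m = s≤s (+-monoʳ-≤ (cnt Single L) (*-monoʳ-≤ x₀ (m≤n+m _ (bit (Double x)))))
        ... | inj₂ m = ≤-trans (+-mono-≤ (OO (proj₁ (Rep-in p)) (proj₁ (flat (proj₁ (Rep-in p)))) (proj₂ (flat (proj₁ (Rep-in p))))) (total L ps)) (step m)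
          where
          eq : ∀ x a b → x + (a + x * b) ≡ a + x * (1 + b)
          eq = solve-∀
          step : x ∈ₛ Double → x₀ + (cnt Single L + x₀ * cnt Double L) ≤ cnt Single (x ∷ L) + x₀ * cnt Double (x ∷ L)
          step m rewrite m = ≤-trans (≤-reflexive (eq x₀ (cnt Single L) (cnt Double L))) (+-monoˡ-≤ (x₀ * (1 + cnt Double L)) (m≤n+m (cnt Single L) (bit (Single x))))

        cnt-⊆ : ∀ (p q : V → Bool) → (∀ {x} → p x ≡ true → q x ≡ true) → ∀ xs → cnt p (filterᵇ q xs) ≡ cnt p xs
        cnt-⊆ p q h [] = refl
        cnt-⊆ p q h (x ∷ xs) with q x in eq
        ... | true = cong (bit (p x) +_) (cnt-⊆ p q h xs)
        ... | false with p x in eq′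
        ...   | true = ⊥-elim (true≢false (h eq′) eq)
        ...   | false = cnt-⊆ p q h xs

        flat-33 : size S ≤ 17 * x₀
        flat-33 = ≤-trans (covered (elements Rep) S λ {y} p → lose (∈-elements {Rep} (lead-Rep p))
              (let (s′ , e) = cl-in {y} (lead-∈ p) in cl-intro p (sym e)))
            (≤-trans (total (elements Rep) (elements-all Rep))
            (≤-trans (≤-reflexive (cong₂ (λ a b → a + x₀ * b) (cnt-⊆ Single Rep Single⊑ vs) (cnt-⊆ Double Rep Double⊑ vs))) (arithmetic x₀ two≤)))
          where
          arithmetic : ∀ x → 2 ≤ x → s + x * d ≤ 17 * x
          -- With x = 2 + y the total is (s + 2d) + y d, and the two parts are at most 34 and 17y.
          arithmetic (suc (suc y)) (s≤s (s≤s _)) = ≤-trans (≤-reflexive (eq s d y)) (≤-trans (+-mono-≤ weight≤34 (*-monoʳ-≤ y d≤17)) (≤-reflexive (eq′ y)))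
            where
            eq : ∀ s d y → s + (2 + y) * d ≡ s + 2 * d + y * d
            eq = solve-∀
            eq′ : ∀ y → 34 + y * 17 ≡ 17 * (2 + y)
            eq′ = solve-∀

      module Final {R B : Colour} (setting : Setting R B) (outR : Out R) (outB : Out B) where
        open Setting setting
        open Basic setting

        one-coloured? : (∃ λ x → x ∈ₛ S × Has R 2 0 (cl x) × Has B 2 0 (cl x)) ⊎ OneColoured R B S
        one-coloured? with Finₚ.any? (λ x → in? x S ×-dec (has? R 2 0 (cl x) ×-dec has? B 2 0 (cl x)))
        ... | yes h = inj₁ h
        ... | no none = inj₂ oc
          where
          oc : OneColoured R B S
          oc {x} p with has? R 2 0 (cl x) | has? B 2 0 (cl x)
          ... | no h | _ = inj₁ h
          ... | yes _ | no h = inj₂ h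
          ... | yes h | yes h′ = ⊥-elim (none (x , p , h , h′))

        top-33 : ∀ {Y} → Room Y → Ok R E₃ S → Ok B E₃ S → size S ≤ Y
        top-33 room r b with one-coloured?
        ... | inj₁ (x , p , h , h′) = Setup.both-33 setting outR outB room r b p h h′
        ... | inj₂ oc with find-class 2 0 S
        ...   | inj₁ (x , p , h) = Setup.red-33 setting outR outB room r b oc p h
        ...   | inj₂ noR with Basic.find-class (swap-setting setting) 2 0 S
        ...     | inj₁ (x , p , h) = Setup.red-33 (swap-setting setting) outB outR room b r (Sum.swap ∘ oc) p h
        ...     | inj₂ noB = ≤-trans (FlatCase.flat-33 setting r b (λ p → noR p , noB p)) (Room.r₁ room)

        top-22 : Ok R E₂ S → Ok B E₂ S → size S ≤ 6 * x₀
        top-22 r b with find-class 2 0 S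
        ... | inj₁ (x , p , h) = Setup.top-22-red setting outR outB r b p h
        ... | inj₂ noR with Basic.find-class (swap-setting setting) 2 0 S
        ...   | inj₁ (x , p , h) = Setup.top-22-red (swap-setting setting) outB outR b r p h
        ...   | inj₂ noB = ≤-trans (Half.flat-22 setting S-closed (λ p → noR p , noB p) r b) (*-monoˡ-≤ x₀ {5} {6} (n≤1+n 5))

    -- Kites, that is, monochromatic copies of H₂.

    record Kite (i : Colour) (S : Subset) : Set where
      field
        base : Has i 4 0 S
        {y p q} : V
        y∈ : y ∈ₛ S
        y∉ : y ∉ Has.list base
        p∈ : p ∈ Has.list base
        q∈ : q ∈ Has.list base
        p≢q : p ≢ q
        yp : c y p ≡ i
        yq : c y q ≡ i

    kite-⊑ : ∀ {i P Q} → P ⊑ Q → Kite i P → Kite i Q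
    kite-⊑ h κ = record { base = has-⊑ h base ; y∈ = h y∈ ; y∉ = y∉ ; p∈ = p∈ ; q∈ = q∈ ; p≢q = p≢q ; yp = yp ; yq = yq }
      where open Kite κ

    row₀ : ∀ {i x} C → lack (adjacent i) x C ≡ 0 → ∀ {y} → y ∈ C → c x y ≡ i
    row₀ {i} {x} (z ∷ C) l (here refl) with adjacent i x z in eq
    ... | true = adjacent-≡ eq
    row₀ {i} {x} (z ∷ C) l (there m) = row₀ C (m+n≡0⇒n≡0 (pen (adjacent i x z)) l) m

    row₁ : ∀ {i x} z C → lack (adjacent i) x (z ∷ C) ≤ 1 → ∃ λ q → q ∈ z ∷ C × (∀ {y} → y ∈ z ∷ C → y ≢ q → c x y ≡ i)
    row₁ {i} {x} z C l with adjacent i x z in eq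
    ... | false = z , here refl , λ { (here e) ne → ⊥-elim (ne e) ; (there m) _ → row₀ C (n≤0⇒n≡0 (s≤s⁻¹ l)) m }
    row₁ {i} {x} z [] l | true = z , here refl , λ { (here e) ne → ⊥-elim (ne e) }
    row₁ {i} {x} z (w ∷ C) l | true with row₁ w C l
    ... | q , m , h = q , there m , λ { (here refl) _ → adjacent-≡ eq ; (there m′) ne → h m′ ne }

    OnlyGap : Colour → List V → V → V → Set
    OnlyGap i C p q = ∀ {x y} → x ∈ C → y ∈ C → x ≢ y → c x y ≡ i ⊎ (x ≡ p × y ≡ q) ⊎ (x ≡ q × y ≡ p)

    gap-from : ∀ {i x q} C → (∀ {y} → y ∈ C → y ≢ q → c x y ≡ i) → (∀ {y z} → y ∈ C → z ∈ C → y ≢ z → c y z ≡ i) → OnlyGap i (x ∷ C) x q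
    gap-from C h h′ (here refl) (here refl) ne = ⊥-elim (ne refl)
    gap-from {x = x} {q} C h h′ {y = y} (here refl) (there m) ne = case y Fin.≟ q of λ { (yes e) → inj₂ (inj₁ (refl , e)) ; (no ne′) → inj₁ (h m ne′) }
    gap-from {x = x} {q} C h h′ {y} (there m) (here refl) ne = case y Fin.≟ q of λ
      { (yes e) → inj₂ (inj₂ (e , refl)) ; (no ne′) → inj₁ (trans (c-sym y x) (h m ne′)) }
    gap-from C h h′ (there m) (there m′) ne = inj₁ (h′ m m′ ne)

    only-gap : ∀ {i} x y C → Unique (x ∷ y ∷ C) → miss (adjacent i) (x ∷ y ∷ C) ≤ 1 →
      ∃ λ p → ∃ λ q → p ∈ x ∷ y ∷ C × q ∈ x ∷ y ∷ C × p ≢ q × OnlyGap i (x ∷ y ∷ C) p q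
    only-gap {i} x y C (n ∷ u) m with lack (adjacent i) x (y ∷ C) in eq
    only-gap {i} x y C (n ∷ u) m | suc a with row₁ {i} {x} y C (≤-trans (≤-reflexive eq) (≤-trans (m≤m+n (suc a) _) m))
    ... | q , q∈ , h = x , q , here refl , there q∈ , All.lookup n q∈ , gap-from (y ∷ C) h (clique-pair (y ∷ C) (n≤0⇒n≡0 (≤-trans (m≤n+m _ a) (s≤s⁻¹ m))))
    only-gap {i} x y [] ((n ∷ []) ∷ u) m | zero = x , y , here refl , there (here refl) , n ,
      gap-from (y ∷ []) (λ { (here refl) ne → ⊥-elim (ne refl) }) λ { (here refl) (here refl) ne → ⊥-elim (ne refl) }
    only-gap {i} x y (z ∷ C) (n ∷ u) m | zero with only-gap {i} y z C u m
    ... | p , q , p∈ , q∈ , ne , h = p , q , there p∈ , there q∈ , ne , λ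
      { (here refl) (here refl) ne′ → ⊥-elim (ne′ refl)
      ; (here refl) (there m′) _ → inj₁ (row₀ (y ∷ z ∷ C) eq m′)
      ; {x = w} (there m′) (here refl) _ → inj₁ (trans (c-sym w x) (row₀ (y ∷ z ∷ C) eq m′))
      ; (there m′) (there m″) ne′ → h m′ m″ ne′ }

    record J₅ (i : Colour) (S : Subset) : Set where
      field
        {r s t p q} : V
        unique : Unique (r ∷ s ∷ t ∷ p ∷ q ∷ [])
        inside : All (_∈ₛ S) (r ∷ s ∷ t ∷ p ∷ q ∷ [])
        only : OnlyGap i (r ∷ s ∷ t ∷ p ∷ q ∷ []) p q

    -- The ends of the gap come last, matching the vertices 3 and 4 of `H₃`. If no pair is missing,
    -- an arbitrary pair serves as the gap.
    sorted-J₅ : ∀ {i S} → Has i 5 1 S → J₅ i S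
    sorted-J₅ (has C@(_ ∷ _ ∷ _) u a l m) with only-gap _ _ _ u m
    ... | p , q , p∈ , q∈ , ne , h with two-front p∈ q∈ ne
    ...   | r ∷ s ∷ t ∷ [] , σ = record { unique = Unique-↭ τ u ; inside = All-↭ τ a ; only = λ x y → h (∈-resp-↭ (↭-sym τ) x) (∈-resp-↭ (↭-sym τ) y) }
      where
      τ : C ↭ r ∷ s ∷ t ∷ p ∷ q ∷ []
      τ = ↭-trans σ (↭-sym (↭-trans (shift p (r ∷ s ∷ t ∷ []) (q ∷ [])) (prep p (shift q (r ∷ s ∷ t ∷ []) []))))
    ...   | [] , σ = case trans (sym l) (↭-length σ) of λ ()
    ...   | _ ∷ [] , σ = case trans (sym l) (↭-length σ) of λ ()
    ...   | _ ∷ _ ∷ [] , σ = case trans (sym l) (↭-length σ) of λ ()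
    ...   | _ ∷ _ ∷ _ ∷ _ ∷ _ , σ = case trans (sym l) (↭-length σ) of λ ()

    row-all : ∀ {i x C} → All (λ y → c x y ≡ i) C → lack (adjacent i) x C ≡ 0
    row-all [] = refl
    row-all (e ∷ es) = trans (cong (λ b → pen b + _) (adjacent-true e)) (row-all es)

    clique : ∀ {i S} C → Unique C → All (_∈ₛ S) C → (∀ {x y} → x ∈ C → y ∈ C → x ≢ y → c x y ≡ i) → Has i (length C) 0 S
    clique {i} C u a h = has C u a refl (≤-reflexive (go C u h))
      where
      go : ∀ C → Unique C → (∀ {x y} → x ∈ C → y ∈ C → x ≢ y → c x y ≡ i) → miss (adjacent i) C ≡ 0
      go [] u h = refl
      go (x ∷ C) (n ∷ u) h = cong₂ _+_ (row-all (All.tabulate λ m → h (here refl) (there m) (All.lookup n m))) (go C u λ m m′ → h (there m) (there m′))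

    -- Without `q`, one end of the gap, a K₄ remains, and `q` is joined to `r` and `s` in it. Hence
    -- all bounds for sets without J₅ apply to sets without kites.
    kite-J₅ : ∀ {i S} → Has i 5 1 S → Kite i S
    kite-J₅ {i} h with sorted-J₅ h
    ... | record { r = r ; s = s ; t = t ; p = p ; q = q ; unique = u@((rs ∷ rt ∷ rp ∷ rq ∷ []) ∷ (st ∷ sp ∷ sq ∷ []) ∷ (tp ∷ tq ∷ []) ∷ (pq ∷ []) ∷ _)
                 ; inside = a ∷ b ∷ d ∷ e ∷ f ∷ [] ; only = only } = record
      { base = clique (r ∷ s ∷ t ∷ p ∷ []) ((rs ∷ rt ∷ rp ∷ []) ∷ (st ∷ sp ∷ []) ∷ (tp ∷ []) ∷ [] ∷ []) (a ∷ b ∷ d ∷ e ∷ [])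
          λ x y ne → [ id , [ (λ (_ , e) → ⊥-elim (q∉ (subst (_∈ _) e y))) , (λ (e , _) → ⊥-elim (q∉ (subst (_∈ _) e x))) ]′ ]′ (only (keep x) (keep y) ne)
      ; y∈ = f ; y∉ = q∉ ; p∈ = here refl ; q∈ = there (here refl) ; p≢q = rs
      ; yp = [ id , [ (λ (_ , e) → ⊥-elim (rq e)) , (λ (_ , e) → ⊥-elim (rp e)) ]′ ]′ (only (there (there (there (there (here refl))))) (here refl) (rq ∘ sym))
      ; yq = [ id , [ (λ (_ , e) → ⊥-elim (sq e)) , (λ (_ , e) → ⊥-elim (sp e)) ]′ ]′ (only (there (there (there (there (here refl))))) (there (here refl)) (sq ∘ sym)) }
      where
      q∉ : q ∉ r ∷ s ∷ t ∷ p ∷ []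
      q∉ (here e) = rq (sym e)
      q∉ (there (here e)) = sq (sym e)
      q∉ (there (there (here e))) = tq (sym e)
      q∉ (there (there (there (here e)))) = pq (sym e)
      keep : ∀ {x} → x ∈ r ∷ s ∷ t ∷ p ∷ [] → x ∈ r ∷ s ∷ t ∷ p ∷ q ∷ []
      keep = ∈-++⁺ˡ {ys = q ∷ []}

    ok-E₃-kite : ∀ {i S} → ¬ Kite i S → Ok i E₃ S
    ok-E₃-kite h j = h (kite-J₅ j)

    -- Two edges joined completely form a K₄ to which every other vertex of P is joined twice.
    cross : ∀ {i P Q S} → P ⊑ S → Q ⊑ S → Joined i P Q → ¬ Kite i S → Has i 2 0 P → Has i 2 0 Q → size P ≤ 2
    cross {i} {P} {Q} {S} hP hQ j free h h′ with edge-of h | edge-of h′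
    ... | p , p′ , p∈ , p′∈ , pp′ , e | q , q′ , q∈ , q′∈ , qq′ , e′ = ≤-trans (size-mono {P} {fromList (p ∷ p′ ∷ [])} λ {y} m → ∈-fromList {y} (p ∷ p′ ∷ []) (in-edge m)) (fromList-≤ (p ∷ p′ ∷ []))
      where
      in-edge : ∀ {y} → y ∈ₛ P → y ∈ p ∷ p′ ∷ []
      in-edge {y} m with Any.any? (y Fin.≟_) (p ∷ p′ ∷ [])
      ... | yes i = i
      ... | no y∉ = ⊥-elim (free record
        { base = has-join {i} {P} {Q} {S} hP hQ j (has-edge p∈ p′∈ pp′ e) (has-edge q∈ q′∈ qq′ e′)
        ; y∈ = hP m
        ; y∉ = λ { (here e) → y∉ (here e) ; (there (here e)) → y∉ (there (here e)) ; (there (there (here e))) → proj₁ (j m q∈) e ; (there (there (there (here e)))) → proj₁ (j m q′∈) e }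
        ; p∈ = there (there (here refl)) ; q∈ = there (there (there (here refl))) ; p≢q = qq′ ; yp = proj₂ (j m q∈) ; yq = proj₂ (j m q′∈) })

    -- A triangle and one vertex of `Q` form a K₄, and a second vertex of `Q` would be joined to the
    -- whole triangle.
    cone : ∀ {i P Q S} → P ⊑ S → Q ⊑ S → Joined i P Q → ¬ Kite i S → Has i 3 0 P → size Q ≤ 1
    cone {i} {P} {Q} {S} hP hQ j free h@(has (a ∷ b ∷ d ∷ []) ((ab ∷ _) ∷ _) (a∈ ∷ b∈ ∷ d∈ ∷ []) refl _) = size-subsingleton Q λ {y} {z} y∈ z∈ → case z Fin.≟ y of λ
      { (yes e) → sym e
      ; (no ne) → ⊥-elim (free record
          { base = has-join {i} {P} {Q} {S} hP hQ j h (has-one {x = y} y∈) ; y∈ = hQ z∈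
          ; y∉ = λ { (here e) → proj₁ (j a∈ z∈) (sym e) ; (there (here e)) → proj₁ (j b∈ z∈) (sym e) ; (there (there (here e))) → proj₁ (j d∈ z∈) (sym e) ; (there (there (there (here e)))) → ne e }
          ; p∈ = here refl ; q∈ = there (here refl) ; p≢q = ab ; yp = trans (c-sym _ _) (proj₂ (j a∈ z∈)) ; yq = trans (c-sym _ _) (proj₂ (j b∈ z∈)) }) }

    escape : ∀ {P} L → length L < size P → ∃ λ w → w ∈ₛ P × w ∉ L
    escape {P} L l with Finₚ.any? (λ w → in? w P ×-dec ¬? (Any.any? (w Fin.≟_) L))
    ... | yes (w , m , h) = w , m , h
    ... | no none = ⊥-elim (<⇒≱ l (≤-trans (size-mono {P} {fromList L} λ {w} m → ∈-fromList {w} L (case Any.any? (w Fin.≟_) L of λ { (yes i) → i ; (no h) → ⊥-elim (none (w , m , h)) })) (fromList-≤ L)))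

    -- R(H₂) ≤ 18: a vertex outside a red K₄ has at most one red neighbour in it, so the vertices outside span no blue triangle.
    size-kite : ∀ {R B} → R ≢ B → ∀ Q → (∀ {x y} → x ∈ₛ Q → y ∈ₛ Q → x ≢ y → c x y ≡ R ⊎ c x y ≡ B) → ¬ Kite R Q → ¬ Kite B Q → size Q ≤ 17
    size-kite {R} {B} R≢B Q two noR noB with size Q ≤? 17
    ... | yes h = h
    ... | no h = ⊥-elim ([ around R≢B two noR noB , around (R≢B ∘ sym) (λ p q ne → Sum.swap (two p q ne)) noB noR ]′ (K4-18 R≢B Q two (≰⇒> h)))
      where
      around : ∀ {R B} → R ≢ B → (∀ {x y} → x ∈ₛ Q → y ∈ₛ Q → x ≢ y → c x y ≡ R ⊎ c x y ≡ B) → ¬ Kite R Q → ¬ Kite B Q → Has R 4 0 Q → ⊥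
      around {R} {B} R≢B two noR noB base@(has C u a l m) = <⇒≱ {17} {4 + 10} (≤-trans (≰⇒> h) (≤-trans (size-cover {Q} {fromList C} {U} parts)
          (+-mono-≤ (≤-trans (fromList-≤ C) (≤-reflexive l)) (On.size-T5 B R (R≢B ∘ sym) U (λ p q ne → Sum.swap (two (U⊑ p) (U⊑ q) ne)) no-triangle (ok-E₃-kite (noR ∘ kite-⊑ U⊑)))))) (m≤n+m 14 3)
        where
        U : Subset
        U x = Q x ∧ not (fromList C x)
        U⊑ : U ⊑ Q
        U⊑ {x} p = proj₁ (∧-true {Q x} p)
        outside : ∀ {x} → x ∈ₛ U → x ∉ C
        outside {x} p i = true≢false (∈-fromList {x} C i) (not-true (proj₂ (∧-true {Q x} p)))
        parts : ∀ {x} → x ∈ₛ Q → x ∈ₛ fromList C ⊎ x ∈ₛ U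
        parts {x} q with fromList C x
        ... | true = inj₁ refl
        ... | false = inj₂ (∧-intro q refl)
        four : 4 ≤ size (fromList C)
        four = ≤-trans (≤-reflexive (sym l)) (fromList-≥ C u)
        RedAt : V → V → Set
        RedAt y p = ∀ {q} → q ∈ C → q ≢ p → c y q ≡ B
        red-at : ∀ {y} → y ∈ₛ U → ∃ (RedAt y)
        red-at {y} y∈ with Any.any? (λ p → c y p Fin.≟ R) C
        ... | no none = y , λ {q} q∈ _ → [ (λ e → ⊥-elim (none (lose q∈ e))) , id ]′ (two (U⊑ y∈) (All.lookup a q∈) λ { refl → outside y∈ q∈ })
        ... | yes some with find some
        ...   | p , p∈ , e = p , λ {q} q∈ ne → [ (λ e′ → ⊥-elim (noR record
                { base = base ; y∈ = U⊑ y∈ ; y∉ = outside y∈ ; p∈ = p∈ ; q∈ = q∈ ; p≢q = ne ∘ sym ; yp = e ; yq = e′ })) , id ]′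
                (two (U⊑ y∈) (All.lookup a q∈) λ { refl → outside y∈ q∈ })
        no-triangle : Ok B T U
        no-triangle (has (x ∷ y ∷ z ∷ []) un@((xy ∷ xz ∷ []) ∷ (yz ∷ []) ∷ _) (x∈ ∷ y∈ ∷ z∈ ∷ []) refl mm)
          with red-at x∈ | red-at y∈ | red-at z∈
        -- The three exceptions leave one vertex `w` of the four in `C`, joined by `B` to the whole
        -- triangle. A further vertex `v`, other than `w`, `p` and `q`, is joined by `B` to `x` and
        -- `y` and completes a kite.
        ... | p , hp | q , hq | r , hr with escape {fromList C} (p ∷ q ∷ r ∷ []) four
        ...   | w , w∈ , w∉ with escape {fromList C} (w ∷ p ∷ q ∷ []) four
        ...     | v , v∈ , v∉ = noB record
                  { base = has (w ∷ x ∷ y ∷ z ∷ [])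
                      ((away x∈ ∷ away y∈ ∷ away z∈ ∷ []) ∷ un) (All.lookup a wC ∷ U⊑ x∈ ∷ U⊑ y∈ ∷ U⊑ z∈ ∷ []) refl
                      (≤-trans (≤-reflexive (cong (_+ miss (adjacent B) (x ∷ y ∷ z ∷ [])) (row-all
                        (trans (c-sym w x) (hp wC (w∉ ∘ here)) ∷ trans (c-sym w y) (hq wC (w∉ ∘ there ∘ here)) ∷ trans (c-sym w z) (hr wC (w∉ ∘ there ∘ there ∘ here)) ∷ [])))) mm)
                  ; y∈ = All.lookup a vC
                  ; y∉ = λ { (here e) → v∉ (here e) ; (there (here refl)) → outside x∈ vC ; (there (there (here refl))) → outside y∈ vC ; (there (there (there (here refl)))) → outside z∈ vC }
                  ; p∈ = there (here refl) ; q∈ = there (there (here refl)) ; p≢q = xy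
                  ; yp = trans (c-sym v x) (hp vC (v∉ ∘ there ∘ here)) ; yq = trans (c-sym v y) (hq vC (v∉ ∘ there ∘ there ∘ here)) }
          where
          wC = fromList-∈ {w} C w∈
          vC = fromList-∈ {v} C v∈
          away : ∀ {x} → x ∈ₛ U → w ≢ x
          away x∈ refl = outside x∈ wC

    -- Prime partitions without kites.

    module OnPartition (S : Subset) (label : V → V)
      (hom : ∀ {x x′ y} → x ∈ₛ S → x′ ∈ₛ S → y ∈ₛ S → label x ≡ label x′ → label x ≢ label y → c x y ≡ c x′ y)
      (Y x₁ : ℕ) (sizes : Sizes (21 * Y) x₁) where
      open Prime S label hom (21 * Y) x₁ sizes public

      -- All sizes are multiples of a power `Y` of 17, and the target is 17 · 17 · Y = 289Y. The
      -- entries come from the table: 47 and 141 = 3 · 47 with one triangle-free colour, 68 and 204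
      -- = 3 · 68 after one colour is lost or becomes J₄-free. Only `flat` uses the induction on
      -- kites, which improves 21 to 17.
      record Limits (R B : Colour) : Set where
        field
          flat : ∀ {x} → x ∈ₛ S → Ok R O (cl x) → Ok B O (cl x) → size (cl x) ≤ 17 * Y
          T-O : ∀ {x} → x ∈ₛ S → Ok R T (cl x) → Ok B O (cl x) → size (cl x) ≤ 47 * Y
          O-T : ∀ {x} → x ∈ₛ S → Ok R O (cl x) → Ok B T (cl x) → size (cl x) ≤ 47 * Y
          T-E₂ : ∀ {x} → x ∈ₛ S → Ok R T (cl x) → Ok B E₂ (cl x) → size (cl x) ≤ 141 * Y
          E₂-T : ∀ {x} → x ∈ₛ S → Ok R E₂ (cl x) → Ok B T (cl x) → size (cl x) ≤ 141 * Y
          R-free : ∀ {X} → X ⊑ S → Ok R O X → size X ≤ 68 * Y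
          B-free : ∀ {X} → X ⊑ S → Ok B O X → size X ≤ 68 * Y
          R-E₂ : ∀ {X} → X ⊑ S → Ok R E₂ X → size X ≤ 204 * Y
          B-E₂ : ∀ {X} → X ⊑ S → Ok B E₂ X → size X ≤ 204 * Y
          positive : 1 ≤ Y

      swap-limits : ∀ {R B} → Limits R B → Limits B R
      swap-limits l = record
        { flat = λ s p q → flat s q p ; T-O = λ s p q → O-T s q p ; O-T = λ s p q → T-O s q p ; T-E₂ = λ s p q → E₂-T s q p ; E₂-T = λ s p q → T-E₂ s q p
        ; R-free = B-free ; B-free = R-free ; R-E₂ = B-E₂ ; B-E₂ = R-E₂ ; positive = positive }
        where open Limits l

      module Half-kite {R B : Colour} (setting : Setting R B) (limits : Limits R B) (kR : ¬ Kite R S) (kB : ¬ Kite B S) where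
        open Setting setting
        open Bounds bounds
        open Limits limits
        open Full setting
        open Basic setting

        okR : Ok R E₃ S
        okR = ok-E₃-kite kR

        okB : Ok B E₃ S
        okB = ok-E₃-kite kB

        at-most : ∀ {a b} → a ≤ b → a * Y ≤ b * Y
        at-most h = *-monoˡ-≤ Y h

        const : ∀ a → a ≤ a * Y
        const a = ≤-trans (≤-reflexive (sym (*-identityʳ a))) (*-monoʳ-≤ a positive)

        reps-bound : ∀ {Q N b} → Q ⊑ S → (∀ {P} → P ⊑ Q → P ⊑ Rep → size P ≤ N) → (∀ {x} → x ∈ₛ Q → size (cl x) ≤ b) → Closed Q → size Q ≤ N * b
        reps-bound {Q} {N} {b} Q⊑ few small′ cQ = ≤-trans (covered (elements P) Q λ {y} p →
              let (s′ , e) = cl-in {y} (lead-∈ (Q⊑ p)) in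
              lose (∈-elements {P} (∧-intro (lead-Rep (Q⊑ p)) (cl⊑ cQ p (lead-∈ (Q⊑ p))))) (cl-intro (Q⊑ p) (sym e)))
            (≤-trans (total (elements P) (elements-all P)) (≤-trans (*-monoˡ-≤ b (≤-reflexive (size-elements P))) (*-monoˡ-≤ b (few {P} (λ {x} p → proj₂ (∧-true {Rep x} p)) (λ {x} p → proj₁ (∧-true {Rep x} p))))))
          where
          P : Subset
          P x = Rep x ∧ Q x
          total : ∀ L → All (_∈ₛ P) L → sum (map (size ∘ cl) L) ≤ length L * b
          total [] [] = z≤n
          total (x ∷ L) (p ∷ ps) = +-mono-≤ (small′ (proj₂ (∧-true {Rep x} p))) (total L ps)

        rep-pairs : ∀ {P} → P ⊑ Rep → ∀ {x y} → x ∈ₛ P → y ∈ₛ P → x ≢ y → c x y ≡ R ⊎ c x y ≡ B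
        rep-pairs h p q ne = two (proj₁ (Rep-in (h p))) (proj₁ (Rep-in (h q))) (ne ∘ Rep-injective (h p) (h q))

        all-flat : Flat R B S → size S ≤ 289 * Y
        all-flat fl = ≤-trans (reps-bound {S} {17} {17 * Y} id
            (λ {P} hS hP → size-kite R≢B P (rep-pairs {P} hP) (kR ∘ kite-⊑ hS) (kB ∘ kite-⊑ hS)) (λ p → flat p (proj₁ (fl p)) (proj₂ (fl p))) S-closed)
          (≤-reflexive (sym (*-assoc 17 17 Y)))

        -- For disjoint sets with all edges between them of colour R, the first with an R-edge: then both have two vertices, or
        -- the second has no R-edge and either one vertex or the first no R-triangle.
        data Link (P Q : Subset) : Set where
          two-two : size P ≤ 2 → size Q ≤ 2 → Link P Q
          point : Ok R O Q → size Q ≤ 1 → Link P Q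
          triangle-free : Ok R O Q → Ok R T P → Link P Q

        link : ∀ {P Q} → P ⊑ S → Q ⊑ S → Joined R P Q → Has R 2 0 P → Link P Q
        link {P} {Q} hP hQ j h with has? R 2 0 Q | has? R 3 0 P
        ... | yes h′ | _ = two-two (cross {R} {P} {Q} {S} hP hQ j kR h h′) (cross {R} {Q} {P} {S} hQ hP (joined-sym {R} {P} {Q} j) kR h′ h)
        ... | no f | yes t = point f (cone {R} {P} {Q} {S} hP hQ j kR t)
        ... | no f | no t = triangle-free f t

        sum₃ : ∀ a b d e → a + b + d ≤ e → ∀ {u v w} → u ≤ a * Y → v ≤ b * Y → w ≤ d * Y → u + v + w ≤ e * Y
        sum₃ a b d e l hu hv hw = ≤-trans (+-mono-≤ (+-mono-≤ hu hv) hw) (≤-trans (≤-reflexive (eq a b d)) (at-most l))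
          where
          eq : ∀ a b d → a * Y + b * Y + d * Y ≡ (a + b + d) * Y
          eq a b d = trans (cong (_+ d * Y) (sym (*-distribʳ-+ Y a b))) (sym (*-distribʳ-+ Y (a + b) d))

        -- By `cross`, an edge of `B` in both the class and the blue neighbourhood makes the class
        -- tiny; the alternative in the hypothesis records this, and the link in colour `R` does the
        -- rest.
        both : ∀ {x} → x ∈ₛ S → Has R 2 0 (cl x) → Ok B O (nb B x S) ⊎ size (cl x) ≤ 2 → size S ≤ 289 * Y
        both {x} p h free = ≤-trans (size-three S-closed p) (cases (link (cl-S p) (nb⊑ {R} {x} {S}) (nb-joined S-closed p) h) free)
          where
          N⊑ : ∀ i → nb i x S ⊑ S
          N⊑ i = nb⊑ {i} {x} {S}
          B-part : size (nb B x S) ≤ 204 * Y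
          B-part = B-E₂ (N⊑ B) (ok-T-E₂ (around {B} p {2} {1} {3} {0} okB (has-pair B h)))
          cases : Link (cl x) (nb R x S) → Ok B O (nb B x S) ⊎ size (cl x) ≤ 2 → size (cl x) + size (nb R x S) + size (nb B x S) ≤ 289 * Y
          cases (two-two s t) _ = sum₃ 2 2 204 289 (m≤m+n 208 81) (≤-trans s (const 2)) (≤-trans t (const 2)) B-part
          cases (point f t) (inj₁ g) = sum₃ 189 1 68 289 (m≤m+n 258 31) (≤-trans (E₂E₂ p (R₂ p) (B₂ p)) (≤-reflexive (sym (*-assoc 9 21 Y)))) (≤-trans t (const 1)) (B-free (N⊑ B) g)
          cases (triangle-free f t) (inj₁ g) = sum₃ 141 68 68 289 (m≤m+n 277 12) (T-E₂ p t (B₂ p)) (R-free (N⊑ R) f) (B-free (N⊑ B) g)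
          cases (point f t) (inj₂ s) = sum₃ 2 1 204 289 (m≤m+n 207 82) (≤-trans s (const 2)) (≤-trans t (const 1)) B-part
          cases (triangle-free f t) (inj₂ s) = sum₃ 2 68 204 289 (m≤m+n 274 15) (≤-trans s (const 2)) (R-free (N⊑ R) f) B-part

        module Inside (oc : OneColoured R B S) {D : Subset} (cD : Closed D) (bT : Ok B T D) where
          open Closed cD

          N⊑ : ∀ i q → nb i q D ⊑ S
          N⊑ i q = sub ∘ nb⊑ {i} {q} {D}

          r-ok : ∀ {X} → X ⊑ D → Ok R E₃ X
          r-ok h = ok-⊑ E₃ (sub ∘ h) okR

          -- The bound 204 for J₄-free sets would give 47 + 68 + 204 > 289 in `red`, so the absence
          -- of triangles of `B` must be used inside the neighbourhood again. The cases give 47 +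
          -- 126, 10 · 17 and 47 + 42 + 84; with 173 the sum in `red` is 288.
          inside : size D ≤ 173 * Y
          inside with Basic.find-class (swap-setting setting) 2 0 D
          ... | inj₁ (q , q∈ , h) = ≤-trans (size-three cD q∈) (sum₃ 47 126 0 173 ≤-refl
                  (O-T (sub q∈) rO (ok-⊑ T (cl⊑ cD q∈) bT))
                  (≤-trans (one-coloured-22 (nb-closed cD (sub q∈)) (oc ∘ N⊑ R q)
                    (ok-T-E₂ λ t → okR (has-join {R} {cl q} {nb R q D} {S} (cl-S (sub q∈)) (N⊑ R q) (nb-joined cD (sub q∈)) (has-pair R h) t))
                    (ok-T-E₂ (ok-⊑ T (nb⊑ {R} {q} {D}) bT))) (≤-reflexive (sym (*-assoc 6 21 Y))))
                  (≤-reflexive (size-empty (nb B q D) λ {y} m → bT (has-join {B} {cl q} {nb B q D} {D} (cl⊑ cD q∈) (nb⊑ {B} {q} {D}) (nb-joined cD (sub q∈)) h (has-one {x = y} m)))))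
            where
            rO : Ok R O (cl q)
            rO = [ id , (λ f → ⊥-elim (f h)) ]′ (oc (sub q∈))
          ... | inj₂ noB with find-class 2 0 D
          -- With all classes flat, ten representatives are possible by R(K₃, J₅) = 11, each with a
          -- class of at most 17Y vertices.
          ...   | inj₂ noR = ≤-trans (reps-bound {D} {10} {17 * Y} sub
                    (λ {P} hD hP → On.size-T5 B R (R≢B ∘ sym) P (λ p q ne → Sum.swap (rep-pairs {P} hP p q ne)) (ok-⊑ T hD bT) (r-ok hD))
                    (λ p → flat (sub p) (noR p) (noB p)) cD)
                  (≤-trans (≤-reflexive (sym (*-assoc 10 17 Y))) (at-most (m≤m+n 170 3)))
          ...   | inj₁ (q , q∈ , h) = ≤-trans (size-three cD q∈) (cases (link (cl-S s) (N⊑ R q) (nb-joined cD s) h))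
            where
            s = sub q∈
            B-part : size (nb B q D) ≤ 84 * Y
            B-part = ≤-trans (Basic.O-E₃ (swap-setting setting) (nb-closed cD s)
              (λ e → bT (has-join {B} {cl q} {nb B q D} {D} (cl⊑ cD q∈) (nb⊑ {B} {q} {D}) (nb-joined cD s) (has-one {x = q} (cl-self s)) e))
              (r-ok (nb⊑ {B} {q} {D}))) (≤-reflexive (sym (*-assoc 4 21 Y)))
            cases : Link (cl q) (nb R q D) → size (cl q) + size (nb R q D) + size (nb B q D) ≤ 173 * Y
            cases (two-two u v) = sum₃ 2 2 84 173 (m≤m+n 88 85) (≤-trans u (const 2)) (≤-trans v (const 2)) B-part
            cases (point f v) = sum₃ 63 1 84 173 (m≤m+n 148 25) (≤-trans (E₂O s (R₂ s) (noB q∈)) (≤-reflexive (sym (*-assoc 3 21 Y)))) (≤-trans v (const 1)) B-part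
            cases (triangle-free f t) = sum₃ 47 42 84 173 ≤-refl (T-O s t (noB q∈))
              (≤-trans (free-O-E₂ (nb-closed cD s) (noB ∘ nb⊑ {R} {q} {D}) f (ok-T-E₂ (ok-⊑ T (nb⊑ {R} {q} {D}) bT))) (≤-reflexive (sym (*-assoc 2 21 Y))))
              B-part

        red : OneColoured R B S → ∀ {x} → x ∈ₛ S → Has R 2 0 (cl x) → size S ≤ 289 * Y
        red oc {x} p h = ≤-trans (size-three S-closed p) (cases (link (cl-S p) (nb⊑ {R} {x} {S}) (nb-joined S-closed p) h))
          where
          bO : Ok B O (cl x)
          bO = free-colour p oc h
          bT : Ok B T (nb B x S)
          bT = around {B} p {2} {1} {3} {0} okB (has-pair B h)
          B-part : size (nb B x S) ≤ 204 * Y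
          B-part = B-E₂ (nb⊑ {B} {x} {S}) (ok-T-E₂ bT)
          cases : Link (cl x) (nb R x S) → size (cl x) + size (nb R x S) + size (nb B x S) ≤ 289 * Y
          cases (two-two s t) = sum₃ 2 2 204 289 (m≤m+n 208 81) (≤-trans s (const 2)) (≤-trans t (const 2)) B-part
          cases (point f t) = sum₃ 63 1 204 289 (m≤m+n 268 21) (≤-trans (E₂O p (R₂ p) bO) (≤-reflexive (sym (*-assoc 3 21 Y)))) (≤-trans t (const 1)) B-part
          cases (triangle-free f t) = sum₃ 47 68 173 289 (m≤m+n 288 1) (T-O p t bO) (R-free (nb⊑ {R} {x} {S}) f) (Inside.inside oc (nb-closed S-closed p) bT)

      module _ {R B : Colour} (setting : Setting R B) (limits : Limits R B) (kR : ¬ Kite R S) (kB : ¬ Kite B S) where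
        prime-kite : size S ≤ 289 * Y
        prime-kite with Finₚ.any? (λ x → in? x S ×-dec (has? R 2 0 (cl x) ×-dec has? B 2 0 (cl x)))
        ... | yes (x , p , h , h′) = Half-kite.both setting limits kR kB p h (blue (has? B 2 0 (nb B x S)))
          where
          blue : Dec (Has B 2 0 (nb B x S)) → Ok B O (nb B x S) ⊎ size (cl x) ≤ 2
          blue (no f) = inj₁ f
          blue (yes g) = inj₂ (cross {B} {cl x} {nb B x S} {S} (cl-S p) (nb⊑ {B} {x} {S}) (nb-joined S-closed p) kB h′ g)
        ... | no none with Finₚ.any? (λ x → in? x S ×-dec has? R 2 0 (cl x)) | Finₚ.any? (λ x → in? x S ×-dec has? B 2 0 (cl x))
        ...   | yes (x , p , h) | _ = Half-kite.red setting limits kR kB oc p h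
          where
          oc : ∀ {x} → x ∈ₛ S → Ok R O (cl x) ⊎ Ok B O (cl x)
          oc {x} p with has? R 2 0 (cl x)
          ... | no f = inj₁ f
          ... | yes h = inj₂ λ h′ → none (x , p , h , h′)
        ...   | no _ | yes (x , p , h) = Half-kite.red (swap-setting setting) (swap-limits limits) kB kR oc p h
          where
          oc : ∀ {x} → x ∈ₛ S → Ok B O (cl x) ⊎ Ok R O (cl x)
          oc {x} p with has? R 2 0 (cl x)
          ... | no f = inj₂ f
          ... | yes h = inj₁ λ h′ → none (x , p , h , h′)
        ...   | no noR | no noB = Half-kite.all-flat setting limits kR kB λ {x} p → (λ h → noR (x , p , h)) , (λ h → noB (x , p , h))

    -- From subgraphs in sets to copies of H₃ and H₂.

    copy-H₃ : ∀ {i S} → Has i 5 1 S → MonoCopy H₃ c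
    copy-H₃ {i} h with sorted-J₅ h
    ... | record { r = r ; s = s ; t = t ; p = p ; q = q ; unique = u ; only = only } = i , f , (λ {a} {b} → lookup-injective u a b) , edges
      where
      L = r ∷ s ∷ t ∷ p ∷ q ∷ []
      f : Fin 5 → V
      f = lookup L
      edges : ∀ a b → H₃ a b ≡ true → c (f a) (f b) ≡ i
      edges a b e with only (∈-lookup a) (∈-lookup b) (irreflexive h₃ a b e ∘ lookup-injective u a b)
      ... | inj₁ h = h
      ... | inj₂ (inj₁ (x , y)) with lookup-injective u a 3F x | lookup-injective u b 4F y
      ...   | refl | refl = case e of λ ()
      edges a b e | inj₂ (inj₂ (x , y)) with lookup-injective u a 4F x | lookup-injective u b 3F y
      ...   | refl | refl = case e of λ ()

    copy-H₂ : ∀ {i S} → Kite i S → MonoCopy H₂ c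
    copy-H₂ {i} κ with two-front (Kite.p∈ κ) (Kite.q∈ κ) (Kite.p≢q κ)
    ... | r ∷ s ∷ [] , σ = i , lookup L , (λ {a} {b} → lookup-injective unique a b) , edges
      where
      open Kite κ
      open Has base using (list) renaming (unique to list-unique; few to list-few)
      L = p ∷ q ∷ r ∷ s ∷ y ∷ []
      inner : Unique (p ∷ q ∷ r ∷ s ∷ [])
      inner = Unique-↭ σ list-unique
      back : ∀ {x} → x ∈ p ∷ q ∷ r ∷ s ∷ [] → x ∈ list
      back = ∈-resp-↭ (↭-sym σ)
      away : ∀ {x} → x ∈ p ∷ q ∷ r ∷ s ∷ [] → x ≢ y
      away m refl = y∉ (back m)
      unique : Unique L
      unique with inner
      ... | (a ∷ b ∷ d ∷ []) ∷ (e ∷ f ∷ []) ∷ (g ∷ []) ∷ _ =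
        (a ∷ b ∷ d ∷ away (here refl) ∷ []) ∷ (e ∷ f ∷ away (there (here refl)) ∷ []) ∷ (g ∷ away (there (there (here refl))) ∷ []) ∷ (away (there (there (there (here refl)))) ∷ []) ∷ [] ∷ []
      K : ∀ a b → a ≢ b → c (lookup (p ∷ q ∷ r ∷ s ∷ []) a) (lookup (p ∷ q ∷ r ∷ s ∷ []) b) ≡ i
      K a b ne = clique-pair list (n≤0⇒n≡0 list-few) (back (∈-lookup a)) (back (∈-lookup b)) (ne ∘ lookup-injective inner a b)
      edges : ∀ a b → H₂ a b ≡ true → c (lookup L a) (lookup L b) ≡ i
      edges 0F 1F _ = K 0F 1F λ ()
      edges 0F 2F _ = K 0F 2F λ ()
      edges 0F 3F _ = K 0F 3F λ ()
      edges 1F 0F _ = K 1F 0F λ ()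
      edges 1F 2F _ = K 1F 2F λ ()
      edges 1F 3F _ = K 1F 3F λ ()
      edges 2F 0F _ = K 2F 0F λ ()
      edges 2F 1F _ = K 2F 1F λ ()
      edges 2F 3F _ = K 2F 3F λ ()
      edges 3F 0F _ = K 3F 0F λ ()
      edges 3F 1F _ = K 3F 1F λ ()
      edges 3F 2F _ = K 3F 2F λ ()
      edges 4F 0F _ = yp
      edges 4F 1F _ = yq
      edges 0F 4F _ = trans (c-sym p y) yp
      edges 1F 4F _ = trans (c-sym q y) yq
      edges 0F 0F ()
      edges 1F 1F ()
      edges 2F 2F ()
      edges 3F 3F ()
      edges 4F 4F ()
      edges 2F 4F ()
      edges 3F 4F ()
      edges 4F 2F ()
      edges 4F 3F ()
    copy-H₂ κ | [] , σ = case trans (sym (Has.count (Kite.base κ))) (↭-length σ) of λ ()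
    copy-H₂ κ | _ ∷ [] , σ = case trans (sym (Has.count (Kite.base κ))) (↭-length σ) of λ ()
    copy-H₂ κ | _ ∷ _ ∷ _ ∷ _ , σ = case trans (sym (Has.count (Kite.base κ))) (↭-length σ) of λ ()

    kite? : ∀ i S → Dec (Kite i S)
    kite? i S with Any.any? (λ C → (AllPairs.allPairs? (λ x y → ¬? (x Fin.≟ y)) C ×-dec (All.all? (λ x → in? x S) C ×-dec ((length C Data.Nat.≟ 4) ×-dec (miss (adjacent i) C Data.Nat.≤? 0))))
          ×-dec Finₚ.any? (λ y → (in? y S ×-dec ¬? (Any.any? (y Fin.≟_) C)) ×-dec Finₚ.any? (λ p → (Any.any? (p Fin.≟_) C ×-dec (c y p Fin.≟ i)) ×-dec
            Finₚ.any? (λ q → Any.any? (q Fin.≟_) C ×-dec (¬? (p Fin.≟ q) ×-dec (c y q Fin.≟ i)))))) (tuples 4)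
    ... | yes h = let (C , _ , (u , a , l , m) , y , (y∈ , y∉) , p , (p∈ , yp) , q , q∈ , ne , yq) = find h in
            yes record { base = has C u a l m ; y∈ = y∈ ; y∉ = y∉ ; p∈ = p∈ ; q∈ = q∈ ; p≢q = ne ; yp = yp ; yq = yq }
    ... | no h = no λ { record { base = has C u a l m ; y∈ = y∈ ; y∉ = y∉ ; p∈ = p∈ ; q∈ = q∈ ; p≢q = ne ; yp = yp ; yq = yq } →
        h (lose (subst (λ s → C ∈ tuples s) l (∈-tuples C)) ((u , a , l , m) , _ , (y∈ , y∉) , _ , (p∈ , yp) , _ , q∈ , ne , yq)) }

    -- Induction over all sets of vertices.

    module Bounding
      (no-rainbow : ∀ {x y z} → x ≢ y → y ≢ z → x ≢ z → c x y ≢ c x z → c y z ≡ c x y ⊎ c y z ≡ c x z) where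
      open Decompose c c-sym no-rainbow using (Partition; partition-acc)
      open Assignments {k} public

      record JoinOf (i : Colour) (S : Subset) : Set where
        field
          P Q : Subset
          {p₀ q₀} : V
          P⊑ : P ⊑ S
          Q⊑ : Q ⊑ S
          p∈ : p₀ ∈ₛ P
          q∈ : q₀ ∈ₛ Q
          covers : ∀ {x} → x ∈ₛ S → x ∈ₛ P ⊎ x ∈ₛ Q
          joined : Joined i P Q

        edge : p₀ ∈ₛ S × q₀ ∈ₛ S × p₀ ≢ q₀ × c p₀ q₀ ≡ i
        edge = let (ne , e) = joined p∈ q∈ in P⊑ p∈ , Q⊑ q∈ , ne , e

        sum-bound : ∀ {a b} → size P ≤ a → size Q ≤ b → size S ≤ a + b
        sum-bound h h′ = ≤-trans (size-cover {S} {P} {Q} covers) (+-mono-≤ h h′)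

        outside : ∀ {A B} → Joined i A B → ∀ {x} → x ∈ₛ B → A x ≡ false
        outside {A} j {x} m with A x in eq
        ... | false = refl
        ... | true = ⊥-elim (proj₁ (j eq m) refl)

        P< : size P < size S
        P< = size-< {P} {S} P⊑ (Q⊑ q∈) (outside {P} {Q} joined q∈)

        Q< : size Q < size S
        Q< = size-< {Q} {S} Q⊑ (P⊑ p∈) (outside {Q} {P} (joined-sym {i} {P} {Q} joined) p∈)

        without : ∀ {s s′ d d′} → ¬ Has i (s + s′) (d + d′) S → Has i s d P → ¬ Has i s′ d′ Q
        without h a b = h (has-join P⊑ Q⊑ joined a b)

      flip-join : ∀ {i S} → JoinOf i S → JoinOf i S
      flip-join j = record { P = Q ; Q = P ; P⊑ = Q⊑ ; Q⊑ = P⊑ ; p∈ = q∈ ; q∈ = p∈ ; covers = λ m → Sum.swap (covers m) ; joined = joined-sym {_} {P} {Q} joined }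
        where open JoinOf j

      record PrimeOf (S : Subset) : Set where
        field
          R B : Colour
          R≢B : R ≢ B
          label : V → V
          hom : ∀ {x x′ y} → x ∈ₛ S → x′ ∈ₛ S → y ∈ₛ S → label x ≡ label x′ → label x ≢ label y → c x y ≡ c x′ y
          two : ∀ {x y} → x ∈ₛ S → y ∈ₛ S → label x ≢ label y → c x y ≡ R ⊎ c x y ≡ B
          outR : ∀ {x} → x ∈ₛ S → ∃ λ y → y ∈ₛ S × label x ≢ label y × c x y ≡ R
          outB : ∀ {x} → x ∈ₛ S → ∃ λ y → y ∈ₛ S × label x ≢ label y × c x y ≡ B
          {v} : V
          v∈ : v ∈ₛ S

      -- If a vertex lacks one of the two colours outside its class, its class is joined to
      -- everything else in the other colour. The same happens when the two colours coincide.
      decompose : ∀ S {a b} → a ∈ₛ S → b ∈ₛ S → a ≢ b → (∃ λ i → JoinOf i S) ⊎ PrimeOf S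
      decompose S a∈ b∈ a≢b = go (partition-acc (elements S) (<-wellFounded _) (elements-unique S) (∈-elements {S} a∈) (∈-elements {S} b∈) a≢b)
        where
        go : Partition (elements S) → (∃ λ i → JoinOf i S) ⊎ PrimeOf S
        go pt = result
          where
          open Partition pt using (label; R; B; a≁b; a; b)
          ∈e : ∀ {x} → x ∈ₛ S → x ∈ elements S
          ∈e = ∈-elements {S}
          hom : ∀ {x x′ y} → x ∈ₛ S → x′ ∈ₛ S → y ∈ₛ S → label x ≡ label x′ → label x ≢ label y → c x y ≡ c x′ y
          hom p q r = Partition.hom pt (∈e p) (∈e q) (∈e r)
          two : ∀ {x y} → x ∈ₛ S → y ∈ₛ S → label x ≢ label y → c x y ≡ R ⊎ c x y ≡ B
          two p q = Partition.two pt (∈e p) (∈e q)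
          a∈′ : a ∈ₛ S
          a∈′ = elements-∈ {S} (Partition.a∈ pt)
          b∈′ : b ∈ₛ S
          b∈′ = elements-∈ {S} (Partition.b∈ pt)
          another : ∀ x → ∃ λ y → y ∈ₛ S × label x ≢ label y
          another x with label x Fin.≟ label a
          ... | no ne = a , a∈′ , ne
          ... | yes e = b , b∈′ , λ e′ → a≁b (trans (sym e) e′)
          out? : ∀ i x → Dec (∃ λ y → y ∈ₛ S × label x ≢ label y × c x y ≡ i)
          out? i x = Finₚ.any? λ y → in? y S ×-dec (¬? (label x Fin.≟ label y) ×-dec (c x y Fin.≟ i))
          join-at : ∀ i {x} → x ∈ₛ S → (∀ {y} → y ∈ₛ S → label x ≢ label y → c x y ≡ i) → JoinOf i S
          join-at i {x} x∈ h = record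
            { P = P ; Q = Q ; p₀ = x ; q₀ = proj₁ (another x) ; P⊑ = λ {y} m → proj₁ (P-in y m) ; Q⊑ = λ {y} m → proj₁ (Q-in y m)
            ; p∈ = ∧-intro x∈ (dec-true (label x Fin.≟ label x) refl)
            ; q∈ = Q-intro _ (proj₁ (proj₂ (another x))) (proj₂ (proj₂ (another x)))
            ; covers = λ {y} m → case label x Fin.≟ label y of λ
                { (yes e) → inj₁ (∧-intro m (dec-true (label x Fin.≟ label y) e)) ; (no ne) → inj₂ (Q-intro y m ne) }
            ; joined = λ {y} {z} m m′ → let (s , e) = P-in y m ; (s′ , ne) = Q-in z m′ in
                (λ { refl → ne e }) , trans (sym (hom x∈ s s′ e ne)) (h s′ ne) }
            where
            P Q : Subset
            P y = S y ∧ does (label x Fin.≟ label y)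
            Q y = S y ∧ not (does (label x Fin.≟ label y))
            P-in : ∀ y → y ∈ₛ P → y ∈ₛ S × label x ≡ label y
            P-in y m with ∧-true {S y} m
            ... | s , d with label x Fin.≟ label y
            ...   | yes e = s , e
            Q-in : ∀ y → y ∈ₛ Q → y ∈ₛ S × label x ≢ label y
            Q-in y m with ∧-true {S y} m
            ... | s , d = s , λ e → true≢false (dec-true (label x Fin.≟ label y) e) (not-true d)
            Q-intro : ∀ y → y ∈ₛ S → label x ≢ label y → y ∈ₛ Q
            Q-intro y s ne = ∧-intro s (cong not (dec-false (label x Fin.≟ label y) ne))
          missing : ∀ i → (∃ λ x → x ∈ₛ S × ¬ (∃ λ y → y ∈ₛ S × label x ≢ label y × c x y ≡ i)) ⊎
                          (∀ {x} → x ∈ₛ S → ∃ λ y → y ∈ₛ S × label x ≢ label y × c x y ≡ i)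
          missing i with Finₚ.any? (λ x → in? x S ×-dec ¬? (out? i x))
          ... | yes (x , p , h) = inj₁ (x , p , h)
          ... | no none = inj₂ λ {x} p → case out? i x of λ { (yes h) → h ; (no h) → ⊥-elim (none (x , p , h)) }
          result : (∃ λ i → JoinOf i S) ⊎ PrimeOf S
          result with missing R
          ... | inj₁ (x , p , h) = inj₁ (B , join-at B p λ {y} s ne → [ (λ e → ⊥-elim (h (y , s , ne , e))) , id ]′ (two p s ne))
          ... | inj₂ outR with missing B
          ...   | inj₁ (x , p , h) = inj₁ (R , join-at R p λ {y} s ne → [ id , (λ e → ⊥-elim (h (y , s , ne , e))) ]′ (two p s ne))
          ...   | inj₂ outB with R Fin.≟ B
          ...     | yes e = inj₁ (R , join-at R a∈′ λ {y} s ne → [ id , (λ e′ → trans e′ (sym e)) ]′ (two a∈′ s ne))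
          ...     | no ne = inj₂ record { R = R ; B = B ; R≢B = ne ; label = label ; hom = hom ; two = two ; outR = outR ; outB = outB ; v∈ = a∈′ }

      Sat : Assignment → Subset → Set
      Sat σ S = ∀ i → Ok i (σ i) S

      ok-E₃ : ∀ {i S} s → Ok i s S → Ok i E₃ S
      ok-E₃ O h = ok-E₂-E₃ (ok-O-E₂ h)
      ok-E₃ E₁ h = ok-E₂-E₃ (ok-E₁-E₂ h)
      ok-E₃ T h = ok-E₂-E₃ (ok-T-E₂ h)
      ok-E₃ E₂ h = ok-E₂-E₃ h
      ok-E₃ E₃ h = h

      Bounded-below : Subset → Set
      Bounded-below S = ∀ {P} → size P < size S → ∀ σ m a τ ε → Profile σ m a τ ε → Sat σ P → size P ≤ β m a τ ε

      sat-update : ∀ {σ P i s} → (∀ j → j ≢ i → Ok j (σ j) P) → Ok i s P → Sat (σ [ i ≔ s ]) P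
      sat-update {σ} {P} {i} {s} h o j with j Fin.≟ i
      ... | yes refl = o
      ... | no ne = h j ne

      module JoinCase {S : Subset} (ih : Bounded-below S) (σ : Assignment) (sat : Sat σ S) {i : Colour} where

        -- The joining colour is erased first; each side then regains it in the smaller state that
        -- the other side leaves to it.
        ρ : Assignment
        ρ = σ [ i ≔ O ]

        rest-ok : ∀ {X} → X ⊑ S → ∀ j → j ≢ i → Ok j (ρ j) X
        rest-ok X⊑ j ne = subst (λ s → Ok j s _) (sym (at-other σ O ne)) (ok-⊑ (σ j) X⊑ (sat j))

        module _ {m a τ ε} (p : Profile ρ m a τ ε) {X : Subset} (X< : size X < size S) (X⊑ : X ⊑ S) where
          bound-O : Ok i O X → size X ≤ β m a τ ε
          bound-O o = ih X< ρ m a τ ε p (sat-update (λ j ne → ok-⊑ (σ j) X⊑ (sat j)) o)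

          bound-E₁ : Ok i E₁ X → size X ≤ β m a τ true
          bound-E₁ o = ih X< _ m a τ true (add-E₁ p (at-same σ i O)) (sat-update (rest-ok X⊑) o)

          bound-E₂ : Ok i E₂ X → size X ≤ 3 * β m a τ ε
          bound-E₂ o = ≤-trans (ih X< _ m (suc a) τ ε (add-E₂ p (at-same σ i O)) (sat-update (rest-ok X⊑) o)) (≤-reflexive (sym (β-suc m a τ ε)))

        bound-T : ∀ {m a ε} (p : Profile ρ m a false ε) {X : Subset} (X< : size X < size S) (X⊑ : X ⊑ S) → Ok i T X → size X ≤ β m a true ε
        bound-T p X< X⊑ o = ih X< _ _ _ true _ (add-T p (at-same σ i O)) (sat-update (rest-ok X⊑) o)

        module E₃-case (ok : Ok i E₃ S) {m a τ ε} (p : Profile ρ m a τ ε) where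
          -- If another colour already holds the state T, the J₄-free bound for `P` suffices: 4 · 47
          -- = 188 ≤ 195. Otherwise a triangle in `P` reduces `Q` to one vertex, and without a
          -- triangle the free flag is given to colour `i` on `P`.
          one-side : (j : JoinOf i S) → Has i 3 1 (JoinOf.P j) → size S ≤ β (suc m) a τ ε
          one-side j h = cases τ refl
            where
            open JoinOf j
            Q-O : Ok i O Q
            Q-O = without {3} {2} {1} {0} ok h
            P-E₂ : Ok i E₂ P
            P-E₂ g = without {4} {1} {1} {0} ok g (has-one q∈)
            cases : ∀ t → τ ≡ t → size S ≤ β (suc m) a τ ε
            cases true refl = ≤-trans (sum-bound (bound-E₂ p P< P⊑ P-E₂) (bound-O p Q< Q⊑ Q-O)) (E₃-E₂O ε a m)
            cases false refl with has? i 3 0 P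
            ... | yes g = ≤-trans (sum-bound (bound-E₂ p P< P⊑ P-E₂) (small {i} {Q} (without {3} {2} {0} {1} ok g))) (E₃-E₂1 ε a m)
            ... | no g = ≤-trans (sum-bound (bound-T p P< P⊑ g) (bound-O p Q< Q⊑ Q-O)) (E₃-TO ε a m)

          join-E₃ : JoinOf i S → size S ≤ β (suc m) a τ ε
          join-E₃ j with has? i 3 1 (JoinOf.P j) | has? i 3 1 (JoinOf.Q j)
          ... | yes h | _ = one-side j h
          ... | no _ | yes h = one-side (flip-join j) h
          ... | no h | no h′ = ≤-trans (JoinOf.sum-bound j (bound-E₁ p (JoinOf.P< j) (JoinOf.P⊑ j) h) (bound-E₁ p (JoinOf.Q< j) (JoinOf.Q⊑ j) h′)) (E₃-E₁E₁ τ ε a m)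

        module E₂-case (ok : Ok i E₂ S) {m a τ ε} (p : Profile ρ m a τ ε) where
          one-side : (j : JoinOf i S) → Has i 2 0 (JoinOf.P j) → size S ≤ β m (suc a) τ ε
          one-side j h = ≤-trans (sum-bound (bound-E₁ p P< P⊑ (λ g → without {3} {1} {1} {0} ok g (has-one q∈))) (small {i} {Q} (without {2} {2} {0} {1} ok h))) (E₂-E₁1 τ ε a m)
            where open JoinOf j

          join-E₂ : JoinOf i S → size S ≤ β m (suc a) τ ε
          join-E₂ j with has? i 2 0 (JoinOf.P j) | has? i 2 0 (JoinOf.Q j)
          ... | yes h | _ = one-side j h
          ... | no _ | yes h = one-side (flip-join j) h
          ... | no h | no h′ = ≤-trans (JoinOf.sum-bound j (bound-O p (JoinOf.P< j) (JoinOf.P⊑ j) h) (bound-O p (JoinOf.Q< j) (JoinOf.Q⊑ j) h′))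
                  (≤-trans (≤-trans (m≤m+n _ x) (≤-reflexive (eq x))) (≤-reflexive (β-suc m a τ ε)))
            where
            x = β m a τ ε
            eq : ∀ x → x + x + x ≡ 3 * x
            eq = solve-∀

        join-case : ∀ {m a τ ε} → Profile σ m a τ ε → JoinOf i S → size S ≤ β m a τ ε
        join-case {m} {a} {τ} {ε} pr j with σ i in eq | sat i
        ... | O | ok = let (p , q , ne , e) = JoinOf.edge j in ⊥-elim (ok (has-edge p q ne e))
        ... | E₁ | ok = ≤-trans (sum-bound (small {i} {P} λ g → without {2} {1} {1} {0} ok g (has-one q∈))
                (small {i} {Q} λ g → JoinOf.without (flip-join j) {2} {1} {1} {0} ok g (has-one p∈))) (enough ε refl)
          where
          open JoinOf j
          enough : ∀ e → ε ≡ e → 2 ≤ β m a τ ε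
          enough false refl = ⊥-elim (Profile.e≡ pr refl i eq)
          enough true refl with 2 ≤? β m a τ true
          ... | yes h = h
          ... | no h = case proj₂ (proj₂ (proj₂ (β≡1 m a τ true (≰⇒> h)))) of λ ()
        ... | T | ok with drop-T pr eq
        ...   | refl , p = ≤-trans (sum-bound (bound-O p P< P⊑ λ g → without {2} {1} {0} {0} ok g (has-one q∈))
                (bound-O p Q< Q⊑ λ g → JoinOf.without (flip-join j) {2} {1} {0} {0} ok g (has-one p∈))) (T-OO ε a m)
          where open JoinOf j
        join-case pr j | E₂ | ok with drop-E₂ pr eq
        ...   | a′ , refl , p = E₂-case.join-E₂ ok p j
        join-case pr j | E₃ | ok with drop-E₃ pr eq
        ...   | m′ , refl , p = E₃-case.join-E₃ ok p j

      module PrimeCase {S : Subset} (ih : Bounded-below S) (σ : Assignment) (sat : Sat σ S) (prime : PrimeOf S) where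
        open PrimeOf prime

        ρ : Assignment
        ρ = (σ [ R ≔ O ]) [ B ≔ O ]

        ρR : ρ R ≡ O
        ρR = trans (at-other (σ [ R ≔ O ]) O R≢B) (at-same σ R O)

        ρB : ρ B ≡ O
        ρB = at-same (σ [ R ≔ O ]) B O

        both-update : ∀ {X r b} → X ⊑ S → Ok R r X → Ok B b X → Sat ((ρ [ R ≔ r ]) [ B ≔ b ]) X
        both-update {X} {r} {b} X⊑ okR okB = sat-update first okB
          where
          first : ∀ j → j ≢ B → Ok j ((ρ [ R ≔ r ]) j) X
          first j ne = by-cases (j Fin.≟ R)
            where
            by-cases : Dec (j ≡ R) → Ok j ((ρ [ R ≔ r ]) j) X
            by-cases (yes refl) = subst (λ s → Ok R s X) (sym (at-same ρ R r)) okR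
            by-cases (no ne′) = subst (λ s → Ok j s X) (sym (trans (at-other ρ r ne′) (trans (at-other (σ [ R ≔ O ]) O ne) (at-other σ O ne′)))) (ok-⊑ (σ j) X⊑ (sat j))

        -- The parameters belong to the profile with `R` and `B` erased, and `x₀` bounds a flat
        -- class by the induction hypothesis.
        module Rest {m a τ ε} (p : Profile ρ m a τ ε) (large : 2 ≤ β m a τ ε) where
          x₀ x₁ : ℕ
          x₀ = β m a τ ε
          x₁ = β m a τ true
          sizes : Sizes x₀ x₁
          sizes = β-sizes τ ε a m large
          open Prime S label hom x₀ x₁ sizes

          proper : ∀ {x} → x ∈ₛ S → size (cl x) < size S
          proper {x} s = let (y , s′ , ne , _) = outR s in size-< {cl x} {S} {y} (cl-S s) s′ (away y s′ ne)
            where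
            away : ∀ y → y ∈ₛ S → label x ≢ label y → cl x y ≡ false
            away y s′ ne with cl x y in eq
            ... | false = refl
            ... | true = ⊥-elim (ne (proj₂ (cl-in {x} {y} eq)))

          add-O : ∀ {σ m a τ ε i} → Profile σ m a τ ε → σ i ≡ O → Profile (σ [ i ≔ O ]) m a τ ε
          add-O {σ} {i = i} p s with count-update isE₃ σ i O | count-update isE₂ σ i O | count-update isT σ i O
          ... | x | y | z rewrite s = record
            { m≡ = trans (sym (+-identityʳ _)) (trans x (trans (+-identityʳ _) (Profile.m≡ p)))
            ; a≡ = trans (sym (+-identityʳ _)) (trans y (trans (+-identityʳ _) (Profile.a≡ p)))
            ; t≡ = trans (sym (+-identityʳ _)) (trans z (trans (+-identityʳ _) (Profile.t≡ p))) ; e≡ = λ h → no-E₁ {i = i} {s = O} (Profile.e≡ p h) λ () }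

          class-bound : ∀ {r b x m a τ ε} → x ∈ₛ S → Profile ((ρ [ R ≔ r ]) [ B ≔ b ]) m a τ ε → Ok R r (cl x) → Ok B b (cl x) → size (cl x) ≤ β m a τ ε
          class-bound s pr okR okB = ih (proper s) _ _ _ _ _ pr (both-update (cl-S s) okR okB)

          B-free : ∀ s → (ρ [ R ≔ s ]) B ≡ O
          B-free s = trans (at-other ρ s (R≢B ∘ sym)) ρB

          outR′ : Out R
          outR′ s = let (y , s′ , ne , e) = outR s in y , nb-intro S s′ ne e

          outB′ : Out B
          outB′ s = let (y , s′ , ne , e) = outB s in y , nb-intro S s′ ne e

          setting : Ok R E₃ S → Ok B E₃ S → Setting R B
          setting okR okB = record
            { R≢B = R≢B ; two = two ; bounds = record
              { OO = λ s → class-bound s (add-O (add-O p ρR) (B-free O))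
              ; E₁E₁ = λ s → class-bound s (add-E₁ (add-E₁ p ρR) (B-free E₁))
              ; OE₂ = λ s h h′ → ≤-trans (class-bound s (add-E₂ (add-O p ρR) (B-free O)) h h′) (≤-reflexive (sym (β-suc m a τ ε)))
              ; E₂O = λ s h h′ → ≤-trans (class-bound s (add-O (add-E₂ p ρR) (B-free E₂)) h h′) (≤-reflexive (sym (β-suc m a τ ε)))
              ; E₁E₂ = λ s h h′ → ≤-trans (class-bound s (add-E₂ (add-E₁ p ρR) (B-free E₁)) h h′) (≤-reflexive (sym (β-suc m a τ true)))
              ; E₂E₁ = λ s h h′ → ≤-trans (class-bound s (add-E₁ (add-E₂ p ρR) (B-free E₂)) h h′) (≤-reflexive (sym (β-suc m a τ true)))
              ; E₂E₂ = λ s h h′ → ≤-trans (class-bound s (add-E₂ (add-E₂ p ρR) (B-free E₂)) h h′)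
                  (≤-reflexive (trans (sym (β-suc m (suc a) τ ε)) (trans (cong (3 *_) (sym (β-suc m a τ ε))) (sym (*-assoc 3 3 (β m a τ ε)))))) }
            ; R₂ = λ s → class-E₂ s outR′ okR ; B₂ = λ s → class-E₂ s outB′ okB }

          rest-33 : Ok R E₃ S → Ok B E₃ S → ∀ {Y} →
            (17 * x₀ + 0 * x₁ ≤ Y) × (0 * x₀ + 9 * x₁ ≤ Y) × (4 * x₀ + 7 * x₁ ≤ Y) × (11 * x₀ + 3 * x₁ ≤ Y) × (12 * x₀ + 2 * x₁ ≤ Y) × (7 * x₀ + 5 * x₁ ≤ Y) × (9 * x₀ + 4 * x₁ ≤ Y) →
            size S ≤ Y
          rest-33 hR hB {Y} f = Final.top-33 (setting hR hB) outR′ outB′ room hR hB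
            where
            f₁ = proj₁ f
            f₂ = proj₁ (proj₂ f)
            f₃ = proj₁ (proj₂ (proj₂ f))
            f₄ = proj₁ (proj₂ (proj₂ (proj₂ f)))
            f₅ = proj₁ (proj₂ (proj₂ (proj₂ (proj₂ f))))
            f₆ = proj₁ (proj₂ (proj₂ (proj₂ (proj₂ (proj₂ f)))))
            f₇ = proj₂ (proj₂ (proj₂ (proj₂ (proj₂ (proj₂ f)))))
            e₁ : ∀ x y → 17 * x ≡ 17 * x + 0 * y
            e₁ = solve-∀
            e₂ : ∀ x y → 9 * y ≡ 0 * x + 9 * y
            e₂ = solve-∀
            e₃ : ∀ x y → 7 * y + 4 * x ≡ 4 * x + 7 * y
            e₃ = solve-∀
            e₄ : ∀ x y → 7 * x + 9 * x + x ≡ 17 * x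
            e₄ = solve-∀
            e₅ : ∀ x y → 7 * x + (3 * y + 4 * x) ≡ 11 * x + 3 * y
            e₅ = solve-∀
            e₆ : ∀ x y → y + (3 * x + y) + 9 * x ≡ 12 * x + 2 * y
            e₆ = solve-∀
            e₇ : ∀ x y → y + (3 * x + y) + (3 * y + 4 * x) ≡ 7 * x + 5 * y
            e₇ = solve-∀
            e₈ : ∀ x y → y + (y + y + y) + 9 * x ≡ 9 * x + 4 * y
            e₈ = solve-∀
            e₉ : ∀ x y → y + (y + y + y) + (3 * y + 4 * x) ≡ 4 * x + 7 * y
            e₉ = solve-∀
            x′ = x₀
            y′ = x₁
            max-left : ∀ {p q r} a → a + p ≤ r → a + q ≤ r → a + (p ⊔ q) ≤ r
            max-left {p} {q} a h h′ = ≤-trans (≤-reflexive (+-distribˡ-⊔ a p q)) (⊔-lub h h′)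
            max-mid : ∀ {p q r} a b z → a + (p + b) + z ≤ r → a + (q + b) + z ≤ r → a + ((p ⊔ q) + b) + z ≤ r
            max-mid {p} {q} a b z h h′ with ≤-total p q
            ... | inj₁ l = ≤-trans (≤-reflexive (cong (λ w → a + (w + b) + z) (m≤n⇒m⊔n≡n l))) h′
            ... | inj₂ l = ≤-trans (≤-reflexive (cong (λ w → a + (w + b) + z) (m≥n⇒m⊔n≡m l))) h
            room : Room Y
            room = record
              { r₁ = ≤-trans (≤-reflexive (e₁ x′ y′)) f₁
              ; r₂ = ≤-trans (≤-reflexive (e₂ x′ y′)) f₂
              ; r₃ = ≤-trans (≤-reflexive (e₃ x′ y′)) f₃
              ; r₄ = max-left (7 * x₀) (≤-trans (≤-trans (m≤m+n _ x₀) (≤-reflexive (e₄ x′ y′))) (≤-trans (≤-reflexive (e₁ x′ y′)) f₁)) (≤-trans (≤-reflexive (e₅ x′ y′)) f₄)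
              ; r₅ = max-mid x₁ x₁ M₂₃
                  (max-left (x₁ + (3 * x₀ + x₁)) (≤-trans (≤-reflexive (e₆ x′ y′)) f₅) (≤-trans (≤-reflexive (e₇ x′ y′)) f₆))
                  (max-left (x₁ + (x₁ + x₁ + x₁)) (≤-trans (≤-reflexive (e₈ x′ y′)) f₇) (≤-trans (≤-reflexive (e₉ x′ y′)) f₃)) }

          rest-23 : Ok R E₂ S → Ok B E₃ S → size S ≤ 9 * x₀ ⊔ (3 * x₁ + 4 * x₀)
          rest-23 hR hB = Setup.top-23 (setting (ok-E₃ E₂ hR) hB) outR′ outB′ hR hB

          rest-32 : Ok R E₃ S → Ok B E₂ S → size S ≤ 9 * x₀ ⊔ (3 * x₁ + 4 * x₀)
          rest-32 hR hB = Setup.top-23 (swap-setting (setting hR (ok-E₃ E₂ hB))) outB′ outR′ hB hR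

          rest-22 : Ok R E₂ S → Ok B E₂ S → size S ≤ 6 * x₀
          rest-22 hR hB = Final.top-22 (setting (ok-E₃ E₂ hR) (ok-E₃ E₂ hB)) outR′ outB′ hR hB

        okR : ∀ {r} → σ R ≡ r → Ok R r S
        okR e = subst (λ s → Ok R s S) e (sat R)

        okB : ∀ {b} → σ B ≡ b → Ok B b S
        okB e = subst (λ s → Ok B s S) e (sat B)

        -- With the trivial profile every colour other than `R` and `B` has state O and cannot
        -- occur.
        pure-two : Profile ρ 0 0 false false → ∀ {x y} → x ∈ₛ S → y ∈ₛ S → x ≢ y → c x y ≡ R ⊎ c x y ≡ B
        pure-two p {x} {y} s s′ ne with c x y Fin.≟ R | c x y Fin.≟ B
        ... | yes e | _ = inj₁ e
        ... | no _ | yes e = inj₂ e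
        ... | no nr | no nb = ⊥-elim (subst (λ s → Ok (c x y) s S)
                (trans (sym (trans (at-other (σ [ R ≔ O ]) O nb) (at-other σ O nr))) (all-O p (c x y))) (sat (c x y)) (has-edge s s′ ne refl))

        pure? : ∀ {m a τ ε} → Profile ρ m a τ ε → (m ≡ 0 × a ≡ 0 × τ ≡ false × ε ≡ false) ⊎ 2 ≤ β m a τ ε
        pure? {m} {a} {τ} {ε} p with 2 ≤? β m a τ ε
        ... | yes h = inj₂ h
        ... | no h = inj₁ (β≡1 m a τ ε (≰⇒> h))

        drop-second : ∀ {s} → σ B ≡ s → (σ [ R ≔ O ]) B ≡ s
        drop-second e = trans (at-other σ O (R≢B ∘ sym)) e

        module _ {m a τ ε} (pr : Profile σ m a τ ε) where

          case-33 : σ R ≡ E₃ → σ B ≡ E₃ → size S ≤ β m a τ ε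
          case-33 r b with drop-E₃ pr r
          ... | m₁ , refl , p₁ with drop-E₃ p₁ (drop-second b)
          ...   | m₂ , refl , p with pure? p
          ...     | inj₁ (refl , refl , refl , refl) = On.size-55 R B R≢B S (pure-two p) (okR r) (okB b)
          ...     | inj₂ large = Rest.rest-33 p large (okR r) (okB b) (prime-33 τ ε a m₂)

          case-23 : σ R ≡ E₂ → σ B ≡ E₃ → size S ≤ β m a τ ε
          case-23 r b with drop-E₂ pr r
          ... | a₁ , refl , p₁ with drop-E₃ p₁ (drop-second b)
          ...   | m₁ , refl , p with pure? p
          ...     | inj₁ (refl , refl , refl , refl) = On.size-45 R B R≢B S (pure-two p) (okR r) (okB b)
          ...     | inj₂ large = ≤-trans (Rest.rest-23 p large (okR r) (okB b)) (prime-23 τ ε a₁ m₁)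

          case-32 : σ R ≡ E₃ → σ B ≡ E₂ → size S ≤ β m a τ ε
          case-32 r b with drop-E₃ pr r
          ... | m₁ , refl , p₁ with drop-E₂ p₁ (drop-second b)
          ...   | a₁ , refl , p with pure? p
          ...     | inj₁ (refl , refl , refl , refl) = On.size-45 B R (R≢B ∘ sym) S (λ q q′ ne → Sum.swap (pure-two p q q′ ne)) (okB b) (okR r)
          ...     | inj₂ large = ≤-trans (Rest.rest-32 p large (okR r) (okB b)) (prime-23 τ ε a₁ m₁)

          -- In the general case a triangle-free colour is weakened to a J₄-free one; the table is
          -- generous enough there, as `prime-T3` shows. Only sets with two colours use the Ramsey
          -- number of K₃ and J₅.
          case-T3 : σ R ≡ T → σ B ≡ E₃ → size S ≤ β m a τ ε
          case-T3 r b with drop-T pr r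
          ... | refl , p₁ with drop-E₃ p₁ (drop-second b)
          ...   | m₁ , refl , p with pure? p
          ...     | inj₁ (refl , refl , refl , refl) = ≤-trans (On.size-T5 R B R≢B S (pure-two p) (okR r) (okB b)) (n≤1+n 10)
          ...     | inj₂ large = ≤-trans (Rest.rest-23 p large (ok-T-E₂ (okR r)) (okB b)) (prime-T3 ε a m₁)

          case-3T : σ R ≡ E₃ → σ B ≡ T → size S ≤ β m a τ ε
          case-3T r b with drop-E₃ pr r
          ... | m₁ , refl , p₁ with drop-T p₁ (drop-second b)
          ...   | refl , p with pure? p
          ...     | inj₁ (refl , refl , refl , refl) = ≤-trans (On.size-T5 B R (R≢B ∘ sym) S (λ q q′ ne → Sum.swap (pure-two p q q′ ne)) (okB b) (okR r)) (n≤1+n 10)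
          ...     | inj₂ large = ≤-trans (Rest.rest-32 p large (okR r) (ok-T-E₂ (okB b))) (prime-T3 ε a m₁)

          case-22 : σ R ≡ E₂ → σ B ≡ E₂ → size S ≤ β m a τ ε
          case-22 r b with drop-E₂ pr r
          ... | a₁ , refl , p₁ with drop-E₂ p₁ (drop-second b)
          ...   | a₂ , refl , p with pure? p
          ...     | inj₁ (refl , refl , refl , refl) = On.size-44 R B R≢B S (pure-two p) (okR r) (okB b)
          ...     | inj₂ large = ≤-trans (Rest.rest-22 p large (okR r) (okB b)) (≤-trans (*-monoˡ-≤ (β m a₂ τ ε) {6} {9} (m≤m+n 6 3))
                      (≤-reflexive (trans (*-assoc 3 3 (β m a₂ τ ε)) (trans (cong (3 *_) (β-suc m a₂ τ ε)) (β-suc m (suc a₂) τ ε)))))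

          case-T2 : σ R ≡ T → σ B ≡ E₂ → size S ≤ β m a τ ε
          case-T2 r b with drop-T pr r
          ... | refl , p₁ with drop-E₂ p₁ (drop-second b)
          ...   | a₁ , refl , p with pure? p
          ...     | inj₁ (refl , refl , refl , refl) = On.size-T4 R B R≢B S (pure-two p) (okR r) (okB b)
          ...     | inj₂ large = ≤-trans (Rest.rest-22 p large (ok-T-E₂ (okR r)) (okB b)) (prime-T2 ε a₁ m)

          case-2T : σ R ≡ E₂ → σ B ≡ T → size S ≤ β m a τ ε
          case-2T r b with drop-E₂ pr r
          ... | a₁ , refl , p₁ with drop-T p₁ (drop-second b)
          ...   | refl , p with pure? p
          ...     | inj₁ (refl , refl , refl , refl) = On.size-T4 B R (R≢B ∘ sym) S (λ q q′ ne → Sum.swap (pure-two p q q′ ne)) (okB b) (okR r)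
          ...     | inj₂ large = ≤-trans (Rest.rest-22 p large (okR r) (ok-T-E₂ (okB b))) (prime-T2 ε a₁ m)

          case-TT : σ R ≡ T → σ B ≡ T → size S ≤ β m a τ ε
          case-TT r b with drop-T pr r
          ... | refl , p₁ = case proj₁ (drop-T p₁ (drop-second b)) of λ ()

          -- Without J₃ in one of the colours S is a join in the other one.
          case-E₁ : ∀ {i j} → σ i ≡ E₁ → Ok i E₁ S → (∀ {x y} → x ∈ₛ S → y ∈ₛ S → label x ≢ label y → c x y ≡ i ⊎ c x y ≡ j) → size S ≤ β m a τ ε
          case-E₁ {i} {j} e ok two′ with Parts.Dir.split S label hom i j two′ {S} (Parts.S-closed S label hom) ok
          ... | Parts.Dir.single {x} s h = let (y , s′ , ne , _) = outR s in ⊥-elim (ne (proj₂ (Parts.cl-in S label hom {x} {y} (h s′))))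
          ... | Parts.Dir.join {P} {P′} {p} {q} _ _ P⊑ P′⊑ p∈ q∈ cov jn = JoinCase.join-case ih σ sat pr
                  (record { P = P ; Q = P′ ; p₀ = p ; q₀ = q ; P⊑ = P⊑ ; Q⊑ = P′⊑ ; p∈ = p∈ ; q∈ = q∈ ; covers = cov ; joined = jn })
          ... | Parts.Dir.tiny h = ≤-trans h (enough ε refl)
            where
            enough : ∀ f → ε ≡ f → 2 ≤ β m a τ ε
            enough false refl = ⊥-elim (Profile.e≡ pr refl i e)
            enough true refl with 2 ≤? β m a τ true
            ... | yes h = h
            ... | no h = case proj₂ (proj₂ (proj₂ (β≡1 m a τ true (≰⇒> h)))) of λ ()

          no-O : ∀ {i} → σ i ≡ O → (∀ {x} → x ∈ₛ S → ∃ λ y → y ∈ₛ S × label x ≢ label y × c x y ≡ i) → size S ≤ β m a τ ε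
          no-O {i} e out = let (y , s , ne , e′) = out v∈ in ⊥-elim (subst (λ s → Ok i s S) e (sat i) (has-edge v∈ s (ne ∘ cong label) e′))

          prime-case : size S ≤ β m a τ ε
          prime-case with σ R in r | σ B in b
          ... | O | _ = no-O r outR
          ... | _ | O = no-O b outB
          ... | E₁ | _ = case-E₁ r (okR r) two
          ... | _ | E₁ = case-E₁ b (okB b) (λ p q ne → Sum.swap (two p q ne))
          ... | T | T = case-TT r b
          ... | T | E₂ = case-T2 r b
          ... | T | E₃ = case-T3 r b
          ... | E₂ | T = case-2T r b
          ... | E₂ | E₂ = case-22 r b
          ... | E₂ | E₃ = case-23 r b
          ... | E₃ | T = case-3T r b
          ... | E₃ | E₂ = case-32 r b
          ... | E₃ | E₃ = case-33 r b

      -- The induction is on the size for all assignments at once, because a part of the set may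
      -- satisfy an assignment with other states and flags.
      bounded : ∀ S → Acc _<_ (size S) → ∀ σ m a τ ε → Profile σ m a τ ε → Sat σ S → size S ≤ β m a τ ε
      bounded S (acc rec) σ m a τ ε pr sat with Finₚ.any? (λ x → Finₚ.any? (λ y → in? x S ×-dec (in? y S ×-dec ¬? (x Fin.≟ y))))
      ... | no none = ≤-trans (size-subsingleton S (λ {x} {y} p q → case x Fin.≟ y of λ { (yes e) → e ; (no ne) → ⊥-elim (none (x , y , p , q , ne)) })) (β≥1 m a τ ε)
      ... | yes (x , y , p , q , ne) = [ (λ (i , j) → JoinCase.join-case ih σ sat pr j) , (λ prime → PrimeCase.prime-case ih σ sat prime pr) ]′ (decompose S p q ne)
        where
        ih : Bounded-below S
        ih {P} lt = bounded P (rec lt)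

      bound : ∀ S σ m a τ ε → Profile σ m a τ ε → Sat σ S → size S ≤ β m a τ ε
      bound S = bounded S (<-wellFounded _)

      KiteFree : Assignment → Subset → Set
      KiteFree σ S = ∀ i → (σ i ≡ O × Ok i O S) ⊎ (σ i ≡ E₃ × ¬ Kite i S)

      kite-sat : ∀ {σ S} → KiteFree σ S → Sat σ S
      kite-sat {σ} {S} f i with f i
      ... | inj₁ (e , h) = subst (λ s → Ok i s S) (sym e) h
      ... | inj₂ (e , h) = subst (λ s → Ok i s S) (sym e) (ok-E₃-kite h)

      kite-free-⊑ : ∀ {σ P Q} → P ⊑ Q → KiteFree σ Q → KiteFree σ P
      kite-free-⊑ h f i = Sum.map (λ (e , o) → e , ok-⊑ O h o) (λ (e , κ) → e , κ ∘ kite-⊑ h) (f i)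

      drop-free : ∀ {σ S i} → Ok i O S → KiteFree σ S → KiteFree (σ [ i ≔ O ]) S
      drop-free {σ} {S} {i} o f j = go (j Fin.≟ i)
        where
        go : Dec (j ≡ i) → ((σ [ i ≔ O ]) j ≡ O × Ok j O S) ⊎ ((σ [ i ≔ O ]) j ≡ E₃ × ¬ Kite j S)
        go (yes refl) = inj₁ (at-same σ i O , o)
        go (no ne) = Sum.map (λ (e , h) → trans (at-other σ O ne) e , h) (λ (e , h) → trans (at-other σ O ne) e , h) (f j)

      -- The recursion is on `j` alone: it is invoked only for flat classes, which have lost two
      -- colours. All other parts of the set are bounded by `β`, which is available for every set.
      kite-bound : ∀ j S σ → KiteFree σ S → Profile σ (double (suc j)) 0 false false → size S ≤ 17 ^ suc j

      module Step (j : ℕ) (S : Subset) (σ : Assignment) (free : KiteFree σ S) (pr : Profile σ (double (suc j)) 0 false false) where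

        sat : Sat σ S
        sat = kite-sat free

        ih : Bounded-below S
        ih {P} _ = bound P

        state : ∀ {i x y} → x ∈ₛ S → y ∈ₛ S → x ≢ y → c x y ≡ i → σ i ≡ E₃ × ¬ Kite i S
        state {i} p q ne e = [ (λ (_ , o) → ⊥-elim (o (has-edge p q ne e))) , id ]′ (free i)

        join : ∀ {i} → JoinOf i S → size S ≤ 17 ^ suc j
        join {i} jn with (let (p , q , ne , e) = JoinOf.edge jn in state p q ne e)
        ... | e , κ with drop-E₃ pr e
        ...   | _ , refl , p = cases (has? i 3 1 (JoinOf.P jn)) (has? i 3 1 (JoinOf.Q jn))
          where
          X = 17 ^ j
          ok : Ok i E₃ S
          ok = ok-E₃-kite κ
          one-side : (j : JoinOf i S) → Has i 3 1 (JoinOf.P j) → size S ≤ 17 * X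
          -- Joins leave an odd number of colours, for which `β` is strong enough: 3 · 4 + 4 = 16
          -- here and 7 + 7 = 14 without a J₃ on either side, both below 17.
          one-side jo h = ≤-trans (sum-bound (≤-trans (JoinCase.bound-E₂ ih σ sat {i} p P< P⊑ λ g → without {4} {1} {1} {0} ok g (has-one q∈)) (*-monoʳ-≤ 3 (≤-reflexive (β-odd j false))))
              (≤-trans (JoinCase.bound-O ih σ sat {i} p Q< Q⊑ (without {3} {2} {1} {0} ok h)) (≤-reflexive (β-odd j false)))) (≤-trans (≤-reflexive (eq X)) (*-monoˡ-≤ X (n≤1+n 16)))
            where
            open JoinOf jo
            eq : ∀ X → 3 * (4 * X) + 4 * X ≡ 16 * X
            eq = solve-∀
          cases : Dec (Has i 3 1 (JoinOf.P jn)) → Dec (Has i 3 1 (JoinOf.Q jn)) → size S ≤ 17 * X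
          cases (yes h) _ = one-side jn h
          cases (no _) (yes h) = one-side (flip-join jn) h
          cases (no h) (no h′) = ≤-trans (JoinOf.sum-bound jn (side (JoinCase.bound-E₁ ih σ sat {i} p (JoinOf.P< jn) (JoinOf.P⊑ jn) h)) (side (JoinCase.bound-E₁ ih σ sat {i} p (JoinOf.Q< jn) (JoinOf.Q⊑ jn) h′)))
              (≤-trans (≤-reflexive (eq X)) (*-monoˡ-≤ X (m≤m+n 14 3)))
            where
            side : ∀ {s} → s ≤ β (suc (double j)) 0 false true → s ≤ 7 * X
            side h = ≤-trans h (≤-reflexive (β-odd j true))
            eq : ∀ X → 7 * X + 7 * X ≡ 14 * X
            eq = solve-∀

        prime : PrimeOf S → size S ≤ 17 ^ suc j
        prime pm = result (state v∈ (proj₁ (proj₂ yR)) (λ e → proj₁ (proj₂ (proj₂ yR)) (cong label e)) (proj₂ (proj₂ (proj₂ yR))))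
                          (state v∈ (proj₁ (proj₂ yB)) (λ e → proj₁ (proj₂ (proj₂ yB)) (cong label e)) (proj₂ (proj₂ (proj₂ yB))))
          where
          open PrimeOf pm
          yR = outR v∈
          yB = outB v∈
          result : σ R ≡ E₃ × ¬ Kite R S → σ B ≡ E₃ × ¬ Kite B S → size S ≤ 17 ^ suc j
          result (eR , kR) (eB , kB) with drop-E₃ pr eR | drop-E₃ pr eB
          ... | _ , refl , pR | _ , refl , pB with drop-E₃ pR ((PrimeCase.drop-second ih σ sat pm) eB)
          ...   | _ , e , p = go j e p pR pB
            where
            go : ∀ j {m} → suc (double j) ≡ suc m → Profile (PrimeCase.ρ ih σ sat pm) m 0 false false → Profile (σ [ R ≔ O ]) (suc (double j)) 0 false false → Profile (σ [ B ≔ O ]) (suc (double j)) 0 false false → size S ≤ 17 ^ suc j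
            -- No third colour is left, so R₂(H₂) ≤ 18 applies directly.
            go zero refl p _ _ = size-kite R≢B S ((PrimeCase.pure-two ih σ sat pm) p) kR kB
            go (suc j) refl p pR pB = ≤-trans (OnPartition.prime-kite S label hom Y x₁ sizes setting limits kR kB) (≤-reflexive (*-assoc 17 17 Y))
              where
              Y x₁ : ℕ
              Y = 17 ^ j
              x₁ = β (double (suc j)) 0 false true
              positive : 1 ≤ Y
              positive = m^n>0 17 j
              x₀≡ : β (double (suc j)) 0 false false ≡ 21 * Y
              x₀≡ = β-even j false false
              large : 2 ≤ β (double (suc j)) 0 false false
              large = ≤-trans (≤-trans (m≤m+n 2 19) (≤-trans (≤-reflexive (sym (*-identityʳ 21))) (*-monoʳ-≤ 21 positive))) (≤-reflexive (sym x₀≡))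
              sizes : Sizes (21 * Y) x₁
              sizes = subst (λ z → Sizes z x₁) x₀≡ (PrimeCase.Rest.sizes ih σ sat pm p large)
              open OnPartition S label hom Y x₁ sizes using (Setting; Limits; cl; cl-in; Rep)
              okR : Ok R E₃ S
              okR = ok-E₃-kite kR
              okB : Ok B E₃ S
              okB = ok-E₃-kite kB
              one : ∀ {i X} → Profile (σ [ i ≔ O ]) (suc (double (suc j))) 0 false false → X ⊑ S → Ok i O X → size X ≤ 68 * Y
              one {i} {X} q h o = ≤-trans (bound X _ _ 0 false false q (sat-update (λ l ne → ok-⊑ (σ l) h (sat l)) o)) (≤-reflexive (trans (*-identityˡ _) (u-period 1 j false false)))
              three′ : ∀ {i X} → Profile (σ [ i ≔ O ]) (suc (double (suc j))) 0 false false → X ⊑ S → Ok i E₂ X → size X ≤ 204 * Y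
              three′ {i} {X} q h o = ≤-trans (bound X _ _ 1 false false (add-E₂ q (at-same σ i O)) (sat-update (λ l ne → subst (λ s → Ok l s X) (sym (at-other σ O ne)) (ok-⊑ (σ l) h (sat l))) o))
                (≤-reflexive (trans (cong (3 *_) (u-period 1 j false false)) (sym (*-assoc 3 68 Y))))
              transport : ∀ {x x′} (e : x ≡ x′) (z : Sizes x x₁) → Prime.Setting S label hom x x₁ z R B → Prime.Setting S label hom x′ x₁ (subst (λ w → Sizes w x₁) e z) R B
              transport refl _ s = s
              setting : Setting R B
              setting = transport x₀≡ (PrimeCase.Rest.sizes ih σ sat pm p large) ((PrimeCase.Rest.setting ih σ sat pm p large) okR okB)
              class : ∀ {r b x} t → x ∈ₛ S → Profile (((PrimeCase.ρ ih σ sat pm) [ R ≔ r ]) [ B ≔ b ]) (double (suc j)) 0 t false → Ok R r (cl x) → Ok B b (cl x) → size (cl x) ≤ u 2 t false * Y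
              class t s q o o′ = ≤-trans ((PrimeCase.Rest.class-bound ih σ sat pm p large) s q o o′) (≤-reflexive (β-even j t false))
              class₃ : ∀ {r b x} t → x ∈ₛ S → Profile (((PrimeCase.ρ ih σ sat pm) [ R ≔ r ]) [ B ≔ b ]) (double (suc j)) 1 t false → Ok R r (cl x) → Ok B b (cl x) → size (cl x) ≤ 3 * u 2 t false * Y
              class₃ t s q o o′ = ≤-trans ((PrimeCase.Rest.class-bound ih σ sat pm p large) s q o o′) (≤-reflexive (trans (cong (3 *_) (u-period 0 j t false)) (sym (*-assoc 3 (u 2 t false) Y))))
              limits : Limits R B
              limits = record
                { flat = λ s o o′ → kite-bound j (cl _) (PrimeCase.ρ ih σ sat pm) (drop-free o′ (drop-free o (kite-free-⊑ (proj₁ ∘ cl-in) free))) p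
                ; T-O = λ s → class true s ((PrimeCase.Rest.add-O ih σ sat pm p large) (add-T p (PrimeCase.ρR ih σ sat pm)) ((PrimeCase.Rest.B-free ih σ sat pm p large) T))
                ; O-T = λ s → class true s (add-T ((PrimeCase.Rest.add-O ih σ sat pm p large) p (PrimeCase.ρR ih σ sat pm)) ((PrimeCase.Rest.B-free ih σ sat pm p large) O))
                ; T-E₂ = λ s → class₃ true s (add-E₂ (add-T p (PrimeCase.ρR ih σ sat pm)) ((PrimeCase.Rest.B-free ih σ sat pm p large) T))
                ; E₂-T = λ s → class₃ true s (add-T (add-E₂ p (PrimeCase.ρR ih σ sat pm)) ((PrimeCase.Rest.B-free ih σ sat pm p large) E₂))
                ; R-free = one pR ; B-free = one pB ; R-E₂ = three′ pR ; B-E₂ = three′ pB ; positive = positive }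

        result : size S ≤ 17 ^ suc j
        result with Finₚ.any? (λ x → Finₚ.any? (λ y → in? x S ×-dec (in? y S ×-dec ¬? (x Fin.≟ y))))
        ... | no none = ≤-trans (size-subsingleton S (λ {x} {y} p q → case x Fin.≟ y of λ { (yes e) → e ; (no ne) → ⊥-elim (none (x , y , p , q , ne)) })) (m^n>0 17 (suc j))
        ... | yes (x , y , p , q , ne) = [ (λ (_ , jn) → join jn) , prime ]′ (decompose S p q ne)

      kite-bound j S σ free pr = Step.result j S σ free pr

      everything : Subset
      everything _ = true

      size-everything : size everything ≡ n
      size-everything = trans (all-count (allFin n)) (length-tabulate {n = n} id)
        where
        all-count : ∀ (L : List (Fin n)) → cnt everything L ≡ length L
        all-count [] = refl
        all-count (x ∷ L) = cong suc (all-count L)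

      σ₃ : Assignment
      σ₃ _ = E₃

      profile : Profile σ₃ k 0 false false
      profile = record { m≡ = trans (ones (allFin k)) (length-tabulate {n = k} id) ; a≡ = zeros (allFin k) ; t≡ = zeros (allFin k) ; e≡ = λ _ _ () }
        where
        ones : ∀ (L : List (Fin k)) → cnt (λ _ → true) L ≡ length L
        ones [] = refl
        ones (x ∷ L) = cong suc (ones L)
        zeros : ∀ (L : List (Fin k)) → cnt (λ _ → false) L ≡ 0
        zeros [] = refl
        zeros (x ∷ L) = zeros L

      find-H₃ : β k 0 false false < n → MonoCopy H₃ c
      find-H₃ l with Finₚ.any? (λ i → has? i 5 1 everything)
      ... | yes (_ , h) = copy-H₃ h
      ... | no none = ⊥-elim (<⇒≱ l (≤-trans (≤-reflexive (sym size-everything)) (bound everything σ₃ k 0 false false profile λ i h → none (i , h))))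

      find-H₂ : ∀ {j} → k ≡ double (suc j) → 17 ^ suc j < n → MonoCopy H₂ c
      find-H₂ {j} e l with Finₚ.any? (λ i → kite? i everything)
      ... | yes (_ , κ) = copy-H₂ κ
      ... | no none = ⊥-elim (<⇒≱ l (≤-trans (≤-reflexive (sym size-everything)) (kite-bound j everything σ₃ (λ i → inj₂ (refl , λ κ → none (i , κ)))
              (subst (λ m → Profile σ₃ m 0 false false) e profile))))

-- The Gallai-Ramsey numbers for both parities.

open import Data.Nat using (ℕ; zero; suc; _≤_; _<_; _+_; _*_; _∸_; _^_; _≡ᵇ_; _≤ᵇ_; s≤s⁻¹)
open import Data.Nat.Properties
open import Data.Nat.DivMod using (_/_; _%_; m*n%n≡0; m*n/n≡m; [m+kn]%n≡m%n)
open import Data.Bool using (true; false; if_then_else_)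
open import Data.Fin using (Fin)
import Data.Fin as Fin
open import Data.Product using (_×_; _,_)
open import Data.Sum using (_⊎_; inj₁; inj₂)
open import Data.Empty using (⊥-elim)
open import Data.Unit using (tt)
open import Function using (_∘_; id)
open import Relation.Nullary
open import Relation.Nullary.Decidable using (toWitness)
open import Relation.Binary.PropositionalEquality hiding ([_])
open LowerBound
open import Defs
open Beta using (β; double)
open Periods using (β-odd; β-even)
open UpperBound using (module Coloured)

mono-⊆ : ∀ {k n} (c : Colouring k n) {G H : Graph 5} → (∀ u v → G u v ≡ true → H u v ≡ true) → MonoCopy H c → MonoCopy G c
mono-⊆ c h (a , f , inj , e) = a , f , inj , λ u v → e u v ∘ h u v

H₂⊆H₃ : ∀ u v → H₂ u v ≡ true → H₃ u v ≡ true
H₂⊆H₃ = toWitness {a? = subgraph? H₂ H₃} tt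

H₁⊆H₃ : ∀ u v → H₁ u v ≡ true → H₃ u v ≡ true
H₁⊆H₃ = H₁⊆ h₃

module _ {k n : ℕ} (c : Colouring k n) (c-sym : IsEdgeColouring c) where

  symmetrised : Colouring k n
  symmetrised x y = if Fin.toℕ x ≤ᵇ Fin.toℕ y then c x y else c y x

  symmetrised-≡ : ∀ {x y} → x ≢ y → symmetrised x y ≡ c x y
  symmetrised-≡ {x} {y} ne with Fin.toℕ x ≤ᵇ Fin.toℕ y
  ... | true = refl
  ... | false = c-sym y x (ne ∘ sym)

  symmetrised-sym : ∀ x y → symmetrised x y ≡ symmetrised y x
  symmetrised-sym x y with x Fin.≟ y
  ... | yes refl = refl
  ... | no ne = trans (symmetrised-≡ ne) (trans (c-sym x y ne) (sym (symmetrised-≡ (ne ∘ sym))))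

  no-rainbow : Gallai c → ∀ {x y z} → x ≢ y → y ≢ z → x ≢ z → symmetrised x y ≢ symmetrised x z → symmetrised y z ≡ symmetrised x y ⊎ symmetrised y z ≡ symmetrised x z
  no-rainbow g {x} {y} {z} xy yz xz ne = cases (c y z Fin.≟ c x y) (c y z Fin.≟ c x z)
    where
    cases : Dec (c y z ≡ c x y) → Dec (c y z ≡ c x z) → symmetrised y z ≡ symmetrised x y ⊎ symmetrised y z ≡ symmetrised x z
    cases (yes e) _ = inj₁ (trans (symmetrised-≡ yz) (trans e (sym (symmetrised-≡ xy))))
    cases (no _) (yes e) = inj₂ (trans (symmetrised-≡ yz) (trans e (sym (symmetrised-≡ xz))))
    cases (no p) (no q) = ⊥-elim (g (x , y , z , xy , yz , xz , p ∘ sym , q , λ e → ne (trans (symmetrised-≡ xy) (trans e (sym (symmetrised-≡ xz))))))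

  unsymmetrise : ∀ w → MonoCopy (graphOf w) symmetrised → MonoCopy (graphOf w) c
  unsymmetrise w (a , f , inj , e) = a , f , inj , λ u v uv → trans (sym (symmetrised-≡ (irreflexive w u v uv ∘ inj))) (e u v uv)

module Arrow {k n : ℕ} (c : Colouring k n) (c-sym : IsEdgeColouring c) (g : Gallai c) where

  arrow-H₃ : β k 0 false false < n → MonoCopy H₃ c
  arrow-H₃ l = unsymmetrise c c-sym h₃ (Coloured.Bounding.find-H₃ (symmetrised c c-sym) (symmetrised-sym c c-sym) (no-rainbow c c-sym g) l)

  arrow-H₂ : ∀ {j} → k ≡ double (suc j) → 17 ^ suc j < n → MonoCopy H₂ c
  arrow-H₂ {j} e l = unsymmetrise c c-sym h₂ (Coloured.Bounding.find-H₂ (symmetrised c c-sym) (symmetrised-sym c c-sym) (no-rainbow c c-sym g) {j} e l)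

data Parity : ℕ → Set where
  even : ∀ j → Parity (double (suc j))
  odd : ∀ j → Parity (suc (double j))

parity : ∀ k → Parity (suc k)
parity zero = odd 0
parity (suc zero) = even 0
parity (suc (suc k)) with suc k | parity k
... | _ | even j = even (suc j)
... | _ | odd j = odd (suc j)

double-≡ : ∀ j → double j ≡ j * 2
double-≡ zero = refl
double-≡ (suc j) = cong (2 +_) (double-≡ j)

half : ∀ j → double j / 2 ≡ j
half j = trans (cong (_/ 2) (double-≡ j)) (m*n/n≡m j 2)

grValue-even : ∀ r j → grValue r (double (suc j)) ≡ (r ∸ 1) * 17 ^ j + 1
grValue-even r j = trans (cong (λ b → if b ≡ᵇ 0 then (r ∸ 1) * 17 ^ (double j / 2) + 1 else 4 * 17 ^ (suc (double j) / 2) + 1)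
    (trans (cong (_% 2) (double-≡ (suc j))) (m*n%n≡0 (suc j) 2))) (cong (λ h → (r ∸ 1) * 17 ^ h + 1) (half j))

grValue-odd : ∀ r j → grValue r (suc (double j)) ≡ 4 * 17 ^ j + 1
grValue-odd r j = trans (cong (λ b → if b ≡ᵇ 0 then (r ∸ 1) * 17 ^ ((suc (double j) ∸ 2) / 2) + 1 else 4 * 17 ^ (double j / 2) + 1)
    (trans (cong (λ d → suc d % 2) (double-≡ j)) ([m+kn]%n≡m%n 1 j 2))) (cong (λ h → 4 * 17 ^ h + 1) (half j))

-- The value is the same for the three graphs, so the largest of them, which contains the other two,
-- decides.
upper-odd : ∀ w j → GallaiArrows (suc (double j)) (graphOf w) (4 * 17 ^ j + 1)
upper-odd w j c c-sym g = shrink w (Arrow.arrow-H₃ c c-sym g (≤-reflexive (trans (cong suc (β-odd j false)) (+-comm 1 _))))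
  where
  shrink : ∀ w → MonoCopy H₃ c → MonoCopy (graphOf w) c
  shrink h₁ = mono-⊆ c H₁⊆H₃
  shrink h₂ = mono-⊆ c H₂⊆H₃
  shrink h₃ = id

upper-even : ∀ w j → GallaiArrows (double (suc j)) (graphOf w) ((r₂ w ∸ 1) * 17 ^ j + 1)
upper-even h₁ j c c-sym g = mono-⊆ c (H₁⊆ h₂) (Arrow.arrow-H₂ c c-sym g {j} refl (≤-reflexive (+-comm 1 _)))
upper-even h₂ j c c-sym g = Arrow.arrow-H₂ c c-sym g {j} refl (≤-reflexive (+-comm 1 _))
upper-even h₃ j c c-sym g = Arrow.arrow-H₃ c c-sym g (≤-reflexive (trans (cong suc (β-even j false false)) (+-comm 1 _)))

extremal-odd : ∀ w j → Avoids w (suc (double j)) (4 * 17 ^ j)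
extremal-odd w j = subst (λ k → Avoids w k (4 * 17 ^ j)) (+-comm (double j) 1) (iterated j (base₁ w))

extremal-even : ∀ w j → Avoids w (double (suc j)) ((r₂ w ∸ 1) * 17 ^ j)
extremal-even w j = subst (λ k → Avoids w k ((r₂ w ∸ 1) * 17 ^ j)) (+-comm (double j) 2) (iterated j (base₂ w))

minimal : ∀ {w k} M → GallaiArrows k (graphOf w) (M + 1) → Avoids w k M → IsGR k (graphOf w) (M + 1)
minimal M up A = up , λ n l → ¬arrows (restrict (s≤s⁻¹ (≤-trans l (≤-reflexive (+-comm M 1)))) A)

gallai-ramsey : ∀ w {k} → Parity k → IsGR k (graphOf w) (grValue (r₂ w) k)
gallai-ramsey w (even j) = subst (IsGR _ (graphOf w)) (sym (grValue-even (r₂ w) j)) (minimal _ (upper-even w j) (extremal-even w j))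
gallai-ramsey w (odd j) = subst (IsGR _ (graphOf w)) (sym (grValue-odd (r₂ w) j)) (minimal _ (upper-odd w j) (extremal-odd w j))

-- Three edges cannot receive three of two colours, so every two-colouring is a Gallai colouring and
-- R₂ is the case k = 2.
ramsey : ∀ w → IsR2 (graphOf w) (r₂ w)
ramsey w = let (up , low) = subst (IsGR 2 (graphOf w)) (value w) (gallai-ramsey w (even 0)) in
  (λ c c-sym → up c c-sym (gallai₂ c)) , λ n l h → low n l λ c c-sym _ → h c c-sym
  where
  value : ∀ w → grValue (r₂ w) 2 ≡ r₂ w
  value h₁ = refl
  value h₂ = refl
  value h₃ = refl

theorem1p3 : (w : Which) →
    IsR2 (graphOf w) (r₂ w) ×
    ((k : ℕ) → 1 ≤ k → IsGR k (graphOf w) (grValue (r₂ w) k))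
theorem1p3 w = ramsey w , λ { (suc k) _ → gallai-ramsey w (parity k) }
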